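{- Let $\mathbf{S}_0$ be the $2$-adic Banach space of $2^{ -1/2}$-overconvergent cuspidal $2$-adic modular forms of weight $0$ and tame level $1$ over $\mathbf{Q}_2$, with its compact operator $U=U_2$. Let $D$ be the infinite diagonal matrix $(d_{i,j})_{i,j\ge1}$ with diagonal entries $$d_{j,j}=\frac{2^{4j+1}\,(3j)!^2\,j!^2}{3\cdot(2j)!^4},\qquad j\ge1.$$ Then the ($2$-adic) Newton polygons of $\det(1-XU)$ on $\mathbf{S}_0$ and of $\det(1-XD)$ coincide.
   Context: Let $\Delta(\tau)=q\prod_{n\ge1}(1-q^n)^{24}$, $q=e^{2\pi i\tau}$, $f(\tau)=\Delta(2\tau)/\Delta(\tau)=q+24q^2+\cdots$ and $g=2^6f$. The space $\mathbf{M}_0$ of $2^{ -1/2}$-overconvergent $2$-adic modular forms of weight $0$ and tame level $1$ is the Banach space (with supremum norm) of rigid analytic functions over $\mathbf{Q}_2$ on the affinoid $X_0(1)_{\ge 2^{ -1/2}}$ of the level one modular curve obtained by removing the open disc of radius $2^{ -1/2}$ (in the sense of a suitable local parameter after adding auxiliary level structure) over the supersingular point. Concretely this affinoid is the region $\{|j|\ge 2^{ -6}\}$ of the $j$-line, and it is identified (preserving $q$-expansions) with the region $\{|g|\le 1\}$ of $X_0(2)$; thus $\mathbf{M}_0$ is the space of series $\sum_{n\ge0}a_ng^n$ with $a_n\in\mathbf{Q}_2$, $a_n\to0$, with norm $\max_n|a_n|$. The subspace $\mathbf{S}_0=\mathbf{S}_0(\mathrm{SL}_2(\mathbf{Z});\mathbf{Q}_2;2^{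 -1/2})$ consists of the elements whose $q$-expansion has zero constant term, i.e. the series $\sum_{n\ge1}a_ng^n$ with $a_n\to 0$. The operator $U$ acts on $q$-expansions by $U(\sum a_nq^n)=\sum a_{2n}q^n$; it is a compact operator on $\mathbf{M}_0$ preserving $\mathbf{S}_0$. For a compact operator, $\det(1-X\,\cdot)\in\mathbf{Q}_2[[X]]$ denotes its characteristic (Fredholm) power series in the sense of Serre; the matrix $D$ defines a compact operator on $\mathbf{S}_0$ by $g^j\mapsto d_{j,j}g^j$, and $\det(1-XD)=\prod_{j\ge1}(1-d_{j,j}X)$. The Newton polygon of a power series $1+\sum_{n\ge1} c_nX^n$ is the lower convex hull of the points $(0,0)$ and $(n,v_2(c_n))$, where $v_2$ is the $2$-adic valuation with $v_2(2)=1$. -}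

module Defs where

open import Algebra.Bundles using (CommutativeRing)
open import Algebra.Module.Bundles using (LeftModule)
import Algebra.Module.Construct.TensorUnit as TensorUnit
open import Algebra.Module.Morphism.Structures using (module LeftModuleMorphisms)
import Algebra.Properties.CommutativeMonoid.Sum as MonoidSum
import Algebra.Properties.CommutativeSemigroup as CommutativeSemigroupProperties
import Algebra.Properties.Ring as RingProperties
import Algebra.Properties.Semiring.Exp as Exp
import Algebra.Properties.Semiring.Sum as SemiringSum
open import Data.Bool.Base using (true; false; if_then_else_)
open import Data.Fin.Base as Fin using (Fin; toℕ; punchIn)
open import Data.Integer.Base as ℤ using (ℤ; +_; -[1+_])
open import Data.Fin.Properties using (toℕ-fromℕ<; toℕ-injective; toℕ<n; suc-injective)
import Data.Integer.Properties as ℤ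
import Data.Integer.Solver as ℤ-Solver
open import Data.List.Base as List using (List; []; _∷_; [_]; _++_; map; foldr)
open import Data.List.Relation.Unary.All as All using (All; []; _∷_)
import Data.List.Relation.Unary.All.Properties as All
open import Data.Nat.Base as ℕ using (ℕ; zero; suc; _!; NonZero)
import Data.Nat.Coprimality as Coprimality
import Data.Nat.Properties as ℕ
import Data.Nat.Solver as ℕ-Solver
open import Data.Product.Base using (Σ-syntax; ∃-syntax; _×_; _,_; proj₁; proj₂)
open import Data.Rational.Base as ℚ using (ℚ; 0ℚ; 1ℚ; ½)
import Data.Rational.Properties as ℚ
import Data.Rational.Solver as ℚ-Solver
import Data.Rational.Unnormalised.Base as ℚᵘ
import Data.Rational.Unnormalised.Properties as ℚᵘ
open import Data.Sum.Base using (_⊎_; inj₁; inj₂)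
open import Data.Vec.Functional as Vector using (Vector)
open import Function.Base using (_∘_)
open import Level using (0ℓ)
import Relation.Binary.Reasoning.Setoid as SetoidReasoning
open import Relation.Binary.PropositionalEquality
  using (_≡_; refl; sym; trans; cong; cong₂; subst; module ≡-Reasoning)
open import Relation.Nullary.Decidable using (Dec; yes; no; does; dec-true; dec-false)
open import Relation.Nullary.Negation using (¬_)
open import Relation.Unary using (Pred)

module ℚᵘ-Reasoning = SetoidReasoning ℚᵘ.≃-setoid

ι : ℤ → ℚ
ι a = ℚ.mkℚ a 0 (Coprimality.sym (Coprimality.1-coprimeTo ℤ.∣ a ∣))

module ℚ-Exp = Exp (CommutativeRing.semiring ℚ.+-*-commutativeRing)

2^ : ℤ → ℚ
2^ (+ n)    = ι (+ 2) ℚ-Exp.^ n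
2^ -[1+ n ] = ½ ℚ-Exp.^ suc n

-- k ≤ν r says that v₂(r) ≥ k, i.e. that r ∈ 2ᵏℤ₍₂₎.
infix 4 _≤ν_
record _≤ν_ (k : ℤ) (r : ℚ) : Set where
  constructor ν
  field
    num  : ℤ
    half : ℕ
    eq   : r ℚ.* ι (+ (1 ℕ.+ 2 ℕ.* half)) ≡ 2^ k ℚ.* ι num

ι-+ : ∀ a b → ι (a ℤ.+ b) ≡ ι a ℚ.+ ι b
ι-+ a b = ℚ.toℚᵘ-injective (begin
  ℚ.toℚᵘ (ι (a ℤ.+ b))             ≈⟨ ℚᵘ.*≡* (solve 2 (λ x y → (x :+ y) :* con (+ 1) :=
                                        (x :* con (+ 1) :+ y :* con (+ 1)) :* con (+ 1)) refl a b) ⟩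
  ℚ.toℚᵘ (ι a) ℚᵘ.+ ℚ.toℚᵘ (ι b)   ≈⟨ ℚ.toℚᵘ-homo-+ (ι a) (ι b) ⟨
  ℚ.toℚᵘ (ι a ℚ.+ ι b)             ∎)
  where
  open ℚᵘ-Reasoning
  open ℤ-Solver.+-*-Solver

ι-* : ∀ a b → ι (a ℤ.* b) ≡ ι a ℚ.* ι b
ι-* a b = ℚ.toℚᵘ-injective (ℚᵘ.≃-sym (ℚ.toℚᵘ-homo-* (ι a) (ι b)))

ι-neg : ∀ a → ι (ℤ.- a) ≡ ℚ.- ι a
ι-neg a = ℚ.toℚᵘ-injective (ℚᵘ.≃-sym (ℚ.toℚᵘ-homo‿- (ι a)))

/-*-ι : ∀ a d b c .{{_ : NonZero d}} → a ℤ.* b ≡ c ℤ.* + d → (a ℚ./ d) ℚ.* ι b ≡ ι c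
/-*-ι a d@(suc d-1) b c eq = ℚ.toℚᵘ-injective (begin
  ℚ.toℚᵘ ((a ℚ./ d) ℚ.* ι b)         ≈⟨ ℚ.toℚᵘ-homo-* (a ℚ./ d) (ι b) ⟩
  ℚ.toℚᵘ (a ℚ./ d) ℚᵘ.* ℚ.toℚᵘ (ι b) ≈⟨ ℚᵘ.*-congʳ {ℚ.toℚᵘ (ι b)} (ℚ.toℚᵘ-fromℚᵘ (ℚᵘ.mkℚᵘ a d-1)) ⟩
  ℚᵘ.mkℚᵘ a d-1 ℚᵘ.* ℚᵘ.mkℚᵘ b 0     ≈⟨ ℚᵘ.*≡* (trans (ℤ.*-identityʳ (a ℤ.* b)) (trans eq (cong (λ n → c ℤ.* + n) (sym (ℕ.*-identityʳ d))))) ⟩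
  ℚ.toℚᵘ (ι c)                       ∎)
  where open ℚᵘ-Reasoning

2^-⊖ : ∀ m n → 2^ (m ℤ.⊖ n) ≡ ι (+ 2) ℚ-Exp.^ m ℚ.* ½ ℚ-Exp.^ n
2^-⊖ m       zero    = sym (ℚ.*-identityʳ _)
2^-⊖ zero    (suc n) = sym (ℚ.*-identityˡ _)
2^-⊖ (suc m) (suc n) = begin
  2^ (suc m ℤ.⊖ suc n)                            ≡⟨ cong 2^ (ℤ.[1+m]⊖[1+n]≡m⊖n m n) ⟩
  2^ (m ℤ.⊖ n)                                    ≡⟨ 2^-⊖ m n ⟩
  x ℚ.* y                                         ≡⟨ ℚ.*-identityˡ _ ⟨
  (ι (+ 2) ℚ.* ½) ℚ.* (x ℚ.* y)                   ≡⟨ solve 4 (λ a b c d → (a :* b) :* (c :* d) := (a :* c) :* (b :* d)) refl (ι (+ 2)) ½ x y ⟩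
  (ι (+ 2) ℚ.* x) ℚ.* (½ ℚ.* y)                   ∎
  where
  open ≡-Reasoning
  open ℚ-Solver.+-*-Solver
  x = ι (+ 2) ℚ-Exp.^ m
  y = ½ ℚ-Exp.^ n

2^-+ : ∀ k l → 2^ (k ℤ.+ l) ≡ 2^ k ℚ.* 2^ l
2^-+ (+ m)    (+ n)    = ℚ-Exp.^-homo-* (ι (+ 2)) m n
2^-+ (+ m)    -[1+ n ] = 2^-⊖ m (suc n)
2^-+ -[1+ m ] (+ n)    = trans (2^-⊖ n (suc m)) (ℚ.*-comm (ι (+ 2) ℚ-Exp.^ n) (½ ℚ-Exp.^ suc m))
2^-+ -[1+ m ] -[1+ n ] = trans (cong (½ ℚ-Exp.^_) (cong suc (sym (ℕ.+-suc m n)))) (ℚ-Exp.^-homo-* ½ (suc m) (suc n))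

2^-ι : ∀ n → 2^ (+ n) ≡ ι (+ (2 ℕ.^ n))
2^-ι zero    = refl
2^-ι (suc n) = begin
  ι (+ 2) ℚ.* 2^ (+ n)              ≡⟨ cong (ι (+ 2) ℚ.*_) (2^-ι n) ⟩
  ι (+ 2) ℚ.* ι (+ (2 ℕ.^ n))       ≡⟨ ι-* (+ 2) (+ (2 ℕ.^ n)) ⟨
  ι (+ 2 ℤ.* + (2 ℕ.^ n))           ≡⟨ cong ι (ℤ.pos-* 2 (2 ℕ.^ n)) ⟨
  ι (+ (2 ℕ.* 2 ℕ.^ n))             ∎
  where open ≡-Reasoning

odd : ℕ → ℚ
odd h = ι (+ (1 ℕ.+ 2 ℕ.* h))

odd-* : ∀ g h → odd (g ℕ.+ h ℕ.+ 2 ℕ.* (g ℕ.* h)) ≡ odd g ℚ.* odd h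
odd-* g h = begin
  odd (g ℕ.+ h ℕ.+ 2 ℕ.* (g ℕ.* h))                              ≡⟨ cong (ι ∘ +_) (solve 2 (λ x y → con 1 :+ con 2 :* (x :+ y :+ con 2 :* (x :* y)) := (con 1 :+ con 2 :* x) :* (con 1 :+ con 2 :* y)) refl g h) ⟩
  ι (+ ((1 ℕ.+ 2 ℕ.* g) ℕ.* (1 ℕ.+ 2 ℕ.* h)))                    ≡⟨ cong ι (ℤ.pos-* (1 ℕ.+ 2 ℕ.* g) (1 ℕ.+ 2 ℕ.* h)) ⟩
  ι (+ (1 ℕ.+ 2 ℕ.* g) ℤ.* + (1 ℕ.+ 2 ℕ.* h))                    ≡⟨ ι-* (+ (1 ℕ.+ 2 ℕ.* g)) (+ (1 ℕ.+ 2 ℕ.* h)) ⟩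
  odd g ℚ.* odd h                                                ∎
  where
  open ≡-Reasoning
  open ℕ-Solver.+-*-Solver

≤ν-0 : ∀ {k} → k ≤ν 0ℚ
≤ν-0 {k} = ν (+ 0) 0 (trans (ℚ.*-zeroˡ (odd 0)) (sym (ℚ.*-zeroʳ (2^ k))))

≤ν-ι : ∀ a → + 0 ≤ν ι a
≤ν-ι a = ν a 0 (ℚ.*-comm (ι a) 1ℚ)

≤ν-neg : ∀ {k r} → k ≤ν r → k ≤ν ℚ.- r
≤ν-neg {k} {r} (ν a h eq) = ν (ℤ.- a) h (begin
  ℚ.- r ℚ.* odd h         ≡⟨ ℚ.neg-distribˡ-* r (odd h) ⟨
  ℚ.- (r ℚ.* odd h)       ≡⟨ cong ℚ.-_ eq ⟩
  ℚ.- (2^ k ℚ.* ι a)      ≡⟨ ℚ.neg-distribʳ-* (2^ k) (ι a) ⟩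
  2^ k ℚ.* (ℚ.- ι a)      ≡⟨ cong (2^ k ℚ.*_) (ι-neg a) ⟨
  2^ k ℚ.* ι (ℤ.- a)      ∎)
  where open ≡-Reasoning

≤ν-+ : ∀ {k r s} → k ≤ν r → k ≤ν s → k ≤ν r ℚ.+ s
≤ν-+ {k} {r} {s} (ν a g eq₁) (ν b h eq₂) =
  ν (a ℤ.* + (1 ℕ.+ 2 ℕ.* h) ℤ.+ b ℤ.* + (1 ℕ.+ 2 ℕ.* g)) (g ℕ.+ h ℕ.+ 2 ℕ.* (g ℕ.* h)) (begin
  (r ℚ.+ s) ℚ.* odd (g ℕ.+ h ℕ.+ 2 ℕ.* (g ℕ.* h))          ≡⟨ cong ((r ℚ.+ s) ℚ.*_) (odd-* g h) ⟩
  (r ℚ.+ s) ℚ.* (odd g ℚ.* odd h)                          ≡⟨ solve 4 (λ x y u v → (x :+ y) :* (u :* v) := (x :* u) :* v :+ (y :* v) :* u) refl r s (odd g) (odd h) ⟩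
  (r ℚ.* odd g) ℚ.* odd h ℚ.+ (s ℚ.* odd h) ℚ.* odd g      ≡⟨ cong₂ (λ x y → x ℚ.* odd h ℚ.+ y ℚ.* odd g) eq₁ eq₂ ⟩
  (2^ k ℚ.* ι a) ℚ.* odd h ℚ.+ (2^ k ℚ.* ι b) ℚ.* odd g    ≡⟨ solve 5 (λ t x y u v → (t :* x) :* v :+ (t :* y) :* u := t :* (x :* v :+ y :* u)) refl (2^ k) (ι a) (ι b) (odd g) (odd h) ⟩
  2^ k ℚ.* (ι a ℚ.* odd h ℚ.+ ι b ℚ.* odd g)               ≡⟨ cong (2^ k ℚ.*_) (cong₂ ℚ._+_ (ι-* a (+ (1 ℕ.+ 2 ℕ.* h))) (ι-* b (+ (1 ℕ.+ 2 ℕ.* g)))) ⟨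
  2^ k ℚ.* (ι (a ℤ.* + (1 ℕ.+ 2 ℕ.* h)) ℚ.+ ι (b ℤ.* + (1 ℕ.+ 2 ℕ.* g)))  ≡⟨ cong (2^ k ℚ.*_) (ι-+ (a ℤ.* + (1 ℕ.+ 2 ℕ.* h)) (b ℤ.* + (1 ℕ.+ 2 ℕ.* g))) ⟨
  2^ k ℚ.* ι (a ℤ.* + (1 ℕ.+ 2 ℕ.* h) ℤ.+ b ℤ.* + (1 ℕ.+ 2 ℕ.* g))        ∎)
  where
  open ≡-Reasoning
  open ℚ-Solver.+-*-Solver

≤ν-- : ∀ {k r s} → k ≤ν r → k ≤ν s → k ≤ν r ℚ.- s
≤ν-- p q = ≤ν-+ p (≤ν-neg q)

≤ν-* : ∀ {k l r s} → k ≤ν r → l ≤ν s → k ℤ.+ l ≤ν r ℚ.* s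
≤ν-* {k} {l} {r} {s} (ν a g eq₁) (ν b h eq₂) = ν (a ℤ.* b) (g ℕ.+ h ℕ.+ 2 ℕ.* (g ℕ.* h)) (begin
  (r ℚ.* s) ℚ.* odd (g ℕ.+ h ℕ.+ 2 ℕ.* (g ℕ.* h))    ≡⟨ cong ((r ℚ.* s) ℚ.*_) (odd-* g h) ⟩
  (r ℚ.* s) ℚ.* (odd g ℚ.* odd h)                    ≡⟨ interchange r s (odd g) (odd h) ⟩
  (r ℚ.* odd g) ℚ.* (s ℚ.* odd h)                    ≡⟨ cong₂ ℚ._*_ eq₁ eq₂ ⟩
  (2^ k ℚ.* ι a) ℚ.* (2^ l ℚ.* ι b)                  ≡⟨ interchange (2^ k) (ι a) (2^ l) (ι b) ⟩
  (2^ k ℚ.* 2^ l) ℚ.* (ι a ℚ.* ι b)                  ≡⟨ cong₂ ℚ._*_ (2^-+ k l) (ι-* a b) ⟨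
  2^ (k ℤ.+ l) ℚ.* ι (a ℤ.* b)                       ∎)
  where
  open ≡-Reasoning
  open ℚ-Solver.+-*-Solver
  interchange : ∀ w x y z → (w ℚ.* x) ℚ.* (y ℚ.* z) ≡ (w ℚ.* y) ℚ.* (x ℚ.* z)
  interchange = solve 4 (λ w x y z → (w :* x) :* (y :* z) := (w :* y) :* (x :* z)) refl

≤ν-mono : ∀ {j k r} → j ℤ.≤ k → k ≤ν r → j ≤ν r
≤ν-mono {j} {k} {r} j≤k (ν a h eq) = ν (+ (2 ℕ.^ n) ℤ.* a) h (begin
  r ℚ.* odd h                               ≡⟨ eq ⟩
  2^ k ℚ.* ι a                              ≡⟨ cong (λ l → 2^ l ℚ.* ι a) k≡j+n ⟩
  2^ (j ℤ.+ + n) ℚ.* ι a                    ≡⟨ cong (ℚ._* ι a) (2^-+ j (+ n)) ⟩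
  (2^ j ℚ.* 2^ (+ n)) ℚ.* ι a               ≡⟨ ℚ.*-assoc (2^ j) (2^ (+ n)) (ι a) ⟩
  2^ j ℚ.* (2^ (+ n) ℚ.* ι a)               ≡⟨ cong (λ x → 2^ j ℚ.* (x ℚ.* ι a)) (2^-ι n) ⟩
  2^ j ℚ.* (ι (+ (2 ℕ.^ n)) ℚ.* ι a)        ≡⟨ cong (2^ j ℚ.*_) (ι-* (+ (2 ℕ.^ n)) a) ⟨
  2^ j ℚ.* ι (+ (2 ℕ.^ n) ℤ.* a)            ∎)
  where
  open ≡-Reasoning
  n = ℤ.∣ k ℤ.- j ∣
  k≡j+n : k ≡ j ℤ.+ + n
  k≡j+n = begin
    k                   ≡⟨ ℤ-Solver.+-*-Solver.solve 2 (λ x y → x ℤ-Solver.+-*-Solver.:= y ℤ-Solver.+-*-Solver.:+ (x ℤ-Solver.+-*-Solver.:- y)) refl k j ⟩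
    j ℤ.+ (k ℤ.- j)     ≡⟨ cong (λ i → j ℤ.+ i) (ℤ.0≤i⇒+∣i∣≡i (ℤ.i≤j⇒0≤j-i j≤k)) ⟨
    j ℤ.+ + n           ∎

oddPart : ∀ fuel d → d ℕ.≤ fuel → .{{NonZero d}} → ∃[ e ] ∃[ h ] d ≡ 2 ℕ.^ e ℕ.* (1 ℕ.+ 2 ℕ.* h)
oddPart fuel d d≤fuel with parity d
  where
  parity : ∀ n → (∃[ h ] n ≡ 2 ℕ.* h) ⊎ (∃[ h ] n ≡ 1 ℕ.+ 2 ℕ.* h)
  parity zero    = inj₁ (0 , refl)
  parity (suc n) with parity n
  ... | inj₁ (h , eq) = inj₂ (h , cong suc eq)
  ... | inj₂ (h , eq) = inj₁ (suc h , trans (cong suc eq) (sym (ℕ.*-suc 2 h)))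
... | inj₂ (h , eq) = 0 , h , trans eq (sym (ℕ.*-identityˡ _))
oddPart (suc fuel) (suc d) d≤fuel | inj₁ (suc h , eq)
  with oddPart fuel (suc h) (ℕ.s≤s⁻¹ (ℕ.≤-trans h<d d≤fuel))
  where
  h<d : suc (suc h) ℕ.≤ suc d
  h<d = subst (suc (suc h) ℕ.≤_) (sym eq) (ℕ.s≤s (ℕ.≤-trans (ℕ.≤-reflexive (ℕ.+-comm 1 h)) (ℕ.+-monoʳ-≤ h (ℕ.s≤s ℕ.z≤n))))
... | e , o , eq′ = suc e , o , trans eq (trans (cong (2 ℕ.*_) eq′) (sym (ℕ.*-assoc 2 (2 ℕ.^ e) _)))

≤ν-bounded : ∀ r → ∃[ k ] k ≤ν r
≤ν-bounded r with oddPart (ℚ.↧ₙ r) (ℚ.↧ₙ r) ℕ.≤-refl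
... | e , h , eq = ℤ.- + e , ν (ℚ.↥ r) h (begin
  r ℚ.* odd h                                                     ≡⟨ ℚ.*-identityˡ _ ⟨
  1ℚ ℚ.* (r ℚ.* odd h)                                            ≡⟨ cong (λ k → 2^ k ℚ.* (r ℚ.* odd h)) (ℤ.+-inverseˡ (+ e)) ⟨
  2^ (ℤ.- + e ℤ.+ + e) ℚ.* (r ℚ.* odd h)                          ≡⟨ cong (ℚ._* (r ℚ.* odd h)) (trans (2^-+ (ℤ.- + e) (+ e)) (cong (2^ (ℤ.- + e) ℚ.*_) (2^-ι e))) ⟩
  (2^ (ℤ.- + e) ℚ.* ι (+ (2 ℕ.^ e))) ℚ.* (r ℚ.* odd h)            ≡⟨ solve 4 (λ w x y z → (w :* x) :* (y :* z) := w :* (y :* (x :* z))) refl (2^ (ℤ.- + e)) (ι (+ (2 ℕ.^ e))) r (odd h) ⟩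
  2^ (ℤ.- + e) ℚ.* (r ℚ.* (ι (+ (2 ℕ.^ e)) ℚ.* odd h))            ≡⟨ cong (λ x → 2^ (ℤ.- + e) ℚ.* (r ℚ.* x)) den ⟨
  2^ (ℤ.- + e) ℚ.* (r ℚ.* ι (ℚ.↧ r))                              ≡⟨ cong (λ x → 2^ (ℤ.- + e) ℚ.* (x ℚ.* ι (ℚ.↧ r))) (ℚ.↥p/↧p≡p r) ⟨
  2^ (ℤ.- + e) ℚ.* ((ℚ.↥ r ℚ./ ℚ.↧ₙ r) ℚ.* ι (ℚ.↧ r))             ≡⟨ cong (2^ (ℤ.- + e) ℚ.*_) (/-*-ι (ℚ.↥ r) (ℚ.↧ₙ r) (ℚ.↧ r) (ℚ.↥ r) refl) ⟩
  2^ (ℤ.- + e) ℚ.* ι (ℚ.↥ r)                                      ∎)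
  where
  open ≡-Reasoning
  open ℚ-Solver.+-*-Solver
  den : ι (ℚ.↧ r) ≡ ι (+ (2 ℕ.^ e)) ℚ.* odd h
  den = trans (cong (ι ∘ +_) eq) (trans (cong ι (ℤ.pos-* (2 ℕ.^ e) _)) (ι-* (+ (2 ℕ.^ e)) _))

Eventually : (ℕ → Set) → Set
Eventually P = ∃[ N ] ∀ n → N ℕ.≤ n → P n

ev-pure : ∀ {P : ℕ → Set} → (∀ n → P n) → Eventually P
ev-pure p = 0 , λ n _ → p n

ev-map : ∀ {P Q : ℕ → Set} → (∀ {n} → P n → Q n) → Eventually P → Eventually Q
ev-map f (N , p) = N , λ n N≤n → f (p n N≤n)

ev-zip : ∀ {P Q R : ℕ → Set} → (∀ {n} → P n → Q n → R n) → Eventually P → Eventually Q → Eventually R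
ev-zip f (M , p) (N , q) = M ℕ.⊔ N , λ n le →
  f (p n (ℕ.≤-trans (ℕ.m≤m⊔n M N) le)) (q n (ℕ.≤-trans (ℕ.m≤n⊔m M N) le))

ev-const : ∀ {P : Set} → Eventually (λ _ → P) → P
ev-const (N , p) = p N ℕ.≤-refl

record ℚ₂ : Set where
  no-eta-equality
  field
    seq    : ℕ → ℚ
    cauchy : ∀ k → ∃[ N ] ∀ m n → N ℕ.≤ m → N ℕ.≤ n → k ≤ν seq m ℚ.- seq n

open ℚ₂ public

infix 4 _≈₂_ _≤ν₂_
infixl 6 _+₂_
infixl 7 _*₂_
infix 8 -₂_

-- A record rather than a function so that x and y can be inferred.
record _≈₂_ (x y : ℚ₂) : Set where
  constructor ≈-intro
  field close : ∀ k → Eventually λ n → k ≤ν seq x n ℚ.- seq y n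

open _≈₂_ public

_≤ν₂_ : ℤ → ℚ₂ → Set
k ≤ν₂ x = Eventually λ n → k ≤ν seq x n

≤ν-resp : ∀ {k r s} → r ≡ s → k ≤ν r → k ≤ν s
≤ν-resp refl p = p

split : ∀ b k → b ℤ.+ (k ℤ.- b) ≡ k
split = solve 2 (λ b k → b :+ (k :- b) := k) refl
  where open ℤ-Solver.+-*-Solver

≤ν-*ˡ : ∀ {b k r s} → b ≤ν r → k ℤ.- b ≤ν s → k ≤ν r ℚ.* s
≤ν-*ˡ {b} {k} {r} {s} p q = subst (_≤ν r ℚ.* s) (split b k) (≤ν-* p q)

≤ν-*ʳ : ∀ {b k r s} → k ℤ.- b ≤ν r → b ≤ν s → k ≤ν r ℚ.* s
≤ν-*ʳ {b} {k} {r} {s} p q = ≤ν-resp (ℚ.*-comm s r) (≤ν-*ˡ q p)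

seq-bounded : ∀ x → ∃[ b ] b ≤ν₂ x
seq-bounded x = b ℤ.⊓ + 0 , N , λ n N≤n →
  ≤ν-resp (rearrange (seq x n) (seq x N))
    (≤ν-+ (≤ν-mono (ℤ.i⊓j≤j b (+ 0)) (proj₂ (cauchy x (+ 0)) n N N≤n ℕ.≤-refl))
          (≤ν-mono (ℤ.i⊓j≤i b (+ 0)) (proj₂ (≤ν-bounded (seq x N)))))
  where
  open ℚ-Solver.+-*-Solver
  N = proj₁ (cauchy x (+ 0))
  b = proj₁ (≤ν-bounded (seq x N))
  rearrange : ∀ r s → (r ℚ.- s) ℚ.+ s ≡ r
  rearrange = solve 2 (λ r s → (r :- s) :+ s := r) refl

const₂ : ℚ → ℚ₂
const₂ r .seq _    = r
const₂ r .cauchy _ = 0 , λ _ _ _ _ → ≤ν-resp (sym (ℚ.+-inverseʳ r)) ≤ν-0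

0₂ 1₂ : ℚ₂
0₂ = const₂ 0ℚ
1₂ = const₂ 1ℚ

_+₂_ : ℚ₂ → ℚ₂ → ℚ₂
(x +₂ y) .seq n    = seq x n ℚ.+ seq y n
(x +₂ y) .cauchy k with cauchy x k | cauchy y k
... | M , p | N , q = M ℕ.⊔ N , λ m n lem len →
  ≤ν-resp (rearrange (seq x m) (seq x n) (seq y m) (seq y n))
    (≤ν-+ (p m n (ℕ.≤-trans (ℕ.m≤m⊔n M N) lem) (ℕ.≤-trans (ℕ.m≤m⊔n M N) len))
          (q m n (ℕ.≤-trans (ℕ.m≤n⊔m M N) lem) (ℕ.≤-trans (ℕ.m≤n⊔m M N) len)))
  where
  open ℚ-Solver.+-*-Solver
  rearrange : ∀ a b c d → (a ℚ.- b) ℚ.+ (c ℚ.- d) ≡ (a ℚ.+ c) ℚ.- (b ℚ.+ d)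
  rearrange = solve 4 (λ a b c d → (a :- b) :+ (c :- d) := (a :+ c) :- (b :+ d)) refl

-₂_ : ℚ₂ → ℚ₂
(-₂ x) .seq n    = ℚ.- seq x n
(-₂ x) .cauchy k with cauchy x k
... | N , p = N , λ m n N≤m N≤n → ≤ν-resp (rearrange (seq x n) (seq x m)) (p n m N≤n N≤m)
  where
  open ℚ-Solver.+-*-Solver
  rearrange : ∀ a b → a ℚ.- b ≡ (ℚ.- b) ℚ.- (ℚ.- a)
  rearrange = solve 2 (λ a b → a :- b := (:- b) :- (:- a)) refl

*-diff : ∀ a b c d → a ℚ.* (c ℚ.- d) ℚ.+ (a ℚ.- b) ℚ.* d ≡ a ℚ.* c ℚ.- b ℚ.* d
*-diff = solve 4 (λ a b c d → a :* (c :- d) :+ (a :- b) :* d := a :* c :- b :* d) refl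
  where open ℚ-Solver.+-*-Solver

_*₂_ : ℚ₂ → ℚ₂ → ℚ₂
(x *₂ y) .seq n    = seq x n ℚ.* seq y n
(x *₂ y) .cauchy k = (K ℕ.⊔ L) ℕ.⊔ (M ℕ.⊔ N) , λ m n lem len →
  ≤ν-resp (*-diff (seq x m) (seq x n) (seq y m) (seq y n))
    (≤ν-+ (≤ν-*ˡ (proj₂ (proj₂ bx) m (≤K lem)) (proj₂ cy m n (≤N lem) (≤N len)))
          (≤ν-*ʳ (proj₂ cx m n (≤M lem) (≤M len)) (proj₂ (proj₂ by) n (≤L len))))
  where
  bx = seq-bounded x
  by = seq-bounded y
  cx = cauchy x (k ℤ.- proj₁ by)
  cy = cauchy y (k ℤ.- proj₁ bx)
  K = proj₁ (proj₂ bx)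
  L = proj₁ (proj₂ by)
  M = proj₁ cx
  N = proj₁ cy
  ≤K : ∀ {m} → (K ℕ.⊔ L) ℕ.⊔ (M ℕ.⊔ N) ℕ.≤ m → K ℕ.≤ m
  ≤K = ℕ.m⊔n≤o⇒m≤o K L ∘ ℕ.m⊔n≤o⇒m≤o (K ℕ.⊔ L) (M ℕ.⊔ N)
  ≤L : ∀ {m} → (K ℕ.⊔ L) ℕ.⊔ (M ℕ.⊔ N) ℕ.≤ m → L ℕ.≤ m
  ≤L = ℕ.m⊔n≤o⇒n≤o K L ∘ ℕ.m⊔n≤o⇒m≤o (K ℕ.⊔ L) (M ℕ.⊔ N)
  ≤M : ∀ {m} → (K ℕ.⊔ L) ℕ.⊔ (M ℕ.⊔ N) ℕ.≤ m → M ℕ.≤ m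
  ≤M = ℕ.m⊔n≤o⇒m≤o M N ∘ ℕ.m⊔n≤o⇒n≤o (K ℕ.⊔ L) (M ℕ.⊔ N)
  ≤N : ∀ {m} → (K ℕ.⊔ L) ℕ.⊔ (M ℕ.⊔ N) ℕ.≤ m → N ℕ.≤ m
  ≤N = ℕ.m⊔n≤o⇒n≤o M N ∘ ℕ.m⊔n≤o⇒n≤o (K ℕ.⊔ L) (M ℕ.⊔ N)

pointwise : ∀ {x y} → (∀ n → seq x n ≡ seq y n) → x ≈₂ y
pointwise {x} {y} eq .close k = ev-pure λ n →
  ≤ν-resp (trans (sym (ℚ.+-inverseʳ (seq y n))) (cong (ℚ._- seq y n) (sym (eq n)))) ≤ν-0

≈₂-refl : ∀ {x} → x ≈₂ x
≈₂-refl {x} = pointwise {x} {x} λ _ → refl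

≈₂-sym : ∀ {x y} → x ≈₂ y → y ≈₂ x
≈₂-sym {x} {y} p .close k = ev-map (λ {n} q → ≤ν-resp (rearrange (seq x n) (seq y n)) (≤ν-neg q)) (close p k)
  where
  open ℚ-Solver.+-*-Solver
  rearrange : ∀ a b → ℚ.- (a ℚ.- b) ≡ b ℚ.- a
  rearrange = solve 2 (λ a b → :- (a :- b) := b :- a) refl

≈₂-trans : ∀ {x y z} → x ≈₂ y → y ≈₂ z → x ≈₂ z
≈₂-trans {x} {y} {z} p q .close k =
  ev-zip (λ {n} r s → ≤ν-resp (rearrange (seq x n) (seq y n) (seq z n)) (≤ν-+ r s)) (close p k) (close q k)
  where
  open ℚ-Solver.+-*-Solver
  rearrange : ∀ a b c → (a ℚ.- b) ℚ.+ (b ℚ.- c) ≡ a ℚ.- c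
  rearrange = solve 3 (λ a b c → (a :- b) :+ (b :- c) := a :- c) refl

+₂-cong : ∀ {x x′ y y′} → x ≈₂ x′ → y ≈₂ y′ → x +₂ y ≈₂ x′ +₂ y′
+₂-cong {x} {x′} {y} {y′} p q .close k =
  ev-zip (λ {n} r s → ≤ν-resp (rearrange (seq x n) (seq x′ n) (seq y n) (seq y′ n)) (≤ν-+ r s)) (close p k) (close q k)
  where
  open ℚ-Solver.+-*-Solver
  rearrange : ∀ a b c d → (a ℚ.- b) ℚ.+ (c ℚ.- d) ≡ (a ℚ.+ c) ℚ.- (b ℚ.+ d)
  rearrange = solve 4 (λ a b c d → (a :- b) :+ (c :- d) := (a :+ c) :- (b :+ d)) refl

-₂-cong : ∀ {x y} → x ≈₂ y → -₂ x ≈₂ -₂ y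
-₂-cong {x} {y} p .close k = ev-map (λ {n} q → ≤ν-resp (rearrange (seq x n) (seq y n)) (≤ν-neg q)) (close p k)
  where
  open ℚ-Solver.+-*-Solver
  rearrange : ∀ a b → ℚ.- (a ℚ.- b) ≡ (ℚ.- a) ℚ.- (ℚ.- b)
  rearrange = solve 2 (λ a b → :- (a :- b) := (:- a) :- (:- b)) refl

*₂-cong : ∀ {x x′ y y′} → x ≈₂ x′ → y ≈₂ y′ → x *₂ y ≈₂ x′ *₂ y′
*₂-cong {x} {x′} {y} {y′} p q .close k =
  ev-zip (λ {n} t u → ≤ν-resp (*-diff (seq x n) (seq x′ n) (seq y n) (seq y′ n)) (≤ν-+ t u))
    (ev-zip ≤ν-*ˡ (proj₂ (seq-bounded x)) (close q (k ℤ.- proj₁ (seq-bounded x))))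
    (ev-zip ≤ν-*ʳ (close p (k ℤ.- proj₁ (seq-bounded y′))) (proj₂ (seq-bounded y′)))

ℚ₂-commutativeRing : CommutativeRing 0ℓ 0ℓ
ℚ₂-commutativeRing = record
  { Carrier = ℚ₂
  ; _≈_     = _≈₂_
  ; _+_     = _+₂_
  ; _*_     = _*₂_
  ; -_      = -₂_
  ; 0#      = 0₂
  ; 1#      = 1₂
  ; isCommutativeRing = record
    { isRing = record
      { +-isAbelianGroup = record
        { isGroup = record
          { isMonoid = record
            { isSemigroup = record
              { isMagma = record
                { isEquivalence = record
                  { refl  = ≈₂-refl
                  ; sym   = ≈₂-sym
                  ; trans = ≈₂-trans
                  }
                ; ∙-cong = +₂-cong
                }
              ; assoc = λ x y z → pointwise λ n → ℚ.+-assoc (seq x n) (seq y n) (seq z n)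
              }
            ; identity = (λ x → pointwise λ n → ℚ.+-identityˡ (seq x n))
                       , (λ x → pointwise λ n → ℚ.+-identityʳ (seq x n))
            }
          ; inverse = (λ x → pointwise λ n → ℚ.+-inverseˡ (seq x n))
                    , (λ x → pointwise λ n → ℚ.+-inverseʳ (seq x n))
          ; ⁻¹-cong = -₂-cong
          }
        ; comm = λ x y → pointwise λ n → ℚ.+-comm (seq x n) (seq y n)
        }
      ; *-cong = *₂-cong
      ; *-assoc = λ x y z → pointwise λ n → ℚ.*-assoc (seq x n) (seq y n) (seq z n)
      ; *-identity = (λ x → pointwise λ n → ℚ.*-identityˡ (seq x n))
                   , (λ x → pointwise λ n → ℚ.*-identityʳ (seq x n))
      ; distrib = (λ x y z → pointwise λ n → ℚ.*-distribˡ-+ (seq x n) (seq y n) (seq z n))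
                , (λ x y z → pointwise λ n → ℚ.*-distribʳ-+ (seq x n) (seq y n) (seq z n))
      }
    ; *-comm = λ x y → pointwise λ n → ℚ.*-comm (seq x n) (seq y n)
    }
  }

module ℚ₂-Ring = CommutativeRing ℚ₂-commutativeRing
module ℚ₂-Sum = SemiringSum ℚ₂-Ring.semiring
module ℚ₂-Exp = Exp ℚ₂-Ring.semiring
open ℚ₂-Sum using (sum)

ν₂-resp : ∀ {k x y} → x ≈₂ y → k ≤ν₂ x → k ≤ν₂ y
ν₂-resp {k} {x} {y} p q = ev-zip (λ {n} r s → ≤ν-resp (rearrange (seq x n) (seq y n)) (≤ν-- r s)) q (close p k)
  where
  open ℚ-Solver.+-*-Solver
  rearrange : ∀ a b → a ℚ.- (a ℚ.- b) ≡ b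
  rearrange = solve 2 (λ a b → a :- (a :- b) := b) refl

ν₂-mono : ∀ {j k} x → j ℤ.≤ k → k ≤ν₂ x → j ≤ν₂ x
ν₂-mono x j≤k = ev-map (≤ν-mono j≤k)

ν₂-const : ∀ {k r} → k ≤ν r → k ≤ν₂ const₂ r
ν₂-const p = ev-pure λ _ → p

ν₂-0 : ∀ {k} → k ≤ν₂ 0₂
ν₂-0 = ν₂-const ≤ν-0

ν₂-+ : ∀ {k} x y → k ≤ν₂ x → k ≤ν₂ y → k ≤ν₂ x +₂ y
ν₂-+ x y = ev-zip ≤ν-+

ν₂-neg : ∀ {k} x → k ≤ν₂ x → k ≤ν₂ -₂ x
ν₂-neg x = ev-map ≤ν-neg

ν₂-* : ∀ {k l} x y → k ≤ν₂ x → l ≤ν₂ y → k ℤ.+ l ≤ν₂ x *₂ y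
ν₂-* x y = ev-zip ≤ν-*

ν₂-sum : ∀ {k n} (t : Vector ℚ₂ n) → (∀ i → k ≤ν₂ t i) → k ≤ν₂ sum t
ν₂-sum {n = zero}  t p = ν₂-0
ν₂-sum {n = suc n} t p = ν₂-+ (t Fin.zero) (sum (t ∘ Fin.suc)) (p Fin.zero) (ν₂-sum (t ∘ Fin.suc) (p ∘ Fin.suc))

k≤∣k∣ : ∀ k → k ℤ.≤ + ℤ.∣ k ∣
k≤∣k∣ (+ n)    = ℤ.≤-refl
k≤∣k∣ -[1+ n ] = ℤ.-≤+

k≤ : ∀ k {n} → ℤ.∣ k ∣ ℕ.≤ n → k ℤ.≤ + n
k≤ k le = ℤ.≤-trans (k≤∣k∣ k) (ℤ.+≤+ le)

module Limit
  (x : ℕ → ℚ₂)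
  (x-cauchy : ∀ k → ∃[ N ] ∀ m n → N ℕ.≤ m → N ℕ.≤ n → k ≤ν₂ x m +₂ (-₂ x n))
  where

  outer : ℕ → ℕ
  outer k = proj₁ (x-cauchy (+ k))

  inner : ℕ → ℕ
  inner k = proj₁ (cauchy (x (outer k)) (+ k))

  diagonal : ℕ → ℚ
  diagonal k = seq (x (outer k)) (inner k)

  telescope : ∀ a b c → (a ℚ.- b) ℚ.+ (b ℚ.- c) ≡ a ℚ.- c
  telescope = solve 3 (λ a b c → (a :- b) :+ (b :- c) := a :- c) refl
    where open ℚ-Solver.+-*-Solver

  diagonal-near : ∀ {k} i N → k ℤ.≤ + i → outer i ℕ.≤ N → Eventually λ n → k ≤ν diagonal i ℚ.- seq (x N) n
  diagonal-near i N k≤i le = ev-zip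
    (λ {n} a b → ≤ν-mono k≤i (≤ν-resp (telescope (diagonal i) (seq (x (outer i)) n) (seq (x N) n)) (≤ν-+ a b)))
    (inner i , λ n len → proj₂ (cauchy (x (outer i)) (+ i)) (inner i) n ℕ.≤-refl len)
    (proj₂ (x-cauchy (+ i)) (outer i) N ℕ.≤-refl le)

  diagonal-step : ∀ {k} i j → k ℤ.≤ + i → k ℤ.≤ + j → k ≤ν diagonal i ℚ.- diagonal j
  diagonal-step i j k≤i k≤j = ev-const (ev-zip
    (λ {n} a b → ≤ν-resp (rearrange (diagonal i) (seq (x common) n) (diagonal j)) (≤ν-- a b))
    (diagonal-near i common k≤i (ℕ.m≤m+n (outer i) (outer j)))
    (diagonal-near j common k≤j (ℕ.m≤n+m (outer j) (outer i))))
    where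
    open ℚ-Solver.+-*-Solver
    common = outer i ℕ.+ outer j
    rearrange : ∀ a b c → (a ℚ.- b) ℚ.- (c ℚ.- b) ≡ a ℚ.- c
    rearrange = solve 3 (λ a b c → (a :- b) :- (c :- b) := a :- c) refl

  lim : ℚ₂
  lim .seq      = diagonal
  lim .cauchy k = ℤ.∣ k ∣ , λ m n lem len → diagonal-step m n (k≤ k lem) (k≤ k len)

  lim-correct : ∀ k → Eventually λ N → k ≤ν₂ lim +₂ (-₂ x N)
  lim-correct k = outer i , λ N le → ev-zip
    (λ {n} a b → ≤ν-resp (telescope (diagonal n) (diagonal i) (seq (x N) n)) (≤ν-+ a b))
    (i , λ n len → diagonal-step n i (k≤ k len) (k≤ k ℕ.≤-refl))
    (diagonal-near i N (k≤ k ℕ.≤-refl) le)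
    where i = ℤ.∣ k ∣

ν₂-trans : ∀ {k} x y z → k ≤ν₂ x +₂ (-₂ y) → k ≤ν₂ y +₂ (-₂ z) → k ≤ν₂ x +₂ (-₂ z)
ν₂-trans x y z = ev-zip λ {n} p q → ≤ν-resp (rearrange (seq x n) (seq y n) (seq z n)) (≤ν-+ p q)
  where
  open ℚ-Solver.+-*-Solver
  rearrange : ∀ a b c → (a ℚ.- b) ℚ.+ (b ℚ.- c) ≡ a ℚ.- c
  rearrange = solve 3 (λ a b c → (a :- b) :+ (b :- c) := a :- c) refl

ν₂-flip : ∀ {k} x y → k ≤ν₂ x +₂ (-₂ y) → k ≤ν₂ y +₂ (-₂ x)
ν₂-flip x y = ev-map λ {n} p → ≤ν-resp (rearrange (seq x n) (seq y n)) (≤ν-neg p)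
  where
  open ℚ-Solver.+-*-Solver
  rearrange : ∀ a b → ℚ.- (a ℚ.- b) ≡ b ℚ.- a
  rearrange = solve 2 (λ a b → :- (a :- b) := b :- a) refl

ν₂-approx : ∀ {k} x y → k ≤ν₂ x +₂ (-₂ y) → k ≤ν₂ y → k ≤ν₂ x
ν₂-approx x y = ev-zip λ {n} p q → ≤ν-resp (rearrange (seq x n) (seq y n)) (≤ν-+ p q)
  where
  open ℚ-Solver.+-*-Solver
  rearrange : ∀ a b → (a ℚ.- b) ℚ.+ b ≡ a
  rearrange = solve 2 (λ a b → (a :- b) :+ b := a) refl

ev-all : ∀ {r} {P : Fin r → ℕ → Set} → (∀ l → Eventually (P l)) → Eventually λ n → ∀ l → P l n
ev-all {zero}  p = ev-pure λ _ ()
ev-all {suc r} p = ev-zip (λ { a b Fin.zero → a ; a b (Fin.suc l) → b l }) (p Fin.zero) (ev-all (p ∘ Fin.suc))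

lowerBound : ∀ {r} (f : Fin r → ℤ) → ∃[ b ] ∀ l → b ℤ.≤ f l
lowerBound {zero}  f = + 0 , λ ()
lowerBound {suc r} f = f Fin.zero ℤ.⊓ proj₁ rest , λ where
    Fin.zero    → ℤ.i⊓j≤i (f Fin.zero) (proj₁ rest)
    (Fin.suc l) → ℤ.≤-trans (ℤ.i⊓j≤j (f Fin.zero) (proj₁ rest)) (proj₂ rest l)
  where rest = lowerBound (f ∘ Fin.suc)

record c₀ : Set where
  no-eta-equality
  field
    coeff : ℕ → ℚ₂
    null  : ∀ k → Eventually λ i → k ≤ν₂ coeff i

open c₀ public

infix 4 _≈ᶜ_ _≤ν∞_

record _≈ᶜ_ (a b : c₀) : Set where
  constructor ≈ᶜ-intro
  field coeff-≈ : ∀ i → coeff a i ≈₂ coeff b i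

open _≈ᶜ_ public

-- ‖a‖ ≤ 2⁻ᵏ
_≤ν∞_ : ℤ → c₀ → Set
k ≤ν∞ a = ∀ i → k ≤ν₂ coeff a i

module _ where
  private
    _+ᶜ_ : c₀ → c₀ → c₀
    (a +ᶜ b) .coeff i = coeff a i +₂ coeff b i
    (a +ᶜ b) .null k  = ev-zip (λ {i} → ν₂-+ (coeff a i) (coeff b i)) (null a k) (null b k)

    -ᶜ_ : c₀ → c₀
    (-ᶜ a) .coeff i = -₂ coeff a i
    (-ᶜ a) .null k  = ev-map (λ {i} → ν₂-neg (coeff a i)) (null a k)

    0ᶜ : c₀
    0ᶜ .coeff _ = 0₂
    0ᶜ .null k  = ev-pure λ _ → ν₂-0

    _·ᶜ_ : ℚ₂ → c₀ → c₀
    (x ·ᶜ a) .coeff i = x *₂ coeff a i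
    (x ·ᶜ a) .null k  = ev-map
      (λ {i} p → subst (_≤ν₂ x *₂ coeff a i) (split b k) (ν₂-* x (coeff a i) (proj₂ (seq-bounded x)) p))
      (null a (k ℤ.- b))
      where b = proj₁ (seq-bounded x)

  open ℚ₂-Ring

  c₀-leftModule : LeftModule ℚ₂-Ring.ring 0ℓ 0ℓ
  c₀-leftModule = record
    { Carrierᴹ = c₀
    ; _≈ᴹ_     = _≈ᶜ_
    ; _+ᴹ_     = _+ᶜ_
    ; _*ₗ_     = _·ᶜ_
    ; 0ᴹ       = 0ᶜ
    ; -ᴹ_      = -ᶜ_
    ; isLeftModule = record
      { isLeftSemimodule = record
        { +ᴹ-isCommutativeMonoid = record
          { isMonoid = record
            { isSemigroup = record
              { isMagma = record
                { isEquivalence = record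
                  { refl  = ≈ᶜ-intro λ i → ≈₂-refl
                  ; sym   = λ p → ≈ᶜ-intro λ i → ≈₂-sym (coeff-≈ p i)
                  ; trans = λ p q → ≈ᶜ-intro λ i → ≈₂-trans (coeff-≈ p i) (coeff-≈ q i)
                  }
                ; ∙-cong = λ p q → ≈ᶜ-intro λ i → +₂-cong (coeff-≈ p i) (coeff-≈ q i)
                }
              ; assoc = λ a b c → ≈ᶜ-intro λ i → +-assoc (coeff a i) (coeff b i) (coeff c i)
              }
            ; identity = (λ a → ≈ᶜ-intro λ i → +-identityˡ (coeff a i))
                       , (λ a → ≈ᶜ-intro λ i → +-identityʳ (coeff a i))
            }
          ; comm = λ a b → ≈ᶜ-intro λ i → +-comm (coeff a i) (coeff b i)
          }
        ; isPreleftSemimodule = record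
          { *ₗ-cong      = λ p q → ≈ᶜ-intro λ i → *₂-cong p (coeff-≈ q i)
          ; *ₗ-zeroˡ     = λ a → ≈ᶜ-intro λ i → zeroˡ (coeff a i)
          ; *ₗ-distribʳ  = λ a x y → ≈ᶜ-intro λ i → distribʳ (coeff a i) x y
          ; *ₗ-identityˡ = λ a → ≈ᶜ-intro λ i → *-identityˡ (coeff a i)
          ; *ₗ-assoc     = λ x y a → ≈ᶜ-intro λ i → *-assoc x y (coeff a i)
          ; *ₗ-zeroʳ     = λ x → ≈ᶜ-intro λ i → zeroʳ x
          ; *ₗ-distribˡ  = λ x a b → ≈ᶜ-intro λ i → distribˡ x (coeff a i) (coeff b i)
          }
        }
      ; -ᴹ‿cong    = λ p → ≈ᶜ-intro λ i → -₂-cong (coeff-≈ p i)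
      ; -ᴹ‿inverse = (λ a → ≈ᶜ-intro λ i → -‿inverseˡ (coeff a i))
                   , (λ a → ≈ᶜ-intro λ i → -‿inverseʳ (coeff a i))
      }
    }

module C₀ = LeftModule c₀-leftModule
module C₀-Sum = MonoidSum C₀.+ᴹ-commutativeMonoid

basis : ℕ → c₀
basis j .coeff i = if does (i ℕ.≟ j) then 1₂ else 0₂
basis j .null k  = suc j , λ i j<i →
  subst (λ b → k ≤ν₂ (if b then 1₂ else 0₂)) (sym (dec-false (i ℕ.≟ j) (ℕ.>⇒≢ j<i))) ν₂-0

basis-norm : ∀ j → + 0 ≤ν∞ basis j
basis-norm j i with does (i ℕ.≟ j)
... | true  = ν₂-const (≤ν-ι (+ 1))
... | false = ν₂-0

private
  ℚ₂-rawLeftModule = LeftModule.rawLeftModule (TensorUnit.leftModule {R = ℚ₂-Ring.ring})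

IsLinear : (c₀ → c₀) → Set
IsLinear = LeftModuleMorphisms.IsLeftModuleHomomorphism C₀.rawLeftModule C₀.rawLeftModule

record BoundedFunctional : Set where
  no-eta-equality
  open LeftModuleMorphisms C₀.rawLeftModule ℚ₂-rawLeftModule
  field
    ⟦_⟧      : c₀ → ℚ₂
    isLinear : IsLeftModuleHomomorphism ⟦_⟧
    bounded  : ∃[ b ] ∀ k a → k ≤ν∞ a → k ℤ.+ b ≤ν₂ ⟦ a ⟧

-- The operator a ↦ Σₗ φₗ(a) vₗ.  Asking for bounded φₗ, rather than for a
-- continuous operator with finitely generated image, is the same thing
-- classically and spares a choice of coordinates on the image.
record FiniteRankOperator : Set where
  field
    rank        : ℕ
    functionals : Vector BoundedFunctional rank
    vectors     : Vector c₀ rank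

  open C₀-Sum using (sum-syntax)

  ⟦_⟧ : c₀ → c₀
  ⟦ a ⟧ = ∑[ l < rank ] (BoundedFunctional.⟦ functionals l ⟧ a C₀.*ₗ vectors l)

-- T is a limit of finite rank operators for the operator norm.
IsCompact : (c₀ → c₀) → Set
IsCompact T = ∀ k → Σ[ F ∈ FiniteRankOperator ]
  ∀ m a → m ≤ν∞ a → m ℤ.+ k ≤ν∞ T a C₀.+ᴹ (C₀.-ᴹ FiniteRankOperator.⟦ F ⟧ a)

record CompactOperator : Set where
  no-eta-equality
  field
    ⟦_⟧       : c₀ → c₀
    isLinear  : IsLinear ⟦_⟧
    isCompact : IsCompact ⟦_⟧

  matrix : ℕ → ℕ → ℚ₂
  matrix i j = coeff ⟦ basis j ⟧ i

c₀-sum-ν : ∀ {k n} i (t : Vector c₀ n) → (∀ l → k ≤ν₂ coeff (t l) i) → k ≤ν₂ coeff (C₀-Sum.sum t) i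
c₀-sum-ν {n = zero}  i t p = ν₂-0
c₀-sum-ν {n = suc n} i t p = ν₂-+ (coeff (t Fin.zero) i) (coeff (C₀-Sum.sum (t ∘ Fin.suc)) i)
  (p Fin.zero) (c₀-sum-ν i (t ∘ Fin.suc) (p ∘ Fin.suc))

module _ (T : CompactOperator) where
  open CompactOperator T

  module Approximation (k : ℤ) where
    open FiniteRankOperator (proj₁ (isCompact k)) public
      using (rank; functionals; vectors) renaming (⟦_⟧ to F)

    φ : Fin rank → c₀ → ℚ₂
    φ l = BoundedFunctional.⟦ functionals l ⟧

    b : Fin rank → ℤ
    b l = proj₁ (BoundedFunctional.bounded (functionals l))

    φ-basis : ∀ l j → b l ≤ν₂ φ l (basis j)
    φ-basis l j = subst (_≤ν₂ φ l (basis j)) (ℤ.+-identityˡ (b l))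
      (proj₂ (BoundedFunctional.bounded (functionals l)) (+ 0) (basis j) (basis-norm j))

    error : ∀ i j → k ≤ν₂ matrix i j +₂ (-₂ coeff (F (basis j)) i)
    error i j = subst (_≤ν₂ matrix i j +₂ (-₂ coeff (F (basis j)) i)) (ℤ.+-identityˡ k)
      (proj₂ (isCompact k) (+ 0) (basis j) (basis-norm j) i)

  rows-null : ∀ k → Eventually λ i → ∀ j → k ≤ν₂ matrix i j
  rows-null k = ev-map
    (λ {i} p j → ν₂-approx (matrix i j) (coeff (F (basis j)) i) (error i j)
      (c₀-sum-ν i (λ l → φ l (basis j) C₀.*ₗ vectors l) λ l →
        subst (_≤ν₂ φ l (basis j) *₂ coeff (vectors l) i) (split (b l) k)
          (ν₂-* (φ l (basis j)) (coeff (vectors l) i) (φ-basis l j) (p l))))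
    (ev-all λ l → null (vectors l) (k ℤ.- b l))
    where open Approximation k

  row-bounded : ∀ i → ∃[ c ] ∀ j → c ≤ν₂ matrix i j
  row-bounded i = c , λ j → ν₂-approx (matrix i j) (coeff (F (basis j)) i)
    (ν₂-mono (matrix i j +₂ (-₂ coeff (F (basis j)) i)) (ℤ.i⊓j≤j (proj₁ least) (+ 0)) (error i j))
    (c₀-sum-ν i (λ l → φ l (basis j) C₀.*ₗ vectors l) λ l →
      ν₂-mono (φ l (basis j) *₂ coeff (vectors l) i)
        (ℤ.≤-trans (ℤ.i⊓j≤i (proj₁ least) (+ 0)) (proj₂ least l))
        (ν₂-* (φ l (basis j)) (coeff (vectors l) i) (φ-basis l j) (proj₂ (seq-bounded (coeff (vectors l) i)))))
    where
    open Approximation (+ 0)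
    least = lowerBound λ l → b l ℤ.+ proj₁ (seq-bounded (coeff (vectors l) i))
    c = proj₁ least ℤ.⊓ + 0

  matrix-bounded : ∃[ c ] ∀ i j → c ≤ν₂ matrix i j
  matrix-bounded = c , λ i j → bound i j (i ℕ.<? N)
    where
    N = proj₁ (rows-null (+ 0))
    least = lowerBound {N} λ l → proj₁ (row-bounded (toℕ l))
    c = proj₁ least ℤ.⊓ + 0
    bound : ∀ i j → Dec (i ℕ.< N) → c ≤ν₂ matrix i j
    bound i j (yes i<N) = ν₂-mono (matrix i j)
      (ℤ.≤-trans (ℤ.i⊓j≤i (proj₁ least) (+ 0))
        (subst (λ l → proj₁ least ℤ.≤ proj₁ (row-bounded l)) (toℕ-fromℕ< i<N) (proj₂ least (Fin.fromℕ< i<N))))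
      (proj₂ (row-bounded i) j)
    bound i j (no i≮N) = ν₂-mono (matrix i j) (ℤ.i⊓j≤j (proj₁ least) (+ 0))
      (proj₂ (rows-null (+ 0)) i (ℕ.≮⇒≥ i≮N) j)

module _ (d : ℕ → ℚ₂) (d-null : ∀ k → Eventually λ i → k ≤ν₂ d i) where
  open ℚ₂-Ring hiding (refl; sym; trans)

  private
    scale : c₀ → c₀
    scale a .coeff i = d i *₂ coeff a i
    scale a .null k  = ev-zip
      (λ {i} p q → subst (_≤ν₂ d i *₂ coeff a i) (ℤ.+-identityʳ k) (ν₂-* (d i) (coeff a i) p q))
      (d-null k) (null a (+ 0))

    coordinate : ℕ → BoundedFunctional
    coordinate l = record
      { ⟦_⟧      = λ a → coeff a l
      ; isLinear = record
        { +ᴹ-isGroupHomomorphism = record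
          { isMonoidHomomorphism = record
            { isMagmaHomomorphism = record
              { isRelHomomorphism = record { cong = λ p → coeff-≈ p l }
              ; homo = λ a b → ≈₂-refl
              }
            ; ε-homo = ≈₂-refl
            }
          ; ⁻¹-homo = λ a → ≈₂-refl
          }
        ; *ₗ-homo = λ x a → ≈₂-refl
        }
      ; bounded  = + 0 , λ k a p → subst (_≤ν₂ coeff a l) (sym (ℤ.+-identityʳ k)) (p l)
      }

    truncation : ℕ → FiniteRankOperator
    truncation N = record
      { rank        = N
      ; functionals = λ l → coordinate (toℕ l)
      ; vectors     = λ l → d (toℕ l) C₀.*ₗ basis (toℕ l)
      }

    term : c₀ → ℕ → c₀
    term a l = coeff a l C₀.*ₗ (d l C₀.*ₗ basis l)

    term-off : ∀ a {i l} → ¬ i ≡ l → coeff (term a l) i ≈₂ 0₂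
    term-off a {i} {l} i≢l rewrite dec-false (i ℕ.≟ l) i≢l =
      ≈₂-trans (*-congˡ {coeff a l} (zeroʳ (d l))) (zeroʳ (coeff a l))

    term-on : ∀ a i → coeff (term a i) i ≈₂ coeff (scale a) i
    term-on a i rewrite dec-true (i ℕ.≟ i) refl =
      ≈₂-trans (*-congˡ {coeff a i} (*-identityʳ (d i))) (*-comm (coeff a i) (d i))

    sum-off : ∀ {n} i (t : Vector c₀ n) → (∀ l → coeff (t l) i ≈₂ 0₂) → coeff (C₀-Sum.sum t) i ≈₂ 0₂
    sum-off {zero}  i t p = ≈₂-refl
    sum-off {suc n} i t p = ≈₂-trans (+₂-cong (p Fin.zero) (sum-off i (t ∘ Fin.suc) (p ∘ Fin.suc))) (+-identityˡ 0₂)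

    sum-on : ∀ {n x} i (t : Vector c₀ n) (p : Fin n) → coeff (t p) i ≈₂ x →
             (∀ l → ¬ l ≡ p → coeff (t l) i ≈₂ 0₂) → coeff (C₀-Sum.sum t) i ≈₂ x
    sum-on {x = x} i t Fin.zero on off = ≈₂-trans
      (+₂-cong on (sum-off i (t ∘ Fin.suc) λ l → off (Fin.suc l) λ ())) (+-identityʳ x)
    sum-on {x = x} i t (Fin.suc p) on off = ≈₂-trans
      (+₂-cong (off Fin.zero λ ()) (sum-on i (t ∘ Fin.suc) p on λ l l≢p → off (Fin.suc l) (l≢p ∘ suc-injective)))
      (+-identityˡ x)

    truncation-exact : ∀ {N} a {i} → i ℕ.< N → coeff (FiniteRankOperator.⟦ truncation N ⟧ a) i ≈₂ coeff (scale a) i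
    truncation-exact a {i} i<N = sum-on i (term a ∘ toℕ) (Fin.fromℕ< i<N)
      (subst (λ l → coeff (term a l) i ≈₂ coeff (scale a) i) (sym (toℕ-fromℕ< i<N)) (term-on a i))
      λ l l≢p → term-off a λ i≡l → l≢p (toℕ-injective (trans (sym i≡l) (sym (toℕ-fromℕ< i<N))))

    error-bound : ∀ k m a → m ≤ν∞ a →
      m ℤ.+ k ≤ν∞ scale a C₀.+ᴹ (C₀.-ᴹ FiniteRankOperator.⟦ truncation (proj₁ (d-null k)) ⟧ a)
    error-bound k m a p i with i ℕ.<? proj₁ (d-null k)
    ... | yes i<N = ν₂-resp
      (≈₂-sym (≈₂-trans (+-congˡ {coeff (scale a) i} (-‿cong (truncation-exact a i<N))) (-‿inverseʳ (coeff (scale a) i))))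
      ν₂-0
    ... | no i≮N = ν₂-+ (coeff (scale a) i) (-₂ coeff F i)
      (subst (_≤ν₂ d i *₂ coeff a i) (ℤ.+-comm k m) (ν₂-* (d i) (coeff a i) (proj₂ (d-null k) i (ℕ.≮⇒≥ i≮N)) (p i)))
      (ν₂-resp (≈₂-sym (≈₂-trans (-‿cong F-off) -0#≈0#)) ν₂-0)
      where
      open RingProperties ℚ₂-Ring.ring using (-0#≈0#)
      F = FiniteRankOperator.⟦ truncation (proj₁ (d-null k)) ⟧ a
      F-off : coeff F i ≈₂ 0₂
      F-off = sum-off i (term a ∘ toℕ) λ l → term-off a λ i≡l → i≮N (subst (ℕ._< proj₁ (d-null k)) (sym i≡l) (toℕ<n l))

  diagonal : CompactOperator
  diagonal = record
    { ⟦_⟧       = scale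
    ; isLinear  = record
      { +ᴹ-isGroupHomomorphism = record
        { isMonoidHomomorphism = record
          { isMagmaHomomorphism = record
            { isRelHomomorphism = record { cong = λ p → ≈ᶜ-intro λ i → *-congˡ {d i} (coeff-≈ p i) }
            ; homo = λ a b → ≈ᶜ-intro λ i → distribˡ (d i) (coeff a i) (coeff b i)
            }
          ; ε-homo = ≈ᶜ-intro λ i → zeroʳ (d i)
          }
        ; ⁻¹-homo = λ a → ≈ᶜ-intro λ i → ≈₂-sym (-‿distribʳ-* (d i) (coeff a i))
        }
      ; *ₗ-homo = λ x a → ≈ᶜ-intro λ i → x∙yz≈y∙xz (d i) x (coeff a i)
      }
    ; isCompact = λ k → truncation (proj₁ (d-null k)) , error-bound k
    }
    where
    open RingProperties ℚ₂-Ring.ring using (-‿distribʳ-*)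
    open CommutativeSemigroupProperties ℚ₂-Ring.*-commutativeSemigroup using (x∙yz≈y∙xz)

det : ∀ {n} → (Fin n → Fin n → ℚ₂) → ℚ₂
det {zero}  A = 1₂
det {suc n} A = ∑[ j < suc n ] ((-₂ 1₂) ^ toℕ j *₂ (A Fin.zero j *₂ det λ r c → A (Fin.suc r) (punchIn j c)))
  where
  open ℚ₂-Sum using (sum-syntax)
  open ℚ₂-Exp using (_^_)

-- The n-element subsets of {0, …, N-1}, each listed in decreasing order.
subsets : (n N : ℕ) → List (Vector ℕ n)
subsets zero    N       = [ (λ ()) ]
subsets (suc n) zero    = []
subsets (suc n) (suc N) = subsets (suc n) N ++ map (N Vector.∷_) (subsets n N)

nTimes : ℕ → ℤ → ℤ
nTimes zero    b = + 0
nTimes (suc n) b = b ℤ.+ nTimes n b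

sign-ν : ∀ j → + 0 ≤ν₂ (-₂ 1₂) ℚ₂-Exp.^ j
sign-ν zero    = ν₂-const (≤ν-ι (+ 1))
sign-ν (suc j) = ν₂-* (-₂ 1₂) ((-₂ 1₂) ℚ₂-Exp.^ j) (ν₂-neg 1₂ (ν₂-const (≤ν-ι (+ 1)))) (sign-ν j)

det-ν : ∀ {n k b} (A : Fin (suc n) → Fin (suc n) → ℚ₂) →
        (∀ j → k ≤ν₂ A Fin.zero j) → (∀ i j → b ≤ν₂ A i j) → k ℤ.+ nTimes n b ≤ν₂ det A
det-ν {n} {k} {b} A top all = ν₂-sum (λ j → sign j *₂ (A Fin.zero j *₂ det (minor j))) λ j →
  subst (_≤ν₂ sign j *₂ (A Fin.zero j *₂ det (minor j))) (ℤ.+-identityˡ _)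
    (ν₂-* (sign j) (A Fin.zero j *₂ det (minor j)) (sign-ν (toℕ j))
      (ν₂-* (A Fin.zero j) (det (minor j)) (top j) (rest n (minor j) λ r c → all (Fin.suc r) (punchIn j c))))
  where
  sign : Fin (suc n) → ℚ₂
  sign j = (-₂ 1₂) ℚ₂-Exp.^ toℕ j
  minor : Fin (suc n) → Fin n → Fin n → ℚ₂
  minor j r c = A (Fin.suc r) (punchIn j c)
  rest : ∀ n (B : Fin n → Fin n → ℚ₂) → (∀ r c → b ≤ν₂ B r c) → nTimes n b ≤ν₂ det B
  rest zero    B p = ν₂-const (≤ν-ι (+ 1))
  rest (suc n) B p = det-ν B (p Fin.zero) p

∑[_] : {A : Set} → List A → (A → ℚ₂) → ℚ₂
∑[ xs ] f = foldr (λ x s → f x +₂ s) 0₂ xs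

∑-++ : ∀ {k} {A : Set} (f : A → ℚ₂) (xs ys : List A) → All (λ y → k ≤ν₂ f y) ys →
       k ≤ν₂ ∑[ xs ++ ys ] f +₂ (-₂ ∑[ xs ] f)
∑-++ {k} {A} f [] ys p = ν₂-+ (∑[ ys ] f) (-₂ 0₂) (go ys p) (ν₂-neg 0₂ ν₂-0)
  where
  go : ∀ ys → All (λ y → k ≤ν₂ f y) ys → k ≤ν₂ ∑[ ys ] f
  go []       []       = ν₂-0
  go (y ∷ ys) (q ∷ qs) = ν₂-+ (f y) (∑[ ys ] f) q (go ys qs)
∑-++ f (x ∷ xs) ys p = ev-map
  (λ {n} → ≤ν-resp (rearrange (seq (f x) n) (seq (∑[ xs ++ ys ] f) n) (seq (∑[ xs ] f) n)))
  (∑-++ f xs ys p)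
  where
  open ℚ-Solver.+-*-Solver
  rearrange : ∀ a b c → b ℚ.- c ≡ (a ℚ.+ b) ℚ.- (a ℚ.+ c)
  rearrange = solve 3 (λ a b c → b :- c := (a :+ b) :- (a :+ c)) refl

module _ (T : CompactOperator) where
  open CompactOperator T using (matrix)

  principalMinor : ∀ {n} → Vector ℕ n → ℚ₂
  principalMinor s = det λ i j → matrix (s i) (s j)

  minorSum : (n N : ℕ) → ℚ₂
  minorSum n N = ∑[ subsets n N ] principalMinor

  minorSum-step : ∀ k n → Eventually λ N → k ≤ν₂ minorSum n (suc N) +₂ (-₂ minorSum n N)
  minorSum-step k zero    = ev-pure λ N → ν₂-resp (≈₂-sym (ℚ₂-Ring.-‿inverseʳ (minorSum 0 N))) ν₂-0
  minorSum-step k (suc n) = ev-map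
    (λ {N} p → ∑-++ principalMinor (subsets (suc n) N) (map (N Vector.∷_) (subsets n N))
      (All.map⁺ (All.universal (λ s → subst (_≤ν₂ principalMinor (N Vector.∷ s)) shift
        (det-ν (λ i j → matrix ((N Vector.∷ s) i) ((N Vector.∷ s) j)) (λ j → p ((N Vector.∷ s) j))
          (λ i j → proj₂ (matrix-bounded T) ((N Vector.∷ s) i) ((N Vector.∷ s) j)))) (subsets n N))))
    (rows-null T (k ℤ.- nTimes n b))
    where
    b = proj₁ (matrix-bounded T)
    shift : (k ℤ.- nTimes n b) ℤ.+ nTimes n b ≡ k
    shift = trans (ℤ.+-comm (k ℤ.- nTimes n b) (nTimes n b)) (split (nTimes n b) k)

  minorSum-cauchy : ∀ n k → ∃[ M ] ∀ i j → M ℕ.≤ i → M ℕ.≤ j → k ≤ν₂ minorSum n i +₂ (-₂ minorSum n j)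
  minorSum-cauchy n k = M , λ i j M≤i M≤j →
    ν₂-trans (minorSum n i) (minorSum n M) (minorSum n j) (from (ℕ.≤⇒≤′ M≤i))
      (ν₂-flip (minorSum n j) (minorSum n M) (from (ℕ.≤⇒≤′ M≤j)))
    where
    M = proj₁ (minorSum-step k n)
    from : ∀ {i} → M ℕ.≤′ i → k ≤ν₂ minorSum n i +₂ (-₂ minorSum n M)
    from (ℕ.≤′-reflexive refl)   = ν₂-resp (≈₂-sym (ℚ₂-Ring.-‿inverseʳ (minorSum n M))) ν₂-0
    from {suc i} (ℕ.≤′-step M≤i) = ν₂-trans (minorSum n (suc i)) (minorSum n i) (minorSum n M)
      (proj₂ (minorSum-step k n) i (ℕ.≤′⇒≤ M≤i)) (from M≤i)

  -- The n-th coefficient of det(1 - XT), namely (-1)ⁿ Σ det(T_S) over the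
  -- n-element sets S of indices, as in Serre's "Endomorphismes complètement
  -- continus des espaces de Banach p-adiques".
  charSeries : ℕ → ℚ₂
  charSeries n = (-₂ 1₂) ℚ₂-Exp.^ n *₂ Limit.lim (minorSum n) (minorSum-cauchy n)

Series : Set
Series = ℕ → ℤ

infixl 7 _⊛_
infixr 8 _^ˢ_

module ℤ-Sum = SemiringSum (CommutativeRing.semiring ℤ.+-*-commutativeRing)

q^ : ℕ → Series
q^ k n = if does (n ℕ.≟ k) then + 1 else + 0

_⊖ˢ_ : Series → Series → Series
(a ⊖ˢ b) n = a n ℤ.- b n

_⊛_ : Series → Series → Series
(a ⊛ b) n = ∑[ i ≤ n ] (a (toℕ i) ℤ.* b (n ℕ.∸ toℕ i))
  where open ℤ-Sum using (sum⁺-syntax)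

_^ˢ_ : Series → ℕ → Series
a ^ˢ zero  = q^ 0
a ^ˢ suc n = a ⊛ (a ^ˢ n)

-- The inverse Σₖ (1 - a)ᵏ of a series a with constant term 1; the k-th
-- summand is divisible by qᵏ.
inv : Series → Series
inv a n = ∑[ k ≤ n ] ((q^ 0 ⊖ˢ a) ^ˢ toℕ k) n
  where open ℤ-Sum using (sum⁺-syntax)

tail : Series → Series
tail a n = a (suc n)

-- a(q²)
double : Series → Series
double a zero          = a 0
double a (suc zero)    = + 0
double a (suc (suc n)) = double (tail a) n

eulerProduct : ℕ → Series
eulerProduct zero    = q^ 0
eulerProduct (suc N) = eulerProduct N ⊛ ((q^ 0 ⊖ˢ q^ (suc N)) ^ˢ 24)

-- The factors (1 - qᵏ)²⁴ with k > n do not affect the coefficient of qⁿ.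
Δ : Series
Δ zero    = + 0
Δ (suc n) = eulerProduct n n

-- Δ(2τ)/Δ(τ), after cancelling a factor q.
f : Series
f = tail (double Δ) ⊛ inv (tail Δ)

g : Series
g n = + (2 ℕ.^ 6) ℤ.* f n

-- The series Σ aₙgⁿ over n ≥ 1 with aₙ → 0 and norm max |aₙ|: coordinate i is
-- the coefficient of gⁱ⁺¹.
S₀ : Set
S₀ = c₀

-- Only the powers gⁱ⁺¹ with i < n contribute to the coefficient of qⁿ.
qExpansion : S₀ → ℕ → ℚ₂
qExpansion a n = ∑[ i < n ] (coeff a (toℕ i) *₂ const₂ (ι ((g ^ˢ suc (toℕ i)) n)))
  where open ℚ₂-Sum using (sum-syntax)

U-on-q : (ℕ → ℚ₂) → ℕ → ℚ₂
U-on-q a n = a (2 ℕ.* n)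

IsU : (S₀ → S₀) → Set
IsU T = ∀ a n → qExpansion (T a) n ≈₂ U-on-q (qExpansion a) n

D-denominator : ℕ → ℕ
D-denominator j = 3 ℕ.* ((2 ℕ.* j) !) ℕ.^ 4

D-numerator : ℕ → ℕ
D-numerator j = 2 ℕ.^ (4 ℕ.* j ℕ.+ 1) ℕ.* ((3 ℕ.* j) !) ℕ.^ 2 ℕ.* (j !) ℕ.^ 2

D-denominator≢0 : ∀ j → NonZero (D-denominator j)
D-denominator≢0 j = ℕ.m*n≢0 3 _ {{_}} {{ℕ.m^n≢0 _ 4 {{(2 ℕ.* j) ℕ.!≢0}}}}

D-entry : ℕ → ℚ
D-entry j = (+ D-numerator j ℚ./ D-denominator j) {{D-denominator≢0 j}}

module _ where
  open ℕ-Solver.+-*-Solver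

  half-product : ∀ j → ∃[ t ] (1 ℕ.+ 3 ℕ.* j) ℕ.* (2 ℕ.+ 3 ℕ.* j) ≡ 2 ℕ.* t
  half-product zero    = 1 , refl
  half-product (suc j) = t ℕ.+ 9 ℕ.* suc j , (begin
    (1 ℕ.+ 3 ℕ.* suc j) ℕ.* (2 ℕ.+ 3 ℕ.* suc j)
      ≡⟨ solve 1 (λ j → (con 1 :+ con 3 :* (con 1 :+ j)) :* (con 2 :+ con 3 :* (con 1 :+ j)) :=
           (con 1 :+ con 3 :* j) :* (con 2 :+ con 3 :* j) :+ con 2 :* (con 9 :* (con 1 :+ j))) refl j ⟩
    (1 ℕ.+ 3 ℕ.* j) ℕ.* (2 ℕ.+ 3 ℕ.* j) ℕ.+ 2 ℕ.* (9 ℕ.* suc j)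
      ≡⟨ cong (ℕ._+ 2 ℕ.* (9 ℕ.* suc j)) (proj₂ (half-product j)) ⟩
    2 ℕ.* t ℕ.+ 2 ℕ.* (9 ℕ.* suc j)
      ≡⟨ ℕ.*-distribˡ-+ 2 t (9 ℕ.* suc j) ⟨
    2 ℕ.* (t ℕ.+ 9 ℕ.* suc j)  ∎)
    where
    open ≡-Reasoning
    t = proj₁ (half-product j)

  Odd : ℕ → Set
  Odd o = ∃[ h ] o ≡ 1 ℕ.+ 2 ℕ.* h

  Odd-* : ∀ {a b} → Odd a → Odd b → Odd (a ℕ.* b)
  Odd-* (g , refl) (h , refl) = g ℕ.+ h ℕ.+ 2 ℕ.* (g ℕ.* h) ,
    solve 2 (λ x y → (con 1 :+ con 2 :* x) :* (con 1 :+ con 2 :* y) := con 1 :+ con 2 :* (x :+ y :+ con 2 :* (x :* y))) refl g h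

  Odd-^ : ∀ {a} n → Odd a → Odd (a ℕ.^ n)
  Odd-^ zero    p = 0 , refl
  Odd-^ (suc n) p = Odd-* p (Odd-^ n p)

  D-numerator-suc : ∀ j → D-numerator (suc j) ≡
    (2 ℕ.^ 4 ℕ.* 2 ℕ.^ (4 ℕ.* j ℕ.+ 1))
      ℕ.* (3 ℕ.* suc j ℕ.* ((2 ℕ.+ 3 ℕ.* j) ℕ.* ((1 ℕ.+ 3 ℕ.* j) ℕ.* (3 ℕ.* j) !))) ℕ.^ 2 ℕ.* (suc j ℕ.* j !) ℕ.^ 2
  D-numerator-suc j = cong₂ (λ x y → x ℕ.* y ℕ.^ 2 ℕ.* (suc j ℕ.* j !) ℕ.^ 2)
    (trans (cong (2 ℕ.^_) (solve 1 (λ j → con 4 :* (con 1 :+ j) :+ con 1 := con 4 :+ (con 4 :* j :+ con 1)) refl j))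
           (ℕ.^-distribˡ-+-* 2 4 (4 ℕ.* j ℕ.+ 1)))
    (trans (cong _! (ℕ.*-suc 3 j)) (cong (ℕ._* ((2 ℕ.+ 3 ℕ.* j) ℕ.* ((1 ℕ.+ 3 ℕ.* j) ℕ.* (3 ℕ.* j) !))) (sym (ℕ.*-suc 3 j))))

  D-denominator-suc : ∀ j → D-denominator (suc j) ≡
    3 ℕ.* (2 ℕ.* suc j ℕ.* ((1 ℕ.+ 2 ℕ.* j) ℕ.* (2 ℕ.* j) !)) ℕ.^ 4
  D-denominator-suc j = cong (λ x → 3 ℕ.* x ℕ.^ 4)
    (trans (cong _! (ℕ.*-suc 2 j)) (cong (ℕ._* ((1 ℕ.+ 2 ℕ.* j) ℕ.* (2 ℕ.* j) !)) (sym (ℕ.*-suc 2 j))))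

  D-divisible : ∀ j → ∃[ o ] ∃[ c ] Odd o × D-numerator j ℕ.* o ≡ 2 ℕ.^ j ℕ.* c ℕ.* D-denominator j
  D-divisible zero    = 3 , 2 , (1 , refl) , refl
  D-divisible (suc j) = o ℕ.* w ℕ.^ 4 , 18 ℕ.* (c ℕ.* t ℕ.^ 2) ,
    Odd-* (proj₁ (proj₂ (proj₂ IH))) (Odd-^ 4 (j , refl)) , (begin
    D-numerator (suc j) ℕ.* (o ℕ.* w ℕ.^ 4)
      ≡⟨ cong (ℕ._* (o ℕ.* w ℕ.^ 4)) (D-numerator-suc j) ⟩
    (16 ℕ.* p) ℕ.* (3 ℕ.* s ℕ.* (y ℕ.* (x ℕ.* a))) ℕ.^ 2 ℕ.* (s ℕ.* b) ℕ.^ 2 ℕ.* (o ℕ.* w ℕ.^ 4)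
      ≡⟨ solve 8 (λ p s x y a b o w →
           (con 16 :* p) :* (con 3 :* s :* (y :* (x :* a))) :^ 2 :* (s :* b) :^ 2 :* (o :* w :^ 4) :=
           (p :* a :^ 2 :* b :^ 2 :* o) :* (con 144 :* s :^ 4 :* (x :* y) :^ 2 :* w :^ 4)) refl p s x y a b o w ⟩
    (p ℕ.* a ℕ.^ 2 ℕ.* b ℕ.^ 2 ℕ.* o) ℕ.* (144 ℕ.* s ℕ.^ 4 ℕ.* (x ℕ.* y) ℕ.^ 2 ℕ.* w ℕ.^ 4)
      ≡⟨ cong₂ (λ u v → u ℕ.* (144 ℕ.* s ℕ.^ 4 ℕ.* v ℕ.^ 2 ℕ.* w ℕ.^ 4)) (proj₂ (proj₂ (proj₂ IH))) (proj₂ (half-product j)) ⟩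
    (e ℕ.* c ℕ.* (3 ℕ.* z ℕ.^ 4)) ℕ.* (144 ℕ.* s ℕ.^ 4 ℕ.* (2 ℕ.* t) ℕ.^ 2 ℕ.* w ℕ.^ 4)
      ≡⟨ solve 6 (λ e c z s t w →
           (e :* c :* (con 3 :* z :^ 4)) :* (con 144 :* s :^ 4 :* (con 2 :* t) :^ 2 :* w :^ 4) :=
           (con 2 :* e) :* (con 18 :* (c :* t :^ 2)) :* (con 3 :* (con 2 :* s :* (w :* z)) :^ 4)) refl e c z s t w ⟩
    (2 ℕ.* e) ℕ.* (18 ℕ.* (c ℕ.* t ℕ.^ 2)) ℕ.* (3 ℕ.* (2 ℕ.* s ℕ.* (w ℕ.* z)) ℕ.^ 4)
      ≡⟨ cong ((2 ℕ.* e) ℕ.* (18 ℕ.* (c ℕ.* t ℕ.^ 2)) ℕ.*_) (D-denominator-suc j) ⟨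
    2 ℕ.^ suc j ℕ.* (18 ℕ.* (c ℕ.* t ℕ.^ 2)) ℕ.* D-denominator (suc j)  ∎)
    where
    open ≡-Reasoning
    IH = D-divisible j
    o = proj₁ IH
    c = proj₁ (proj₂ IH)
    t = proj₁ (half-product j)
    p = 2 ℕ.^ (4 ℕ.* j ℕ.+ 1)
    e = 2 ℕ.^ j
    s = suc j
    w = 1 ℕ.+ 2 ℕ.* j
    x = 1 ℕ.+ 3 ℕ.* j
    y = 2 ℕ.+ 3 ℕ.* j
    a = (3 ℕ.* j) !
    b = j !
    z = (2 ℕ.* j) !

D-entry-ν : ∀ j → + j ≤ν D-entry j
D-entry-ν j = ν (+ c) (proj₁ odd-o) (begin
  D-entry j ℚ.* ι (+ (1 ℕ.+ 2 ℕ.* proj₁ odd-o))  ≡⟨ cong (λ o → D-entry j ℚ.* ι (+ o)) (proj₂ odd-o) ⟨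
  D-entry j ℚ.* ι (+ o)                          ≡⟨ /-*-ι (+ D-numerator j) (D-denominator j) (+ o) (+ (2 ℕ.^ j ℕ.* c)) {{D-denominator≢0 j}} divides ⟩
  ι (+ (2 ℕ.^ j ℕ.* c))                          ≡⟨ cong ι (ℤ.pos-* (2 ℕ.^ j) c) ⟩
  ι (+ (2 ℕ.^ j) ℤ.* + c)                        ≡⟨ ι-* (+ (2 ℕ.^ j)) (+ c) ⟩
  ι (+ (2 ℕ.^ j)) ℚ.* ι (+ c)                    ≡⟨ cong (ℚ._* ι (+ c)) (2^-ι j) ⟨
  2^ (+ j) ℚ.* ι (+ c)                           ∎)
  where
  open ≡-Reasoning
  o = proj₁ (D-divisible j)
  c = proj₁ (proj₂ (D-divisible j))
  odd-o = proj₁ (proj₂ (proj₂ (D-divisible j)))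
  divides : + D-numerator j ℤ.* + o ≡ + (2 ℕ.^ j ℕ.* c) ℤ.* + D-denominator j
  divides = trans (sym (ℤ.pos-* (D-numerator j) o))
    (trans (cong +_ (proj₂ (proj₂ (proj₂ (D-divisible j))))) (ℤ.pos-* (2 ℕ.^ j ℕ.* c) (D-denominator j)))

-- Coordinate i belongs to gⁱ⁺¹, whence the shift in the index.
D : CompactOperator
D = diagonal (λ i → const₂ (D-entry (suc i))) λ k →
  ℤ.∣ k ∣ , λ i ∣k∣≤i → ν₂-const (≤ν-mono (k≤ k (ℕ.m≤n⇒m≤1+n ∣k∣≤i)) (D-entry-ν (suc i)))

-- v₂(x) = k; no k is related to x = 0.
HasValuation : ℚ₂ → ℤ → Set
HasValuation x k = k ≤ν₂ x × ¬ (ℤ.suc k ≤ν₂ x)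

module ℚ-Sum = SemiringSum (CommutativeRing.semiring ℚ.+-*-commutativeRing)

-- (x , y) is a convex combination Σₗ weightₗ (indexₗ , valuationₗ) of points
-- (n , v₂(c n)) with c n ≠ 0.
record InConvexHull (c : ℕ → ℚ₂) (x y : ℚ) : Set where
  open ℚ-Sum using (sum-syntax)
  field
    size         : ℕ
    weight       : Vector ℚ size
    index        : Vector ℕ size
    valuation    : Vector ℤ size
    nonnegative  : ∀ l → 0ℚ ℚ.≤ weight l
    hasValuation : ∀ l → HasValuation (c (index l)) (valuation l)
    total        : ∑[ l < size ] weight l ≡ 1ℚ
    abscissa     : ∑[ l < size ] (weight l ℚ.* ι (+ index l)) ≡ x
    ordinate     : ∑[ l < size ] (weight l ℚ.* ι (valuation l)) ≡ y

-- The points with rational coordinates on the lower boundary of the convex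
-- hull; these are dense in the polygon and include its vertices.
NewtonPolygon : (ℕ → ℚ₂) → Pred (ℚ × ℚ) 0ℓ
NewtonPolygon c (x , y) = InConvexHull c x y × (∀ y′ → InConvexHull c x y′ → y ℚ.≤ y′)

-- Writing U(gʲ) = Σ uᵢⱼ gⁱ, one has wᵢ wⱼ uᵢⱼ = Σₜ xᵢₜ dₜ yₜⱼ with odd integers wᵢ, an integral matrix x that is
-- the identity modulo 2, an integral upper unitriangular y, and dₜ = wₜ² dₜₜ, whose valuations eₜ increase strictly.
-- Expanding the principal minor of U on a set S of n indices by multilinearity in the rows, every term is divisible
-- by 2 ^ (e₁ + ⋯ + eₙ + 1), except for S = {1, …, n} the term d₁ ⋯ dₙ. Hence the n-th coefficients of both
-- characteristic series have valuation e₁ + ⋯ + eₙ exactly.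
--
-- The factorisation is a terminating hypergeometric sum, evaluated by a recurrence in i with a telescoping
-- certificate. The uᵢⱼ come from f² = (48 y + 4096 y²) f + y and f(q) + f(-q) = 48 y + 4096 y², where y = f(q²). In
-- terms of u = (θ₃ / θ₄)⁴ these are rational identities, by Jacobi's θ₃⁴ - θ₄⁴ = θ₂⁴. The latter holds in product
-- form because both sides solve the same functional equation between q and q², given θ₃² + θ₄² = 2 θ₃(q²)² and
-- Gauss's product for θ₄, for which Shanks found a finite version that telescopes.

module Submission where

open import Defs
open import Algebra.Bundles using (CommutativeRing; RawRing)
import Algebra.Properties.CommutativeMonoid.Sum as MonoidSum
import Algebra.Properties.Semiring.Exp as Exp
import Algebra.Solver.Ring as RingSolver
import Algebra.Solver.Ring.AlmostCommutativeRing as ACR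
open import Data.Bool.Base using (true; false; if_then_else_)
open import Data.Empty using (⊥-elim)
open import Data.Fin.Base as Fin using (Fin; toℕ; punchIn)
import Data.Fin.Properties as Fin
open import Data.Integer.Base as ℤ using (ℤ; +_; -[1+_]; +[1+_]; _+_; _*_; _-_; -_)
open import Data.Integer.Divisibility.Signed as ℤ∣ using (_∣_; divides)
import Data.Integer.Properties as ℤ
open import Data.Integer.Solver using (module +-*-Solver)
open import Data.List.Base as List using (List; []; _∷_; _++_; [_])
open import Data.List.Membership.Propositional using (_∈_)
open import Data.List.Membership.Propositional.Properties using (∈-∃++)
import Data.List.Properties as List
open import Data.List.Relation.Unary.All as All using (All; []; _∷_)
import Data.List.Relation.Unary.All.Properties as All
open import Data.List.Relation.Unary.AllPairs using ([]; _∷_)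
open import Data.List.Relation.Unary.Any using (here; there)
open import Data.List.Relation.Unary.Unique.Propositional using (Unique)
open import Data.Maybe.Base using (Maybe; just; nothing)
open import Data.Nat.Base as ℕ using (ℕ; zero; suc; z≤n; s≤s)
import Data.Nat.Divisibility as ℕ∣
import Data.Nat.Properties as ℕ
open import Data.List.Membership.DecPropositional ℕ._≟_ using (_∈?_)
import Data.Nat.Solver as ℕ-Solver
open import Data.Product.Base using (∃-syntax; _×_; _,_; proj₁; proj₂)
open import Data.Rational.Base as ℚ using (0ℚ; 1ℚ)
import Data.Rational.Properties as ℚ
import Data.Rational.Solver as ℚ-Solver
open import Data.Sum.Base using (_⊎_; inj₁; inj₂)
open import Data.Vec.Base as Vec using (Vec; []; _∷_)
open import Data.Vec.Functional as Vector using (Vector)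
import Data.Vec.Properties as Vec
open import Function.Base using (_∘_; case_of_)
open import Level using (0ℓ)
open import Relation.Binary.Definitions using (tri<; tri≈; tri>)
open import Relation.Binary.PropositionalEquality
  using (_≡_; _≢_; refl; sym; trans; cong; cong₂; subst; subst₂; module ≡-Reasoning)
import Relation.Binary.Reasoning.Setoid as SetoidReasoning
open import Relation.Nullary.Decidable using (Dec; yes; no; does; dec-true; dec-false)
open import Relation.Nullary.Negation using (¬_)
open import Relation.Unary using (_≐_)

open +-*-Solver using (solve; _:=_; _:+_; _:*_; _:-_; :-_; _:^_; con)
open ≡-Reasoning

-- The factorisation of U rests on a hidden symmetry. In closed form uᵢⱼ = 3j/(i+j) · 2^(2(i+j)-1) ·
-- C(i+j, 2j-i), and C(i+j, 2j-i) = C(i+j, 2i-j), so uᵢⱼ / 3j is symmetric in i and j and calls for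
-- a decomposition of the shape L D Lᵀ. After scaling by wᵢ wⱼ with wᵢ = (2i-1)!!², which clears the
-- odd denominators, its terms are 2t Tᵢ(t) Tⱼ(t), where Tᵢ(t) = C(2i, i-t) (2t-i+1) ⋯ (2t+i-1). The
-- factor 3j · 2t is then shared out so that both triangular matrices become integral with unit
-- diagonal: t Tᵢ(t) and j Tⱼ(t) are multiples of κ = (3t)! / (3 t!), and what remains is dₜ = 6 κ²
-- = wₜ² dₜₜ. This is where the given diagonal matrix comes from. Multilinearity is applied to the
-- rows, so evenness off the diagonal is asked of x and unitriangularity of y. The polygons are
-- compared coefficient by coefficient: they depend on a series only through the valuations of its
-- coefficients.

-- Integral determinants and their expansion by multilinearity

Σ< : ℕ → (ℕ → ℤ) → ℤ
Σ< zero    h = + 0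
Σ< (suc m) h = Σ< m h + h m

Σ<-cong : ∀ m {h k} → (∀ t → t ℕ.< m → h t ≡ k t) → Σ< m h ≡ Σ< m k
Σ<-cong zero    eq = refl
Σ<-cong (suc m) eq = cong₂ _+_ (Σ<-cong m λ t t<m → eq t (ℕ.m<n⇒m<1+n t<m)) (eq m ℕ.≤-refl)

Σ<-*ˡ : ∀ c m h → c * Σ< m h ≡ Σ< m (λ t → c * h t)
Σ<-*ˡ c zero    h = ℤ.*-zeroʳ c
Σ<-*ˡ c (suc m) h = trans (ℤ.*-distribˡ-+ c (Σ< m h) (h m)) (cong (_+ c * h m) (Σ<-*ˡ c m h))

Σ<-0 : ∀ m h → (∀ t → t ℕ.< m → h t ≡ + 0) → Σ< m h ≡ + 0
Σ<-0 m h eq = trans (Σ<-cong m eq) (zeros m)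
  where
  zeros : ∀ m → Σ< m (λ _ → + 0) ≡ + 0
  zeros zero    = refl
  zeros (suc m) = cong (_+ + 0) (zeros m)

-- The sum over all τ ∈ {0, …, m - 1}ⁿ of (∏ᵢ x (sᵢ) (τᵢ)) F τ.
expansion : ∀ {n} → ℕ → (ℕ → ℕ → ℤ) → Vec ℕ n → (Vec ℕ n → ℤ) → ℤ
expansion m x []      F = F []
expansion m x (i ∷ s) F = Σ< m λ t → x i t * expansion m x s (λ τ → F (t ∷ τ))

-- Determinants by repeated contraction: with columns kept in a vector, the
-- first-row expansion is itself recursive, which makes contractions
-- anticommute by a direct induction.

contract : ∀ {C : Set} {n} → (C → ℤ) → (Vec C n → ℤ) → Vec C (suc n) → ℤ
contract {n = zero}  r F (c ∷ cs) = r c * F cs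
contract {n = suc n} r F (c ∷ cs) = r c * F cs - contract r (λ ds → F (c ∷ ds)) cs

module _ {C : Set} where

  private
    Row = C → ℤ

  detᶻ : ∀ {n} → Vec Row n → Vec C n → ℤ
  detᶻ []       []  = + 1
  detᶻ (r ∷ rs) cs  = contract r (detᶻ rs) cs

  contract-cong : ∀ {n} {r s : Row} {F G : Vec C n → ℤ} → (∀ c → r c ≡ s c) → (∀ cs → F cs ≡ G cs) →
                  ∀ cs → contract r F cs ≡ contract s G cs
  contract-cong {zero}  p q (c ∷ cs) = cong₂ _*_ (p c) (q cs)
  contract-cong {suc n} p q (c ∷ cs) =
    cong₂ _-_ (cong₂ _*_ (p c) (q cs)) (contract-cong p (λ ds → q (c ∷ ds)) cs)

  contract-Σ : ∀ {n} m (x : ℕ → ℤ) (r : ℕ → Row) (F : Vec C n → ℤ) cs →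
               contract (λ c → Σ< m λ t → x t * r t c) F cs ≡ Σ< m λ t → x t * contract (r t) F cs
  contract-Σ {zero}  m x r F (c ∷ cs) = begin
    Σ< m (λ t → x t * r t c) * F cs          ≡⟨ ℤ.*-comm (Σ< m (λ t → x t * r t c)) (F cs) ⟩
    F cs * Σ< m (λ t → x t * r t c)          ≡⟨ Σ<-*ˡ (F cs) m _ ⟩
    Σ< m (λ t → F cs * (x t * r t c))        ≡⟨ Σ<-cong m (λ t _ → rotate (F cs) (x t) (r t c)) ⟩
    Σ< m (λ t → x t * (r t c * F cs))        ∎
    where
    rotate : ∀ a b c → a * (b * c) ≡ b * (c * a)
    rotate = solve 3 (λ a b c → a :* (b :* c) := b :* (c :* a)) refl
  contract-Σ {suc n} m x r F (c ∷ cs) = begin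
    Σ< m (λ t → x t * r t c) * F cs - contract (λ c → Σ< m λ t → x t * r t c) G cs
      ≡⟨ cong₂ _-_ (ℤ.*-comm (Σ< m (λ t → x t * r t c)) (F cs)) (contract-Σ m x r G cs) ⟩
    F cs * Σ< m (λ t → x t * r t c) - Σ< m (λ t → x t * contract (r t) G cs)
      ≡⟨ collect m ⟩
    Σ< m (λ t → x t * (r t c * F cs - contract (r t) G cs)) ∎
    where
    G = λ ds → F (c ∷ ds)
    collect : ∀ m → F cs * Σ< m (λ t → x t * r t c) - Σ< m (λ t → x t * contract (r t) G cs) ≡
                    Σ< m (λ t → x t * (r t c * F cs - contract (r t) G cs))
    collect zero    = solve 1 (λ a → a :* con (+ 0) :- con (+ 0) := con (+ 0)) refl (F cs)
    collect (suc m) = trans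
      (solve 6 (λ f s x r s′ k → f :* (s :+ x :* r) :- (s′ :+ x :* k) := (f :* s :- s′) :+ x :* (r :* f :- k)) refl
        (F cs) (Σ< m (λ t → x t * r t c)) (x m) (r m c) (Σ< m (λ t → x t * contract (r t) G cs)) (contract (r m) G cs))
      (cong (_+ x m * (r m c * F cs - contract (r m) G cs)) (collect m))

  contract-linear : ∀ {n} (r : Row) m (x : ℕ → ℤ) (F : ℕ → Vec C n → ℤ) cs →
                    contract r (λ ds → Σ< m λ t → x t * F t ds) cs ≡ Σ< m λ t → x t * contract r (F t) cs
  contract-linear {zero}  r m x F (c ∷ cs) = trans (Σ<-*ˡ (r c) m _)
    (Σ<-cong m λ t _ → solve 3 (λ a b c → a :* (b :* c) := b :* (a :* c)) refl (r c) (x t) (F t cs))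
  contract-linear {suc n} r m x F (c ∷ cs) = trans
    (cong (λ z → r c * Σ< m (λ t → x t * F t cs) - z) (contract-linear r m x (λ t ds → F t (c ∷ ds)) cs))
    (collect m)
    where
    collect : ∀ m → r c * Σ< m (λ t → x t * F t cs) - Σ< m (λ t → x t * contract r (λ ds → F t (c ∷ ds)) cs) ≡
                    Σ< m (λ t → x t * (r c * F t cs - contract r (λ ds → F t (c ∷ ds)) cs))
    collect zero    = solve 1 (λ a → a :* con (+ 0) :- con (+ 0) := con (+ 0)) refl (r c)
    collect (suc m) = trans
      (solve 6 (λ f s x r s′ k → f :* (s :+ x :* r) :- (s′ :+ x :* k) := (f :* s :- s′) :+ x :* (f :* r :- k)) refl
        (r c) (Σ< m (λ t → x t * F t cs)) (x m) (F m cs)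
        (Σ< m (λ t → x t * contract r (λ ds → F t (c ∷ ds)) cs)) (contract r (λ ds → F m (c ∷ ds)) cs))
      (cong (_+ x m * (r c * F m cs - contract r (λ ds → F m (c ∷ ds)) cs)) (collect m))

  contract-- : ∀ {n} (r : Row) (F G : Vec C n → ℤ) cs → contract r (λ ds → F ds - G ds) cs ≡ contract r F cs - contract r G cs
  contract-- {zero}  r F G (c ∷ cs) =
    solve 3 (λ r f g → r :* (f :- g) := r :* f :- r :* g) refl (r c) (F cs) (G cs)
  contract-- {suc n} r F G (c ∷ cs) = trans
    (cong (λ z → r c * (F cs - G cs) - z) (contract-- r (λ ds → F (c ∷ ds)) (λ ds → G (c ∷ ds)) cs))
    (solve 5 (λ r f g a b → r :* (f :- g) :- (a :- b) := (r :* f :- a) :- (r :* g :- b)) refl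
      (r c) (F cs) (G cs) (contract r (λ ds → F (c ∷ ds)) cs) (contract r (λ ds → G (c ∷ ds)) cs))

  contract-* : ∀ {n} (r : Row) a (F : Vec C n → ℤ) cs → contract r (λ ds → a * F ds) cs ≡ a * contract r F cs
  contract-* {zero}  r a F (c ∷ cs) = solve 3 (λ r a f → r :* (a :* f) := a :* (r :* f)) refl (r c) a (F cs)
  contract-* {suc n} r a F (c ∷ cs) = trans
    (cong (λ z → r c * (a * F cs) - z) (contract-* r a (λ ds → F (c ∷ ds)) cs))
    (solve 4 (λ r a f k → r :* (a :* f) :- a :* k := a :* (r :* f :- k)) refl
      (r c) a (F cs) (contract r (λ ds → F (c ∷ ds)) cs))

  contract-anticomm : ∀ {n} (a b : Row) (F : Vec C n → ℤ) cs →
                      contract a (contract b F) cs ≡ - contract b (contract a F) cs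
  contract-anticomm {zero}  a b F (c ∷ d ∷ []) =
    solve 5 (λ p q r s f → p :* (q :* f) :- r :* (s :* f) := :- (s :* (r :* f) :- q :* (p :* f))) refl
      (a c) (b d) (a d) (b c) (F [])
  contract-anticomm {suc n} a b F (c ∷ cs) = begin
    a c * contract b F cs - contract a (λ ds → b c * F ds - contract b (F ∘ (c ∷_)) ds) cs
      ≡⟨ cong (λ z → a c * contract b F cs - z) (unfold a b) ⟩
    a c * contract b F cs - (b c * contract a F cs - contract a (contract b (F ∘ (c ∷_))) cs)
      ≡⟨ cong (λ z → a c * contract b F cs - (b c * contract a F cs - z)) (contract-anticomm a b (F ∘ (c ∷_)) cs) ⟩
    a c * contract b F cs - (b c * contract a F cs - - contract b (contract a (F ∘ (c ∷_))) cs)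
      ≡⟨ solve 3 (λ x y z → x :- (y :- :- z) := :- (y :- (x :- z))) refl
           (a c * contract b F cs) (b c * contract a F cs) (contract b (contract a (F ∘ (c ∷_))) cs) ⟩
    - (b c * contract a F cs - (a c * contract b F cs - contract b (contract a (F ∘ (c ∷_))) cs))
      ≡⟨ cong (λ z → - (b c * contract a F cs - z)) (unfold b a) ⟨
    - (b c * contract a F cs - contract b (λ ds → a c * F ds - contract a (F ∘ (c ∷_)) ds) cs) ∎
    where
    unfold : ∀ a b → contract a (λ ds → b c * F ds - contract b (F ∘ (c ∷_)) ds) cs ≡
                     b c * contract a F cs - contract a (contract b (F ∘ (c ∷_))) cs
    unfold a b = trans (contract-- a (λ ds → b c * F ds) (contract b (F ∘ (c ∷_))) cs)
      (cong (_- contract a (contract b (F ∘ (c ∷_))) cs) (contract-* a (b c) F cs))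

  self-negative⇒0 : ∀ z → z ≡ - z → z ≡ + 0
  self-negative⇒0 (+ zero)    eq = refl
  self-negative⇒0 (+[1+ n ])  ()
  self-negative⇒0 (-[1+ n ])  ()

  contract-0 : ∀ {n} (r : Row) {F : Vec C n → ℤ} → (∀ cs → F cs ≡ + 0) → ∀ cs → contract r F cs ≡ + 0
  contract-0 r {F} eq cs = trans (contract-cong {s = r} {G = λ ds → + 0 * F ds} (λ _ → refl) eq cs)
    (contract-* r (+ 0) F cs)

  -- Anticommutation moves row `t` past the other rows to its second copy; two adjacent equal rows
  -- make the determinant its own negative.
  detᶻ-repeat : ∀ {n} (v : ℕ → Row) {t} {τ : Vec ℕ n} → t ∈ Vec.toList τ → ∀ cs → detᶻ (Vec.map v (t ∷ τ)) cs ≡ + 0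
  detᶻ-repeat v {t} {t ∷ τ} (here refl) cs =
    self-negative⇒0 _ (contract-anticomm (v t) (v t) (detᶻ (Vec.map v τ)) cs)
  detᶻ-repeat v {t} {s ∷ τ} (there t∈τ) cs = begin
    contract (v t) (contract (v s) (detᶻ (Vec.map v τ))) cs    ≡⟨ contract-anticomm (v t) (v s) (detᶻ (Vec.map v τ)) cs ⟩
    - contract (v s) (detᶻ (Vec.map v (t ∷ τ))) cs             ≡⟨ cong -_ (contract-0 (v s) (detᶻ-repeat v {τ = τ} t∈τ) cs) ⟩
    + 0                                                        ∎

  -- Sorts the terms of `detᶻ-expand`: a sequence with a repetition contributes 0, so the exponents
  -- met in the remaining terms are distinct and `E-least` bounds their sum.
  detᶻ-unique : ∀ {n} (v : ℕ → Row) (τ : Vec ℕ n) → Unique (Vec.toList τ) ⊎ (∀ cs → detᶻ (Vec.map v τ) cs ≡ + 0)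
  detᶻ-unique v []      = inj₁ []
  detᶻ-unique v (t ∷ τ) with t ∈? Vec.toList τ | detᶻ-unique v τ
  ... | yes t∈τ | _       = inj₂ (detᶻ-repeat v {τ = τ} t∈τ)
  ... | no  _   | inj₂ eq = inj₂ (contract-0 (v t) eq)
  ... | no t∉τ  | inj₁ u  = inj₁ (All.¬Any⇒All¬ _ t∉τ ∷ u)

  contract-expansion : ∀ {k n} (r : Row) m x (s : Vec ℕ k) (F : Vec ℕ k → Vec C n → ℤ) cs →
    contract r (λ ds → expansion m x s λ τ → F τ ds) cs ≡ expansion m x s λ τ → contract r (F τ) cs
  contract-expansion r m x []      F cs = refl
  contract-expansion r m x (i ∷ s) F cs = trans
    (contract-linear r m (x i) (λ t ds → expansion m x s λ τ → F (t ∷ τ) ds) cs)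
    (Σ<-cong m λ t _ → cong (x i t *_) (contract-expansion r m x s (λ τ → F (t ∷ τ)) cs))

  detᶻ-expand : ∀ {n} m (x : ℕ → ℕ → ℤ) (v : ℕ → Row) (s : Vec ℕ n) cs →
    detᶻ (Vec.map (λ i c → Σ< m λ t → x i t * v t c) s) cs ≡ expansion m x s λ τ → detᶻ (Vec.map v τ) cs
  detᶻ-expand m x v []      [] = refl
  detᶻ-expand m x v (i ∷ s) cs = begin
    contract (λ c → Σ< m λ t → x i t * v t c) (detᶻ (Vec.map _ s)) cs
      ≡⟨ contract-Σ m (x i) v _ cs ⟩
    Σ< m (λ t → x i t * contract (v t) (detᶻ (Vec.map _ s)) cs)
      ≡⟨ Σ<-cong m (λ t _ → cong (x i t *_) (trans
           (contract-cong {r = v t} (λ _ → refl) (detᶻ-expand m x v s) cs)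
           (contract-expansion (v t) m x s (λ τ → detᶻ (Vec.map v τ)) cs))) ⟩
    Σ< m (λ t → x i t * expansion m x s λ τ → detᶻ (Vec.map v (t ∷ τ)) cs)  ∎

∏ : ∀ {n} → (ℕ → ℤ) → Vec ℕ n → ℤ
∏ d []      = + 1
∏ d (t ∷ τ) = d t * ∏ d τ

∏² : ∀ {n} → (ℕ → ℕ → ℤ) → Vec ℕ n → Vec ℕ n → ℤ
∏² x []      []      = + 1
∏² x (i ∷ s) (t ∷ τ) = x i t * ∏² x s τ

-- `W` accumulates the entries already chosen in earlier rows. Divisibility is assumed for complete
-- products only, and this is how the assumption is handed down to the remaining rows.
expansion-diagonal : ∀ {n} K m (x : ℕ → ℕ → ℤ) (s : Vec ℕ n) (F : Vec ℕ n → ℤ) W →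
  All (ℕ._< m) (Vec.toList s) → (∀ τ → τ ≢ s → K ∣ W * (∏² x s τ * F τ)) →
  K ∣ W * (expansion m x s F - ∏² x s s * F s)
expansion-diagonal K m x [] F W [] off = divides (+ 0)
  (solve 2 (λ w f → w :* (f :- con (+ 1) :* f) := con (+ 0)) refl W (F []))
expansion-diagonal K m x (i ∷ s) F W (i<m ∷ s<m) off =
  subst (K ∣_) rearrange
    (ℤ∣.∣m∣n⇒∣m+n (rest m i<m)
      (expansion-diagonal K m x s (F ∘ (i ∷_)) (W * x i i) s<m
        λ τ τ≢s → subst (K ∣_) (regroup W (x i i) (∏² x s τ) (F (i ∷ τ))) (off (i ∷ τ) λ { refl → τ≢s refl })))
  where
  term : ℕ → ℤ
  term t = x i t * expansion m x s (F ∘ (t ∷_))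
  regroup : ∀ w a p f → w * ((a * p) * f) ≡ (w * a) * (p * f)
  regroup = solve 4 (λ w a p f → w :* ((a :* p) :* f) := (w :* a) :* (p :* f)) refl
  rearrange : W * (Σ< m term - term i) + (W * x i i) * (expansion m x s (F ∘ (i ∷_)) - ∏² x s s * F (i ∷ s))
                                ≡ W * (Σ< m term - x i i * ∏² x s s * F (i ∷ s))
  rearrange = solve 6 (λ w σ a p f e →
      w :* (σ :- a :* e) :+ (w :* a) :* (e :- p :* f) := w :* (σ :- a :* p :* f)) refl
    W (Σ< m term) (x i i) (∏² x s s) (F (i ∷ s)) (expansion m x s (F ∘ (i ∷_)))
  -- When the head `t` differs from `i`, even the tail `s` gives an off-diagonal product, so the
  -- whole term is divisible and not only its difference from that product.
  all : ∀ t → t ≢ i → K ∣ W * term t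
  all t t≢i = subst (K ∣_) (ℤ.*-assoc W (x i t) _) (subst (K ∣_)
    (solve 3 (λ w e z → w :* (e :- z) :+ w :* z := w :* e) refl (W * x i t) (expansion m x s (F ∘ (t ∷_))) (∏² x s s * F (t ∷ s)))
    (ℤ∣.∣m∣n⇒∣m+n
      (expansion-diagonal K m x s (F ∘ (t ∷_)) (W * x i t) s<m
        λ τ _ → subst (K ∣_) (regroup W (x i t) (∏² x s τ) (F (t ∷ τ))) (off (t ∷ τ) λ { refl → t≢i refl }))
      (subst (K ∣_) (regroup W (x i t) (∏² x s s) (F (t ∷ s))) (off (t ∷ s) λ { refl → t≢i refl }))))
  below : ∀ m′ → m′ ℕ.≤ i → K ∣ W * Σ< m′ term
  below zero     le = divides (+ 0) (ℤ.*-zeroʳ W)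
  below (suc m′) le = subst (K ∣_) (sym (ℤ.*-distribˡ-+ W (Σ< m′ term) (term m′)))
    (ℤ∣.∣m∣n⇒∣m+n (below m′ (ℕ.≤-trans (ℕ.n≤1+n m′) le)) (all m′ (ℕ.<⇒≢ le)))
  rest : ∀ m′ → i ℕ.< m′ → K ∣ W * (Σ< m′ term - term i)
  rest (suc m′) (s≤s i≤m′) with ℕ.m≤n⇒m<n∨m≡n i≤m′
  ... | inj₂ refl = subst (K ∣_)
    (solve 3 (λ w a b → w :* a := w :* ((a :+ b) :- b)) refl W (Σ< i term) (term i)) (below i ℕ.≤-refl)
  ... | inj₁ i<m′ = subst (K ∣_)
    (solve 4 (λ w a b c → w :* (a :- b) :+ w :* c := w :* ((a :+ c) :- b)) refl W (Σ< m′ term) (term i) (term m′))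
    (ℤ∣.∣m∣n⇒∣m+n (rest m′ i<m′) (all m′ (ℕ.<⇒≢ i<m′ ∘ sym)))

-- Powers of two and sums of distinct exponents

p2 : ℕ → ℤ
p2 k = + (2 ℕ.^ k)

p2-suc : ∀ k → p2 (suc k) ≡ + 2 * p2 k
p2-suc k = ℤ.pos-* 2 (2 ℕ.^ k)

p2-+ : ∀ k l → p2 (k ℕ.+ l) ≡ p2 k * p2 l
p2-+ k l = trans (cong +_ (ℕ.^-distribˡ-+-* 2 k l)) (ℤ.pos-* (2 ℕ.^ k) (2 ℕ.^ l))

p2-∣ : ∀ {k l} → k ℕ.≤ l → p2 k ∣ p2 l
p2-∣ {k} {l} k≤l = divides (p2 (l ℕ.∸ k)) (trans (cong p2 (sym (ℕ.m∸n+n≡m k≤l))) (p2-+ (l ℕ.∸ k) k))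

∣-* : ∀ {a b c d} → a ∣ b → c ∣ d → a * c ∣ b * d
∣-* {a} {_} {c} (divides p refl) (divides q refl) = divides (p * q)
  (solve 4 (λ p a q c → (p :* a) :* (q :* c) := (p :* q) :* (a :* c)) refl p a q c)

module Exponents (e : ℕ → ℕ) (e-mono : ∀ t → e t ℕ.< e (suc t)) where

  E : ℕ → ℕ
  E zero    = 0
  E (suc n) = e n ℕ.+ E n

  Σe : List ℕ → ℕ
  Σe []       = 0
  Σe (t ∷ ts) = e t ℕ.+ Σe ts

  e-≤ : ∀ {s t} → s ℕ.≤′ t → e s ℕ.≤ e t
  e-≤ (ℕ.≤′-reflexive refl) = ℕ.≤-refl
  e-≤ (ℕ.≤′-step s≤t)       = ℕ.≤-trans (e-≤ s≤t) (ℕ.<⇒≤ (e-mono _))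

  Σe-++ : ∀ ts us → Σe (ts ++ us) ≡ Σe ts ℕ.+ Σe us
  Σe-++ []       us = refl
  Σe-++ (t ∷ ts) us = trans (cong (e t ℕ.+_) (Σe-++ ts us)) (sym (ℕ.+-assoc (e t) (Σe ts) (Σe us)))

  Unique-drop : ∀ (ts : List ℕ) {t us} → Unique (ts ++ t ∷ us) → Unique (ts ++ us) × All (_≢ t) (ts ++ us)
  Unique-drop []       (t∉us ∷ u) = u , All.map (λ t≢u u≡t → t≢u (sym u≡t)) t∉us
  Unique-drop (s ∷ ts) (s∉ ∷ u) with All.++⁻ˡ ts s∉ | All.++⁻ʳ ts s∉
  ... | s∉ts | s≢t ∷ s∉us = (All.++⁺ s∉ts s∉us ∷ proj₁ (Unique-drop ts u)) , (s≢t ∷ proj₂ (Unique-drop ts u))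

  record Removal (t : ℕ) (ts : List ℕ) : Set₁ where
    field
      others : List ℕ
      unique : Unique others
      absent : All (_≢ t) others
      sum-eq : Σe ts ≡ e t ℕ.+ Σe others
      len-eq : List.length ts ≡ suc (List.length others)
      all    : ∀ {P : ℕ → Set} → All P ts → All P others

  remove : ∀ {t ts} → t ∈ ts → Unique ts → Removal t ts
  remove {t} t∈ts u with ∈-∃++ t∈ts
  ... | ys , zs , refl = record
    { others = ys ++ zs
    ; unique = proj₁ (Unique-drop ys u)
    ; absent = proj₂ (Unique-drop ys u)
    ; sum-eq = trans (Σe-++ ys (t ∷ zs)) (trans
        (ℕ-Solver.+-*-Solver.solve 3 (λ a b c → a ⊹ (b ⊹ c) ≔ b ⊹ (a ⊹ c)) refl (Σe ys) (e t) (Σe zs))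
        (cong (e t ℕ.+_) (sym (Σe-++ ys zs))))
    ; len-eq = trans (List.length-++ ys) (trans (ℕ.+-suc (List.length ys) (List.length zs)) (cong suc (sym (List.length-++ ys))))
    ; all    = λ ps → All.++⁺ (All.++⁻ˡ ys ps) (All.tail (All.++⁻ʳ ys ps))
    }
    where open ℕ-Solver.+-*-Solver renaming (_:+_ to _⊹_; _:=_ to _≔_) using ()

  -- If the largest admissible element `m` occurs, remove it: the others lie below `m`, so there are
  -- at most `m` of them, and `e m` is at least the last summand of `E`. The bound on the length is
  -- carried along for this comparison.
  E-least-bounded : ∀ m ts → Unique ts → All (ℕ._< m) ts → List.length ts ℕ.≤ m × E (List.length ts) ℕ.≤ Σe ts
  E-least-bounded zero    []       u b = z≤n , z≤n
  E-least-bounded zero    (t ∷ ts) u (() ∷ b)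
  E-least-bounded (suc m) ts u b with m ∈? ts
  ... | no m∉ts = ℕ.m≤n⇒m≤1+n (proj₁ IH) , proj₂ IH
    where
    IH = E-least-bounded m ts u (All.zipWith (λ { (t<1+m , m≢t) → ℕ.≤∧≢⇒< (ℕ.s≤s⁻¹ t<1+m) (λ t≡m → m≢t (sym t≡m)) })
      (b , All.¬Any⇒All¬ ts m∉ts))
  ... | yes m∈ts = subst (ℕ._≤ suc m) (sym len-eq) (s≤s (proj₁ IH)) ,
      subst₂ ℕ._≤_ (cong E (sym len-eq)) (sym sum-eq) (ℕ.+-mono-≤ (e-≤ (ℕ.≤⇒≤′ (proj₁ IH))) (proj₂ IH))
    where
    open Removal (remove m∈ts u)
    IH = E-least-bounded m others unique
      (All.zipWith (λ { (t<1+m , t≢m) → ℕ.≤∧≢⇒< (ℕ.s≤s⁻¹ t<1+m) t≢m }) (all b , absent))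

  upperBound : ∀ ts → ∃[ m ] All (ℕ._< m) ts
  upperBound []       = 0 , []
  upperBound (t ∷ ts) with upperBound ts
  ... | m , b = suc (t ℕ.⊔ m) ,
    (s≤s (ℕ.m≤m⊔n t m) ∷ All.map (λ s<m → ℕ.m≤n⇒m≤1+n (ℕ.≤-trans s<m (ℕ.m≤n⊔m t m))) b)

  E-least : ∀ ts → Unique ts → E (List.length ts) ℕ.≤ Σe ts
  E-least ts u = proj₂ (E-least-bounded _ ts u (proj₂ (upperBound ts)))

  -- Remove `t`. The others still sum to at least `E` of their number, and `t` exceeds that number,
  -- so `e t` exceeds the last summand of `E (List.length ts)`.
  E-least-strict : ∀ {t} ts → Unique ts → t ∈ ts → List.length ts ℕ.≤ t → E (List.length ts) ℕ.< Σe ts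
  E-least-strict {t} ts u t∈ts le = subst₂ ℕ._<_ (cong E (sym len-eq)) (sym sum-eq)
    (ℕ.+-mono-<-≤ (ℕ.≤-trans (e-mono _) (e-≤ (ℕ.≤⇒≤′ (subst (ℕ._≤ t) len-eq le)))) (E-least others unique))
    where open Removal (remove t∈ts u)

-- Principal minors of a factored matrix

down : ∀ n → Vec ℕ n
down zero    = []
down (suc n) = n ∷ down n

contract-vanish : ∀ {C : Set} {n} {r : C → ℤ} (F : Vec C n → ℤ) {cs} →
  All (λ c → r c ≡ + 0) (Vec.toList cs) → contract r F cs ≡ + 0
contract-vanish {n = zero}  F {c ∷ []} (p ∷ ps) = cong (_* F []) p
contract-vanish {n = suc n} {r} F {c ∷ cs} (p ∷ ps) = begin
  r c * F cs - contract r (F ∘ (c ∷_)) cs   ≡⟨ cong₂ (λ a b → a * F cs - b) p (contract-vanish (F ∘ (c ∷_)) ps) ⟩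
  + 0 * F cs - + 0                          ≡⟨ solve 1 (λ a → con (+ 0) :* a :- con (+ 0) := con (+ 0)) refl (F cs) ⟩
  + 0                                       ∎

-- A factorisation x d y, with d diagonal, of an integral matrix.
record Factorisation : Set where
  field
    e      : ℕ → ℕ
    e-mono : ∀ t → e t ℕ.< e (suc t)
    d      : ℕ → ℤ
    d-ν    : ∀ t → ∃[ h ] d t ≡ (+ 1 + + 2 * h) * p2 (e t)
    x y    : ℕ → ℕ → ℤ
    x-diag : ∀ t → x t t ≡ + 1
    x-even : ∀ i t → i ≢ t → + 2 ∣ x i t
    y-diag : ∀ t → y t t ≡ + 1
    y-zero : ∀ {t j} → j ℕ.< t → y t j ≡ + 0

  open Exponents e e-mono public

  xd : ℕ → ℕ → ℤ
  xd i t = x i t * d t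

  -- Cutting the sum at any `m` above the column index `j` loses nothing, since `y t j` vanishes for
  -- `j < t`.
  entry : ℕ → ℕ → ℕ → ℤ
  entry m i j = Σ< m λ t → xd i t * y t j

  d-∣ : ∀ t → p2 (e t) ∣ d t
  d-∣ t = divides (+ 1 + + 2 * proj₁ (d-ν t)) (proj₂ (d-ν t))

  ∏²-∣ : ∀ {n} (s τ : Vec ℕ n) → p2 (Σe (Vec.toList τ)) ∣ ∏² xd s τ
  ∏²-∣ []      []      = ℤ∣.∣-refl
  ∏²-∣ (i ∷ s) (t ∷ τ) = subst (_∣ xd i t * ∏² xd s τ) (sym (p2-+ (e t) _))
    (∣-* (ℤ∣.∣n⇒∣m*n (x i t) (d-∣ t)) (∏²-∣ s τ))

  -- At the first position where `s` and `τ` differ, the entry of `x` supplies one factor 2 beyond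
  -- those of `d`.
  ∏²-∣-off : ∀ {n} (s τ : Vec ℕ n) → τ ≢ s → p2 (suc (Σe (Vec.toList τ))) ∣ ∏² xd s τ
  ∏²-∣-off []      []      τ≢s = ⊥-elim (τ≢s refl)
  ∏²-∣-off (i ∷ s) (t ∷ τ) τ≢s with i ℕ.≟ t
  ... | no i≢t = subst (_∣ xd i t * ∏² xd s τ) eq (∣-* (∣-* (x-even i t i≢t) (d-∣ t)) (∏²-∣ s τ))
    where
    eq : (+ 2 * p2 (e t)) * p2 (Σe (Vec.toList τ)) ≡ p2 (suc (e t ℕ.+ Σe (Vec.toList τ)))
    eq = trans (cong (_* p2 (Σe (Vec.toList τ))) (sym (p2-suc (e t)))) (sym (p2-+ (suc (e t)) (Σe (Vec.toList τ))))
  ... | yes refl = subst (_∣ xd i i * ∏² xd s τ) eq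
    (∣-* (ℤ∣.∣n⇒∣m*n (x i i) (d-∣ i)) (∏²-∣-off s τ λ { refl → τ≢s refl }))
    where
    eq : p2 (e i) * p2 (suc (Σe (Vec.toList τ))) ≡ p2 (suc (e i ℕ.+ Σe (Vec.toList τ)))
    eq = trans (sym (p2-+ (e i) (suc (Σe (Vec.toList τ))))) (cong p2 (ℕ.+-suc (e i) (Σe (Vec.toList τ))))

  minor : ∀ {n} → ℕ → Vec ℕ n → ℤ
  minor m s = detᶻ (Vec.map (entry m) s) s

  -- In a term with `τ ≢ s`, either `τ` repeats an index and the determinant of rows of `y` is 0, or
  -- its exponents are distinct and sum to at least `E n`; the evenness of `x` then adds one more
  -- factor 2.
  minor-diagonal : ∀ {n} m (s : Vec ℕ n) → All (ℕ._< m) (Vec.toList s) →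
    p2 (suc (E n)) ∣ minor m s - ∏² xd s s * detᶻ (Vec.map y s) s
  minor-diagonal {n} m s s<m = subst (p2 (suc (E n)) ∣_)
    (trans (ℤ.*-identityˡ _) (cong (_- ∏² xd s s * F s) (sym (detᶻ-expand m xd y s s))))
    (expansion-diagonal _ m xd s F (+ 1) s<m off)
    where
    F = λ τ → detᶻ (Vec.map y τ) s
    off : ∀ τ → τ ≢ s → p2 (suc (E n)) ∣ + 1 * (∏² xd s τ * F τ)
    off τ τ≢s with detᶻ-unique y τ
    ... | inj₂ eq = divides (+ 0) (trans (cong (λ z → + 1 * (∏² xd s τ * z)) (eq s))
      (solve 1 (λ a → con (+ 1) :* (a :* con (+ 0)) := con (+ 0)) refl (∏² xd s τ)))
    ... | inj₁ u = ℤ∣.∣n⇒∣m*n (+ 1) (ℤ∣.∣m⇒∣m*n (F τ) (ℤ∣.∣-trans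
      (p2-∣ (s≤s (subst (λ k → E k ℕ.≤ Σe (Vec.toList τ)) (Vec.length-toList τ) (E-least (Vec.toList τ) u))))
      (∏²-∣-off s τ τ≢s)))

  -- An index `t` with `n ≤ t` makes the diagonal term small as well: by `E-least-strict` its
  -- exponents sum to more than `E n`.
  minor-off : ∀ {n} m (s : Vec ℕ n) {t} → All (ℕ._< m) (Vec.toList s) → t ∈ Vec.toList s → n ℕ.≤ t →
              p2 (suc (E n)) ∣ minor m s
  minor-off {n} m s {t} s<m t∈s n≤t = subst (p2 (suc (E n)) ∣_)
    (solve 2 (λ a b → (a :- b) :+ b := a) refl (minor m s) (∏² xd s s * detᶻ (Vec.map y s) s))
    (ℤ∣.∣m∣n⇒∣m+n (minor-diagonal m s s<m) main)
    where
    main : p2 (suc (E n)) ∣ ∏² xd s s * detᶻ (Vec.map y s) s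
    main with detᶻ-unique y s
    ... | inj₂ eq = divides (+ 0) (trans (cong (∏² xd s s *_) (eq s)) (ℤ.*-zeroʳ (∏² xd s s)))
    ... | inj₁ u = ℤ∣.∣m⇒∣m*n _ (ℤ∣.∣-trans
      (p2-∣ (subst (λ k → E k ℕ.< Σe (Vec.toList s)) (Vec.length-toList s)
        (E-least-strict (Vec.toList s) u t∈s (subst (ℕ._≤ t) (sym (Vec.length-toList s)) n≤t))))
      (∏²-∣ s s))

  down-< : ∀ n → All (ℕ._< n) (Vec.toList (down n))
  down-< zero    = []
  down-< (suc n) = ℕ.≤-refl ∷ All.map ℕ.m<n⇒m<1+n (down-< n)

  -- Rows and columns are listed in decreasing order, so the first row of this upper triangular
  -- matrix has its only nonzero entry in the first column, and expansion along that row suffices.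
  detᶻ-unitriangular : ∀ n → detᶻ (Vec.map y (down n)) (down n) ≡ + 1
  detᶻ-unitriangular zero          = refl
  detᶻ-unitriangular (suc zero)    = cong (_* + 1) (y-diag 0)
  detᶻ-unitriangular (suc m@(suc n)) = begin
    y m m * detᶻ (Vec.map y (down m)) (down m) - contract (y m) (detᶻ (Vec.map y (down m)) ∘ (m ∷_)) (down m)
      ≡⟨ cong₂ (λ a b → a * detᶻ (Vec.map y (down m)) (down m) - b) (y-diag m)
           (contract-vanish (detᶻ (Vec.map y (down m)) ∘ (m ∷_)) (All.map y-zero (down-< m))) ⟩
    + 1 * detᶻ (Vec.map y (down m)) (down m) - + 0
      ≡⟨ cong (λ a → + 1 * a - + 0) (detᶻ-unitriangular m) ⟩
    + 1 ∎

  ∏²-down : ∀ n → ∃[ h ] ∏² xd (down n) (down n) ≡ (+ 1 + + 2 * h) * p2 (E n)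
  ∏²-down zero    = + 0 , refl
  ∏²-down (suc n) with d-ν n | ∏²-down n
  ... | g , eq₁ | h , eq₂ = g + h + + 2 * (g * h) , (begin
    (x n n * d n) * ∏² xd (down n) (down n)
      ≡⟨ cong₂ _*_ (cong₂ _*_ (x-diag n) eq₁) eq₂ ⟩
    (+ 1 * ((+ 1 + + 2 * g) * p2 (e n))) * ((+ 1 + + 2 * h) * p2 (E n))
      ≡⟨ solve 4 (λ g h a b → (con (+ 1) :* ((con (+ 1) :+ con (+ 2) :* g) :* a)) :* ((con (+ 1) :+ con (+ 2) :* h) :* b)
           := (con (+ 1) :+ con (+ 2) :* (g :+ h :+ con (+ 2) :* (g :* h))) :* (a :* b)) refl g h (p2 (e n)) (p2 (E n)) ⟩
    (+ 1 + + 2 * (g + h + + 2 * (g * h))) * (p2 (e n) * p2 (E n))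
      ≡⟨ cong ((+ 1 + + 2 * (g + h + + 2 * (g * h))) *_) (p2-+ (e n) (E n)) ⟨
    (+ 1 + + 2 * (g + h + + 2 * (g * h))) * p2 (E (suc n)) ∎)

  minor-main : ∀ n m → n ℕ.≤ m → ∃[ h ] minor m (down n) ≡ (+ 1 + + 2 * h) * p2 (E n)
  minor-main n m n≤m
    with minor-diagonal m (down n) (All.map (λ lt → ℕ.≤-trans lt n≤m) (down-< n)) | ∏²-down n
  ... | divides q eq | h , eq′ = h + q , (begin
    minor m (down n)
      ≡⟨ solve 2 (λ a b → a := (a :- b :* con (+ 1)) :+ b) refl (minor m (down n)) b ⟩
    (minor m (down n) - b * + 1) + b
      ≡⟨ cong (λ z → (minor m (down n) - b * z) + b) (detᶻ-unitriangular n) ⟨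
    (minor m (down n) - b * detᶻ (Vec.map y (down n)) (down n)) + b
      ≡⟨ cong₂ _+_ (trans eq (cong (q *_) (p2-suc (E n)))) eq′ ⟩
    q * (+ 2 * p2 (E n)) + (+ 1 + + 2 * h) * p2 (E n)
      ≡⟨ solve 3 (λ q h p → q :* (con (+ 2) :* p) :+ (con (+ 1) :+ con (+ 2) :* h) :* p :=
           (con (+ 1) :+ con (+ 2) :* (h :+ q)) :* p) refl q h (p2 (E n)) ⟩
    (+ 1 + + 2 * (h + q)) * p2 (E n) ∎)
    where b = ∏² xd (down n) (down n)

-- Valuations of the coefficients of characteristic series

K : ℤ → ℚ₂
K z = const₂ (ι z)

ι-injective : ∀ {a b} → ι a ≡ ι b → a ≡ b
ι-injective = cong ℚ.↥_

K-* : ∀ a b → K (a * b) ≈₂ K a *₂ K b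
K-* a b = pointwise λ _ → ι-* a b

K-- : ∀ a b → K (a - b) ≈₂ K a +₂ (-₂ K b)
K-- a b = pointwise λ _ → trans (ι-+ a (- b)) (cong (ι a ℚ.+_) (ι-neg b))

module ℚ₂-Reasoning where
  open SetoidReasoning ℚ₂-Ring.setoid public renaming (begin_ to begin₂_; _∎ to _∎₂)

alternating : ∀ {n} → Vector ℚ₂ n → ℚ₂
alternating {n} t = ℚ₂-Sum.sum λ (j : Fin n) → (-₂ 1₂) ℚ₂-Exp.^ toℕ j *₂ t j

alternating-suc : ∀ {n} (t : Vector ℚ₂ (suc n)) → alternating t ≈₂ t Fin.zero +₂ (-₂ alternating (t ∘ Fin.suc))
alternating-suc {n} t = begin₂
  (1₂ *₂ t Fin.zero) +₂ ℚ₂-Sum.sum (λ j → ((-₂ 1₂) *₂ sign j) *₂ t (Fin.suc j))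
    ≈⟨ +₂-cong (ℚ₂-Ring.*-identityˡ (t Fin.zero)) (ℚ₂-Sum.sum-cong-≋ λ j → ℚ₂-Ring.*-assoc (-₂ 1₂) (sign j) (t (Fin.suc j))) ⟩
  t Fin.zero +₂ ℚ₂-Sum.sum (λ j → (-₂ 1₂) *₂ (sign j *₂ t (Fin.suc j)))
    ≈⟨ +₂-cong (≈₂-refl {t Fin.zero}) (ℚ₂-Sum.*-distribˡ-sum (-₂ 1₂) λ j → sign j *₂ t (Fin.suc j)) ⟨
  t Fin.zero +₂ ((-₂ 1₂) *₂ alternating (t ∘ Fin.suc))
    ≈⟨ +₂-cong (≈₂-refl {t Fin.zero}) (pointwise λ k → neg (seq (alternating (t ∘ Fin.suc)) k)) ⟩
  t Fin.zero +₂ (-₂ alternating (t ∘ Fin.suc)) ∎₂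
  where
  open ℚ₂-Reasoning
  sign : Fin n → ℚ₂
  sign j = (-₂ 1₂) ℚ₂-Exp.^ toℕ j
  neg : ∀ a → ℚ.- 1ℚ ℚ.* a ≡ ℚ.- a
  neg a = trans (sym (ℚ.neg-distribˡ-* 1ℚ a)) (cong ℚ.-_ (ℚ.*-identityˡ a))

alternating-*ʳ : ∀ {n} (t : Vector ℚ₂ n) x → alternating t *₂ x ≈₂ alternating (λ j → t j *₂ x)
alternating-*ʳ t x = ≈₂-trans (ℚ₂-Sum.*-distribʳ-sum x λ j → (-₂ 1₂) ℚ₂-Exp.^ toℕ j *₂ t j)
  (ℚ₂-Sum.sum-cong-≋ λ j → ℚ₂-Ring.*-assoc ((-₂ 1₂) ℚ₂-Exp.^ toℕ j) (t j) x)

-- Bridges the two first-row expansions: `det` carries explicit signs (-1)ʲ and deletes column j,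
-- while `contract` produces the signs through repeated subtraction.
alternating-contract : ∀ {C : Set} {n} (r : C → ℤ) (F : Vec C n → ℤ) (cs : Vec C (suc n)) (t : Vector ℚ₂ (suc n)) →
  (∀ j → t j ≈₂ K (r (Vec.lookup cs j) * F (Vec.removeAt cs j))) → alternating t ≈₂ K (contract r F cs)
alternating-contract {n = zero} r F (c ∷ []) t eq = begin₂
  alternating t                    ≈⟨ alternating-suc t ⟩
  t Fin.zero +₂ (-₂ 0₂)            ≈⟨ pointwise (λ k → ℚ.+-identityʳ (seq (t Fin.zero) k)) ⟩
  t Fin.zero                       ≈⟨ eq Fin.zero ⟩
  K (r c * F [])                   ∎₂
  where open ℚ₂-Reasoning
alternating-contract {n = suc n} r F (c ∷ cs@(_ ∷ _)) t eq = begin₂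
  alternating t                                     ≈⟨ alternating-suc t ⟩
  t Fin.zero +₂ (-₂ alternating (t ∘ Fin.suc))      ≈⟨ +₂-cong (eq Fin.zero) (-₂-cong
                                                        (alternating-contract r (F ∘ (c ∷_)) cs (t ∘ Fin.suc) (eq ∘ Fin.suc))) ⟩
  K (r c * F cs) +₂ (-₂ K (contract r (F ∘ (c ∷_)) cs))  ≈⟨ K-- (r c * F cs) (contract r (F ∘ (c ∷_)) cs) ⟨
  K (r c * F cs - contract r (F ∘ (c ∷_)) cs)       ∎₂
  where open ℚ₂-Reasoning

lookup-removeAt : ∀ {A : Set} {n} (xs : Vec A (suc n)) j k →
                  Vec.lookup (Vec.removeAt xs j) k ≡ Vec.lookup xs (punchIn j k)
lookup-removeAt (x ∷ xs)           Fin.zero    k           = refl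
lookup-removeAt (x ∷ xs@(_ ∷ _))   (Fin.suc j) Fin.zero    = refl
lookup-removeAt (x ∷ xs@(_ ∷ _))   (Fin.suc j) (Fin.suc k) = lookup-removeAt xs j k

module ℕ-Product = MonoidSum ℕ.*-1-commutativeMonoid

-- Row i is scaled by `w i` and column j by `v j`, which turns a matrix over `ℚ₂` into an integral
-- one. The two weight vectors are separate because a minor of the expansion loses the first row but
-- an arbitrary column.
det-scaled : ∀ {C : Set} {n} (A : Fin n → Fin n → ℚ₂) (rs : Vec (C → ℤ) n) (cs : Vec C n) (w v : Vector ℕ n) →
  (∀ i j → A i j *₂ K (+ (w i ℕ.* v j)) ≈₂ K (Vec.lookup rs i (Vec.lookup cs j))) →
  det A *₂ K (+ (ℕ-Product.sum w ℕ.* ℕ-Product.sum v)) ≈₂ K (detᶻ rs cs)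
det-scaled {n = zero}  A []       []  w v eq = pointwise λ _ → refl
det-scaled {n = suc n} A (r ∷ rs) cs w v eq = ≈₂-trans
  (alternating-*ʳ (λ j → A Fin.zero j *₂ det (minor j)) (K (+ W)))
  (alternating-contract r (detᶻ rs) cs _ term)
  where
  minor : Fin (suc n) → Fin n → Fin n → ℚ₂
  minor j i k = A (Fin.suc i) (punchIn j k)
  W = ℕ-Product.sum w ℕ.* ℕ-Product.sum v
  W′ : Fin (suc n) → ℕ
  W′ j = ℕ-Product.sum (w ∘ Fin.suc) ℕ.* ℕ-Product.sum (v ∘ punchIn j)
  W-split : ∀ j → + W ≡ + (w Fin.zero ℕ.* v j) * + W′ j
  W-split j = begin
    + W
      ≡⟨ cong (λ z → + (w Fin.zero ℕ.* ℕ-Product.sum (w ∘ Fin.suc) ℕ.* z)) (ℕ-Product.sum-remove {i = j} v) ⟩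
    + (w Fin.zero ℕ.* ℕ-Product.sum (w ∘ Fin.suc) ℕ.* (v j ℕ.* ℕ-Product.sum (v ∘ punchIn j)))
      ≡⟨ cong +_ (interchange (w Fin.zero) _ (v j) _) ⟩
    + (w Fin.zero ℕ.* v j ℕ.* W′ j)
      ≡⟨ ℤ.pos-* (w Fin.zero ℕ.* v j) (W′ j) ⟩
    + (w Fin.zero ℕ.* v j) * + W′ j ∎
    where
    open ℕ-Solver.+-*-Solver renaming (_:*_ to _⊠_; _:=_ to _≔_; solve to solveℕ) using ()
    interchange : ∀ a b c d → a ℕ.* b ℕ.* (c ℕ.* d) ≡ a ℕ.* c ℕ.* (b ℕ.* d)
    interchange = solveℕ 4 (λ a b c d → a ⊠ b ⊠ (c ⊠ d) ≔ a ⊠ c ⊠ (b ⊠ d)) refl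
  term : ∀ j → (A Fin.zero j *₂ det (minor j)) *₂ K (+ W) ≈₂ K (r (Vec.lookup cs j) * detᶻ rs (Vec.removeAt cs j))
  term j = begin₂
    (A Fin.zero j *₂ det (minor j)) *₂ K (+ W)
      ≈⟨ ℚ₂-Ring.reflexive (cong (λ z → (A Fin.zero j *₂ det (minor j)) *₂ K z) (W-split j)) ⟩
    (A Fin.zero j *₂ det (minor j)) *₂ K (+ (w Fin.zero ℕ.* v j) * + W′ j)
      ≈⟨ pointwise (λ k → trans (cong (λ z → seq (A Fin.zero j) k ℚ.* seq (det (minor j)) k ℚ.* z) (ι-* (+ (w Fin.zero ℕ.* v j)) (+ W′ j)))
           (interchange (seq (A Fin.zero j) k) (seq (det (minor j)) k) (ι (+ (w Fin.zero ℕ.* v j))) (ι (+ W′ j)))) ⟩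
    (A Fin.zero j *₂ K (+ (w Fin.zero ℕ.* v j))) *₂ (det (minor j) *₂ K (+ W′ j))
      ≈⟨ *₂-cong (eq Fin.zero j) (det-scaled (minor j) rs (Vec.removeAt cs j) (w ∘ Fin.suc) (v ∘ punchIn j) λ i k →
           subst (λ c → minor j i k *₂ K (+ (w (Fin.suc i) ℕ.* v (punchIn j k))) ≈₂ K (Vec.lookup rs i c))
             (sym (lookup-removeAt cs j k)) (eq (Fin.suc i) (punchIn j k))) ⟩
    K (r (Vec.lookup cs j)) *₂ K (detᶻ rs (Vec.removeAt cs j))
      ≈⟨ K-* (r (Vec.lookup cs j)) (detᶻ rs (Vec.removeAt cs j)) ⟨
    K (r (Vec.lookup cs j) * detᶻ rs (Vec.removeAt cs j)) ∎₂
    where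
    open ℚ₂-Reasoning
    open ℚ-Solver.+-*-Solver renaming (_:*_ to _⊠_; _:=_ to _≔_; solve to solveℚ) using ()
    interchange : ∀ a b c d → (a ℚ.* b) ℚ.* (c ℚ.* d) ≡ (a ℚ.* c) ℚ.* (b ℚ.* d)
    interchange = solveℚ 4 (λ a b c d → (a ⊠ b) ⊠ (c ⊠ d) ≔ (a ⊠ c) ⊠ (b ⊠ d)) refl

≤ν-cancel-odd : ∀ {k r} g → k ≤ν r ℚ.* odd g → k ≤ν r
≤ν-cancel-odd {k} {r} g (ν a h eq) = ν a (g ℕ.+ h ℕ.+ 2 ℕ.* (g ℕ.* h))
  (trans (cong (r ℚ.*_) (odd-* g h)) (trans (sym (ℚ.*-assoc r (odd g) (odd h))) eq))

∣⇒≤ν : ∀ k {z} → p2 k ∣ z → + k ≤ν ι z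
∣⇒≤ν k (divides q refl) = ν q 0 (trans (ℚ.*-identityʳ _) (trans (cong ι (ℤ.*-comm q (p2 k)))
  (trans (ι-* (p2 k) q) (cong (ℚ._* ι q) (sym (2^-ι k))))))

2∤1 : ∀ z → + 1 ≢ + 2 * z
2∤1 z eq = case ℕ∣.∣1⇒≡1 (ℤ∣.∣⇒∣ᵤ {+ 2} {+ 1} (divides z (trans eq (ℤ.*-comm (+ 2) z)))) of λ ()

-- Cancelling 2ᵏ from the equation inside `_≤ν_` would leave a product of two odd numbers equal to
-- an even number.
≤ν⇒∣ : ∀ k h → ¬ + suc k ≤ν ι ((+ 1 + + 2 * h) * p2 k)
≤ν⇒∣ k h (ν a g eq) = 2∤1 (a - g′ - h - + 2 * (h * g′)) (begin
  + 1
    ≡⟨ solve 2 (λ g h → con (+ 1) := (con (+ 1) :+ con (+ 2) :* h) :* (con (+ 1) :+ con (+ 2) :* g) :- con (+ 2) :* (g :+ h :+ con (+ 2) :* (h :* g))) refl g′ h ⟩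
  (+ 1 + + 2 * h) * (+ 1 + + 2 * g′) - + 2 * (g′ + h + + 2 * (h * g′))
    ≡⟨ cong (_- + 2 * (g′ + h + + 2 * (h * g′))) cancelled ⟩
  + 2 * a - + 2 * (g′ + h + + 2 * (h * g′))
    ≡⟨ solve 3 (λ a g h → con (+ 2) :* a :- con (+ 2) :* (g :+ h :+ con (+ 2) :* (h :* g)) := con (+ 2) :* (a :- g :- h :- con (+ 2) :* (h :* g))) refl a g′ h ⟩
  + 2 * (a - g′ - h - + 2 * (h * g′)) ∎)
  where
  g′ = + g
  odd-eq : + (1 ℕ.+ 2 ℕ.* g) ≡ + 1 + + 2 * g′
  odd-eq = cong (λ z → + 1 + z) (ℤ.pos-* 2 g)
  cancelled : (+ 1 + + 2 * h) * (+ 1 + + 2 * g′) ≡ + 2 * a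
  cancelled = ℤ.*-cancelʳ-≡ _ _ (p2 k) {{ℕ.m^n≢0 2 k}} (begin
    (+ 1 + + 2 * h) * (+ 1 + + 2 * g′) * p2 k
      ≡⟨ solve 3 (λ a b c → a :* b :* c := (a :* c) :* b) refl (+ 1 + + 2 * h) (+ 1 + + 2 * g′) (p2 k) ⟩
    (+ 1 + + 2 * h) * p2 k * (+ 1 + + 2 * g′)
      ≡⟨ ι-injective (begin
         ι ((+ 1 + + 2 * h) * p2 k * (+ 1 + + 2 * g′))   ≡⟨ ι-* ((+ 1 + + 2 * h) * p2 k) (+ 1 + + 2 * g′) ⟩
         ι ((+ 1 + + 2 * h) * p2 k) ℚ.* ι (+ 1 + + 2 * g′) ≡⟨ cong (λ z → ι ((+ 1 + + 2 * h) * p2 k) ℚ.* ι z) odd-eq ⟨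
         ι ((+ 1 + + 2 * h) * p2 k) ℚ.* odd g            ≡⟨ eq ⟩
         2^ (+ suc k) ℚ.* ι a                            ≡⟨ cong (ℚ._* ι a) (2^-ι (suc k)) ⟩
         ι (p2 (suc k)) ℚ.* ι a                          ≡⟨ ι-* (p2 (suc k)) a ⟨
         ι (p2 (suc k) * a)                              ∎) ⟩
    p2 (suc k) * a
      ≡⟨ cong (_* a) (p2-suc k) ⟩
    + 2 * p2 k * a
      ≡⟨ solve 2 (λ p a → con (+ 2) :* p :* a := con (+ 2) :* a :* p) refl (p2 k) a ⟩
    + 2 * a * p2 k ∎)

ν₂-cancel-odd : ∀ {x z W} k → Odd W → x *₂ K (+ W) ≈₂ K z → p2 k ∣ z → + k ≤ν₂ x
ν₂-cancel-odd {x} {z} k (g , refl) eq p2∣z = ev-map (≤ν-cancel-odd g)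
  (ν₂-resp {y = x *₂ K _} (≈₂-sym eq) (ν₂-const (∣⇒≤ν k p2∣z)))

¬ν₂-odd : ∀ {x z W} k h → x *₂ K (+ W) ≈₂ K z → z ≡ (+ 1 + + 2 * h) * p2 k → ¬ + suc k ≤ν₂ x
¬ν₂-odd {x} {z} {W} k h eq refl k<x = ≤ν⇒∣ k h (ev-const (ν₂-resp {y = K z} eq
  (subst (_≤ν₂ x *₂ K (+ W)) (ℤ.+-identityʳ (+ suc k)) (ν₂-* x (K (+ W)) k<x (ν₂-const (≤ν-ι (+ W)))))))

Odd-product : ∀ {n} (w : Vector ℕ n) → (∀ i → Odd (w i)) → Odd (ℕ-Product.sum w)
Odd-product {zero}  w p = 0 , refl
Odd-product {suc n} w p = Odd-* (p Fin.zero) (Odd-product (w ∘ Fin.suc) (p ∘ Fin.suc))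

subsets-empty : ∀ n {N} → N ℕ.< n → subsets n N ≡ []
subsets-empty (suc n) {zero}  lt       = refl
subsets-empty (suc n) {suc N} (s≤s lt) =
  cong₂ _++_ (subsets-empty (suc n) (ℕ.m<n⇒m<1+n lt)) (cong (List.map (N Vector.∷_)) (subsets-empty n lt))

subsets-down : ∀ n → ∃[ s ] subsets n n ≡ [ s ] × Vec.tabulate s ≡ down n
subsets-down zero    = _ , refl , refl
subsets-down (suc n) with subsets-down n
... | s , eq , eq′ = n Vector.∷ s ,
  cong₂ _++_ (subsets-empty (suc n) ℕ.≤-refl) (cong (List.map (n Vector.∷_)) eq) , cong (n ∷_) eq′

-- Scaling entry (i , j) by `w i ℕ.* w j` multiplies a principal minor by the square of an odd
-- number, so valuations can be read off the integral matrix of the factorisation.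
module CharSeries (T : CompactOperator) (Φ : Factorisation) (w : ℕ → ℕ) (w-odd : ∀ i → Odd (w i))
  (link : ∀ m i j → i ℕ.< m → j ℕ.< m →
          CompactOperator.matrix T i j *₂ K (+ (w i ℕ.* w j)) ≈₂ K (Factorisation.entry Φ m i j)) where

  open Factorisation Φ

  private
    weight : ∀ {n} → Vector ℕ n → ℕ
    weight s = ℕ-Product.sum (w ∘ s) ℕ.* ℕ-Product.sum (w ∘ s)

    weight-odd : ∀ {n} (s : Vector ℕ n) → Odd (weight s)
    weight-odd s = Odd-* (Odd-product (w ∘ s) (w-odd ∘ s)) (Odd-product (w ∘ s) (w-odd ∘ s))

  principalMinor-scaled : ∀ {n} m (s : Vector ℕ n) → All (ℕ._< m) (Vec.toList (Vec.tabulate s)) →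
    principalMinor T s *₂ K (+ weight s) ≈₂ K (minor m (Vec.tabulate s))
  principalMinor-scaled m s s<m = det-scaled _ (Vec.map (entry m) (Vec.tabulate s)) (Vec.tabulate s) (w ∘ s) (w ∘ s) λ i j →
    subst₂ (λ r c → CompactOperator.matrix T (s i) (s j) *₂ K (+ (w (s i) ℕ.* w (s j))) ≈₂ K (r c))
      (sym (trans (Vec.lookup-map i (entry m) (Vec.tabulate s)) (cong (entry m) (Vec.lookup∘tabulate s i))))
      (sym (Vec.lookup∘tabulate s j))
      (link m (s i) (s j) (bound s s<m i) (bound s s<m j))
    where
    bound : ∀ {n} (s : Vector ℕ n) → All (ℕ._< m) (Vec.toList (Vec.tabulate s)) → ∀ i → s i ℕ.< m
    bound s (p ∷ ps) Fin.zero    = p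
    bound s (p ∷ ps) (Fin.suc i) = bound (s ∘ Fin.suc) ps i

  principalMinor-off : ∀ {n} N (s : Vector ℕ n) → suc n ℕ.≤ N → + suc (E (suc n)) ≤ν₂ principalMinor T (N Vector.∷ s)
  principalMinor-off {n} N s n<N = ν₂-cancel-odd (suc (E (suc n))) (weight-odd (N Vector.∷ s))
    (principalMinor-scaled m (N Vector.∷ s) s<m) (minor-off m (Vec.tabulate (N Vector.∷ s)) s<m (here refl) n<N)
    where
    m = proj₁ (upperBound (Vec.toList (Vec.tabulate (N Vector.∷ s))))
    s<m = proj₂ (upperBound (Vec.toList (Vec.tabulate (N Vector.∷ s))))

  -- Going from N to N + 1 adds exactly the subsets with largest element N. Since n ≤ N, each of
  -- them contains an index outside {0, ..., n-1}, and its minor is divisible by 2 ^ (E n + 1).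
  minorSum-stable : ∀ n {N} → n ℕ.≤′ N → + suc (E n) ≤ν₂ minorSum T n N +₂ (-₂ minorSum T n n)
  minorSum-stable n (ℕ.≤′-reflexive refl) = ν₂-resp (≈₂-sym (ℚ₂-Ring.-‿inverseʳ (minorSum T n n))) ν₂-0
  minorSum-stable zero (ℕ.≤′-step le) = minorSum-stable zero le
  minorSum-stable (suc n) {suc N} (ℕ.≤′-step le) =
    ν₂-trans (minorSum T (suc n) (suc N)) (minorSum T (suc n) N) (minorSum T (suc n) (suc n))
      (∑-++ (principalMinor T) (subsets (suc n) N) (List.map (N Vector.∷_) (subsets n N))
        (All.map⁺ (All.universal (λ s → principalMinor-off N s (ℕ.≤′⇒≤ le)) (subsets n N))))
      (minorSum-stable (suc n) le)

  minorSum-main : ∀ n → HasValuation (minorSum T n n) (+ E n)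
  minorSum-main n with subsets-down n
  ... | s , eq , eq′ = subst (λ ss → HasValuation (∑[ ss ] (principalMinor T)) (+ E n)) (sym eq)
      ( ν₂-resp (≈₂-sym sum≈) (ν₂-cancel-odd (E n) (weight-odd s) scaled (divides (+ 1 + + 2 * proj₁ main) (proj₂ main)))
      , λ lt → ¬ν₂-odd (E n) (proj₁ main) scaled (proj₂ main) (ν₂-resp {y = principalMinor T s} sum≈ lt))
    where
    sum≈ : principalMinor T s +₂ 0₂ ≈₂ principalMinor T s
    sum≈ = ℚ₂-Ring.+-identityʳ (principalMinor T s)
    main = minor-main n n ℕ.≤-refl
    scaled : principalMinor T s *₂ K (+ weight s) ≈₂ K (minor n (down n))
    scaled = subst (λ v → principalMinor T s *₂ K (+ weight s) ≈₂ K (minor n v)) eq′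
      (principalMinor-scaled n s (subst (λ v → All (ℕ._< n) (Vec.toList v)) (sym eq′) (down-< n)))

  charSeries-valuation : ∀ n → HasValuation (charSeries T n) (+ E n)
  charSeries-valuation n =
      subst (_≤ν₂ sign *₂ lim) (ℤ.+-identityˡ (+ E n)) (ν₂-* sign lim (sign-ν n)
        (ν₂-approx lim S₀′ (ν₂-mono (lim +₂ (-₂ S₀′)) (ℤ.+≤+ (ℕ.n≤1+n (E n))) near) (proj₁ (minorSum-main n))))
    -- Multiplying by the sign a second time removes it; a higher valuation of the limit would then
    -- pass, by closeness, to the leading principal minor.
    , λ lt → proj₂ (minorSum-main n) (ν₂-approx S₀′ lim (ν₂-flip lim S₀′ near)
        (ν₂-resp {y = lim} (unsign n lim) (subst (_≤ν₂ sign *₂ (sign *₂ lim)) (ℤ.+-identityˡ (+ suc (E n)))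
          (ν₂-* sign (sign *₂ lim) (sign-ν n) lt))))
    where
    open Limit (minorSum T n) (minorSum-cauchy T n) using (lim; lim-correct)
    S₀′ = minorSum T n n
    sign = (-₂ 1₂) ℚ₂-Exp.^ n
    near : + suc (E n) ≤ν₂ lim +₂ (-₂ S₀′)
    near = ν₂-trans lim (minorSum T n N) S₀′ (proj₂ (lim-correct (+ suc (E n))) N (ℕ.m≤n+m _ n))
      (minorSum-stable n (ℕ.≤⇒≤′ (ℕ.m≤m+n n _)))
      where N = n ℕ.+ proj₁ (lim-correct (+ suc (E n)))
    unsign : ∀ n x → (-₂ 1₂) ℚ₂-Exp.^ n *₂ ((-₂ 1₂) ℚ₂-Exp.^ n *₂ x) ≈₂ x
    unsign zero    x = pointwise λ k → trans (ℚ.*-identityˡ _) (ℚ.*-identityˡ (seq x k))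
    unsign (suc n) x = ≈₂-trans
      (pointwise λ k → trans (regroup (ℚ.- 1ℚ) (seq ((-₂ 1₂) ℚ₂-Exp.^ n) k) (seq x k)) (ℚ.*-identityˡ _))
      (unsign n x)
      where
      open ℚ-Solver.+-*-Solver renaming (_:*_ to _⊠_; _:=_ to _≔_; solve to solveℚ) using ()
      regroup : ∀ u s x → (u ℚ.* s) ℚ.* ((u ℚ.* s) ℚ.* x) ≡ (u ℚ.* u) ℚ.* (s ℚ.* (s ℚ.* x))
      regroup = solveℚ 3 (λ u s x → (u ⊠ s) ⊠ ((u ⊠ s) ⊠ x) ≔ (u ⊠ u) ⊠ (s ⊠ (s ⊠ x))) refl

-- Newton polygons depend only on valuations

HasValuation-unique : ∀ {x k l} → HasValuation x k → HasValuation x l → k ≡ l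
HasValuation-unique {x} {k} {l} (p , ¬p) (q , ¬q) with ℤ.<-cmp k l
... | tri≈ _ k≡l _ = k≡l
... | tri< k<l _ _ = ⊥-elim (¬p (ν₂-mono x (ℤ.i<j⇒suc[i]≤j k<l) q))
... | tri> _ _ l<k = ⊥-elim (¬q (ν₂-mono x (ℤ.i<j⇒suc[i]≤j l<k) p))

-- The same weights and indices serve for both series: a valuation recorded in the convex
-- combination must be the common value `v`, by uniqueness.
InConvexHull-resp : ∀ {c c′} (v : ℕ → ℤ) → (∀ n → HasValuation (c n) (v n)) → (∀ n → HasValuation (c′ n) (v n)) →
                    ∀ {x y} → InConvexHull c x y → InConvexHull c′ x y
InConvexHull-resp {c} {c′} v p q h = record
  { size         = size
  ; weight       = weight
  ; index        = index
  ; valuation    = valuation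
  ; nonnegative  = nonnegative
  ; hasValuation = λ l → subst (HasValuation (c′ (index l)))
      (HasValuation-unique {c (index l)} (p (index l)) (hasValuation l)) (q (index l))
  ; total        = total
  ; abscissa     = abscissa
  ; ordinate     = ordinate
  }
  where open InConvexHull h

NewtonPolygon-resp : ∀ {c c′} (v : ℕ → ℤ) → (∀ n → HasValuation (c n) (v n)) → (∀ n → HasValuation (c′ n) (v n)) →
                     NewtonPolygon c ≐ NewtonPolygon c′
NewtonPolygon-resp v p q =
    (λ (h , least) → InConvexHull-resp v p q h , λ y′ h′ → least y′ (InConvexHull-resp v q p h′))
  , (λ (h , least) → InConvexHull-resp v q p h , λ y′ h′ → least y′ (InConvexHull-resp v p q h′))

-- The hypergeometric identity behind the factorisation of U

-- Binomial coefficients with an integer lower index, 0 outside of Pascal's triangle.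
Bin : ℕ → ℤ → ℤ
Bin zero    k = if does (k ℤ.≟ + 0) then + 1 else + 0
Bin (suc n) k = Bin n k + Bin n (k - + 1)

k*Bin0 : ∀ k → k * Bin 0 k ≡ + 0
k*Bin0 (+ zero)  = refl
k*Bin0 (+[1+ n ]) = ℤ.*-zeroʳ (+[1+ n ])
k*Bin0 -[1+ n ]  = ℤ.*-zeroʳ -[1+ n ]

Bin-absorb : ∀ n k → k * Bin (suc n) k ≡ + suc n * Bin n (k - + 1)
Bin-absorb zero k = begin
  k * (Bin 0 k + Bin 0 (k - + 1))
    ≡⟨ solve 3 (λ k a b → k :* (a :+ b) := k :* a :+ (k :- con (+ 1)) :* b :+ b) refl k (Bin 0 k) (Bin 0 (k - + 1)) ⟩
  k * Bin 0 k + (k - + 1) * Bin 0 (k - + 1) + Bin 0 (k - + 1)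
    ≡⟨ cong₂ (λ a b → a + b + Bin 0 (k - + 1)) (k*Bin0 k) (k*Bin0 (k - + 1)) ⟩
  + 0 + + 0 + Bin 0 (k - + 1)
    ≡⟨ solve 1 (λ b → con (+ 0) :+ con (+ 0) :+ b := con (+ 1) :* b) refl (Bin 0 (k - + 1)) ⟩
  + 1 * Bin 0 (k - + 1) ∎
Bin-absorb (suc n) k = begin
  k * (Bin (suc n) k + b)
    ≡⟨ solve 3 (λ k a b → k :* (a :+ b) := k :* a :+ (k :- con (+ 1)) :* b :+ b) refl k (Bin (suc n) k) b ⟩
  k * Bin (suc n) k + (k - + 1) * b + b
    ≡⟨ cong₂ (λ u v → u + v + b) (Bin-absorb n k) (Bin-absorb n (k - + 1)) ⟩
  + suc n * Bin n (k - + 1) + + suc n * Bin n (k - + 1 - + 1) + b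
    ≡⟨ solve 3 (λ n a b → n :* a :+ n :* b :+ (a :+ b) := (con (+ 1) :+ n) :* (a :+ b)) refl (+ suc n) (Bin n (k - + 1)) (Bin n (k - + 1 - + 1)) ⟩
  + suc (suc n) * b ∎
  where b = Bin (suc n) (k - + 1)

Bin-absorbʳ : ∀ n k → (+ suc n - k) * Bin (suc n) k ≡ + suc n * Bin n k
Bin-absorbʳ n k = begin
  (+ suc n - k) * Bin (suc n) k
    ≡⟨ solve 3 (λ n k b → (n :- k) :* b := n :* b :- k :* b) refl (+ suc n) k (Bin (suc n) k) ⟩
  + suc n * Bin (suc n) k - k * Bin (suc n) k
    ≡⟨ cong (λ z → + suc n * Bin (suc n) k - z) (Bin-absorb n k) ⟩
  + suc n * (Bin n k + Bin n (k - + 1)) - + suc n * Bin n (k - + 1)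
    ≡⟨ solve 3 (λ n a b → n :* (a :+ b) :- n :* b := n :* a) refl (+ suc n) (Bin n k) (Bin n (k - + 1)) ⟩
  + suc n * Bin n k ∎

Bin-ratio : ∀ n k → k * Bin n k ≡ (+ suc n - k) * Bin n (k - + 1)
Bin-ratio n k = begin
  k * Bin n k
    ≡⟨ solve 3 (λ k a n → k :* a := n :* a :- (n :- k) :* a) refl k (Bin n k) (+ suc n) ⟩
  + suc n * Bin n k - (+ suc n - k) * Bin n k
    ≡⟨ cong (_- (+ suc n - k) * Bin n k) (Bin-absorbʳ n k) ⟨
  (+ suc n - k) * (Bin n k + Bin n (k - + 1)) - (+ suc n - k) * Bin n k
    ≡⟨ solve 3 (λ m a b → m :* (a :+ b) :- m :* a := m :* b) refl (+ suc n - k) (Bin n k) (Bin n (k - + 1)) ⟩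
  (+ suc n - k) * Bin n (k - + 1) ∎

Bin-negative : ∀ n k → Bin n -[1+ k ] ≡ + 0
Bin-negative zero    k = refl
Bin-negative (suc n) k = cong₂ _+_ (Bin-negative n k) (Bin-negative n (suc (k ℕ.+ 0)))

Bin-large : ∀ n k → Bin n (+ (suc n ℕ.+ k)) ≡ + 0
Bin-large zero    k = refl
Bin-large (suc n) k = cong₂ _+_
  (trans (cong (Bin n ∘ +_ ∘ suc) (sym (ℕ.+-suc n k))) (Bin-large n (suc k))) (Bin-large n k)

Bin-zero : ∀ n → Bin n (+ 0) ≡ + 1
Bin-zero zero    = refl
Bin-zero (suc n) = cong₂ _+_ (Bin-zero n) (Bin-negative n 0)

Bin-one : ∀ n → Bin n (+ 1) ≡ + n
Bin-one zero    = refl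
Bin-one (suc n) = trans (cong₂ _+_ (Bin-one n) (Bin-zero n)) (ℤ.+-comm (+ n) (+ 1))

Bin-sym : ∀ n k → Bin n k ≡ Bin n (+ n - k)
Bin-sym zero (+ zero)   = refl
Bin-sym zero (+[1+ n ]) = refl
Bin-sym zero (-[1+ n ]) = refl
Bin-sym (suc n) k = begin
  Bin n k + Bin n (k - + 1)
    ≡⟨ cong₂ _+_ (Bin-sym n k) (Bin-sym n (k - + 1)) ⟩
  Bin n (+ n - k) + Bin n (+ n - (k - + 1))
    ≡⟨ cong₂ (λ u v → Bin n u + Bin n v)
         (solve 2 (λ n k → n :- k := (con (+ 1) :+ n) :- k :- con (+ 1)) refl (+ n) k)
         (solve 2 (λ n k → n :- (k :- con (+ 1)) := (con (+ 1) :+ n) :- k) refl (+ n) k) ⟩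
  Bin n (+ suc n - k - + 1) + Bin n (+ suc n - k)
    ≡⟨ ℤ.+-comm (Bin n (+ suc n - k - + 1)) (Bin n (+ suc n - k)) ⟩
  Bin (suc n) (+ suc n - k) ∎

-- Q a x = (x - a) (x - a + 1) ⋯ (x + a)
Q : ℕ → ℤ → ℤ
Q zero    x = x
Q (suc a) x = Q a x * (x * x - + suc a * + suc a)

-- Both sides are (x - a) ⋯ (x + a + 2). Similarly `Q-down` extends the window by two factors below,
-- and both sides of `Q-shift` are (x - a) ⋯ (x + a + 1).
Q-up : ∀ a x → Q (suc a) (x + + 1) ≡ Q a x * ((x + + suc a + + 1) * (x + + suc a))
Q-up zero x = solve 1 (λ x → (x :+ con (+ 1)) :* ((x :+ con (+ 1)) :* (x :+ con (+ 1)) :- con (+ 1)) :=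
  x :* ((x :+ con (+ 1) :+ con (+ 1)) :* (x :+ con (+ 1)))) refl x
Q-up (suc a) x = trans
  (cong (_* ((x + + 1) * (x + + 1) - + suc (suc a) * + suc (suc a))) (Q-up a x))
  (solve 3 (λ q x s → q :* ((x :+ s :+ con (+ 1)) :* (x :+ s)) :* ((x :+ con (+ 1)) :* (x :+ con (+ 1)) :- (con (+ 1) :+ s) :* (con (+ 1) :+ s)) :=
    q :* (x :* x :- s :* s) :* ((x :+ (con (+ 1) :+ s) :+ con (+ 1)) :* (x :+ (con (+ 1) :+ s)))) refl (Q a x) x (+ suc a))

Q-down : ∀ a x → Q (suc a) (x - + 1) ≡ Q a x * ((x - + suc a - + 1) * (x - + suc a))
Q-down zero x = solve 1 (λ x → (x :- con (+ 1)) :* ((x :- con (+ 1)) :* (x :- con (+ 1)) :- con (+ 1)) :=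
  x :* ((x :- con (+ 1) :- con (+ 1)) :* (x :- con (+ 1)))) refl x
Q-down (suc a) x = trans
  (cong (_* ((x - + 1) * (x - + 1) - + suc (suc a) * + suc (suc a))) (Q-down a x))
  (solve 3 (λ q x s → q :* ((x :- s :- con (+ 1)) :* (x :- s)) :* ((x :- con (+ 1)) :* (x :- con (+ 1)) :- (con (+ 1) :+ s) :* (con (+ 1) :+ s)) :=
    q :* (x :* x :- s :* s) :* ((x :- (con (+ 1) :+ s) :- con (+ 1)) :* (x :- (con (+ 1) :+ s)))) refl (Q a x) x (+ suc a))

Q-shift : ∀ a x → Q a (x + + 1) * (x - + a) ≡ Q a x * (x + + suc a)
Q-shift zero x = solve 1 (λ x → (x :+ con (+ 1)) :* (x :- con (+ 0)) := x :* (x :+ con (+ 1))) refl x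
Q-shift (suc a) x = begin
  Q a (x + + 1) * ((x + + 1) * (x + + 1) - s * s) * (x - s)
    ≡⟨ solve 3 (λ q x a → q :* ((x :+ con (+ 1)) :* (x :+ con (+ 1)) :- (con (+ 1) :+ a) :* (con (+ 1) :+ a)) :* (x :- (con (+ 1) :+ a)) :=
         q :* (x :- a) :* ((x :+ con (+ 2) :+ a) :* (x :- (con (+ 1) :+ a)))) refl (Q a (x + + 1)) x (+ a) ⟩
  Q a (x + + 1) * (x - + a) * ((x + + 2 + + a) * (x - s))
    ≡⟨ cong (_* ((x + + 2 + + a) * (x - s))) (Q-shift a x) ⟩
  Q a x * (x + s) * ((x + + 2 + + a) * (x - s))
    ≡⟨ solve 3 (λ q x a → q :* (x :+ (con (+ 1) :+ a)) :* ((x :+ con (+ 2) :+ a) :* (x :- (con (+ 1) :+ a))) :=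
         q :* (x :* x :- (con (+ 1) :+ a) :* (con (+ 1) :+ a)) :* (x :+ (con (+ 2) :+ a))) refl (Q a x) x (+ a) ⟩
  Q a x * (x * x - s * s) * (x + + suc (suc a)) ∎
  where s = + suc a

dbl : ℕ → ℕ
dbl zero    = zero
dbl (suc n) = suc (suc (dbl n))

+dbl : ∀ n → + dbl n ≡ + 2 * + n
+dbl zero    = refl
+dbl (suc n) = trans (cong (λ z → + 2 + z) (+dbl n)) (solve 1 (λ n → con (+ 2) :+ con (+ 2) :* n := con (+ 2) :* (con (+ 1) :+ n)) refl (+ n))

-- With i = a + 1 and t = C + 1.
T : ℕ → ℤ → ℤ
T a C = Bin (dbl (suc a)) (+ a - C) * Q a (+ 2 * (+ 1 + C))

-- The summand 2t Tᵢ(t) Tⱼ(t) of the decomposition L D Lᵀ of the symmetric part of U; `T` vanishes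
-- for t > i, which makes the sum finite and the factor triangular.
F : ℕ → ℕ → ℤ → ℤ
F a b C = + 2 * (+ 1 + C) * (T a C * T b C)

-- The companion of `F`: its differences in C give the recurrence of `F` in `a`. It vanishes at C =
-- 0 because `Q (suc a) (+ 1)` contains the factor 1 - 1, and for C > b because its second binomial
-- coefficient does.
H : ℕ → ℕ → ℤ → ℤ
H a b C = - (+ 4 * + suc b * (+ 3 * + suc a + + 2) *
  (Bin (suc (dbl (suc a))) (+ suc a - C) * Bin (suc (dbl b)) (+ b - C) *
  (Q (suc a) (+ 2 * (+ 1 + C) - + 1) * Q (suc b) (+ 2 * (+ 1 + C) - + 1))))

-- This is all that remains of `certificate` once the common factor π ρ (V + W) (X + Y) has been
-- taken out.
certificate-polynomial : ∀ i j t →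
    (i + j + + 1) * ((+ 2 * i - j + + 1) * (+ 2 * i - j + + 2) * (+ 2 * t) * (+ 2 * t * (+ 2 * t) - i * i) * ((+ 2 * i + + 2) * (+ 2 * j))
      - + 4 * (+ 2 * i + + 1) * (i + j) * (+ 2 * j - i) * (+ 2 * t) * (+ 2 * j) * ((i + + 1 + t) * (i + + 1 - t)))
    ≡ + 4 * j * (+ 3 * i + + 2) *
      ((i + + 1 + t) * (j + t) * ((+ 2 * t - i - + 1) * (+ 2 * t - i) * ((+ 2 * t - j - + 1) * (+ 2 * t - j)))
      - (i + + 1 - t) * (j - t) * ((+ 2 * t + i + + 1) * (+ 2 * t + i) * ((+ 2 * t + j + + 1) * (+ 2 * t + j))))
certificate-polynomial = solve 3 (λ i j t →
      (i :+ j :+ con (+ 1)) :* ((con (+ 2) :* i :- j :+ con (+ 1)) :* (con (+ 2) :* i :- j :+ con (+ 2)) :* (con (+ 2) :* t) :* (con (+ 2) :* t :* (con (+ 2) :* t) :- i :* i) :* ((con (+ 2) :* i :+ con (+ 2)) :* (con (+ 2) :* j))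
        :- con (+ 4) :* (con (+ 2) :* i :+ con (+ 1)) :* (i :+ j) :* (con (+ 2) :* j :- i) :* (con (+ 2) :* t) :* (con (+ 2) :* j) :* ((i :+ con (+ 1) :+ t) :* (i :+ con (+ 1) :- t)))
      := con (+ 4) :* j :* (con (+ 3) :* i :+ con (+ 2)) :*
        ((i :+ con (+ 1) :+ t) :* (j :+ t) :* ((con (+ 2) :* t :- i :- con (+ 1)) :* (con (+ 2) :* t :- i) :* ((con (+ 2) :* t :- j :- con (+ 1)) :* (con (+ 2) :* t :- j)))
        :- (i :+ con (+ 1) :- t) :* (j :- t) :* ((con (+ 2) :* t :+ i :+ con (+ 1)) :* (con (+ 2) :* t :+ i) :* ((con (+ 2) :* t :+ j :+ con (+ 1)) :* (con (+ 2) :* t :+ j))))) refl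

-- The certificate of Zeilberger's algorithm for F, with X, Y and V, W
-- neighbouring binomial coefficients; multiplication by (2i + 2) 2j turns both
-- sides into multiples of (X + Y) (V + W).
certificate : ∀ i j t X Y B V W π ρ .{{_ : ℤ.NonZero ((+ 2 * i + + 2) * (+ 2 * j))}} →
  (i + + 1 - t) * X ≡ (i + + 1 + t) * Y → (i + + 1 + t) * Y ≡ (+ 2 * i + + 1) * B → (j - t) * V ≡ (j + t) * W →
  (i + j + + 1) * ((+ 2 * i - j + + 1) * (+ 2 * i - j + + 2) * (+ 2 * t * ((X + Y) * (π * (+ 2 * t * (+ 2 * t) - i * i)) * ((V + W) * ρ)))
     - + 4 * ((+ 2 * i + + 1) * (+ 2 * i + + 1)) * (i + j) * (+ 2 * j - i) * (+ 2 * t * (B * π * ((V + W) * ρ))))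
  ≡ + 4 * j * (+ 3 * i + + 2) * (X * V * (π * ((+ 2 * t - i - + 1) * (+ 2 * t - i)) * (ρ * ((+ 2 * t - j - + 1) * (+ 2 * t - j)))))
    - + 4 * j * (+ 3 * i + + 2) * (Y * W * (π * ((+ 2 * t + i + + 1) * (+ 2 * t + i)) * (ρ * ((+ 2 * t + j + + 1) * (+ 2 * t + j)))))
certificate i j t X Y B V W π ρ {{nz}} XY YB VW = ℤ.*-cancelˡ-≡ (m₁ * m₂) _ _ {{nz}} (begin
  m₁ * m₂ * (s′ * (p′ * (+ 2 * t * ((X + Y) * (π * r′) * ((V + W) * ρ))) - + 4 * (c′ * c′) * (i + j) * q′ * (+ 2 * t * (B * π * ((V + W) * ρ)))))
    ≡⟨ regroupˡ m₁ m₂ s′ p′ t (X + Y) π r′ (V + W) ρ c′ (i + j) q′ B ⟩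
  s′ * (π * ρ * (V + W)) * (p′ * (+ 2 * t) * r′ * (m₁ * m₂) * (X + Y) - + 4 * c′ * (i + j) * q′ * (+ 2 * t) * m₂ * (m₁ * (c′ * B)))
    ≡⟨ cong (λ z → s′ * (π * ρ * (V + W)) * (p′ * (+ 2 * t) * r′ * (m₁ * m₂) * (X + Y) - + 4 * c′ * (i + j) * q′ * (+ 2 * t) * m₂ * z)) cB ⟩
  s′ * (π * ρ * (V + W)) * (p′ * (+ 2 * t) * r′ * (m₁ * m₂) * (X + Y) - + 4 * c′ * (i + j) * q′ * (+ 2 * t) * m₂ * ((i + + 1 + t) * ((i + + 1 - t) * (X + Y))))
    ≡⟨ regroupᵐ s′ (π * ρ * (V + W)) (p′ * (+ 2 * t) * r′ * (m₁ * m₂)) (X + Y) (+ 4 * c′ * (i + j) * q′ * (+ 2 * t) * m₂) (i + + 1 + t) (i + + 1 - t) ⟩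
  π * ρ * (V + W) * (X + Y) * (s′ * (p′ * (+ 2 * t) * r′ * (m₁ * m₂) - + 4 * c′ * (i + j) * q′ * (+ 2 * t) * m₂ * ((i + + 1 + t) * (i + + 1 - t))))
    ≡⟨ cong (π * ρ * (V + W) * (X + Y) *_) (certificate-polynomial i j t) ⟩
  π * ρ * (V + W) * (X + Y) * (k * ((i + + 1 + t) * (j + t) * (d₁′ * d₂′) - (i + + 1 - t) * (j - t) * (u₁′ * u₂′)))
    ≡⟨ regroupʳ (π * ρ) (V + W) (X + Y) k (i + + 1 + t) (j + t) (d₁′ * d₂′) (i + + 1 - t) (j - t) (u₁′ * u₂′) ⟩
  π * ρ * k * ((i + + 1 + t) * (X + Y) * ((j + t) * (V + W)) * (d₁′ * d₂′) - (i + + 1 - t) * (X + Y) * ((j - t) * (V + W)) * (u₁′ * u₂′))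
    ≡⟨ cong₂ (λ a b → π * ρ * k * (a * (d₁′ * d₂′) - b * (u₁′ * u₂′))) (cong₂ _*_ mX mV) (cong₂ _*_ mY mW) ⟨
  π * ρ * k * (m₁ * X * (m₂ * V) * (d₁′ * d₂′) - m₁ * Y * (m₂ * W) * (u₁′ * u₂′))
    ≡⟨ regroupᵉ π ρ k m₁ X m₂ V d₁′ d₂′ Y W u₁′ u₂′ ⟩
  m₁ * m₂ * (k * (X * V * (π * d₁′ * (ρ * d₂′))) - k * (Y * W * (π * u₁′ * (ρ * u₂′)))) ∎)
  where
  m₁ = + 2 * i + + 2
  m₂ = + 2 * j
  k  = + 4 * j * (+ 3 * i + + 2)
  s′ = i + j + + 1
  p′ = (+ 2 * i - j + + 1) * (+ 2 * i - j + + 2)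
  q′ = + 2 * j - i
  c′ = + 2 * i + + 1
  r′ = + 2 * t * (+ 2 * t) - i * i
  d₁′ = (+ 2 * t - i - + 1) * (+ 2 * t - i)
  d₂′ = (+ 2 * t - j - + 1) * (+ 2 * t - j)
  u₁′ = (+ 2 * t + i + + 1) * (+ 2 * t + i)
  u₂′ = (+ 2 * t + j + + 1) * (+ 2 * t + j)
  regroupˡ : ∀ m₁ m₂ s p t Z π r D ρ c ij q B →
    m₁ * m₂ * (s * (p * (+ 2 * t * (Z * (π * r) * (D * ρ))) - + 4 * (c * c) * ij * q * (+ 2 * t * (B * π * (D * ρ))))) ≡
    s * (π * ρ * D) * (p * (+ 2 * t) * r * (m₁ * m₂) * Z - + 4 * c * ij * q * (+ 2 * t) * m₂ * (m₁ * (c * B)))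
  regroupˡ = solve 14 (λ m₁ m₂ s p t Z π r D ρ c ij q B →
    m₁ :* m₂ :* (s :* (p :* (con (+ 2) :* t :* (Z :* (π :* r) :* (D :* ρ))) :- con (+ 4) :* (c :* c) :* ij :* q :* (con (+ 2) :* t :* (B :* π :* (D :* ρ))))) :=
    s :* (π :* ρ :* D) :* (p :* (con (+ 2) :* t) :* r :* (m₁ :* m₂) :* Z :- con (+ 4) :* c :* ij :* q :* (con (+ 2) :* t) :* m₂ :* (m₁ :* (c :* B)))) refl
  regroupᵐ : ∀ s π p Z q a b → s * π * (p * Z - q * (a * (b * Z))) ≡ π * Z * (s * (p - q * (a * b)))
  regroupᵐ = solve 7 (λ s π p Z q a b → s :* π :* (p :* Z :- q :* (a :* (b :* Z))) := π :* Z :* (s :* (p :- q :* (a :* b)))) refl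
  regroupʳ : ∀ π D Z k a b d e f u → π * D * Z * (k * (a * b * d - e * f * u)) ≡ π * k * (a * Z * (b * D) * d - e * Z * (f * D) * u)
  regroupʳ = solve 10 (λ π D Z k a b d e f u → π :* D :* Z :* (k :* (a :* b :* d :- e :* f :* u)) :=
    π :* k :* (a :* Z :* (b :* D) :* d :- e :* Z :* (f :* D) :* u)) refl
  regroupᵉ : ∀ π ρ k m X n V d d′ Y W u u′ → π * ρ * k * (m * X * (n * V) * (d * d′) - m * Y * (n * W) * (u * u′)) ≡
    m * n * (k * (X * V * (π * d * (ρ * d′))) - k * (Y * W * (π * u * (ρ * u′))))
  regroupᵉ = solve 13 (λ π ρ k m X n V d d′ Y W u u′ → π :* ρ :* k :* (m :* X :* (n :* V) :* (d :* d′) :- m :* Y :* (n :* W) :* (u :* u′)) :=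
    m :* n :* (k :* (X :* V :* (π :* d :* (ρ :* d′))) :- k :* (Y :* W :* (π :* u :* (ρ :* u′))))) refl
  ratioˡ : ∀ a b X Y → a * X ≡ b * Y → (a + b) * X ≡ b * (X + Y)
  ratioˡ a b X Y eq = begin
    (a + b) * X     ≡⟨ ℤ.*-distribʳ-+ X a b ⟩
    a * X + b * X   ≡⟨ cong (_+ b * X) eq ⟩
    b * Y + b * X   ≡⟨ solve 3 (λ b X Y → b :* Y :+ b :* X := b :* (X :+ Y)) refl b X Y ⟩
    b * (X + Y)     ∎
  ratioʳ : ∀ a b X Y → a * X ≡ b * Y → (a + b) * Y ≡ a * (X + Y)
  ratioʳ a b X Y eq = begin
    (a + b) * Y     ≡⟨ ℤ.*-distribʳ-+ Y a b ⟩
    a * Y + b * Y   ≡⟨ cong (λ z → a * Y + z) eq ⟨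
    a * Y + a * X   ≡⟨ solve 3 (λ a X Y → a :* Y :+ a :* X := a :* (X :+ Y)) refl a X Y ⟩
    a * (X + Y)     ∎
  m₁-split : m₁ ≡ (i + + 1 - t) + (i + + 1 + t)
  m₁-split = solve 2 (λ i t → con (+ 2) :* i :+ con (+ 2) := (i :+ con (+ 1) :- t) :+ (i :+ con (+ 1) :+ t)) refl i t
  m₂-split : m₂ ≡ (j - t) + (j + t)
  m₂-split = solve 2 (λ j t → con (+ 2) :* j := (j :- t) :+ (j :+ t)) refl j t
  mX : m₁ * X ≡ (i + + 1 + t) * (X + Y)
  mX = trans (cong (_* X) m₁-split) (ratioˡ (i + + 1 - t) (i + + 1 + t) X Y XY)
  mY : m₁ * Y ≡ (i + + 1 - t) * (X + Y)
  mY = trans (cong (_* Y) m₁-split) (ratioʳ (i + + 1 - t) (i + + 1 + t) X Y XY)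
  mV : m₂ * V ≡ (j + t) * (V + W)
  mV = trans (cong (_* V) m₂-split) (ratioˡ (j - t) (j + t) V W VW)
  mW : m₂ * W ≡ (j - t) * (V + W)
  mW = trans (cong (_* W) m₂-split) (ratioʳ (j - t) (j + t) V W VW)
  cB : m₁ * (c′ * B) ≡ (i + + 1 + t) * ((i + + 1 - t) * (X + Y))
  cB = begin
    m₁ * (c′ * B)                     ≡⟨ cong (m₁ *_) YB ⟨
    m₁ * ((i + + 1 + t) * Y)          ≡⟨ solve 3 (λ m a Y → m :* (a :* Y) := a :* (m :* Y)) refl m₁ (i + + 1 + t) Y ⟩
    (i + + 1 + t) * (m₁ * Y)          ≡⟨ cong ((i + + 1 + t) *_) mY ⟩
    (i + + 1 + t) * ((i + + 1 - t) * (X + Y)) ∎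

H-difference : ∀ a b C → let i = + suc a ; j = + suc b in
  (i + j + + 1) * ((+ 2 * i - j + + 1) * (+ 2 * i - j + + 2) * F (suc a) b C
    - + 4 * ((+ 2 * i + + 1) * (+ 2 * i + + 1)) * (i + j) * (+ 2 * j - i) * F a b C) ≡ H a b (+ 1 + C) - H a b C
H-difference a b C = begin
  _ ≡⟨ certificate i j t X Y (Bin (dbl (suc a)) (+ a - C)) V W (Q a (+ 2 * t)) (Q b (+ 2 * t)) {{nz}} XY YB VW ⟩
  k * (X * V * (Q a (+ 2 * t) * ((+ 2 * t - i - + 1) * (+ 2 * t - i)) * (Q b (+ 2 * t) * ((+ 2 * t - j - + 1) * (+ 2 * t - j)))))
    - k * (Y * W * (Q a (+ 2 * t) * ((+ 2 * t + i + + 1) * (+ 2 * t + i)) * (Q b (+ 2 * t) * ((+ 2 * t + j + + 1) * (+ 2 * t + j)))))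
    -- Each group of linear factors completes a product `Q` at 2t - 1 or at 2t + 1. The former
    -- belongs to H at C; the latter belongs to H at C + 1, because 2t + 1 = 2(t + 1) - 1.
    ≡⟨ cong₂ (λ u v → k * (X * V * u) - k * (Y * W * v))
         (cong₂ _*_ (Q-down a (+ 2 * t)) (Q-down b (+ 2 * t))) (cong₂ _*_ (Q-up a (+ 2 * t)) (Q-up b (+ 2 * t))) ⟨
  k * (X * V * (Q (suc a) (+ 2 * t - + 1) * Q (suc b) (+ 2 * t - + 1)))
    - k * (Y * W * (Q (suc a) (+ 2 * t + + 1) * Q (suc b) (+ 2 * t + + 1)))
    ≡⟨ cong (λ z → k * (X * V * (Q (suc a) (+ 2 * t - + 1) * Q (suc b) (+ 2 * t - + 1))) - k * z)
         (cong₂ _*_ (cong₂ (λ u v → Bin (suc (dbl (suc a))) u * Bin (suc (dbl b)) v)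
            (solve 2 (λ a C → a :- C :- con (+ 1) := a :- (con (+ 1) :+ C)) refl i C)
            (solve 2 (λ a C → a :- C :- con (+ 1) := a :- (con (+ 1) :+ C)) refl (+ b) C))
            (cong₂ (λ u v → Q (suc a) u * Q (suc b) v) next next)) ⟩
  k * (X * V * (Q (suc a) (+ 2 * t - + 1) * Q (suc b) (+ 2 * t - + 1)))
    - k * (Bin (suc (dbl (suc a))) (i - t) * Bin (suc (dbl b)) (+ b - t)
        * (Q (suc a) (+ 2 * (+ 1 + t) - + 1) * Q (suc b) (+ 2 * (+ 1 + t) - + 1)))
    ≡⟨ solve 3 (λ k u v → k :* v :- k :* u := :- (k :* u) :- :- (k :* v)) refl k
           (Bin (suc (dbl (suc a))) (i - t) * Bin (suc (dbl b)) (+ b - t) * (Q (suc a) (+ 2 * (+ 1 + t) - + 1) * Q (suc b) (+ 2 * (+ 1 + t) - + 1)))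
           (X * V * (Q (suc a) (+ 2 * t - + 1) * Q (suc b) (+ 2 * t - + 1))) ⟩
  H a b t - H a b C ∎
  where
  i = + suc a
  j = + suc b
  t = + 1 + C
  k = + 4 * j * (+ 3 * i + + 2)
  X = Bin (suc (dbl (suc a))) (i - C)
  Y = Bin (suc (dbl (suc a))) (i - C - + 1)
  V = Bin (suc (dbl b)) (+ b - C)
  W = Bin (suc (dbl b)) (+ b - C - + 1)
  nz : ℤ.NonZero ((+ 2 * i + + 2) * (+ 2 * j))
  nz = _
  next : + 2 * t + + 1 ≡ + 2 * (+ 1 + t) - + 1
  next = solve 1 (λ t → con (+ 2) :* t :+ con (+ 1) := con (+ 2) :* (con (+ 1) :+ t) :- con (+ 1)) refl t
  XY : (i + + 1 - t) * X ≡ (i + + 1 + t) * Y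
  XY = begin
    (i + + 1 - t) * X              ≡⟨ cong (_* X) (solve 2 (λ i C → i :+ con (+ 1) :- (con (+ 1) :+ C) := i :- C) refl i C) ⟩
    (i - C) * X                    ≡⟨ Bin-ratio (suc (dbl (suc a))) (i - C) ⟩
    (+ dbl (suc (suc a)) - (i - C)) * Y   ≡⟨ cong (λ z → (z - (i - C)) * Y) (+dbl (suc (suc a))) ⟩
    (+ 2 * + suc (suc a) - (i - C)) * Y   ≡⟨ cong (_* Y) (solve 2 (λ i C → con (+ 2) :* (con (+ 1) :+ i) :- (i :- C) := i :+ con (+ 1) :+ (con (+ 1) :+ C)) refl i C) ⟩
    (i + + 1 + t) * Y              ∎
  YB : (i + + 1 + t) * Y ≡ (+ 2 * i + + 1) * Bin (dbl (suc a)) (+ a - C)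
  YB = begin
    (i + + 1 + t) * Y
      ≡⟨ cong₂ (λ u v → u * Bin (suc (dbl (suc a))) v)
           (trans (solve 2 (λ a C → (con (+ 1) :+ a) :+ con (+ 1) :+ (con (+ 1) :+ C) := con (+ 1) :+ con (+ 2) :* (con (+ 1) :+ a) :- (a :- C)) refl (+ a) C)
             (cong (λ z → + 1 + z - (+ a - C)) (sym (+dbl (suc a)))))
           (solve 2 (λ a C → con (+ 1) :+ a :- C :- con (+ 1) := a :- C) refl (+ a) C) ⟩
    (+ suc (dbl (suc a)) - (+ a - C)) * Bin (suc (dbl (suc a))) (+ a - C)
      ≡⟨ Bin-absorbʳ (dbl (suc a)) (+ a - C) ⟩
    + suc (dbl (suc a)) * Bin (dbl (suc a)) (+ a - C)
      ≡⟨ cong (_* Bin (dbl (suc a)) (+ a - C)) (trans (cong (λ z → + 1 + z) (+dbl (suc a))) (ℤ.+-comm (+ 1) (+ 2 * i))) ⟩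
    (+ 2 * i + + 1) * Bin (dbl (suc a)) (+ a - C) ∎
  VW : (j - t) * V ≡ (j + t) * W
  VW = begin
    (j - t) * V                    ≡⟨ cong (_* V) (solve 2 (λ b C → con (+ 1) :+ b :- (con (+ 1) :+ C) := b :- C) refl (+ b) C) ⟩
    (+ b - C) * V                  ≡⟨ Bin-ratio (suc (dbl b)) (+ b - C) ⟩
    (+ dbl (suc b) - (+ b - C)) * W  ≡⟨ cong (λ z → (z - (+ b - C)) * W) (+dbl (suc b)) ⟩
    (+ 2 * j - (+ b - C)) * W      ≡⟨ cong (_* W) (solve 2 (λ b C → con (+ 2) :* (con (+ 1) :+ b) :- (b :- C) := con (+ 1) :+ b :+ (con (+ 1) :+ C)) refl (+ b) C) ⟩
    (j + t) * W                    ∎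

ΣF : ℕ → ℕ → ℕ → ℤ
ΣF a b m = Σ< m λ c → F a b (+ c)

Q-one : ∀ a → Q (suc a) (+ 1) ≡ + 0
Q-one zero    = refl
Q-one (suc a) = cong (_* (+ 1 * + 1 - + suc (suc a) * + suc (suc a))) (Q-one a)

H-zero : ∀ a b → H a b (+ 0) ≡ + 0
H-zero a b = trans (cong (λ z → - (+ 4 * + suc b * (+ 3 * + suc a + + 2) * (X * (z * Q (suc b) (+ 1))))) (Q-one a))
  (solve 2 (λ k x → :- (k :* (x :* con (+ 0))) := con (+ 0)) refl (+ 4 * + suc b * (+ 3 * + suc a + + 2)) X)
  where X = Bin (suc (dbl (suc a))) (+ suc a - + 0) * Bin (suc (dbl b)) (+ b - + 0)

negative-difference : ∀ b k → + b - + (suc b ℕ.+ k) ≡ -[1+ k ]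
negative-difference b k = solve 2 (λ b k → b :- (con (+ 1) :+ b :+ k) := :- (con (+ 1) :+ k)) refl (+ b) (+ k)

Bin-below : ∀ n {b m} → b ℕ.< m → Bin n (+ b - + m) ≡ + 0
Bin-below n {b} b<m with ℕ.m≤n⇒∃[o]m+o≡n b<m
... | k , refl = trans (cong (Bin n) (negative-difference b k)) (Bin-negative n k)

H-large : ∀ a {b m} → b ℕ.< m → H a b (+ m) ≡ + 0
H-large a {b} {m} b<m = trans
  (cong (λ z → - (+ 4 * + suc b * (+ 3 * + suc a + + 2) * (X * z * Y))) (Bin-below (suc (dbl b)) b<m))
  (solve 3 (λ k x y → :- (k :* (x :* con (+ 0) :* y)) := con (+ 0)) refl (+ 4 * + suc b * (+ 3 * + suc a + + 2)) X Y)
  where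
  X = Bin (suc (dbl (suc a))) (+ suc a - + m)
  Y = Q (suc a) (+ 2 * (+ 1 + + m) - + 1) * Q (suc b) (+ 2 * (+ 1 + + m) - + 1)

-- Summing `H-difference` over C telescopes to boundary values, which are 0; the positive factor i +
-- j + 1 of the certificate is cancelled.
ΣF-step : ∀ a b {m} → b ℕ.< m → let i = + suc a ; j = + suc b in
  (+ 2 * i - j + + 1) * (+ 2 * i - j + + 2) * ΣF (suc a) b m ≡
  + 4 * ((+ 2 * i + + 1) * (+ 2 * i + + 1)) * (i + j) * (+ 2 * j - i) * ΣF a b m
ΣF-step a b {m} b<m = ℤ.i-j≡0⇒i≡j _ _ (ℤ.*-cancelˡ-≡ (i + j + + 1) _ (+ 0) {{nz}} (begin
  (i + j + + 1) * (u * ΣF (suc a) b m - v * ΣF a b m)   ≡⟨ telescope m ⟩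
  H a b (+ m) - H a b (+ 0)                             ≡⟨ cong₂ _-_ (H-large a b<m) (H-zero a b) ⟩
  + 0                                                   ≡⟨ ℤ.*-zeroʳ (i + j + + 1) ⟨
  (i + j + + 1) * + 0                                   ∎))
  where
  i = + suc a
  j = + suc b
  u = (+ 2 * i - j + + 1) * (+ 2 * i - j + + 2)
  v = + 4 * ((+ 2 * i + + 1) * (+ 2 * i + + 1)) * (i + j) * (+ 2 * j - i)
  nz : ℤ.NonZero (i + j + + 1)
  nz = _
  telescope : ∀ m → (i + j + + 1) * (u * ΣF (suc a) b m - v * ΣF a b m) ≡ H a b (+ m) - H a b (+ 0)
  telescope zero    = trans
    (solve 3 (λ s u v → s :* (u :* con (+ 0) :- v :* con (+ 0)) := con (+ 0)) refl (i + j + + 1) u v)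
    (sym (ℤ.+-inverseʳ (H a b (+ 0))))
  telescope (suc m) = begin
    (i + j + + 1) * (u * (ΣF (suc a) b m + F (suc a) b (+ m)) - v * (ΣF a b m + F a b (+ m)))
      ≡⟨ solve 7 (λ s u v x y z w → s :* (u :* (x :+ y) :- v :* (z :+ w)) := s :* (u :* x :- v :* z) :+ s :* (u :* y :- v :* w)) refl
           (i + j + + 1) u v (ΣF (suc a) b m) (F (suc a) b (+ m)) (ΣF a b m) (F a b (+ m)) ⟩
    (i + j + + 1) * (u * ΣF (suc a) b m - v * ΣF a b m) + (i + j + + 1) * (u * F (suc a) b (+ m) - v * F a b (+ m))
      ≡⟨ cong₂ _+_ (telescope m) (H-difference a b (+ m)) ⟩
    (H a b (+ m) - H a b (+ 0)) + (H a b (+ suc m) - H a b (+ m))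
      ≡⟨ solve 3 (λ x y z → (x :- y) :+ (z :- x) := z :- y) refl (H a b (+ m)) (H a b (+ 0)) (H a b (+ suc m)) ⟩
    H a b (+ suc m) - H a b (+ 0) ∎

-- ((2a + 1)!!)²
w : ℕ → ℕ
w zero    = 1
w (suc a) = (3 ℕ.+ dbl a) ℕ.* (3 ℕ.+ dbl a) ℕ.* w a

+w-suc : ∀ a → + w (suc a) ≡ (+ 2 * + suc a + + 1) * (+ 2 * + suc a + + 1) * + w a
+w-suc a = begin
  + ((3 ℕ.+ dbl a) ℕ.* (3 ℕ.+ dbl a) ℕ.* w a)            ≡⟨ ℤ.pos-* ((3 ℕ.+ dbl a) ℕ.* (3 ℕ.+ dbl a)) (w a) ⟩
  + ((3 ℕ.+ dbl a) ℕ.* (3 ℕ.+ dbl a)) * + w a            ≡⟨ cong (_* + w a) (ℤ.pos-* (3 ℕ.+ dbl a) (3 ℕ.+ dbl a)) ⟩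
  (+ 3 + + dbl a) * (+ 3 + + dbl a) * + w a              ≡⟨ cong (λ z → z * z * + w a) (trans (cong (λ z → + 3 + z) (+dbl a))
                                                            (solve 1 (λ a → con (+ 3) :+ con (+ 2) :* a := con (+ 2) :* (con (+ 1) :+ a) :+ con (+ 1)) refl (+ a))) ⟩
  (+ 2 * + suc a + + 1) * (+ 2 * + suc a + + 1) * + w a  ∎

-- The denominator i + j is cleared to stay among the integers. Every cutoff `m` beyond both indices
-- is allowed, which makes the statement symmetric in form.
ClosedForm : ℕ → ℕ → Set
ClosedForm a b = ∀ {m} → a ℕ.< m → b ℕ.< m →
  (+ suc a + + suc b) * ΣF a b m ≡ + w a * + w b * p2 (3 ℕ.+ dbl (a ℕ.+ b)) * Bin (2 ℕ.+ (a ℕ.+ b)) (+ 2 * + suc b - + suc a)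

ClosedForm-base : ClosedForm 0 0
ClosedForm-base {suc m} _ _ = cong (+ 2 *_) (only m)
  where
  only : ∀ m → ΣF 0 0 (suc m) ≡ + 8
  only zero    = refl
  only (suc m) = cong₂ _+_ (only m) (trans
    (cong (λ z → + 2 * (+ 1 + + suc m) * (z * Q 0 (+ 2 * (+ 1 + + suc m)) * T 0 (+ suc m))) (Bin-below 2 {0} {suc m} (s≤s z≤n)))
    (solve 2 (λ k t → k :* (con (+ 0) :* t) := con (+ 0)) refl (+ 2 * (+ 1 + + suc m)) (T 0 (+ suc m))))

-- The assumption `b ≤ suc a` keeps both factors 2i - j + 1 and 2i - j + 2 of the leading
-- coefficient positive, so the recurrence can be solved for the next sum.
ClosedForm-step : ∀ a b → b ℕ.≤ suc a → ClosedForm a b → ClosedForm (suc a) b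
ClosedForm-step a b b≤1+a IH {m} 1+a<m b<m = ℤ.*-cancelˡ-≡ (p′ * p″) _ _ {{nz}} (begin
  (p′ * p″) * ((+ suc (suc a) + j) * ΣF (suc a) b m)
    ≡⟨ solve 4 (λ p q s x → (p :* q) :* (s :* x) := s :* (p :* q :* x)) refl p′ p″ (+ suc (suc a) + j) (ΣF (suc a) b m) ⟩
  (+ suc (suc a) + j) * (p′ * p″ * ΣF (suc a) b m)
    ≡⟨ cong ((+ suc (suc a) + j) *_) (ΣF-step a b b<m) ⟩
  (+ suc (suc a) + j) * (+ 4 * (c * c) * (i + j) * q * ΣF a b m)
    ≡⟨ solve 5 (λ s k n q x → s :* (con (+ 4) :* k :* n :* q :* x) := s :* con (+ 4) :* k :* q :* (n :* x)) refl
         (+ suc (suc a) + j) (c * c) (i + j) q (ΣF a b m) ⟩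
  (+ suc (suc a) + j) * + 4 * (c * c) * q * ((i + j) * ΣF a b m)
    ≡⟨ cong ((+ suc (suc a) + j) * + 4 * (c * c) * q *_) (IH (ℕ.<-trans ℕ.≤-refl 1+a<m) b<m) ⟩
  (+ suc (suc a) + j) * + 4 * (c * c) * q * (+ w a * + w b * P * B₀)
    ≡⟨ solve 7 (λ s k q x y P B → s :* con (+ 4) :* k :* q :* (x :* y :* P :* B) := k :* x :* y :* (con (+ 4) :* P) :* (s :* (q :* B))) refl
         (+ suc (suc a) + j) (c * c) q (+ w a) (+ w b) P B₀ ⟩
  c * c * + w a * + w b * (+ 4 * P) * ((+ suc (suc a) + j) * (q * B₀))
    ≡⟨ cong (c * c * + w a * + w b * (+ 4 * P) *_) binomials ⟨
  c * c * + w a * + w b * (+ 4 * P) * (p′ * p″ * B₁)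
    ≡⟨ solve 6 (λ x y P p r B → x :* y :* P :* (p :* r :* B) := (p :* r) :* (x :* y :* P :* B)) refl
         (c * c * + w a) (+ w b) (+ 4 * P) p′ p″ B₁ ⟩
  (p′ * p″) * (c * c * + w a * + w b * (+ 4 * P) * B₁)
    ≡⟨ cong₂ (λ x y → (p′ * p″) * (x * + w b * y * B₁)) (+w-suc a) p2-step ⟨
  (p′ * p″) * (+ w (suc a) * + w b * p2 (3 ℕ.+ dbl (suc a ℕ.+ b)) * B₁) ∎)
  where
  i = + suc a
  j = + suc b
  c = + 2 * i + + 1
  q = + 2 * j - i
  p′ = + 2 * i - j + + 1
  p″ = + 2 * i - j + + 2
  P = p2 (3 ℕ.+ dbl (a ℕ.+ b))
  N = 2 ℕ.+ (a ℕ.+ b)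
  B₀ = Bin N q
  B₁ = Bin (suc N) (+ 2 * j - + suc (suc a))
  r = suc a ℕ.∸ b
  b+r : + b + + r ≡ + suc a
  b+r = cong +_ (ℕ.m+[n∸m]≡n b≤1+a)
  p′-pos : p′ ≡ + suc (a ℕ.+ r)
  p′-pos = begin
    + 2 * i - + suc b + + 1       ≡⟨ solve 2 (λ a b → con (+ 2) :* (con (+ 1) :+ a) :- (con (+ 1) :+ b) :+ con (+ 1) := con (+ 1) :+ a :+ ((con (+ 1) :+ a) :- b)) refl (+ a) (+ b) ⟩
    + 1 + + a + (+ suc a - + b)   ≡⟨ cong (λ z → + 1 + + a + (z - + b)) b+r ⟨
    + 1 + + a + (+ b + + r - + b) ≡⟨ cong (λ z → + 1 + + a + z) (solve 2 (λ b r → b :+ r :- b := r) refl (+ b) (+ r)) ⟩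
    + suc (a ℕ.+ r)               ∎
  p″-pos : p″ ≡ + suc (suc (a ℕ.+ r))
  p″-pos = trans (solve 1 (λ x → x :+ con (+ 2) := con (+ 1) :+ (x :+ con (+ 1))) refl (+ 2 * i - j)) (cong (λ z → + 1 + z) p′-pos)
  nz : ℤ.NonZero (p′ * p″)
  nz = subst₂ (λ x y → ℤ.NonZero (x * y)) (sym p′-pos) (sym p″-pos) _
  p2-step : p2 (3 ℕ.+ dbl (suc a ℕ.+ b)) ≡ + 4 * P
  p2-step = trans (p2-suc (4 ℕ.+ dbl (a ℕ.+ b))) (trans (cong (+ 2 *_) (p2-suc (3 ℕ.+ dbl (a ℕ.+ b))))
    (solve 1 (λ P → con (+ 2) :* (con (+ 2) :* P) := con (+ 4) :* P) refl P))
  +N : + suc N ≡ + suc (suc a) + j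
  +N = cong (+_ ∘ suc ∘ suc) (sym (ℕ.+-suc a b))
  binomials : p′ * p″ * B₁ ≡ (+ suc (suc a) + j) * (q * B₀)
  binomials = begin
    p′ * p″ * B₁
      ≡⟨ ℤ.*-assoc p′ p″ B₁ ⟩
    p′ * (p″ * B₁)
      ≡⟨ cong₂ (λ x y → p′ * (x * Bin (suc N) y))
           (trans (solve 2 (λ a b → con (+ 2) :* (con (+ 1) :+ a) :- (con (+ 1) :+ b) :+ con (+ 2) := (con (+ 2) :+ a) :+ (con (+ 1) :+ b) :- (con (+ 2) :* (con (+ 1) :+ b) :- (con (+ 1) :+ a) :- con (+ 1))) refl (+ a) (+ b))
             (cong (_- (q - + 1)) (sym +N)))
           (solve 2 (λ a b → con (+ 2) :* (con (+ 1) :+ b) :- (con (+ 2) :+ a) := con (+ 2) :* (con (+ 1) :+ b) :- (con (+ 1) :+ a) :- con (+ 1)) refl (+ a) (+ b)) ⟩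
    p′ * ((+ suc N - (q - + 1)) * Bin (suc N) (q - + 1))
      ≡⟨ cong (p′ *_) (Bin-absorbʳ N (q - + 1)) ⟩
    p′ * (+ suc N * Bin N (q - + 1))
      ≡⟨ solve 3 (λ p s B → p :* (s :* B) := s :* (p :* B)) refl p′ (+ suc N) (Bin N (q - + 1)) ⟩
    + suc N * (p′ * Bin N (q - + 1))
      ≡⟨ cong (λ z → + suc N * (z * Bin N (q - + 1))) (trans
           (solve 2 (λ a b → con (+ 2) :* (con (+ 1) :+ a) :- (con (+ 1) :+ b) :+ con (+ 1) := (con (+ 2) :+ a) :+ (con (+ 1) :+ b) :- (con (+ 2) :* (con (+ 1) :+ b) :- (con (+ 1) :+ a))) refl (+ a) (+ b))
           (cong (_- q) (sym +N))) ⟩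
    + suc N * ((+ suc N - q) * Bin N (q - + 1))
      ≡⟨ cong (+ suc N *_) (Bin-ratio N q) ⟨
    + suc N * (q * B₀)
      ≡⟨ cong (_* (q * B₀)) +N ⟩
    (+ suc (suc a) + j) * (q * B₀) ∎

-- `F` is symmetric in its two indices, and so is the right side because (i + j) - (2j - i) = 2i -
-- j.
ClosedForm-sym : ∀ a b → ClosedForm a b → ClosedForm b a
ClosedForm-sym a b IH {m} b<m a<m = begin
  (+ suc b + + suc a) * ΣF b a m
    ≡⟨ cong₂ _*_ (ℤ.+-comm (+ suc b) (+ suc a)) (Σ<-cong m λ c _ → cong (+ 2 * (+ 1 + + c) *_) (ℤ.*-comm (T b (+ c)) (T a (+ c)))) ⟩
  (+ suc a + + suc b) * ΣF a b m
    ≡⟨ IH a<m b<m ⟩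
  + w a * + w b * p2 (3 ℕ.+ dbl (a ℕ.+ b)) * Bin (2 ℕ.+ (a ℕ.+ b)) (+ 2 * + suc b - + suc a)
    ≡⟨ cong (+ w a * + w b * p2 (3 ℕ.+ dbl (a ℕ.+ b)) *_) (trans (Bin-sym (2 ℕ.+ (a ℕ.+ b)) (+ 2 * + suc b - + suc a))
         (cong (Bin (2 ℕ.+ (a ℕ.+ b)))
           (solve 2 (λ a b → con (+ 2) :+ (a :+ b) :- (con (+ 2) :* (con (+ 1) :+ b) :- (con (+ 1) :+ a)) := con (+ 2) :* (con (+ 1) :+ a) :- (con (+ 1) :+ b)) refl (+ a) (+ b)))) ⟩
  + w a * + w b * p2 (3 ℕ.+ dbl (a ℕ.+ b)) * Bin (2 ℕ.+ (a ℕ.+ b)) (+ 2 * + suc a - + suc b)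
    ≡⟨ cong₂ (λ x n → x * p2 (3 ℕ.+ dbl n) * Bin (2 ℕ.+ n) (+ 2 * + suc a - + suc b)) (ℤ.*-comm (+ w a) (+ w b)) (ℕ.+-comm a b) ⟩
  + w b * + w a * p2 (3 ℕ.+ dbl (b ℕ.+ a)) * Bin (2 ℕ.+ (b ℕ.+ a)) (+ 2 * + suc a - + suc b) ∎

closedForm-≤ : ∀ a b → b ℕ.≤ a → ClosedForm a b
closedForm-≤ zero    zero z≤n  = ClosedForm-base
closedForm-≤ (suc a) b b≤1+a with ℕ.m≤n⇒m<n∨m≡n b≤1+a
... | inj₁ b<1+a = ClosedForm-step a b b≤1+a (closedForm-≤ a b (ℕ.s≤s⁻¹ b<1+a))
-- The diagonal is climbed by (a , a), (a + 1 , a), (a , a + 1), (a + 1 , a + 1), where the middle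
-- move is the symmetry; each of the other two respects the bound of `ClosedForm-step`.
... | inj₂ refl  = ClosedForm-step a (suc a) ℕ.≤-refl (ClosedForm-sym (suc a) a (ClosedForm-step a a (ℕ.n≤1+n a) (closedForm-≤ a a ℕ.≤-refl)))

closedForm : ∀ a b → ClosedForm a b
closedForm a b with ℕ.≤-total b a
... | inj₁ b≤a = closedForm-≤ a b b≤a
... | inj₂ a≤b = ClosedForm-sym b a (closedForm-≤ b a a≤b)

-- Closed form of the coefficients of U(gʲ)

shift : (ℕ → ℤ) → ℕ → ℤ
shift h zero    = + 0
shift h (suc i) = h i

-- col j lists the coefficients of U(gʲ) as a polynomial in g.
col : ℕ → ℕ → ℤ
col zero          zero                = + 1
col zero          (suc i)             = + 0
col (suc zero)    (suc zero)          = + 24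
col (suc zero)    (suc (suc zero))    = + 32
col (suc zero)    _                   = + 0
col (suc (suc j)) i = shift (λ i → + 48 * col (suc j) i + + 64 * (shift (col (suc j)) i + col j i)) i

private
  -- With n + 1 = i + j and k = 2j - i this is 3j/(i+j) · C(i+j, k), written without division. As a
  -- sum of two binomial coefficients it inherits Pascal's recurrence.
  G : ℕ → ℤ → ℤ
  G n k = Bin (suc n) k + Bin n (k - + 1)

  G-suc : ∀ n k → G (suc n) k ≡ G n k + G n (k - + 1)
  G-suc n k = solve 4 (λ a b c d → (a :+ b) :+ (c :+ d) := (a :+ c) :+ (b :+ d)) refl
    (Bin (suc n) k) (Bin (suc n) (k - + 1)) (Bin n (k - + 1)) (Bin n (k - + 1 - + 1))

  G-negative : ∀ n {k l} → k ℕ.< l → G n (+ k - + l) ≡ + 0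
  G-negative n {k} {l} k<l = cong₂ _+_ (Bin-below (suc n) k<l)
    (trans (cong (Bin n) (solve 2 (λ k l → k :- l :- con (+ 1) := k :- (con (+ 1) :+ l)) refl (+ k) (+ l))) (Bin-below n (ℕ.m<n⇒m<1+n k<l)))

  G-large : ∀ n {k} → suc n ℕ.< k → G n (+ k) ≡ + 0
  G-large n lt with ℕ.m≤n⇒∃[o]m+o≡n lt
  ... | k , refl = cong₂ _+_ (Bin-large (suc n) k) (Bin-large n k)

  -- 1 = (X + Y)³ = X³ + Y³ + 3XY on solutions of Pascal's recurrence.
  G-cubed : ∀ n k → G (3 ℕ.+ n) k ≡ + 3 * G (suc n) (k - + 1) + (G n k + G n (k - + 3))
  G-cubed n k = begin
    G (3 ℕ.+ n) k
      ≡⟨ trans (G-suc (2 ℕ.+ n) k) (cong₂ _+_ (G-suc (suc n) k) (G-suc (suc n) (k - + 1))) ⟩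
    (G (suc n) k + G (suc n) (k - + 1)) + (G (suc n) (k - + 1) + G (suc n) (k - + 1 - + 1))
      ≡⟨ cong₂ (λ x y → (x + G (suc n) (k - + 1)) + (G (suc n) (k - + 1) + y)) (G-suc n k) (G-suc n (k - + 1 - + 1)) ⟩
    ((G n k + G n (k - + 1)) + G (suc n) (k - + 1)) + (G (suc n) (k - + 1) + (G n (k - + 1 - + 1) + G n (k - + 1 - + 1 - + 1)))
      ≡⟨ solve 5 (λ a b c d e → ((a :+ b) :+ c) :+ (c :+ (d :+ e)) := con (+ 2) :* c :+ (b :+ d) :+ (a :+ e)) refl
           (G n k) (G n (k - + 1)) (G (suc n) (k - + 1)) (G n (k - + 1 - + 1)) (G n (k - + 1 - + 1 - + 1)) ⟩
    + 2 * G (suc n) (k - + 1) + (G n (k - + 1) + G n (k - + 1 - + 1)) + (G n k + G n (k - + 1 - + 1 - + 1))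
      ≡⟨ cong₂ (λ x y → + 2 * G (suc n) (k - + 1) + x + (G n k + G n y)) (sym (G-suc n (k - + 1)))
           (solve 1 (λ k → k :- con (+ 1) :- con (+ 1) :- con (+ 1) := k :- con (+ 3)) refl k) ⟩
    + 2 * G (suc n) (k - + 1) + G (suc n) (k - + 1) + (G n k + G n (k - + 3))
      ≡⟨ solve 2 (λ a b → con (+ 2) :* a :+ a :+ b := con (+ 3) :* a :+ b) refl (G (suc n) (k - + 1)) (G n k + G n (k - + 3)) ⟩
    + 3 * G (suc n) (k - + 1) + (G n k + G n (k - + 3)) ∎

  vanish : ∀ {x} y → x ≡ + 0 → + 0 ≡ y * x
  vanish y refl = sym (ℤ.*-zeroʳ y)

  decrement : ∀ {j i n} → j ℕ.+ suc i ≡ suc n → j ℕ.+ i ≡ n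
  decrement {j} {i} eq = ℕ.suc-injective (trans (sym (ℕ.+-suc j i)) eq)

  p2-double : ∀ n → p2 (3 ℕ.+ n) ≡ + 4 * p2 (suc n)
  p2-double n = trans (p2-suc (2 ℕ.+ n)) (trans (cong (+ 2 *_) (p2-suc (suc n)))
    (solve 1 (λ p → con (+ 2) :* (con (+ 2) :* p) := con (+ 4) :* p) refl (p2 (suc n))))

-- The recurrence of `col` is `G-cubed` weighted by powers of 4: its terms have i + j smaller by 2
-- and by 3, and 48 = 3 · 4², 64 = 4³. The other clauses treat the borders, where `G` vanishes or
-- both sides compute.
col-closed : ∀ j i n → j ℕ.+ i ≡ suc n →
             col j i ≡ p2 (suc (dbl n)) * (Bin (suc n) (+ 2 * + j - + i) + Bin n (+ 2 * + j - + i - + 1))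
col-closed zero (suc i) n eq = vanish (p2 (suc (dbl n))) (G-negative n (s≤s z≤n))
col-closed (suc zero) zero .0 refl = refl
col-closed (suc zero) (suc zero) .1 refl = refl
col-closed (suc zero) (suc (suc zero)) .2 refl = refl
col-closed (suc zero) (suc (suc (suc i))) n eq = vanish (p2 (suc (dbl n))) (G-negative n (s≤s (s≤s (s≤s z≤n))))
col-closed (suc (suc j)) zero n eq = vanish (p2 (suc (dbl n)))
  (trans (cong (G n) (trans (ℤ.+-identityʳ (+ 2 * + suc (suc j))) (sym (+dbl (suc (suc j))))))
    (G-large n (subst (ℕ._< dbl (2 ℕ.+ j)) (trans (sym (ℕ.+-identityʳ _)) eq) (big j))))
  where
  big : ∀ j → suc (suc j) ℕ.< dbl (2 ℕ.+ j)
  big zero    = s≤s (s≤s (s≤s z≤n))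
  big (suc j) = s≤s (ℕ.m≤n⇒m≤1+n (big j))
col-closed (suc (suc zero)) (suc zero) .2 refl = refl
col-closed (suc (suc (suc j))) (suc zero) n eq = trans boundary (vanish (p2 (suc (dbl n)))
  (trans (cong (G n) (cong (_- + 1) (sym (+dbl (3 ℕ.+ j)))))
    (G-large n (subst (λ k → k ℕ.< suc (dbl (2 ℕ.+ j))) (trans (sym (ℕ.+-comm _ 1)) eq) (big j)))))
  where
  col-zero : ∀ j → col (suc j) 0 ≡ + 0
  col-zero zero    = refl
  col-zero (suc j) = refl
  boundary : col (suc (suc (suc j))) 1 ≡ + 0
  boundary = cong₂ (λ x y → + 48 * x + + 64 * (+ 0 + y)) (col-zero (suc j)) (col-zero j)
  big : ∀ j → 4 ℕ.+ j ℕ.< suc (dbl (2 ℕ.+ j))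
  big zero    = ℕ.≤-refl
  big (suc j) = s≤s (ℕ.m≤n⇒m≤1+n (big j))
col-closed (suc (suc j)) (suc (suc i)) zero ()
col-closed (suc (suc j)) (suc (suc i)) (suc zero) eq = case trans (sym (ℕ.+-suc j (suc i))) (ℕ.suc-injective (ℕ.suc-injective eq)) of λ ()
col-closed (suc (suc j)) (suc (suc i)) (suc (suc zero)) eq =
  case trans (sym (trans (ℕ.+-suc j (suc i)) (cong suc (ℕ.+-suc j i)))) (ℕ.suc-injective (ℕ.suc-injective eq)) of λ ()
col-closed (suc (suc j)) (suc (suc i)) (suc (suc (suc n))) eq = begin
  + 48 * col (suc j) (suc i) + + 64 * (col (suc j) i + col j (suc i))
    ≡⟨ cong₂ (λ x y → + 48 * x + + 64 * y) (at {suc j} {suc i} {suc n} arg₁ (col-closed (suc j) (suc i) (suc n) e₁))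
         (cong₂ _+_ (at {suc j} {i} {n} arg₂ (col-closed (suc j) i n e₂)) (at {j} {suc i} {n} arg₃ (col-closed j (suc i) n e₃))) ⟩
  + 48 * (p2 (3 ℕ.+ dbl n) * G (suc n) (k - + 1)) + + 64 * (p2 (suc (dbl n)) * G n k + p2 (suc (dbl n)) * G n (k - + 3))
    ≡⟨ cong (λ z → + 48 * (z * G (suc n) (k - + 1)) + + 64 * (p2 (suc (dbl n)) * G n k + p2 (suc (dbl n)) * G n (k - + 3))) (p2-double (dbl n)) ⟩
  + 48 * (+ 4 * P * G (suc n) (k - + 1)) + + 64 * (P * G n k + P * G n (k - + 3))
    ≡⟨ solve 4 (λ P a b c → con (+ 48) :* (con (+ 4) :* P :* a) :+ con (+ 64) :* (P :* b :+ P :* c) :=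
         con (+ 4) :* (con (+ 4) :* (con (+ 4) :* P)) :* (con (+ 3) :* a :+ (b :+ c))) refl P (G (suc n) (k - + 1)) (G n k) (G n (k - + 3)) ⟩
  + 4 * (+ 4 * (+ 4 * P)) * (+ 3 * G (suc n) (k - + 1) + (G n k + G n (k - + 3)))
    ≡⟨ cong₂ _*_ p2-sextuple (G-cubed n k) ⟨
  p2 (suc (dbl (3 ℕ.+ n))) * G (3 ℕ.+ n) k ∎
  where
  k = + 2 * + suc (suc j) - + suc (suc i)
  P = p2 (suc (dbl n))
  e₁ : suc j ℕ.+ suc i ≡ suc (suc n)
  e₁ = trans (sym (ℕ.+-suc j (suc i))) (ℕ.suc-injective (ℕ.suc-injective eq))
  e₂ : suc j ℕ.+ i ≡ suc n
  e₂ = decrement {suc j} {i} e₁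
  e₃ : j ℕ.+ suc i ≡ suc n
  e₃ = trans (ℕ.+-suc j i) e₂
  arg₁ : + 2 * + suc j - + suc i ≡ k - + 1
  arg₁ = solve 2 (λ i j → con (+ 2) :* (con (+ 1) :+ j) :- (con (+ 1) :+ i) := con (+ 2) :* (con (+ 2) :+ j) :- (con (+ 2) :+ i) :- con (+ 1)) refl (+ i) (+ j)
  arg₂ : + 2 * + suc j - + i ≡ k
  arg₂ = solve 2 (λ i j → con (+ 2) :* (con (+ 1) :+ j) :- i := con (+ 2) :* (con (+ 2) :+ j) :- (con (+ 2) :+ i)) refl (+ i) (+ j)
  arg₃ : + 2 * + j - + suc i ≡ k - + 3
  arg₃ = solve 2 (λ i j → con (+ 2) :* j :- (con (+ 1) :+ i) := con (+ 2) :* (con (+ 2) :+ j) :- (con (+ 2) :+ i) :- con (+ 3)) refl (+ i) (+ j)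
  at : ∀ {j i n k} → + 2 * + j - + i ≡ k → col j i ≡ p2 (suc (dbl n)) * G n (+ 2 * + j - + i) → col j i ≡ p2 (suc (dbl n)) * G n k
  at refl eq = eq
  p2-sextuple : p2 (suc (dbl (3 ℕ.+ n))) ≡ + 4 * (+ 4 * (+ 4 * P))
  p2-sextuple = trans (p2-double (4 ℕ.+ dbl n)) (cong (+ 4 *_) (trans (p2-double (2 ℕ.+ dbl n)) (cong (+ 4 *_) (p2-double (dbl n)))))

col-ΣF : ∀ a b {m} → a ℕ.< m → b ℕ.< m → + (w a ℕ.* w b) * col (suc b) (suc a) ≡ + 3 * + suc b * ΣF a b m
col-ΣF a b {m} a<m b<m = ℤ.*-cancelˡ-≡ (+ suc a + + suc b) _ _ (begin
  n * (+ (w a ℕ.* w b) * col (suc b) (suc a))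
    ≡⟨ cong₂ (λ x y → n * (x * y)) (ℤ.pos-* (w a) (w b))
         (col-closed (suc b) (suc a) (suc (a ℕ.+ b)) (cong suc (ℕ.+-comm b (suc a)))) ⟩
  n * (+ w a * + w b * (P * (B + Bin (suc (a ℕ.+ b)) (k - + 1))))
    ≡⟨ solve 6 (λ n x y P B B′ → n :* (x :* y :* (P :* (B :+ B′))) := x :* y :* P :* (n :* B :+ n :* B′)) refl
         n (+ w a) (+ w b) P B (Bin (suc (a ℕ.+ b)) (k - + 1)) ⟩
  + w a * + w b * P * (n * B + n * Bin (suc (a ℕ.+ b)) (k - + 1))
    -- Absorption replaces (i + j) C(i+j-1, k-1) by k C(i+j, k); afterwards i + j + k = 3j because k
    -- = 2j - i.
    ≡⟨ cong (λ z → + w a * + w b * P * (n * B + z)) (trans (cong (_* Bin (suc (a ℕ.+ b)) (k - + 1)) (cong (+_ ∘ suc) (ℕ.+-suc a b)))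
         (sym (Bin-absorb (suc (a ℕ.+ b)) k))) ⟩
  + w a * + w b * P * (n * B + k * B)
    ≡⟨ solve 6 (λ a b x y P B → x :* y :* P :* (((con (+ 1) :+ a) :+ (con (+ 1) :+ b)) :* B :+ (con (+ 2) :* (con (+ 1) :+ b) :- (con (+ 1) :+ a)) :* B) :=
         con (+ 3) :* (con (+ 1) :+ b) :* (x :* y :* P :* B)) refl (+ a) (+ b) (+ w a) (+ w b) P B ⟩
  + 3 * + suc b * (+ w a * + w b * P * B)
    ≡⟨ cong (+ 3 * + suc b *_) (closedForm a b a<m b<m) ⟨
  + 3 * + suc b * (n * ΣF a b m)
    ≡⟨ solve 3 (λ u n s → u :* (n :* s) := n :* (u :* s)) refl (+ 3 * + suc b) n (ΣF a b m) ⟩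
  n * (+ 3 * + suc b * ΣF a b m) ∎)
  where
  n = + suc a + + suc b
  k = + 2 * + suc b - + suc a
  P = p2 (3 ℕ.+ dbl (a ℕ.+ b))
  B = Bin (2 ℕ.+ (a ℕ.+ b)) k

-- The factors x, d and y for U

-- With t = c + 1 this is (3t)! / (3 t!).
κ : ℕ → ℕ
κ zero    = 2
κ (suc c) = 3 ℕ.* ((1 ℕ.+ 3 ℕ.* suc c) ℕ.* (2 ℕ.+ 3 ℕ.* suc c)) ℕ.* κ c

private
  module ℕS = ℕ-Solver.+-*-Solver

-- One of two consecutive integers is even. Keeping this factor 2 apart from the remaining 2ᵉ shows
-- that the exponent of `κ` grows at every step, whence `exponent-mono`.
κ-ν-step : ∀ c → ∃[ e ] ∃[ h ] (1 ℕ.+ 3 ℕ.* suc c) ℕ.* (2 ℕ.+ 3 ℕ.* suc c) ≡ 2 ℕ.* (2 ℕ.^ e ℕ.* (1 ℕ.+ 2 ℕ.* h))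

κ-ν-step c = split-half (half-product (suc c))
  where
  split-half : ∃[ t ] (1 ℕ.+ 3 ℕ.* suc c) ℕ.* (2 ℕ.+ 3 ℕ.* suc c) ≡ 2 ℕ.* t →
               ∃[ e ] ∃[ h ] (1 ℕ.+ 3 ℕ.* suc c) ℕ.* (2 ℕ.+ 3 ℕ.* suc c) ≡ 2 ℕ.* (2 ℕ.^ e ℕ.* (1 ℕ.+ 2 ℕ.* h))
  split-half (suc t , eq) = let (e , h , eq′) = oddPart (suc t) (suc t) ℕ.≤-refl in e , h , trans eq (cong (2 ℕ.*_) eq′)

κ-ν : ∀ c → ∃[ k ] ∃[ o ] Odd o × κ c ≡ 2 ℕ.^ k ℕ.* o
κ-ν zero    = 1 , 1 , (0 , refl) , refl
κ-ν (suc c) = suc (e ℕ.+ k) , 3 ℕ.* (1 ℕ.+ 2 ℕ.* h) ℕ.* o , Odd-* (Odd-* {3} (1 , refl) (h , refl)) (proj₁ (proj₂ (proj₂ (κ-ν c)))) , (begin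
    3 ℕ.* ((1 ℕ.+ 3 ℕ.* suc c) ℕ.* (2 ℕ.+ 3 ℕ.* suc c)) ℕ.* κ c
      ≡⟨ cong₂ (λ x y → 3 ℕ.* x ℕ.* y) (proj₂ (proj₂ (κ-ν-step c))) (proj₂ (proj₂ (proj₂ (κ-ν c)))) ⟩
    3 ℕ.* (2 ℕ.* (2 ℕ.^ e ℕ.* (1 ℕ.+ 2 ℕ.* h))) ℕ.* (2 ℕ.^ k ℕ.* o)
      ≡⟨ ℕS.solve 4 (λ p o′ q o → ℕS.con 3 ℕS.:* (ℕS.con 2 ℕS.:* (p ℕS.:* o′)) ℕS.:* (q ℕS.:* o) ℕS.:=
           (ℕS.con 2 ℕS.:* (p ℕS.:* q)) ℕS.:* (ℕS.con 3 ℕS.:* o′ ℕS.:* o)) refl (2 ℕ.^ e) (1 ℕ.+ 2 ℕ.* h) (2 ℕ.^ k) o ⟩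
    (2 ℕ.* (2 ℕ.^ e ℕ.* 2 ℕ.^ k)) ℕ.* (3 ℕ.* (1 ℕ.+ 2 ℕ.* h) ℕ.* o)
      ≡⟨ cong (λ z → 2 ℕ.* z ℕ.* (3 ℕ.* (1 ℕ.+ 2 ℕ.* h) ℕ.* o)) (ℕ.^-distribˡ-+-* 2 e k) ⟨
    2 ℕ.^ suc (e ℕ.+ k) ℕ.* (3 ℕ.* (1 ℕ.+ 2 ℕ.* h) ℕ.* o) ∎)
  where
  e = proj₁ (κ-ν-step c)
  h = proj₁ (proj₂ (κ-ν-step c))
  k = proj₁ (κ-ν c)
  o = proj₁ (proj₂ (κ-ν c))

-- With t = c + 1 this is 2 (3t)!² / (3 t!²), the entry dₜₜ multiplied by wₜ². The factor 6 accounts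
-- for the 1 in `exponent`.
diagonalEntry : ℕ → ℕ
diagonalEntry c = 6 ℕ.* (κ c ℕ.* κ c)

exponent : ℕ → ℕ
exponent c = suc (proj₁ (κ-ν c) ℕ.+ proj₁ (κ-ν c))

exponent-mono : ∀ c → exponent c ℕ.< exponent (suc c)
exponent-mono c = s≤s (ℕ.+-mono-< k<k′ k<k′)
  where
  k<k′ : proj₁ (κ-ν c) ℕ.< proj₁ (κ-ν (suc c))
  k<k′ = s≤s (ℕ.m≤n+m (proj₁ (κ-ν c)) (proj₁ (κ-ν-step c)))

diagonalEntry-ν : ∀ c → ∃[ h ] + diagonalEntry c ≡ (+ 1 + + 2 * h) * p2 (exponent c)
diagonalEntry-ν c = + h , (begin
  + (6 ℕ.* (κ c ℕ.* κ c))
    ≡⟨ cong (λ x → + (6 ℕ.* (x ℕ.* x))) (proj₂ (proj₂ (proj₂ (κ-ν c)))) ⟩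
  + (6 ℕ.* (2 ℕ.^ k ℕ.* o ℕ.* (2 ℕ.^ k ℕ.* o)))
    ≡⟨ cong +_ (ℕS.solve 2 (λ p o → ℕS.con 6 ℕS.:* (p ℕS.:* o ℕS.:* (p ℕS.:* o)) ℕS.:= ℕS.con 3 ℕS.:* (o ℕS.:* o) ℕS.:* (ℕS.con 2 ℕS.:* (p ℕS.:* p))) refl (2 ℕ.^ k) o) ⟩
  + (3 ℕ.* (o ℕ.* o) ℕ.* (2 ℕ.* (2 ℕ.^ k ℕ.* 2 ℕ.^ k)))
    ≡⟨ cong₂ (λ x y → + (x ℕ.* (2 ℕ.* y))) (proj₂ odd³) (sym (ℕ.^-distribˡ-+-* 2 k k)) ⟩
  + ((1 ℕ.+ 2 ℕ.* h) ℕ.* 2 ℕ.^ suc (k ℕ.+ k))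
    ≡⟨ ℤ.pos-* (1 ℕ.+ 2 ℕ.* h) (2 ℕ.^ suc (k ℕ.+ k)) ⟩
  + (1 ℕ.+ 2 ℕ.* h) * p2 (suc (k ℕ.+ k))
    ≡⟨ cong (λ z → (+ 1 + z) * p2 (suc (k ℕ.+ k))) (ℤ.pos-* 2 h) ⟩
  (+ 1 + + 2 * + h) * p2 (suc (k ℕ.+ k)) ∎)
  where
  k = proj₁ (κ-ν c)
  o = proj₁ (proj₂ (κ-ν c))
  odd-o = proj₁ (proj₂ (proj₂ (κ-ν c)))
  odd³ : Odd (3 ℕ.* (o ℕ.* o))
  odd³ = Odd-* {3} (1 , refl) (Odd-* odd-o odd-o)
  h = proj₁ odd³

-- Since c = t - 1, the product Q c (2t) runs from t + 1 to 3t - 1, so t times it is (3t - 1)! / (t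
-- - 1)!.
Q-κ : ∀ c → + suc c * Q c (+ 2 * + suc c) ≡ + κ c
Q-κ zero    = refl
Q-κ (suc c) = begin
  + suc (suc c) * Q (suc c) (+ 2 * + suc (suc c))
    ≡⟨ cong (λ x → + suc (suc c) * Q (suc c) x) (solve 1 (λ t → con (+ 2) :* (con (+ 1) :+ t) := con (+ 2) :* t :+ con (+ 1) :+ con (+ 1)) refl t) ⟩
  + suc (suc c) * Q (suc c) (x + + 1)
    ≡⟨ cong (+ suc (suc c) *_) (Q-up c x) ⟩
  + suc (suc c) * (Q c x * ((x + + suc c + + 1) * (x + + suc c)))
    ≡⟨ solve 3 (λ c q y → (con (+ 2) :+ c) :* (q :* y) := q :* (con (+ 2) :* (con (+ 1) :+ c) :- c) :* y) refl (+ c) (Q c x) ((x + + suc c + + 1) * (x + + suc c)) ⟩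
  Q c x * (+ 2 * t - + c) * ((x + + suc c + + 1) * (x + + suc c))
    ≡⟨ cong (_* ((x + + suc c + + 1) * (x + + suc c))) (Q-shift c (+ 2 * t)) ⟩
  Q c (+ 2 * t) * (+ 2 * t + t) * ((x + + suc c + + 1) * (x + + suc c))
    ≡⟨ solve 2 (λ q t → q :* (con (+ 2) :* t :+ t) :* ((con (+ 2) :* t :+ con (+ 1) :+ t :+ con (+ 1)) :* (con (+ 2) :* t :+ con (+ 1) :+ t)) :=
         con (+ 3) :* ((con (+ 1) :+ con (+ 3) :* t) :* (con (+ 2) :+ con (+ 3) :* t)) :* (t :* q)) refl (Q c (+ 2 * t)) t ⟩
  + 3 * ((+ 1 + + 3 * t) * (+ 2 + + 3 * t)) * (t * Q c (+ 2 * t))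
    ≡⟨ cong₂ (λ u v → + 3 * ((+ 1 + u) * (+ 2 + u)) * v) (sym (ℤ.pos-* 3 (suc c))) (Q-κ c) ⟩
  + 3 * (+ (1 ℕ.+ 3 ℕ.* suc c) * + (2 ℕ.+ 3 ℕ.* suc c)) * + κ c
    ≡⟨ cong (λ z → + 3 * z * + κ c) (ℤ.pos-* (1 ℕ.+ 3 ℕ.* suc c) (2 ℕ.+ 3 ℕ.* suc c)) ⟨
  + 3 * + ((1 ℕ.+ 3 ℕ.* suc c) ℕ.* (2 ℕ.+ 3 ℕ.* suc c)) * + κ c
    ≡⟨ cong (_* + κ c) (ℤ.pos-* 3 ((1 ℕ.+ 3 ℕ.* suc c) ℕ.* (2 ℕ.+ 3 ℕ.* suc c))) ⟨
  + (3 ℕ.* ((1 ℕ.+ 3 ℕ.* suc c) ℕ.* (2 ℕ.+ 3 ℕ.* suc c))) * + κ c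
    ≡⟨ ℤ.pos-* (3 ℕ.* ((1 ℕ.+ 3 ℕ.* suc c) ℕ.* (2 ℕ.+ 3 ℕ.* suc c))) (κ c) ⟨
  + κ (suc c) ∎
  where
  t = + suc c
  x = + 2 * t + + 1

-- φ k t = t (t - 1) ⋯ (t - k + 1) · 3t (3t + 1) ⋯ (3t + k - 1) and ψ k t = φ (k + 1) t / t.
φ ψ : ℕ → ℤ → ℤ
φ zero    t = + 1
φ (suc k) t = φ k t * ((t - + k) * (+ 3 * t + + k))
ψ zero    t = + 3 * t
ψ (suc k) t = ψ k t * ((t - + suc k) * (+ 3 * t + + suc k))

-- Widening the window of `Q` adds the factors (2t)² - (t + k)² = (t - k) (3t + k), because c + 1 =
-- t.
Q-φ : ∀ k c → + suc c * Q (k ℕ.+ c) (+ 2 * + suc c) ≡ + κ c * φ k (+ suc c)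
Q-φ zero    c = trans (Q-κ c) (sym (ℤ.*-identityʳ (+ κ c)))
Q-φ (suc k) c = begin
  t * (Q (k ℕ.+ c) (+ 2 * t) * (+ 2 * t * (+ 2 * t) - + suc (k ℕ.+ c) * + suc (k ℕ.+ c)))
    ≡⟨ solve 3 (λ q c k → let t = con (+ 1) :+ c in t :* (q :* (con (+ 2) :* t :* (con (+ 2) :* t) :- (con (+ 1) :+ (k :+ c)) :* (con (+ 1) :+ (k :+ c)))) :=
         (t :* q) :* ((t :- k) :* (con (+ 3) :* t :+ k))) refl (Q (k ℕ.+ c) (+ 2 * t)) (+ c) (+ k) ⟩
  (t * Q (k ℕ.+ c) (+ 2 * t)) * ((t - + k) * (+ 3 * t + + k))
    ≡⟨ cong (_* ((t - + k) * (+ 3 * t + + k))) (Q-φ k c) ⟩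
  + κ c * φ k t * ((t - + k) * (+ 3 * t + + k))
    ≡⟨ ℤ.*-assoc (+ κ c) (φ k t) _ ⟩
  + κ c * φ (suc k) t ∎
  where t = + suc c

-- The first added factor (2t)² - t² = t · 3t supplies the t that `Q-κ` requires, which is why `ψ`
-- is `φ` with one t removed.
Q-ψ : ∀ k c → Q (suc k ℕ.+ c) (+ 2 * + suc c) ≡ + κ c * ψ k (+ suc c)
Q-ψ zero c = begin
  Q c (+ 2 * t) * (+ 2 * t * (+ 2 * t) - t * t)
    ≡⟨ solve 2 (λ q t → q :* (con (+ 2) :* t :* (con (+ 2) :* t) :- t :* t) := (t :* q) :* (con (+ 3) :* t)) refl (Q c (+ 2 * t)) t ⟩
  t * Q c (+ 2 * t) * (+ 3 * t)
    ≡⟨ cong (_* (+ 3 * t)) (Q-κ c) ⟩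
  + κ c * (+ 3 * t) ∎
  where t = + suc c
Q-ψ (suc k) c = begin
  Q (suc k ℕ.+ c) (+ 2 * t) * (+ 2 * t * (+ 2 * t) - + suc (suc k ℕ.+ c) * + suc (suc k ℕ.+ c))
    ≡⟨ cong₂ _*_ (Q-ψ k c) (solve 2 (λ c k → let t = con (+ 1) :+ c ; s = con (+ 1) :+ k in
         con (+ 2) :* t :* (con (+ 2) :* t) :- (con (+ 1) :+ (s :+ c)) :* (con (+ 1) :+ (s :+ c)) := (t :- s) :* (con (+ 3) :* t :+ s)) refl (+ c) (+ k)) ⟩
  + κ c * ψ k t * ((t - + suc k) * (+ 3 * t + + suc k))
    ≡⟨ ℤ.*-assoc (+ κ c) (ψ k t) _ ⟩
  + κ c * ψ (suc k) t ∎
  where t = + suc c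

n[n+1]-even : ∀ c → + 2 ∣ + suc c * + c
n[n+1]-even zero    = divides (+ 0) refl
n[n+1]-even (suc c) = subst (+ 2 ∣_)
  (solve 1 (λ c → (con (+ 1) :+ c) :* c :+ (con (+ 1) :+ c) :* con (+ 2) := (con (+ 2) :+ c) :* (con (+ 1) :+ c)) refl (+ c))
  (ℤ∣.∣m∣n⇒∣m+n (n[n+1]-even c) (divides (+ suc c) refl))

φ-even : ∀ k c → + 2 ∣ φ (2 ℕ.+ k) (+ suc c)
φ-even zero c = subst (+ 2 ∣_)
  (solve 1 (λ c → let t = con (+ 1) :+ c in t :* c :* ((con (+ 3) :* t) :* (con (+ 3) :* t :+ con (+ 1))) :=
     con (+ 1) :* ((t :- con (+ 0)) :* (con (+ 3) :* t :+ con (+ 0))) :* ((t :- con (+ 1)) :* (con (+ 3) :* t :+ con (+ 1)))) refl (+ c))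
  (ℤ∣.∣m⇒∣m*n ((+ 3 * + suc c) * (+ 3 * + suc c + + 1)) (n[n+1]-even c))
φ-even (suc k) c = ℤ∣.∣m⇒∣m*n ((+ suc c - + (2 ℕ.+ k)) * (+ 3 * + suc c + + (2 ℕ.+ k))) (φ-even k c)

-- The quotient j φ k t / t for j = b + 1, t = c + 1 and b = k + c. At k = 0 one has j = t, and the
-- quotient is 1.
ψ′ : ℕ → ℕ → ℕ → ℤ
ψ′ zero    c b = + 1
ψ′ (suc k) c b = + suc b * ψ k (+ suc c)

xᵤ yᵤ : ℕ → ℕ → ℤ
xᵤ a c = Bin (dbl (suc a)) (+ a - + c) * φ (a ℕ.∸ c) (+ suc c)
yᵤ c b = Bin (dbl (suc b)) (+ b - + c) * ψ′ (b ℕ.∸ c) c b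

T-x : ∀ a c → + suc c * T a (+ c) ≡ + κ c * xᵤ a c
T-x a c with ℕ.<-≤-connex a c
... | inj₁ a<c = begin
  + suc c * (Bin (dbl (suc a)) (+ a - + c) * q)  ≡⟨ cong (λ z → + suc c * (z * q)) (Bin-below (dbl (suc a)) a<c) ⟩
  + suc c * (+ 0 * q)                            ≡⟨ solve 4 (λ k q u p → k :* (con (+ 0) :* q) := u :* (con (+ 0) :* p)) refl (+ suc c) q (+ κ c) p ⟩
  + κ c * (+ 0 * p)                              ≡⟨ cong (λ z → + κ c * (z * p)) (Bin-below (dbl (suc a)) a<c) ⟨
  + κ c * xᵤ a c                                 ∎
  where
  q = Q a (+ 2 * (+ 1 + + c))
  p = φ (a ℕ.∸ c) (+ suc c)
... | inj₂ c≤a = begin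
  + suc c * (B * Q a (+ 2 * + suc c))     ≡⟨ solve 3 (λ t b q → t :* (b :* q) := b :* (t :* q)) refl (+ suc c) B (Q a (+ 2 * + suc c)) ⟩
  B * (+ suc c * Q a (+ 2 * + suc c))     ≡⟨ cong (λ n → B * (+ suc c * Q n (+ 2 * + suc c))) (ℕ.m∸n+n≡m c≤a) ⟨
  B * (+ suc c * Q (a ℕ.∸ c ℕ.+ c) (+ 2 * + suc c))  ≡⟨ cong (B *_) (Q-φ (a ℕ.∸ c) c) ⟩
  B * (+ κ c * p)                         ≡⟨ solve 3 (λ b k p → b :* (k :* p) := k :* (b :* p)) refl B (+ κ c) p ⟩
  + κ c * xᵤ a c                          ∎
  where
  B = Bin (dbl (suc a)) (+ a - + c)
  p = φ (a ℕ.∸ c) (+ suc c)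

T-y : ∀ c b → + suc b * T b (+ c) ≡ + κ c * yᵤ c b
T-y c b with ℕ.<-≤-connex b c
... | inj₁ b<c = begin
  + suc b * (Bin (dbl (suc b)) (+ b - + c) * q)  ≡⟨ cong (λ z → + suc b * (z * q)) (Bin-below (dbl (suc b)) b<c) ⟩
  + suc b * (+ 0 * q)                            ≡⟨ solve 4 (λ k q u p → k :* (con (+ 0) :* q) := u :* (con (+ 0) :* p)) refl (+ suc b) q (+ κ c) p ⟩
  + κ c * (+ 0 * p)                              ≡⟨ cong (λ z → + κ c * (z * p)) (Bin-below (dbl (suc b)) b<c) ⟨
  + κ c * yᵤ c b                                 ∎
  where
  q = Q b (+ 2 * (+ 1 + + c))
  p = ψ′ (b ℕ.∸ c) c b
... | inj₂ c≤b = begin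
  + suc b * (B * Q b (+ 2 * + suc c))     ≡⟨ solve 3 (λ t b q → t :* (b :* q) := b :* (t :* q)) refl (+ suc b) B (Q b (+ 2 * + suc c)) ⟩
  B * (+ suc b * Q b (+ 2 * + suc c))     ≡⟨ cong (B *_) (bracket (b ℕ.∸ c) (ℕ.m∸n+n≡m c≤b)) ⟩
  B * (+ κ c * p)                         ≡⟨ solve 3 (λ b k p → b :* (k :* p) := k :* (b :* p)) refl B (+ κ c) p ⟩
  + κ c * yᵤ c b                          ∎
  where
  B = Bin (dbl (suc b)) (+ b - + c)
  p = ψ′ (b ℕ.∸ c) c b
  bracket : ∀ k {b} → k ℕ.+ c ≡ b → + suc b * Q b (+ 2 * + suc c) ≡ + κ c * ψ′ k c b
  bracket zero    refl = trans (Q-κ c) (sym (ℤ.*-identityʳ (+ κ c)))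
  bracket (suc k) refl = trans (cong (+ suc (suc k ℕ.+ c) *_) (Q-ψ k c))
    (solve 3 (λ b k p → b :* (k :* p) := k :* (b :* p)) refl (+ suc (suc k ℕ.+ c)) (+ κ c) (ψ k (+ suc c)))

-- Below the diagonal there are two sources of the factor 2. For a = c + 1 it is the binomial
-- coefficient C(2a+2, 1), as φ 1 t = 3t² may be odd; for larger a, `φ` contains t (t - 1).
xᵤ-even : ∀ a c → a ≢ c → + 2 ∣ xᵤ a c
xᵤ-even a c a≢c with ℕ.<-cmp a c
... | tri≈ _ a≡c _ = ⊥-elim (a≢c a≡c)
... | tri< a<c _ _ = divides (+ 0) (cong (_* φ (a ℕ.∸ c) (+ suc c)) (Bin-below (dbl (suc a)) a<c))
... | tri> _ _ c<a with ℕ.m≤n⇒∃[o]m+o≡n c<a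
...   | zero  , refl = subst (λ k → + 2 ∣ Bin n k * φ (a ℕ.∸ c) (+ suc c))
        (solve 1 (λ c → con (+ 1) := con (+ 1) :+ c :+ con (+ 0) :- c) refl (+ c))
        (ℤ∣.∣m⇒∣m*n (φ (a ℕ.∸ c) (+ suc c)) (divides (+ suc a) (trans (Bin-one n) (trans (+dbl (suc a)) (ℤ.*-comm (+ 2) (+ suc a))))))
  where n = dbl (suc a)
...   | suc k , refl = ℤ∣.∣n⇒∣m*n (Bin (dbl (suc a)) (+ a - + c)) (subst (λ i → + 2 ∣ φ i (+ suc c)) (sym a∸c) (φ-even k c))
  where
  a∸c : suc c ℕ.+ suc k ℕ.∸ c ≡ 2 ℕ.+ k
  a∸c = trans (cong (ℕ._∸ c) (sym (ℕ.+-suc c (suc k)))) (ℕ.m+n∸m≡n c (2 ℕ.+ k))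

U-factorisation : Factorisation
U-factorisation = record
  { e      = exponent
  ; e-mono = exponent-mono
  ; d      = +_ ∘ diagonalEntry
  ; d-ν    = diagonalEntry-ν
  ; x      = xᵤ
  ; y      = yᵤ
  ; x-diag = λ t → cong₂ _*_ (Bin-diag t) (cong (λ k → φ k (+ suc t)) (ℕ.n∸n≡0 t))
  ; x-even = xᵤ-even
  ; y-diag = λ t → cong₂ _*_ (Bin-diag t) (cong (λ k → ψ′ k t t) (ℕ.n∸n≡0 t))
  ; y-zero = λ {t} {j} j<t → cong (_* ψ′ (j ℕ.∸ t) t j) (Bin-below (dbl (suc j)) j<t)
  }
  where
  Bin-diag : ∀ t → Bin (dbl (suc t)) (+ t - + t) ≡ + 1
  Bin-diag t = trans (cong (Bin (dbl (suc t))) (ℤ.+-inverseʳ (+ t))) (Bin-zero (dbl (suc t)))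

U-entry : ∀ m a b → a ℕ.< m → b ℕ.< m →
          + (w a ℕ.* w b) * col (suc b) (suc a) ≡ Factorisation.entry U-factorisation m a b
U-entry m a b a<m b<m = trans (col-ΣF a b a<m b<m) (trans (Σ<-*ˡ (+ 3 * + suc b) m _) (Σ<-cong m λ c _ → begin
  + 3 * + suc b * (+ 2 * + suc c * (T a (+ c) * T b (+ c)))
    -- Of the factor 3j · 2t, t goes to the row and j to the column; each product is then a multiple
    -- of `κ c`, and 6 stays on the diagonal.
    ≡⟨ solve 4 (λ j t x y → con (+ 3) :* j :* (con (+ 2) :* t :* (x :* y)) := con (+ 6) :* ((t :* x) :* (j :* y))) refl
         (+ suc b) (+ suc c) (T a (+ c)) (T b (+ c)) ⟩
  + 6 * ((+ suc c * T a (+ c)) * (+ suc b * T b (+ c)))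
    ≡⟨ cong₂ (λ x y → + 6 * (x * y)) (T-x a c) (T-y c b) ⟩
  + 6 * ((+ κ c * xᵤ a c) * (+ κ c * yᵤ c b))
    ≡⟨ solve 3 (λ k x y → con (+ 6) :* ((k :* x) :* (k :* y)) := x :* (con (+ 6) :* (k :* k)) :* y) refl (+ κ c) (xᵤ a c) (yᵤ c b) ⟩
  xᵤ a c * (+ 6 * (+ κ c * + κ c)) * yᵤ c b
    ≡⟨ cong (λ z → xᵤ a c * z * yᵤ c b) (trans (cong (+ 6 *_) (sym (ℤ.pos-* (κ c) (κ c)))) (sym (ℤ.pos-* 6 (κ c ℕ.* κ c)))) ⟩
  xᵤ a c * + diagonalEntry c * yᵤ c b ∎))

w-odd : ∀ a → Odd (w a)
w-odd zero    = 0 , refl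
w-odd (suc a) = Odd-* (Odd-* 3+2a 3+2a) (w-odd a)
  where
  dbl≡2* : ∀ n → dbl n ≡ 2 ℕ.* n
  dbl≡2* n = ℤ.+-injective (trans (+dbl n) (sym (ℤ.pos-* 2 n)))
  3+2a : Odd (3 ℕ.+ dbl a)
  3+2a = suc a , cong suc (dbl≡2* (suc a))

-- The diagonal matrix D

δ : ℕ → ℕ → ℤ
δ i j = if does (i ℕ.≟ j) then + 1 else + 0

δ-on : ∀ i → δ i i ≡ + 1
δ-on i = cong (if_then + 1 else + 0) (dec-true (i ℕ.≟ i) refl)

δ-off : ∀ {i j} → i ≢ j → δ i j ≡ + 0
δ-off {i} {j} i≢j = cong (if_then + 1 else + 0) (dec-false (i ℕ.≟ j) i≢j)

Σ<-single : ∀ {m i} h → i ℕ.< m → (∀ t → t ≢ i → h t ≡ + 0) → Σ< m h ≡ h i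
Σ<-single {suc m} {i} h (s≤s i≤m) off with ℕ.m≤n⇒m<n∨m≡n i≤m
... | inj₂ refl = trans (cong (_+ h m) (Σ<-0 m h λ t t<m → off t (ℕ.<⇒≢ t<m))) (ℤ.+-identityˡ (h m))
... | inj₁ i<m  = trans (cong₂ _+_ (Σ<-single h i<m off) (off m (ℕ.<⇒≢ i<m ∘ sym))) (ℤ.+-identityʳ (h i))

-- It shares `d` and `exponent` with `U-factorisation`, so the valuations obtained for both
-- characteristic series are literally the same function.
D-factorisation : Factorisation
D-factorisation = record
  { e      = exponent
  ; e-mono = exponent-mono
  ; d      = +_ ∘ diagonalEntry
  ; d-ν    = diagonalEntry-ν
  ; x      = δ
  ; y      = δ
  ; x-diag = δ-on
  ; x-even = λ i t i≢t → divides (+ 0) (δ-off i≢t)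
  ; y-diag = δ-on
  ; y-zero = λ j<t → δ-off (ℕ.>⇒≢ j<t)
  }

-- With j = i + 1, both sides grow from j to j + 1 by the same factor 144 ((3j+1) (3j+2))² ((j+1)
-- (2j+1))⁴.
D-entry-scaled : ∀ i → D-numerator (suc i) ℕ.* (w i ℕ.* w i) ≡ diagonalEntry i ℕ.* D-denominator (suc i)
D-entry-scaled zero    = refl
D-entry-scaled (suc i) = begin
  D-numerator (suc j) ℕ.* (w j ℕ.* w j)
    ≡⟨ cong₂ (λ x z → x ℕ.* (z ℕ.* z ℕ.* w i ℕ.* (z ℕ.* z ℕ.* w i))) (D-numerator-suc j) 3+2i ⟩
  (16 ℕ.* p) ℕ.* (3 ℕ.* suc j ℕ.* (y ℕ.* (x ℕ.* a))) ℕ.^ 2 ℕ.* (suc j ℕ.* b) ℕ.^ 2 ℕ.* (v ℕ.* v ℕ.* w i ℕ.* (v ℕ.* v ℕ.* w i))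
    ≡⟨ ℕ-Solver.+-*-Solver.solve 8 (λ p s x y a b v w → (con′ 16 ⊠ p) ⊠ (con′ 3 ⊠ s ⊠ (y ⊠ (x ⊠ a))) ⊹^ 2 ⊠ (s ⊠ b) ⊹^ 2 ⊠ (v ⊠ v ⊠ w ⊠ (v ⊠ v ⊠ w)) ≔
         (p ⊠ a ⊹^ 2 ⊠ b ⊹^ 2 ⊠ (w ⊠ w)) ⊠ (con′ 144 ⊠ (x ⊠ y) ⊹^ 2 ⊠ (s ⊠ v) ⊹^ 4)) refl p (suc j) x y a b v (w i) ⟩
  D-numerator j ℕ.* (w i ℕ.* w i) ℕ.* (144 ℕ.* (x ℕ.* y) ℕ.^ 2 ℕ.* (suc j ℕ.* v) ℕ.^ 4)
    ≡⟨ cong (ℕ._* (144 ℕ.* (x ℕ.* y) ℕ.^ 2 ℕ.* (suc j ℕ.* v) ℕ.^ 4)) (D-entry-scaled i) ⟩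
  6 ℕ.* (κ i ℕ.* κ i) ℕ.* (3 ℕ.* z ℕ.^ 4) ℕ.* (144 ℕ.* (x ℕ.* y) ℕ.^ 2 ℕ.* (suc j ℕ.* v) ℕ.^ 4)
    ≡⟨ ℕ-Solver.+-*-Solver.solve 6 (λ k z x y s v → con′ 6 ⊠ (k ⊠ k) ⊠ (con′ 3 ⊠ z ⊹^ 4) ⊠ (con′ 144 ⊠ (x ⊠ y) ⊹^ 2 ⊠ (s ⊠ v) ⊹^ 4) ≔
         con′ 6 ⊠ (con′ 3 ⊠ (x ⊠ y) ⊠ k ⊠ (con′ 3 ⊠ (x ⊠ y) ⊠ k)) ⊠ (con′ 3 ⊠ (con′ 2 ⊠ s ⊠ (v ⊠ z)) ⊹^ 4)) refl (κ i) z x y (suc j) v ⟩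
  diagonalEntry j ℕ.* (3 ℕ.* (2 ℕ.* suc j ℕ.* (v ℕ.* z)) ℕ.^ 4)
    ≡⟨ cong (diagonalEntry j ℕ.*_) (D-denominator-suc j) ⟨
  diagonalEntry j ℕ.* D-denominator (suc j) ∎
  where
  open ℕ-Solver.+-*-Solver renaming (_:*_ to _⊠_; _:=_ to _≔_; con to con′; _:^_ to _⊹^_) using ()
  j = suc i
  p = 2 ℕ.^ (4 ℕ.* j ℕ.+ 1)
  x = 1 ℕ.+ 3 ℕ.* j
  y = 2 ℕ.+ 3 ℕ.* j
  a = (3 ℕ.* j) ℕ.!
  b = j ℕ.!
  z = (2 ℕ.* j) ℕ.!
  v = 1 ℕ.+ 2 ℕ.* j
  3+2i : 3 ℕ.+ dbl i ≡ v
  3+2i = cong suc (ℤ.+-injective (trans (+dbl j) (sym (ℤ.pos-* 2 j))))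

D-link : ∀ m i j → i ℕ.< m → j ℕ.< m →
  CompactOperator.matrix D i j *₂ K (+ (w i ℕ.* w j)) ≈₂ K (Factorisation.entry D-factorisation m i j)
D-link m i j i<m j<m = pointwise λ n → trans (value n (i ℕ.≟ j)) (cong ι (sym single))
  where
  single : Factorisation.entry D-factorisation m i j ≡ δ i i * + diagonalEntry i * δ i j
  single = Σ<-single (λ t → δ i t * + diagonalEntry t * δ t j) i<m
    (λ t t≢i → cong (λ z → z * + diagonalEntry t * δ t j) (δ-off (t≢i ∘ sym)))
  value : ∀ n (i≟j : Dec (i ≡ j)) → seq (CompactOperator.matrix D i j) n ℚ.* ι (+ (w i ℕ.* w j)) ≡ ι (δ i i * + diagonalEntry i * δ i j)
  value n (no i≢j) = begin
    D-entry (suc i) ℚ.* seq (if does (i ℕ.≟ j) then 1₂ else 0₂) n ℚ.* ι (+ (w i ℕ.* w j))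
      ≡⟨ cong (λ b → D-entry (suc i) ℚ.* seq (if b then 1₂ else 0₂) n ℚ.* ι (+ (w i ℕ.* w j))) (dec-false (i ℕ.≟ j) i≢j) ⟩
    D-entry (suc i) ℚ.* 0ℚ ℚ.* ι (+ (w i ℕ.* w j))
      ≡⟨ trans (cong (ℚ._* ι (+ (w i ℕ.* w j))) (ℚ.*-zeroʳ (D-entry (suc i)))) (ℚ.*-zeroˡ (ι (+ (w i ℕ.* w j)))) ⟩
    0ℚ
      ≡⟨ cong ι (trans (cong (δ i i * + diagonalEntry i *_) (δ-off i≢j)) (ℤ.*-zeroʳ (δ i i * + diagonalEntry i))) ⟨
    ι (δ i i * + diagonalEntry i * δ i j) ∎
  value n (yes refl) = begin
    D-entry (suc i) ℚ.* seq (if does (i ℕ.≟ i) then 1₂ else 0₂) n ℚ.* ι (+ (w i ℕ.* w i))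
      ≡⟨ cong (λ b → D-entry (suc i) ℚ.* seq (if b then 1₂ else 0₂) n ℚ.* ι (+ (w i ℕ.* w i))) (dec-true (i ℕ.≟ i) refl) ⟩
    D-entry (suc i) ℚ.* 1ℚ ℚ.* ι (+ (w i ℕ.* w i))
      ≡⟨ cong (ℚ._* ι (+ (w i ℕ.* w i))) (ℚ.*-identityʳ (D-entry (suc i))) ⟩
    D-entry (suc i) ℚ.* ι (+ (w i ℕ.* w i))
      ≡⟨ /-*-ι (+ D-numerator (suc i)) (D-denominator (suc i)) (+ (w i ℕ.* w i)) (+ diagonalEntry i) {{D-denominator≢0 (suc i)}}
           (trans (sym (ℤ.pos-* (D-numerator (suc i)) (w i ℕ.* w i))) (trans (cong +_ (D-entry-scaled i)) (ℤ.pos-* (diagonalEntry i) (D-denominator (suc i))))) ⟩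
    ι (+ diagonalEntry i)
      ≡⟨ cong ι (trans (cong₂ (λ x y → x * + diagonalEntry i * y) (δ-on i) (δ-on i))
           (solve 1 (λ d → con (+ 1) :* d :* con (+ 1) := d) refl (+ diagonalEntry i))) ⟨
    ι (δ i i * + diagonalEntry i * δ i i) ∎

-- Formal power series

infix 4 _≈ˢ_

record _≈ˢ_ (a b : Series) : Set where
  constructor ≈ˢ-intro
  field at : ∀ n → a n ≡ b n

open _≈ˢ_

infixl 6 _+ˢ_
infix 8 -ˢ_

_+ˢ_ : Series → Series → Series
(a +ˢ b) n = a n + b n

-ˢ_ : Series → Series
(-ˢ a) n = - a n

infixl 7 _·ˢ_

_·ˢ_ : ℤ → Series → Series
(k ·ˢ a) n = k * a n

constantˢ : ℤ → Series
constantˢ k = k ·ˢ q^ 0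

0ˢ : Series
0ˢ _ = + 0

⊛-congₙ : ∀ n {a a′ b b′} → (∀ i → i ℕ.≤ n → a i ≡ a′ i) → (∀ i → i ℕ.≤ n → b i ≡ b′ i) → (a ⊛ b) n ≡ (a′ ⊛ b′) n
⊛-congₙ zero    p q = cong (_+ + 0) (cong₂ _*_ (p 0 z≤n) (q 0 z≤n))
⊛-congₙ (suc n) p q = cong₂ _+_ (cong₂ _*_ (p 0 z≤n) (q (suc n) ℕ.≤-refl))
  (⊛-congₙ n (λ i i≤n → p (suc i) (s≤s i≤n)) (λ i i≤n → q i (ℕ.m≤n⇒m≤1+n i≤n)))

⊛-cong : ∀ {a a′ b b′} → a ≈ˢ a′ → b ≈ˢ b′ → a ⊛ b ≈ˢ a′ ⊛ b′
⊛-cong p q = ≈ˢ-intro λ n → ⊛-congₙ n (λ i _ → at p i) (λ i _ → at q i)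

-- The convolution unfolds by splitting off the constant term of the left factor; splitting at the
-- other end is what commutativity needs.
⊛-sucʳ : ∀ a b n → (a ⊛ b) (suc n) ≡ (a ⊛ tail b) n + a (suc n) * b 0
⊛-sucʳ a b zero    = solve 4 (λ a b c d → a :* b :+ (c :* d :+ con (+ 0)) := (a :* b :+ con (+ 0)) :+ c :* d) refl (a 0) (b 1) (a 1) (b 0)
⊛-sucʳ a b (suc n) = trans (cong (λ z → a 0 * b (suc (suc n)) + z) (⊛-sucʳ (tail a) b n))
  (sym (ℤ.+-assoc (a 0 * b (suc (suc n))) _ _))

⊛-commₙ : ∀ n a b → (a ⊛ b) n ≡ (b ⊛ a) n
⊛-commₙ zero    a b = cong (_+ + 0) (ℤ.*-comm (a 0) (b 0))
⊛-commₙ (suc n) a b = begin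
  a 0 * b (suc n) + (tail a ⊛ b) n   ≡⟨ cong₂ _+_ (ℤ.*-comm (a 0) (b (suc n))) (⊛-commₙ n (tail a) b) ⟩
  b (suc n) * a 0 + (b ⊛ tail a) n   ≡⟨ ℤ.+-comm (b (suc n) * a 0) _ ⟩
  (b ⊛ tail a) n + b (suc n) * a 0   ≡⟨ ⊛-sucʳ b a n ⟨
  (b ⊛ a) (suc n)                    ∎

⊛-distribʳₙ : ∀ n c a b → ((a +ˢ b) ⊛ c) n ≡ (a ⊛ c) n + (b ⊛ c) n
⊛-distribʳₙ zero    c a b = solve 3 (λ a b c → (a :+ b) :* c :+ con (+ 0) := (a :* c :+ con (+ 0)) :+ (b :* c :+ con (+ 0))) refl (a 0) (b 0) (c 0)
⊛-distribʳₙ (suc n) c a b = trans (cong (λ z → (a 0 + b 0) * c (suc n) + z) (⊛-distribʳₙ n c (tail a) (tail b)))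
  (solve 5 (λ a b c x y → (a :+ b) :* c :+ (x :+ y) := (a :* c :+ x) :+ (b :* c :+ y)) refl (a 0) (b 0) (c (suc n)) ((tail a ⊛ c) n) ((tail b ⊛ c) n))

·ˢ-⊛ₙ : ∀ n k a b → ((k ·ˢ a) ⊛ b) n ≡ k * (a ⊛ b) n
·ˢ-⊛ₙ zero    k a b = solve 3 (λ k a b → (k :* a) :* b :+ con (+ 0) := k :* (a :* b :+ con (+ 0))) refl k (a 0) (b 0)
·ˢ-⊛ₙ (suc n) k a b = trans (cong (λ z → k * a 0 * b (suc n) + z) (·ˢ-⊛ₙ n k (tail a) b))
  (solve 4 (λ k a b z → (k :* a) :* b :+ k :* z := k :* (a :* b :+ z)) refl k (a 0) (b (suc n)) ((tail a ⊛ b) n))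

⊛-assocₙ : ∀ n a b c → ((a ⊛ b) ⊛ c) n ≡ (a ⊛ (b ⊛ c)) n
⊛-assocₙ zero    a b c = solve 3 (λ a b c → (a :* b :+ con (+ 0)) :* c :+ con (+ 0) := a :* (b :* c :+ con (+ 0)) :+ con (+ 0)) refl (a 0) (b 0) (c 0)
⊛-assocₙ (suc n) a b c = begin
  (a ⊛ b) 0 * c (suc n) + (((a 0 ·ˢ tail b) +ˢ (tail a ⊛ b)) ⊛ c) n
    ≡⟨ cong (λ z → (a ⊛ b) 0 * c (suc n) + z) (trans (⊛-distribʳₙ n c (a 0 ·ˢ tail b) (tail a ⊛ b))
         (cong₂ _+_ (·ˢ-⊛ₙ n (a 0) (tail b) c) (⊛-assocₙ n (tail a) b c))) ⟩
  (a 0 * b 0 + + 0) * c (suc n) + (a 0 * (tail b ⊛ c) n + (tail a ⊛ (b ⊛ c)) n)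
    ≡⟨ solve 5 (λ a b c x y → (a :* b :+ con (+ 0)) :* c :+ (a :* x :+ y) := a :* (b :* c :+ x) :+ y) refl
         (a 0) (b 0) (c (suc n)) ((tail b ⊛ c) n) ((tail a ⊛ (b ⊛ c)) n) ⟩
  a 0 * (b ⊛ c) (suc n) + (tail a ⊛ (b ⊛ c)) n ∎

⊛-zeroₙ : ∀ n a → (0ˢ ⊛ a) n ≡ + 0
⊛-zeroₙ zero    a = refl
⊛-zeroₙ (suc n) a = cong (λ z → + 0 + z) (⊛-zeroₙ n a)

⊛-identityₙ : ∀ n a → (q^ 0 ⊛ a) n ≡ a n
⊛-identityₙ zero    a = trans (ℤ.+-identityʳ (+ 1 * a 0)) (ℤ.*-identityˡ (a 0))
⊛-identityₙ (suc n) a = trans (cong₂ _+_ (ℤ.*-identityˡ (a (suc n))) (⊛-zeroₙ n a)) (ℤ.+-identityʳ (a (suc n)))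

⊛-comm : ∀ a b → a ⊛ b ≈ˢ b ⊛ a
⊛-comm a b = ≈ˢ-intro λ n → ⊛-commₙ n a b

seriesRing : CommutativeRing 0ℓ 0ℓ
seriesRing = record
  { Carrier = Series
  ; _≈_     = _≈ˢ_
  ; _+_     = _+ˢ_
  ; _*_     = _⊛_
  ; -_      = -ˢ_
  ; 0#      = 0ˢ
  ; 1#      = q^ 0
  ; isCommutativeRing = record
    { isRing = record
      { +-isAbelianGroup = record
        { isGroup = record
          { isMonoid = record
            { isSemigroup = record
              { isMagma = record
                { isEquivalence = record
                  { refl  = ≈ˢ-intro λ _ → refl
                  ; sym   = λ p → ≈ˢ-intro λ n → sym (at p n)
                  ; trans = λ p q → ≈ˢ-intro λ n → trans (at p n) (at q n)
                  }
                ; ∙-cong = λ p q → ≈ˢ-intro λ n → cong₂ _+_ (at p n) (at q n)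
                }
              ; assoc = λ a b c → ≈ˢ-intro λ n → ℤ.+-assoc (a n) (b n) (c n)
              }
            ; identity = (λ a → ≈ˢ-intro λ n → ℤ.+-identityˡ (a n)) , (λ a → ≈ˢ-intro λ n → ℤ.+-identityʳ (a n))
            }
          ; inverse = (λ a → ≈ˢ-intro λ n → ℤ.+-inverseˡ (a n)) , (λ a → ≈ˢ-intro λ n → ℤ.+-inverseʳ (a n))
          ; ⁻¹-cong = λ p → ≈ˢ-intro λ n → cong -_ (at p n)
          }
        ; comm = λ a b → ≈ˢ-intro λ n → ℤ.+-comm (a n) (b n)
        }
      ; *-cong = ⊛-cong
      ; *-assoc = λ a b c → ≈ˢ-intro λ n → ⊛-assocₙ n a b c
      ; *-identity = (λ a → ≈ˢ-intro λ n → ⊛-identityₙ n a)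
                   , (λ a → ≈ˢ-intro λ n → trans (⊛-commₙ n a (q^ 0)) (⊛-identityₙ n a))
      ; distrib = (λ c a b → ≈ˢ-intro λ n → trans (⊛-commₙ n c (a +ˢ b))
                     (trans (⊛-distribʳₙ n c a b) (cong₂ _+_ (⊛-commₙ n a c) (⊛-commₙ n b c))))
                , (λ c a b → ≈ˢ-intro λ n → ⊛-distribʳₙ n c a b)
      }
    ; *-comm = ⊛-comm
    }
  }

module Ser = CommutativeRing seriesRing
module Ser-Reasoning where
  open SetoidReasoning Ser.setoid public renaming (begin_ to beginˢ_; _∎ to _∎ˢ)

open Ser using () renaming (refl to ≈ˢ-refl; sym to ≈ˢ-sym; trans to ≈ˢ-trans)

·ˢ-as-⊛ : ∀ k a → k ·ˢ a ≈ˢ constantˢ k ⊛ a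
·ˢ-as-⊛ k a = ≈ˢ-intro λ n → trans (cong (k *_) (sym (⊛-identityₙ n a))) (sym (·ˢ-⊛ₙ n k (q^ 0) a))

ℤ-rawRing : RawRing 0ℓ 0ℓ
ℤ-rawRing = CommutativeRing.rawRing ℤ.+-*-commutativeRing

series-almostRing : ACR.AlmostCommutativeRing 0ℓ 0ℓ
series-almostRing = ACR.fromCommutativeRing seriesRing

constantˢ-morphism : ℤ-rawRing ACR.-Raw-AlmostCommutative⟶ series-almostRing
constantˢ-morphism = record
  { ⟦_⟧    = constantˢ
  ; +-homo = λ a b → ≈ˢ-intro λ n → ℤ.*-distribʳ-+ (q^ 0 n) a b
  ; *-homo = λ a b → ≈ˢ-intro λ n → trans (ℤ.*-assoc a b (q^ 0 n)) (at (·ˢ-as-⊛ a (constantˢ b)) n)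
  ; -‿homo = λ a → ≈ˢ-intro λ n → sym (ℤ.neg-distribˡ-* a (q^ 0 n))
  ; 0-homo = ≈ˢ-intro λ n → refl
  ; 1-homo = ≈ˢ-intro λ n → ℤ.*-identityˡ (q^ 0 n)
  }

constantˢ-≟ : ∀ a b → Maybe (constantˢ a ≈ˢ constantˢ b)
constantˢ-≟ a b with a ℤ.≟ b
... | yes refl = just ≈ˢ-refl
... | no _     = nothing

module Ser-Solver = RingSolver ℤ-rawRing series-almostRing constantˢ-morphism constantˢ-≟

open Ser-Solver using () renaming (solve to solveˢ; _:=_ to _≑_; _:+_ to _⊞_; _:*_ to _⊠_; _:-_ to _⊟_; :-_ to ⊟_; _:^_ to _⊡_; con to conˢ)

⊛-congˡ : ∀ x {a b} → a ≈ˢ b → x ⊛ a ≈ˢ x ⊛ b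
⊛-congˡ x p = ⊛-cong {x} {x} (≈ˢ-refl {x}) p

⊛-congʳ : ∀ x {a b} → a ≈ˢ b → a ⊛ x ≈ˢ b ⊛ x
⊛-congʳ x p = ⊛-cong p (≈ˢ-refl {x})

+ˢ-congˡ : ∀ x {a b} → a ≈ˢ b → x +ˢ a ≈ˢ x +ˢ b
+ˢ-congˡ x p = ≈ˢ-intro λ n → cong (λ z → x n + z) (at p n)

+ˢ-congʳ : ∀ x {a b} → a ≈ˢ b → a +ˢ x ≈ˢ b +ˢ x
+ˢ-congʳ x p = ≈ˢ-intro λ n → cong (_+ x n) (at p n)

-ˢ-cong : ∀ {a b} → a ≈ˢ b → -ˢ a ≈ˢ -ˢ b
-ˢ-cong p = ≈ˢ-intro λ n → cong -_ (at p n)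

^ˢ-cong : ∀ n {a b} → a ≈ˢ b → a ^ˢ n ≈ˢ b ^ˢ n
^ˢ-cong zero    p = ≈ˢ-refl
^ˢ-cong (suc n) p = ⊛-cong p (^ˢ-cong n p)

^ˢ-⊛ : ∀ n a b → (a ⊛ b) ^ˢ n ≈ˢ a ^ˢ n ⊛ b ^ˢ n
^ˢ-⊛ zero    a b = ≈ˢ-sym (Ser.*-identityˡ (q^ 0))
^ˢ-⊛ (suc n) a b = ≈ˢ-trans (⊛-congˡ (a ⊛ b) (^ˢ-⊛ n a b))
  (solveˢ 4 (λ a b c d → (a ⊠ b) ⊠ (c ⊠ d) ≑ (a ⊠ c) ⊠ (b ⊠ d)) ≈ˢ-refl a b (a ^ˢ n) (b ^ˢ n))

-- If u c = 0 and u has a nonzero constant term, then c has constant term 0 and c / q satisfies the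
-- same equation.
cancel : ∀ u {a b} → u 0 ≢ + 0 → u ⊛ a ≈ˢ u ⊛ b → a ≈ˢ b
cancel u {a} {b} u≢0 eq = ≈ˢ-intro λ n → ℤ.i-j≡0⇒i≡j (a n) (b n) (vanishes n (a +ˢ (-ˢ b)) λ i → at difference i)
  where
  difference : u ⊛ (a +ˢ (-ˢ b)) ≈ˢ 0ˢ
  difference = ≈ˢ-trans (solveˢ 3 (λ u a b → u ⊠ (a ⊞ (⊟ b)) ≑ u ⊠ a ⊞ (⊟ (u ⊠ b))) ≈ˢ-refl u a b)
    (≈ˢ-trans (Ser.+-congʳ eq) (Ser.-‿inverseʳ (u ⊛ b)))
  zero-product : ∀ x → u 0 * x ≡ + 0 → x ≡ + 0
  zero-product x eq with ℤ.i*j≡0⇒i≡0∨j≡0 (u 0) eq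
  ... | inj₁ u≡0 = ⊥-elim (u≢0 u≡0)
  ... | inj₂ x≡0 = x≡0
  vanishes : ∀ n c → (∀ i → (u ⊛ c) i ≡ + 0) → c n ≡ + 0
  vanishes zero    c eq = zero-product (c 0) (trans (sym (ℤ.+-identityʳ (u 0 * c 0))) (eq 0))
  vanishes (suc n) c eq = vanishes n (tail c) λ i → begin
    (u ⊛ tail c) i                    ≡⟨ ℤ.+-identityʳ _ ⟨
    (u ⊛ tail c) i + + 0              ≡⟨ cong (λ z → (u ⊛ tail c) i + z) (trans (cong (u (suc i) *_) (vanishes zero c eq)) (ℤ.*-zeroʳ (u (suc i)))) ⟨
    (u ⊛ tail c) i + u (suc i) * c 0  ≡⟨ ⊛-sucʳ u c i ⟨
    (u ⊛ c) (suc i)                   ≡⟨ eq (suc i) ⟩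
    + 0                               ∎

-- The substitutions q ↦ -q and q ↦ q², the even part, congruences modulo powers of q

sgn : ℕ → ℤ
sgn zero    = + 1
sgn (suc n) = - sgn n

-- a(-q)
σ : Series → Series
σ a n = sgn n * a n

even-part : Series → Series
even-part a n = a (dbl n)

double-congₙ : ∀ n {a b} → (∀ i → i ℕ.≤ n → a i ≡ b i) → double a n ≡ double b n
double-congₙ zero          p = p 0 z≤n
double-congₙ (suc zero)    p = refl
double-congₙ (suc (suc n)) p = double-congₙ n λ i i≤n → p (suc i) (s≤s (ℕ.m≤n⇒m≤1+n i≤n))

double-cong : ∀ {a b} → a ≈ˢ b → double a ≈ˢ double b
double-cong p = ≈ˢ-intro λ n → double-congₙ n λ i _ → at p i

double-+ₙ : ∀ n a b → double (a +ˢ b) n ≡ double a n + double b n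
double-+ₙ zero          a b = refl
double-+ₙ (suc zero)    a b = refl
double-+ₙ (suc (suc n)) a b = double-+ₙ n (tail a) (tail b)

double-·ₙ : ∀ n k a → double (k ·ˢ a) n ≡ k * double a n
double-·ₙ zero          k a = refl
double-·ₙ (suc zero)    k a = sym (ℤ.*-zeroʳ k)
double-·ₙ (suc (suc n)) k a = double-·ₙ n k (tail a)

double-⊛ₙ : ∀ n a b → double (a ⊛ b) n ≡ (double a ⊛ double b) n
double-⊛ₙ zero          a b = refl
double-⊛ₙ (suc zero)    a b = solve 2 (λ a b → con (+ 0) := a :* con (+ 0) :+ (con (+ 0) :* b :+ con (+ 0))) refl (a 0) (b 0)
double-⊛ₙ (suc (suc n)) a b = begin
  double ((a 0 ·ˢ tail b) +ˢ (tail a ⊛ b)) n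
    ≡⟨ trans (double-+ₙ n (a 0 ·ˢ tail b) (tail a ⊛ b)) (cong₂ _+_ (double-·ₙ n (a 0) (tail b)) (double-⊛ₙ n (tail a) b)) ⟩
  a 0 * double (tail b) n + (double (tail a) ⊛ double b) n
    ≡⟨ cong (λ z → a 0 * double (tail b) n + z) (ℤ.+-identityˡ _) ⟨
  a 0 * double (tail b) n + (+ 0 * double b (suc n) + (double (tail a) ⊛ double b) n) ∎

double-⊛ : ∀ a b → double (a ⊛ b) ≈ˢ double a ⊛ double b
double-⊛ a b = ≈ˢ-intro λ n → double-⊛ₙ n a b

double-+ : ∀ a b → double (a +ˢ b) ≈ˢ double a +ˢ double b
double-+ a b = ≈ˢ-intro λ n → double-+ₙ n a b

double-neg : ∀ a → double (-ˢ a) ≈ˢ -ˢ double a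
double-neg a = ≈ˢ-intro λ n → neg n a
  where
  neg : ∀ n a → double (-ˢ a) n ≡ - double a n
  neg zero          a = refl
  neg (suc zero)    a = refl
  neg (suc (suc n)) a = neg n (tail a)

double-dbl : ∀ n a → double a (dbl n) ≡ a n
double-dbl zero    a = refl
double-dbl (suc n) a = double-dbl n (tail a)

double-odd : ∀ n a → double a (suc (dbl n)) ≡ + 0
double-odd zero    a = refl
double-odd (suc n) a = double-odd n (tail a)

-- This is U(b(q²) a) = b U(a): U is linear over series in q², the property that turns the modular
-- equation into a recurrence.
even-part-⊛ₙ : ∀ n a b → (double b ⊛ a) (dbl n) ≡ (b ⊛ even-part a) n
even-part-⊛ₙ zero    a b = refl
even-part-⊛ₙ (suc n) a b = cong (λ z → b 0 * a (dbl (suc n)) + z)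
  (trans (ℤ.+-identityˡ _) (even-part-⊛ₙ n a (tail b)))

σ-cong : ∀ {a b} → a ≈ˢ b → σ a ≈ˢ σ b
σ-cong p = ≈ˢ-intro λ n → cong (sgn n *_) (at p n)

σ-⊛ₙ : ∀ n a b → sgn n * (a ⊛ b) n ≡ (σ a ⊛ σ b) n
σ-⊛ₙ zero    a b = solve 2 (λ a b → con (+ 1) :* (a :* b :+ con (+ 0)) := (con (+ 1) :* a) :* (con (+ 1) :* b) :+ con (+ 0)) refl (a 0) (b 0)
σ-⊛ₙ (suc n) a b = begin
  - sgn n * (a 0 * b (suc n) + (tail a ⊛ b) n)
    ≡⟨ solve 4 (λ s a b z → (:- s) :* (a :* b :+ z) := (con (+ 1) :* a) :* ((:- s) :* b) :+ con (ℤ.- + 1) :* (s :* z)) refl (sgn n) (a 0) (b (suc n)) ((tail a ⊛ b) n) ⟩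
  (+ 1 * a 0) * (- sgn n * b (suc n)) + - + 1 * (sgn n * (tail a ⊛ b) n)
    ≡⟨ cong (λ z → (+ 1 * a 0) * (- sgn n * b (suc n)) + z) (trans (cong (- + 1 *_) (σ-⊛ₙ n (tail a) b))
         (trans (sym (·ˢ-⊛ₙ n (- + 1) (σ (tail a)) (σ b))) (⊛-congₙ n {(- + 1) ·ˢ σ (tail a)} {tail (σ a)} {σ b} {σ b} (λ i _ → flip i) (λ i _ → refl)))) ⟩
  (+ 1 * a 0) * (- sgn n * b (suc n)) + (tail (σ a) ⊛ σ b) n ∎
  where
  flip : ∀ i → - + 1 * (sgn i * a (suc i)) ≡ - sgn i * a (suc i)
  flip i = solve 2 (λ s a → con (ℤ.- + 1) :* (s :* a) := (:- s) :* a) refl (sgn i) (a (suc i))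

σ-⊛ : ∀ a b → σ (a ⊛ b) ≈ˢ σ a ⊛ σ b
σ-⊛ a b = ≈ˢ-intro λ n → σ-⊛ₙ n a b

σ-+ : ∀ a b → σ (a +ˢ b) ≈ˢ σ a +ˢ σ b
σ-+ a b = ≈ˢ-intro λ n → ℤ.*-distribˡ-+ (sgn n) (a n) (b n)

sgn-square : ∀ n → sgn n * sgn n ≡ + 1
sgn-square zero    = refl
sgn-square (suc n) = trans (solve 1 (λ s → (:- s) :* (:- s) := s :* s) refl (sgn n)) (sgn-square n)

σ-σ : ∀ a → σ (σ a) ≈ˢ a
σ-σ a = ≈ˢ-intro λ n → trans (sym (ℤ.*-assoc (sgn n) (sgn n) (a n))) (trans (cong (_* a n) (sgn-square n)) (ℤ.*-identityˡ (a n)))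

sgn-dbl : ∀ n → sgn (dbl n) ≡ + 1
sgn-dbl zero    = refl
sgn-dbl (suc n) = trans (ℤ.neg-involutive (sgn (dbl n))) (sgn-dbl n)

parity : ∀ n → (∃[ m ] n ≡ dbl m) ⊎ (∃[ m ] n ≡ suc (dbl m))
parity zero    = inj₁ (0 , refl)
parity (suc n) with parity n
... | inj₁ (m , refl) = inj₂ (m , refl)
... | inj₂ (m , refl) = inj₁ (suc m , refl)

-- Congruence modulo qᴺ⁺¹.
infix 4 _≈[_]_
_≈[_]_ : Series → ℕ → Series → Set
a ≈[ N ] b = ∀ n → n ℕ.≤ N → a n ≡ b n

≈[]-⊛ : ∀ {N a a′ b b′} → a ≈[ N ] a′ → b ≈[ N ] b′ → (a ⊛ b) ≈[ N ] (a′ ⊛ b′)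
≈[]-⊛ {a = a} {a′} {b} {b′} p q n n≤N = ⊛-congₙ n {a} {a′} {b} {b′} (λ i i≤n → p i (ℕ.≤-trans i≤n n≤N)) (λ i i≤n → q i (ℕ.≤-trans i≤n n≤N))

≈[]-double : ∀ {N a b} → a ≈[ N ] b → double a ≈[ N ] double b
≈[]-double p n n≤N = double-congₙ n λ i i≤n → p i (ℕ.≤-trans i≤n n≤N)

≈[]-^ : ∀ {N a b} k → a ≈[ N ] b → (a ^ˢ k) ≈[ N ] (b ^ˢ k)
≈[]-^ zero    p = λ _ _ → refl
≈[]-^ {a = a} {b} (suc k) p = ≈[]-⊛ {a = a} {b} {a ^ˢ k} {b ^ˢ k} p (≈[]-^ {a = a} {b} k p)

-- Limits, orders of vanishing and inverses

-- The diagonal is the limit for sequences whose n-th coefficient is final from stage n on. `Δ` is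
-- defined by the same device, so that `tail Δ` is `lim eulerProduct`.
lim : (ℕ → Series) → Series
lim A n = A n n

Stable : (ℕ → Series) → Set
Stable A = ∀ n → A (suc n) ≈[ n ] A n

lim-≈[] : ∀ {A} → Stable A → ∀ N → lim A ≈[ N ] A N
lim-≈[] {A} stable N n n≤N = go (ℕ.≤⇒≤′ n≤N)
  where
  go : ∀ {N} → n ℕ.≤′ N → A n n ≡ A N n
  go (ℕ.≤′-reflexive refl) = refl
  go {suc N} (ℕ.≤′-step le) = trans (go le) (sym (stable N n (ℕ.≤′⇒≤ le)))

by-truncation : ∀ {a b} → (∀ N → a ≈[ N ] b) → a ≈ˢ b
by-truncation p = ≈ˢ-intro λ n → p n n ℕ.≤-refl

Vanishes : ℕ → Series → Set
Vanishes N a = ∀ n → n ℕ.< N → a n ≡ + 0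

Vanishes-⊛ : ∀ {N} x {c} → Vanishes N c → Vanishes N (x ⊛ c)
Vanishes-⊛ x {c} p n n<N = trans (⊛-congₙ n {x} {x} {c} {0ˢ} (λ _ _ → refl) (λ i i≤n → p i (ℕ.≤-<-trans i≤n n<N)))
  (trans (⊛-commₙ n x 0ˢ) (⊛-zeroₙ n x))

Vanishes-shift : ∀ {N b c} → b 0 ≡ + 0 → Vanishes N c → Vanishes (suc N) (b ⊛ c)
Vanishes-shift {b = b} {c} b0 p zero    _         = trans (ℤ.+-identityʳ (b 0 * c 0)) (cong (_* c 0) b0)
Vanishes-shift {b = b} {c} b0 p (suc n) (s≤s n<N) =
  cong₂ _+_ (cong (_* c (suc n)) b0) (Vanishes-⊛ (tail b) p n n<N)

Vanishes-^ : ∀ {b} → b 0 ≡ + 0 → ∀ k → Vanishes k (b ^ˢ k)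
Vanishes-^ b0 zero    = λ _ ()
Vanishes-^ {b} b0 (suc k) = Vanishes-shift {b = b} b0 (Vanishes-^ b0 k)

q^-suc : ∀ k n a → (q^ (suc k) ⊛ a) (suc n) ≡ (q^ k ⊛ a) n
q^-suc k n a = ℤ.+-identityˡ _

q^-+ : ∀ k l → q^ (k ℕ.+ l) ≈ˢ q^ k ⊛ q^ l
q^-+ k l = ≈ˢ-intro (go k)
  where
  go : ∀ k n → q^ (k ℕ.+ l) n ≡ (q^ k ⊛ q^ l) n
  go zero    n       = sym (⊛-identityₙ n (q^ l))
  go (suc k) zero    = refl
  go (suc k) (suc n) = trans (go k n) (sym (q^-suc k n (q^ l)))

Vanishes-q^ : ∀ {N a} k → Vanishes N a → Vanishes (k ℕ.+ N) (q^ k ⊛ a)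
Vanishes-q^ {a = a} zero    p n n<N = trans (⊛-identityₙ n a) (p n n<N)
Vanishes-q^ {a = a} (suc k) p zero    lt       = refl
Vanishes-q^ {a = a} (suc k) p (suc n) (s≤s lt) = trans (q^-suc k n a) (Vanishes-q^ k p n lt)

double-q^ : ∀ k → double (q^ k) ≈ˢ q^ (dbl k)
double-q^ k = ≈ˢ-intro λ n → go n k
  where
  zeros : ∀ n → double 0ˢ n ≡ + 0
  zeros zero          = refl
  zeros (suc zero)    = refl
  zeros (suc (suc n)) = zeros n
  go : ∀ n k → double (q^ k) n ≡ q^ (dbl k) n
  go zero          zero    = refl
  go zero          (suc k) = refl
  go (suc zero)    zero    = refl
  go (suc zero)    (suc k) = refl
  go (suc (suc n)) zero    = zeros n
  go (suc (suc n)) (suc k) = go n k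

σ-q^ : ∀ k → σ (q^ k) ≈ˢ sgn k ·ˢ q^ k
σ-q^ k = ≈ˢ-intro λ n → go n k
  where
  neg : ∀ s t u → s * t ≡ u * t → - s * t ≡ - u * t
  neg s t u eq = trans (sym (ℤ.neg-distribˡ-* s t)) (trans (cong -_ eq) (ℤ.neg-distribˡ-* u t))
  go : ∀ n k → sgn n * q^ k n ≡ sgn k * q^ k n
  go zero    zero    = refl
  go zero    (suc k) = sym (ℤ.*-zeroʳ (sgn (suc k)))
  go (suc n) zero    = ℤ.*-zeroʳ (sgn (suc n))
  go (suc n) (suc k) = neg (sgn n) (q^ k n) (sgn k) (go n k)

Σ<-first : ∀ n h → Σ< (suc n) h ≡ h 0 + Σ< n (h ∘ suc)
Σ<-first zero    h = ℤ.+-comm (+ 0) (h 0)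
Σ<-first (suc n) h = trans (cong (_+ h (suc n)) (Σ<-first n h)) (ℤ.+-assoc (h 0) (Σ< n (h ∘ suc)) (h (suc n)))

sum-Σ< : ∀ n h → ℤ-Sum.sum (λ (i : Fin n) → h (toℕ i)) ≡ Σ< n h
sum-Σ< zero    h = refl
sum-Σ< (suc n) h = trans (cong (λ z → h 0 + z) (sum-Σ< n (h ∘ suc))) (sym (Σ<-first n h))

-- `inv a` stops the geometric series at k = n in degree n, which makes it the diagonal limit of the
-- partial sums; the error bᴺ⁺¹ has no terms up to degree N.
module Inverse (a : Series) (a0 : a 0 ≡ + 1) where

  b : Series
  b = q^ 0 ⊖ˢ a

  b0 : b 0 ≡ + 0
  b0 = cong (λ z → + 1 - z) a0

  partial : ℕ → Series
  partial zero    = b ^ˢ 0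
  partial (suc N) = partial N +ˢ b ^ˢ suc N

  partial-Σ< : ∀ N n → partial N n ≡ Σ< (suc N) (λ k → (b ^ˢ k) n)
  partial-Σ< zero    n = sym (ℤ.+-identityˡ _)
  partial-Σ< (suc N) n = cong (_+ (b ^ˢ suc N) n) (partial-Σ< N n)

  inv-lim : inv a ≈ˢ lim partial
  inv-lim = ≈ˢ-intro λ n → trans (sum-Σ< (suc n) (λ k → (b ^ˢ k) n)) (sym (partial-Σ< n n))

  geometric : ∀ N → a ⊛ partial N ≈ˢ q^ 0 +ˢ (-ˢ (b ^ˢ suc N))
  geometric zero    = ≈ˢ-intro λ n → trans (trans (⊛-commₙ n a (q^ 0)) (⊛-identityₙ n a)) (trans
    (solve 2 (λ o a → a := o :- (o :- a)) refl (q^ 0 n) (a n))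
    (cong (λ z → q^ 0 n - z) (sym (trans (⊛-commₙ n b (q^ 0)) (⊛-identityₙ n b)))))
  geometric (suc N) = beginˢ
    a ⊛ (partial N +ˢ c)
      ≈⟨ Ser.distribˡ a (partial N) c ⟩
    (a ⊛ partial N) +ˢ (a ⊛ c)
      ≈⟨ Ser.+-cong (geometric N) (⊛-congʳ c a-b) ⟩
    (q^ 0 +ˢ (-ˢ c)) +ˢ ((q^ 0 +ˢ (-ˢ b)) ⊛ c)
      ≈⟨ solveˢ 3 (λ o b c → (o ⊞ (⊟ c)) ⊞ ((o ⊞ (⊟ b)) ⊠ c) ≑ o ⊞ ((⊟ c) ⊞ o ⊠ c) ⊞ (⊟ (b ⊠ c))) ≈ˢ-refl (q^ 0) b c ⟩
    q^ 0 +ˢ ((-ˢ c) +ˢ (q^ 0 ⊛ c)) +ˢ (-ˢ (b ⊛ c))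
      ≈⟨ +ˢ-congʳ (-ˢ (b ⊛ c)) (+ˢ-congˡ (q^ 0) (≈ˢ-trans (+ˢ-congˡ (-ˢ c) (Ser.*-identityˡ c)) (Ser.-‿inverseˡ c))) ⟩
    q^ 0 +ˢ 0ˢ +ˢ (-ˢ (b ⊛ c))
      ≈⟨ +ˢ-congʳ (-ˢ (b ⊛ c)) (Ser.+-identityʳ (q^ 0)) ⟩
    q^ 0 +ˢ (-ˢ (b ⊛ c)) ∎ˢ
    where
    open Ser-Reasoning
    c = b ^ˢ suc N
    a-b : a ≈ˢ q^ 0 +ˢ (-ˢ b)
    a-b = ≈ˢ-intro λ n → solve 2 (λ o a → a := o :- (o :- a)) refl (q^ 0 n) (a n)

  inverseʳ : a ⊛ inv a ≈ˢ q^ 0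
  inverseʳ = by-truncation λ N n n≤N → begin
    (a ⊛ inv a) n              ≡⟨ at (⊛-congˡ a inv-lim) n ⟩
    (a ⊛ lim partial) n        ≡⟨ ≈[]-⊛ {a = a} {a} {lim partial} {partial N} (λ _ _ → refl) (lim-≈[] {partial} stable N) n n≤N ⟩
    (a ⊛ partial N) n          ≡⟨ at (geometric N) n ⟩
    q^ 0 n - (b ^ˢ suc N) n    ≡⟨ cong (λ z → q^ 0 n - z) (Vanishes-^ {b} b0 (suc N) n (s≤s n≤N)) ⟩
    q^ 0 n - + 0               ≡⟨ ℤ.+-identityʳ (q^ 0 n) ⟩
    q^ 0 n                     ∎
    where
    stable : Stable partial
    stable N n n≤N = trans (cong (λ z → partial N n + z) (Vanishes-^ {b} b0 (suc N) n (s≤s n≤N))) (ℤ.+-identityʳ (partial N n))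

-- Theta functions

1ˢ 2ˢ : Series
1ˢ = constantˢ (+ 1)
2ˢ = constantˢ (+ 2)

q⁰≈1 : q^ 0 ≈ˢ 1ˢ
q⁰≈1 = ≈ˢ-intro λ n → sym (ℤ.*-identityˡ (q^ 0 n))

q^-≡ : ∀ {k l} → k ≡ l → q^ k ≈ˢ q^ l
q^-≡ refl = ≈ˢ-refl

ε : ℕ → Series
ε n = constantˢ (sgn n)

ε-suc : ∀ n → ε (suc n) ≈ˢ -ˢ ε n
ε-suc n = ≈ˢ-intro λ i → sym (ℤ.neg-distribˡ-* (sgn n) (q^ 0 i))

-- Partial products of ∏ (1 - qᵏ) and ∏ (1 + qᵏ) and partial sums of Σ (-1)ᵏ qᵏ² over ℤ.
𝒩 ℳ 𝒮 : ℕ → Series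
𝒩 zero    = 1ˢ
𝒩 (suc n) = 𝒩 n ⊛ (1ˢ +ˢ (-ˢ q^ (suc n)))
ℳ zero    = 1ˢ
ℳ (suc n) = ℳ n ⊛ (1ˢ +ˢ q^ (suc n))
𝒮 zero    = 1ˢ
𝒮 (suc n) = 𝒮 n +ˢ 2ˢ ⊛ (ε (suc n) ⊛ q^ (suc n ℕ.* suc n))

-- Shanks' finite form of Gauss's identity Σ (-1)ᵏ qᵏ² = ∏ (1 - qᵏ) / (1 + qᵏ):
-- 𝒮 n ⊛ ℳ n is the sum of the terms of the (n + 1)-st antidiagonal of shanks.
shanks : ℕ → ℕ → Series
shanks zero    k       = 𝒩 k
shanks (suc s) zero    = 2ˢ ⊛ (ε (suc s) ⊛ (q^ (suc s ℕ.* suc (suc s)) ⊛ ℳ s))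
shanks (suc s) (suc k) = shanks (suc s) k ⊛ (q^ (suc s) ⊛ (1ˢ +ˢ (-ˢ q^ (suc s ℕ.+ suc k))))

shanks-suc : ∀ s k → shanks s (suc k) ≈ˢ shanks s k ⊛ (q^ s ⊛ (1ˢ +ˢ (-ˢ q^ (s ℕ.+ suc k))))
shanks-suc zero    k = ⊛-congˡ (𝒩 k) (≈ˢ-sym (Ser.*-identityˡ (1ˢ +ˢ (-ˢ q^ (suc k)))))
shanks-suc (suc s) k = ≈ˢ-refl

-- Expresses the increment of `𝒮`, multiplied by `ℳ s`, through the corner `shanks s 0`. The case s
-- = 0 is separate because that corner lacks the factor 2, which 1 + q⁰ provides instead.
shanks-diagonal : ∀ s → -ˢ (q^ (suc s) ⊛ ((1ˢ +ˢ q^ s) ⊛ shanks s 0)) ≈ˢ 2ˢ ⊛ (ε (suc s) ⊛ (q^ (suc s ℕ.* suc s) ⊛ ℳ s))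
shanks-diagonal zero = ≈ˢ-trans
  (-ˢ-cong (⊛-congˡ (q^ 1) (⊛-congʳ 1ˢ (+ˢ-congˡ 1ˢ q⁰≈1))))
  (solveˢ 1 (λ u → ⊟ (u ⊠ ((conˢ (+ 1) ⊞ conˢ (+ 1)) ⊠ conˢ (+ 1))) ≑ conˢ (+ 2) ⊠ (conˢ (ℤ.- + 1) ⊠ (u ⊠ conˢ (+ 1)))) ≈ˢ-refl (q^ 1))
shanks-diagonal (suc r) = ≈ˢ-trans
  (solveˢ 5 (λ u v e w m → ⊟ (u ⊠ ((conˢ (+ 1) ⊞ v) ⊠ (conˢ (+ 2) ⊠ (e ⊠ (w ⊠ m))))) ≑
     conˢ (+ 2) ⊠ ((⊟ e) ⊠ ((u ⊠ w) ⊠ (m ⊠ (conˢ (+ 1) ⊞ v))))) ≈ˢ-refl (q^ (suc s)) (q^ s) (ε s) (q^ (s ℕ.* suc s)) (ℳ r))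
  (⊛-congˡ 2ˢ (⊛-cong (≈ˢ-sym (ε-suc s)) (⊛-congʳ (ℳ s) (≈ˢ-sym (q^-+ (suc s) (s ℕ.* suc s))))))
  where s = suc r

shanks-zero : ∀ s → shanks (suc s) 0 ≈ˢ -ˢ (q^ (suc s) ⊛ (q^ (suc s) ⊛ ((1ˢ +ˢ q^ s) ⊛ shanks s 0)))
shanks-zero s = ≈ˢ-trans
  (⊛-congˡ 2ˢ (⊛-congˡ (ε (suc s)) (⊛-congʳ (ℳ s) (≈ˢ-trans (q^-≡ (ℕ.*-suc (suc s) (suc s))) (q^-+ (suc s) (suc s ℕ.* suc s))))))
  (≈ˢ-trans
    (solveˢ 4 (λ e u w m → conˢ (+ 2) ⊠ (e ⊠ ((u ⊠ w) ⊠ m)) ≑ u ⊠ (conˢ (+ 2) ⊠ (e ⊠ (w ⊠ m)))) ≈ˢ-refl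
      (ε (suc s)) (q^ (suc s)) (q^ (suc s ℕ.* suc s)) (ℳ s))
    (≈ˢ-trans (⊛-congˡ (q^ (suc s)) (≈ˢ-sym (shanks-diagonal s)))
      (solveˢ 2 (λ u x → u ⊠ (⊟ x) ≑ ⊟ (u ⊠ x)) ≈ˢ-refl (q^ (suc s)) (q^ (suc s) ⊛ ((1ˢ +ˢ q^ s) ⊛ shanks s 0)))))

-- The two entries are neighbours on one antidiagonal. Their ratio is so simple that in
-- `antidiagonal-step` the boundary term left by one entry is absorbed by the next.
shanks-neighbours : ∀ s k → (1ˢ +ˢ (-ˢ q^ (suc s))) ⊛ shanks (suc s) k ≈ˢ
                            -ˢ (q^ (suc (suc (s ℕ.+ k))) ⊛ ((1ˢ +ˢ q^ s) ⊛ shanks s (suc k)))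
shanks-neighbours s zero = beginˢ
  (1ˢ +ˢ (-ˢ u)) ⊛ shanks (suc s) 0
    ≈⟨ ⊛-congˡ (1ˢ +ˢ (-ˢ u)) (shanks-zero s) ⟩
  (1ˢ +ˢ (-ˢ u)) ⊛ (-ˢ (u ⊛ (u ⊛ ((1ˢ +ˢ v) ⊛ x))))
    ≈⟨ solveˢ 3 (λ u v x → (conˢ (+ 1) ⊞ (⊟ u)) ⊠ (⊟ (u ⊠ (u ⊠ ((conˢ (+ 1) ⊞ v) ⊠ x)))) ≑
         ⊟ ((u ⊠ u) ⊠ ((conˢ (+ 1) ⊞ v) ⊠ (x ⊠ (conˢ (+ 1) ⊞ (⊟ u)))))) ≈ˢ-refl u v x ⟩
  -ˢ ((u ⊛ u) ⊛ ((1ˢ +ˢ v) ⊛ (x ⊛ (1ˢ +ˢ (-ˢ u)))))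
    ≈⟨ -ˢ-cong (⊛-cong powers (⊛-congˡ (1ˢ +ˢ v) (⊛-congˡ x (+ˢ-congˡ 1ˢ (-ˢ-cong (q^-≡ (ℕ.+-comm 1 s))))))) ⟩
  -ˢ ((z ⊛ v) ⊛ ((1ˢ +ˢ v) ⊛ (x ⊛ (1ˢ +ˢ (-ˢ q^ (s ℕ.+ 1))))))
    ≈⟨ solveˢ 5 (λ z v o x c → ⊟ ((z ⊠ v) ⊠ ((o ⊞ v) ⊠ (x ⊠ c))) ≑ ⊟ (z ⊠ ((o ⊞ v) ⊠ (x ⊠ (v ⊠ c))))) ≈ˢ-refl
         z v 1ˢ x (1ˢ +ˢ (-ˢ q^ (s ℕ.+ 1))) ⟩
  -ˢ (z ⊛ ((1ˢ +ˢ v) ⊛ (x ⊛ (v ⊛ (1ˢ +ˢ (-ˢ q^ (s ℕ.+ 1)))))))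
    ≈⟨ -ˢ-cong (⊛-congˡ z (⊛-congˡ (1ˢ +ˢ v) (shanks-suc s 0))) ⟨
  -ˢ (z ⊛ ((1ˢ +ˢ v) ⊛ shanks s 1)) ∎ˢ
  where
  open Ser-Reasoning
  u = q^ (suc s)
  v = q^ s
  x = shanks s 0
  z = q^ (suc (suc (s ℕ.+ 0)))
  powers : u ⊛ u ≈ˢ z ⊛ v
  powers = ≈ˢ-trans (≈ˢ-sym (q^-+ (suc s) (suc s))) (≈ˢ-trans
    (q^-≡ (trans (cong suc (ℕ.+-suc s s)) (cong (λ n → suc (suc (n ℕ.+ s))) (sym (ℕ.+-identityʳ s)))))
    (q^-+ (suc (suc (s ℕ.+ 0))) s))
shanks-neighbours s (suc k) = beginˢ
  (1ˢ +ˢ (-ˢ u)) ⊛ (shanks (suc s) k ⊛ (u ⊛ (1ˢ +ˢ (-ˢ q^ (suc s ℕ.+ suc k)))))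
    ≈⟨ solveˢ 4 (λ a b u c → a ⊠ (b ⊠ (u ⊠ c)) ≑ (a ⊠ b) ⊠ (u ⊠ c)) ≈ˢ-refl
         (1ˢ +ˢ (-ˢ u)) (shanks (suc s) k) u (1ˢ +ˢ (-ˢ q^ (suc s ℕ.+ suc k))) ⟩
  ((1ˢ +ˢ (-ˢ u)) ⊛ shanks (suc s) k) ⊛ (u ⊛ (1ˢ +ˢ (-ˢ q^ (suc s ℕ.+ suc k))))
    ≈⟨ ⊛-cong (shanks-neighbours s k) (⊛-congˡ u (+ˢ-congˡ 1ˢ (-ˢ-cong (q^-≡ (sym (ℕ.+-suc s (suc k))))))) ⟩
  (-ˢ (z ⊛ ((1ˢ +ˢ v) ⊛ x))) ⊛ (u ⊛ c)
    ≈⟨ solveˢ 5 (λ z a x u c → (⊟ (z ⊠ (a ⊠ x))) ⊠ (u ⊠ c) ≑ ⊟ ((z ⊠ u) ⊠ (a ⊠ (x ⊠ c)))) ≈ˢ-refl z (1ˢ +ˢ v) x u c ⟩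
  -ˢ ((z ⊛ u) ⊛ ((1ˢ +ˢ v) ⊛ (x ⊛ c)))
    ≈⟨ -ˢ-cong (⊛-congʳ ((1ˢ +ˢ v) ⊛ (x ⊛ c)) powers) ⟩
  -ˢ ((z′ ⊛ v) ⊛ ((1ˢ +ˢ v) ⊛ (x ⊛ c)))
    ≈⟨ solveˢ 5 (λ z v a x c → ⊟ ((z ⊠ v) ⊠ (a ⊠ (x ⊠ c))) ≑ ⊟ (z ⊠ (a ⊠ (x ⊠ (v ⊠ c))))) ≈ˢ-refl z′ v (1ˢ +ˢ v) x c ⟩
  -ˢ (z′ ⊛ ((1ˢ +ˢ v) ⊛ (x ⊛ (v ⊛ c))))
    ≈⟨ -ˢ-cong (⊛-congˡ z′ (⊛-congˡ (1ˢ +ˢ v) (shanks-suc s (suc k)))) ⟨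
  -ˢ (z′ ⊛ ((1ˢ +ˢ v) ⊛ shanks s (suc (suc k)))) ∎ˢ
  where
  open Ser-Reasoning
  u = q^ (suc s)
  v = q^ s
  x = shanks s (suc k)
  c = 1ˢ +ˢ (-ˢ q^ (s ℕ.+ suc (suc k)))
  z = q^ (suc (suc (s ℕ.+ k)))
  z′ = q^ (suc (suc (s ℕ.+ suc k)))
  powers : z ⊛ u ≈ˢ z′ ⊛ v
  powers = ≈ˢ-trans (≈ˢ-sym (q^-+ (suc (suc (s ℕ.+ k))) (suc s))) (≈ˢ-trans
    (q^-≡ (cong (suc ∘ suc) (trans (ℕ.+-suc (s ℕ.+ k) s) (cong (ℕ._+ s) (sym (ℕ.+-suc s k))))))
    (q^-+ (suc (suc (s ℕ.+ suc k))) s))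

antidiagonal : ℕ → ℕ → Series
antidiagonal zero    k = 𝒩 k
antidiagonal (suc j) k = antidiagonal j (suc k) +ˢ shanks (suc j) k

-- Multiplication by the next factor of `ℳ` carries a partial antidiagonal to the following one, up
-- to a boundary term at its last entry. By induction on the number of entries the inner boundary
-- terms cancel.
antidiagonal-step : ∀ j k → let n = q^ (suc (j ℕ.+ k)) in
  (1ˢ +ˢ n) ⊛ antidiagonal j k ≈ˢ antidiagonal j (suc k) +ˢ n ⊛ ((1ˢ +ˢ q^ j) ⊛ shanks j k)
antidiagonal-step zero k = ≈ˢ-trans
  (solveˢ 2 (λ n x → (conˢ (+ 1) ⊞ n) ⊠ x ≑ x ⊠ (conˢ (+ 1) ⊞ (⊟ n)) ⊞ n ⊠ ((conˢ (+ 1) ⊞ conˢ (+ 1)) ⊠ x)) ≈ˢ-refl (q^ (suc k)) (𝒩 k))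
  (+ˢ-congˡ (𝒩 (suc k)) (⊛-congˡ (q^ (suc k)) (⊛-congʳ (𝒩 k) (+ˢ-congˡ 1ˢ (≈ˢ-sym q⁰≈1)))))
antidiagonal-step (suc j) k = beginˢ
  (1ˢ +ˢ n) ⊛ (antidiagonal j (suc k) +ˢ x)
    ≈⟨ solveˢ 3 (λ n d x → (conˢ (+ 1) ⊞ n) ⊠ (d ⊞ x) ≑ (conˢ (+ 1) ⊞ n) ⊠ d ⊞ (conˢ (+ 1) ⊞ n) ⊠ x) ≈ˢ-refl n (antidiagonal j (suc k)) x ⟩
  (1ˢ +ˢ n) ⊛ antidiagonal j (suc k) +ˢ (1ˢ +ˢ n) ⊛ x
    ≈⟨ +ˢ-congʳ ((1ˢ +ˢ n) ⊛ x) (≈ˢ-trans (⊛-congʳ (antidiagonal j (suc k)) (+ˢ-congˡ 1ˢ n≈n′))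
         (≈ˢ-trans (antidiagonal-step j (suc k)) (+ˢ-congˡ (antidiagonal j (suc (suc k))) (⊛-congʳ ((1ˢ +ˢ q^ j) ⊛ y) (≈ˢ-sym n≈n′))))) ⟩
  (antidiagonal j (suc (suc k)) +ˢ n ⊛ ((1ˢ +ˢ q^ j) ⊛ y)) +ˢ (1ˢ +ˢ n) ⊛ x
    ≈⟨ +ˢ-congʳ ((1ˢ +ˢ n) ⊛ x) (+ˢ-congˡ (antidiagonal j (suc (suc k))) flipped) ⟩
  (antidiagonal j (suc (suc k)) +ˢ (-ˢ ((1ˢ +ˢ (-ˢ u)) ⊛ x))) +ˢ (1ˢ +ˢ n) ⊛ x
    ≈⟨ solveˢ 4 (λ d u n x → (d ⊞ (⊟ ((conˢ (+ 1) ⊞ (⊟ u)) ⊠ x))) ⊞ (conˢ (+ 1) ⊞ n) ⊠ x ≑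
         (d ⊞ x ⊠ (u ⊠ (conˢ (+ 1) ⊞ (⊟ n)))) ⊞ n ⊠ ((conˢ (+ 1) ⊞ u) ⊠ x)) ≈ˢ-refl (antidiagonal j (suc (suc k))) u n x ⟩
  (antidiagonal j (suc (suc k)) +ˢ x ⊛ (u ⊛ (1ˢ +ˢ (-ˢ n)))) +ˢ n ⊛ ((1ˢ +ˢ u) ⊛ x)
    ≈⟨ +ˢ-congʳ (n ⊛ ((1ˢ +ˢ u) ⊛ x)) (+ˢ-congˡ (antidiagonal j (suc (suc k)))
         (⊛-congˡ x (⊛-congˡ u (+ˢ-congˡ 1ˢ (-ˢ-cong (q^-≡ (sym (ℕ.+-suc (suc j) k)))))))) ⟩
  antidiagonal (suc j) (suc k) +ˢ n ⊛ ((1ˢ +ˢ u) ⊛ x) ∎ˢ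
  where
  open Ser-Reasoning
  n = q^ (suc (suc j ℕ.+ k))
  u = q^ (suc j)
  x = shanks (suc j) k
  y = shanks j (suc k)
  n≈n′ : n ≈ˢ q^ (suc (j ℕ.+ suc k))
  n≈n′ = q^-≡ (cong suc (sym (ℕ.+-suc j k)))
  flipped : n ⊛ ((1ˢ +ˢ q^ j) ⊛ y) ≈ˢ -ˢ ((1ˢ +ˢ (-ˢ u)) ⊛ x)
  flipped = ≈ˢ-trans (solveˢ 1 (λ a → a ≑ ⊟ (⊟ a)) ≈ˢ-refl (n ⊛ ((1ˢ +ˢ q^ j) ⊛ y))) (-ˢ-cong (≈ˢ-sym (shanks-neighbours j k)))

-- The boundary term of `antidiagonal-step` cancels against the increment of `𝒮`; this increment
-- times qⁿ⁺¹ is left over and is the new corner `shanks (suc n) 0`.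
𝒮ℳ : ∀ n → 𝒮 n ⊛ ℳ n ≈ˢ antidiagonal n 0
𝒮ℳ zero = solveˢ 0 (conˢ (+ 1) ⊠ conˢ (+ 1) ≑ conˢ (+ 1)) ≈ˢ-refl
𝒮ℳ (suc n) = beginˢ
  (𝒮 n +ˢ 2ˢ ⊛ (e ⊛ z)) ⊛ (ℳ n ⊛ (1ˢ +ˢ u))
    ≈⟨ solveˢ 5 (λ s e z m u → (s ⊞ conˢ (+ 2) ⊠ (e ⊠ z)) ⊠ (m ⊠ (conˢ (+ 1) ⊞ u)) ≑
         (conˢ (+ 1) ⊞ u) ⊠ (s ⊠ m) ⊞ (conˢ (+ 2) ⊠ (e ⊠ (z ⊠ m)) ⊞ u ⊠ (conˢ (+ 2) ⊠ (e ⊠ (z ⊠ m))))) ≈ˢ-refl (𝒮 n) e z (ℳ n) u ⟩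
  (1ˢ +ˢ u) ⊛ (𝒮 n ⊛ ℳ n) +ˢ (2ˢ ⊛ (e ⊛ (z ⊛ ℳ n)) +ˢ u ⊛ (2ˢ ⊛ (e ⊛ (z ⊛ ℳ n))))
    ≈⟨ Ser.+-cong first (Ser.+-cong (≈ˢ-sym (shanks-diagonal n)) (⊛-congˡ u (≈ˢ-sym (shanks-diagonal n)))) ⟩
  (antidiagonal n 1 +ˢ u ⊛ y) +ˢ ((-ˢ (u ⊛ y)) +ˢ u ⊛ (-ˢ (u ⊛ y)))
    ≈⟨ solveˢ 3 (λ d u y → (d ⊞ u ⊠ y) ⊞ ((⊟ (u ⊠ y)) ⊞ u ⊠ (⊟ (u ⊠ y))) ≑ d ⊞ (⊟ (u ⊠ (u ⊠ y)))) ≈ˢ-refl (antidiagonal n 1) u y ⟩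
  antidiagonal n 1 +ˢ (-ˢ (u ⊛ (u ⊛ y)))
    ≈⟨ +ˢ-congˡ (antidiagonal n 1) (shanks-zero n) ⟨
  antidiagonal (suc n) 0 ∎ˢ
  where
  open Ser-Reasoning
  e = ε (suc n)
  u = q^ (suc n)
  z = q^ (suc n ℕ.* suc n)
  y = (1ˢ +ˢ q^ n) ⊛ shanks n 0
  u≈ : u ≈ˢ q^ (suc (n ℕ.+ 0))
  u≈ = q^-≡ (cong suc (sym (ℕ.+-identityʳ n)))
  first : (1ˢ +ˢ u) ⊛ (𝒮 n ⊛ ℳ n) ≈ˢ antidiagonal n 1 +ˢ u ⊛ y
  first = ≈ˢ-trans (⊛-cong (+ˢ-congˡ 1ˢ u≈) (𝒮ℳ n)) (≈ˢ-trans (antidiagonal-step n 0)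
    (+ˢ-congˡ (antidiagonal n 1) (⊛-congʳ y (≈ˢ-sym u≈))))

Vanishes-≤ : ∀ {M N a} → M ℕ.≤ N → Vanishes N a → Vanishes M a
Vanishes-≤ M≤N p n n<M = p n (ℕ.≤-trans n<M M≤N)

Vanishes-≈ : ∀ {N a b} → a ≈ˢ b → Vanishes N a → Vanishes N b
Vanishes-≈ eq p n n<N = trans (sym (at eq n)) (p n n<N)

-- On the N-th antidiagonal every entry outside row 0 has order greater than N, so modulo qᴺ⁺¹ only
-- `𝒩 N` remains.
Vanishes-shanks : ∀ s k → Vanishes (suc (suc s ℕ.+ k)) (shanks (suc s) k)
Vanishes-shanks s zero = Vanishes-⊛ 2ˢ (Vanishes-⊛ (ε (suc s)) (Vanishes-≤ le (Vanishes-q^ {a = ℳ s} (suc s ℕ.* suc (suc s)) λ _ ())))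
  where
  le : suc (suc s ℕ.+ 0) ℕ.≤ suc s ℕ.* suc (suc s) ℕ.+ 0
  le = ℕ.≤-trans (ℕ.≤-reflexive (cong (suc ∘ suc) (ℕ.+-identityʳ s)))
    (ℕ.≤-trans (ℕ.m≤m+n (suc (suc s)) (s ℕ.* suc (suc s))) (ℕ.m≤m+n (suc s ℕ.* suc (suc s)) 0))
Vanishes-shanks s (suc k) = Vanishes-≈
  (solveˢ 3 (λ x u c → u ⊠ (c ⊠ x) ≑ x ⊠ (u ⊠ c)) ≈ˢ-refl (shanks (suc s) k) (q^ (suc s)) c)
  (Vanishes-≤ le (Vanishes-q^ (suc s) (Vanishes-⊛ c (Vanishes-shanks s k))))
  where
  c = 1ˢ +ˢ (-ˢ q^ (suc s ℕ.+ suc k))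
  le : suc (suc s ℕ.+ suc k) ℕ.≤ suc s ℕ.+ suc (suc s ℕ.+ k)
  le = subst (ℕ._≤ suc s ℕ.+ suc (suc s ℕ.+ k)) (cong (suc ∘ suc) (sym (ℕ.+-suc s k))) (s≤s (ℕ.m≤n+m (suc (suc s ℕ.+ k)) s))

antidiagonal-≈[] : ∀ j k → antidiagonal j k ≈[ j ℕ.+ k ] 𝒩 (j ℕ.+ k)
antidiagonal-≈[] zero    k n n≤ = refl
antidiagonal-≈[] (suc j) k n n≤ = trans
  (cong₂ _+_ (antidiagonal-≈[] j (suc k) n (subst (n ℕ.≤_) (sym (ℕ.+-suc j k)) n≤)) (Vanishes-shanks j k n (s≤s n≤)))
  (trans (ℤ.+-identityʳ _) (cong (λ m → 𝒩 m n) (ℕ.+-suc j k)))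

perturb : ∀ n {a b c} → a ≈ˢ b +ˢ q^ (suc n) ⊛ c → a ≈[ n ] b
perturb n {a} {b} {c} eq i i≤n = trans (at eq i)
  (trans (cong (λ z → b i + z) (Vanishes-q^ {a = c} (suc n) (λ _ ()) i (s≤s (ℕ.≤-trans i≤n (ℕ.m≤m+n n 0))))) (ℤ.+-identityʳ (b i)))

-- X is θ₄(q); θ₃(q) is called Y below.
E₁ M X : Series
E₁ = lim 𝒩
M  = lim ℳ
X  = lim 𝒮

𝒩-stable : Stable 𝒩
𝒩-stable n = perturb n {c = -ˢ 𝒩 n} (solveˢ 2 (λ x u → x ⊠ (conˢ (+ 1) ⊞ (⊟ u)) ≑ x ⊞ u ⊠ (⊟ x)) ≈ˢ-refl (𝒩 n) (q^ (suc n)))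

ℳ-stable : Stable ℳ
ℳ-stable n = perturb n {c = ℳ n} (solveˢ 2 (λ x u → x ⊠ (conˢ (+ 1) ⊞ u) ≑ x ⊞ u ⊠ x) ≈ˢ-refl (ℳ n) (q^ (suc n)))

𝒮-stable : Stable 𝒮
𝒮-stable n = perturb n {c = 2ˢ ⊛ (ε (suc n) ⊛ q^ (n ℕ.* suc n))} (≈ˢ-trans
  (+ˢ-congˡ (𝒮 n) (⊛-congˡ 2ˢ (⊛-congˡ (ε (suc n)) (q^-+ (suc n) (n ℕ.* suc n)))))
  (solveˢ 4 (λ s e u v → s ⊞ conˢ (+ 2) ⊠ (e ⊠ (u ⊠ v)) ≑ s ⊞ u ⊠ (conˢ (+ 2) ⊠ (e ⊠ v))) ≈ˢ-refl (𝒮 n) (ε (suc n)) (q^ (suc n)) (q^ (n ℕ.* suc n))))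

X⊛M : X ⊛ M ≈ˢ E₁
X⊛M = by-truncation λ N n n≤N → begin
  (X ⊛ M) n           ≡⟨ ≈[]-⊛ {a = X} {𝒮 N} {M} {ℳ N} (lim-≈[] 𝒮-stable N) (lim-≈[] ℳ-stable N) n n≤N ⟩
  (𝒮 N ⊛ ℳ N) n       ≡⟨ at (𝒮ℳ N) n ⟩
  antidiagonal N 0 n  ≡⟨ antidiagonal-≈[] N 0 n (ℕ.≤-trans n≤N (ℕ.m≤m+n N 0)) ⟩
  𝒩 (N ℕ.+ 0) n       ≡⟨ cong (λ m → 𝒩 m n) (ℕ.+-identityʳ N) ⟩
  𝒩 N n               ≡⟨ lim-≈[] 𝒩-stable N n n≤N ⟨
  E₁ n                ∎

dbl-+ : ∀ n → dbl n ≡ n ℕ.+ n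
dbl-+ zero    = refl
dbl-+ (suc n) = cong suc (trans (cong suc (dbl-+ n)) (sym (ℕ.+-suc n n)))

double-1 : double 1ˢ ≈ˢ 1ˢ
double-1 = ≈ˢ-intro λ n → trans (double-·ₙ n (+ 1) (q^ 0)) (cong (+ 1 *_) (at (double-q^ 0) n))

𝒩ℳ : ∀ n → 𝒩 n ⊛ ℳ n ≈ˢ double (𝒩 n)
𝒩ℳ zero    = ≈ˢ-trans (solveˢ 0 (conˢ (+ 1) ⊠ conˢ (+ 1) ≑ conˢ (+ 1)) ≈ˢ-refl) (≈ˢ-sym double-1)
𝒩ℳ (suc n) = beginˢ
  (𝒩 n ⊛ (1ˢ +ˢ (-ˢ u))) ⊛ (ℳ n ⊛ (1ˢ +ˢ u))
    ≈⟨ solveˢ 3 (λ x y u → (x ⊠ (conˢ (+ 1) ⊞ (⊟ u))) ⊠ (y ⊠ (conˢ (+ 1) ⊞ u)) ≑ (x ⊠ y) ⊠ (conˢ (+ 1) ⊞ (⊟ (u ⊠ u)))) ≈ˢ-refl (𝒩 n) (ℳ n) u ⟩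
  (𝒩 n ⊛ ℳ n) ⊛ (1ˢ +ˢ (-ˢ (u ⊛ u)))
    ≈⟨ ⊛-cong (𝒩ℳ n) (Ser.+-cong (≈ˢ-sym double-1) (-ˢ-cong u²)) ⟩
  double (𝒩 n) ⊛ (double 1ˢ +ˢ (-ˢ double u))
    ≈⟨ ⊛-congˡ (double (𝒩 n)) (≈ˢ-trans (double-+ 1ˢ (-ˢ u)) (+ˢ-congˡ (double 1ˢ) (double-neg u))) ⟨
  double (𝒩 n) ⊛ double (1ˢ +ˢ (-ˢ u))
    ≈⟨ double-⊛ (𝒩 n) (1ˢ +ˢ (-ˢ u)) ⟨
  double (𝒩 (suc n)) ∎ˢ
  where
  open Ser-Reasoning
  u = q^ (suc n)
  u² : u ⊛ u ≈ˢ double u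
  u² = ≈ˢ-trans (≈ˢ-sym (q^-+ (suc n) (suc n))) (≈ˢ-trans (q^-≡ (sym (dbl-+ (suc n)))) (≈ˢ-sym (double-q^ (suc n))))

E₁⊛M : E₁ ⊛ M ≈ˢ double E₁
E₁⊛M = by-truncation λ N n n≤N → begin
  (E₁ ⊛ M) n         ≡⟨ ≈[]-⊛ {a = E₁} {𝒩 N} {M} {ℳ N} (lim-≈[] 𝒩-stable N) (lim-≈[] ℳ-stable N) n n≤N ⟩
  (𝒩 N ⊛ ℳ N) n      ≡⟨ at (𝒩ℳ N) n ⟩
  double (𝒩 N) n     ≡⟨ ≈[]-double {a = E₁} {𝒩 N} (lim-≈[] 𝒩-stable N) n n≤N ⟨
  double E₁ n        ∎

-- Gauss's identity
X⊛E₂ : X ⊛ double E₁ ≈ˢ E₁ ⊛ E₁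
X⊛E₂ = ≈ˢ-trans (⊛-congˡ X (≈ˢ-sym E₁⊛M))
  (≈ˢ-trans (solveˢ 3 (λ x e m → x ⊠ (e ⊠ m) ≑ (x ⊠ m) ⊠ e) ≈ˢ-refl X E₁ M) (⊛-congʳ E₁ X⊛M))

double-constant : ∀ k → double (constantˢ k) ≈ˢ constantˢ k
double-constant k = ≈ˢ-intro λ n → trans (double-·ₙ n k (q^ 0)) (cong (k *_) (at (double-q^ 0) n))

-- The series θ₃ and the sum θ₃ + θ₄

𝒴 : ℕ → Series
𝒴 zero    = 1ˢ
𝒴 (suc n) = 𝒴 n +ˢ 2ˢ ⊛ q^ (suc n ℕ.* suc n)

Y : Series
Y = lim 𝒴

𝒴-stable : Stable 𝒴
𝒴-stable n = perturb n {c = 2ˢ ⊛ q^ (n ℕ.* suc n)} (≈ˢ-trans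
  (+ˢ-congˡ (𝒴 n) (⊛-congˡ 2ˢ (q^-+ (suc n) (n ℕ.* suc n))))
  (solveˢ 3 (λ s u v → s ⊞ conˢ (+ 2) ⊠ (u ⊠ v) ≑ s ⊞ u ⊠ (conˢ (+ 2) ⊠ v)) ≈ˢ-refl (𝒴 n) (q^ (suc n)) (q^ (n ℕ.* suc n))))

sgn-+ : ∀ m n → sgn (m ℕ.+ n) ≡ sgn m * sgn n
sgn-+ zero    n = sym (ℤ.*-identityˡ (sgn n))
sgn-+ (suc m) n = trans (cong -_ (sgn-+ m n)) (ℤ.neg-distribˡ-* (sgn m) (sgn n))

sgn-n² : ∀ n → sgn (n ℕ.* n) ≡ sgn n
sgn-n² zero    = refl
sgn-n² (suc n) = begin
  sgn (suc n ℕ.+ n ℕ.* suc n)                  ≡⟨ sgn-+ (suc n) (n ℕ.* suc n) ⟩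
  sgn (suc n) * sgn (n ℕ.* suc n)              ≡⟨ cong (λ k → sgn (suc n) * sgn k) (ℕ.*-suc n n) ⟩
  sgn (suc n) * sgn (n ℕ.+ n ℕ.* n)            ≡⟨ cong (sgn (suc n) *_) (trans (sgn-+ n (n ℕ.* n)) (trans (cong (sgn n *_) (sgn-n² n)) (sgn-square n))) ⟩
  sgn (suc n) * + 1                            ≡⟨ ℤ.*-identityʳ (sgn (suc n)) ⟩
  sgn (suc n)                                  ∎

ε-square : ∀ n → ε n ⊛ ε n ≈ˢ 1ˢ
ε-square n = ≈ˢ-intro λ i → trans (sym (at (·ˢ-as-⊛ (sgn n) (ε n)) i))
  (trans (sym (ℤ.*-assoc (sgn n) (sgn n) (q^ 0 i))) (cong (_* q^ 0 i) (sgn-square n)))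

σ-constant : ∀ k → σ (constantˢ k) ≈ˢ constantˢ k
σ-constant k = ≈ˢ-intro λ n → trans
  (solve 3 (λ s k o → s :* (k :* o) := k :* (s :* o)) refl (sgn n) k (q^ 0 n))
  (cong (k *_) (trans (at (σ-q^ 0) n) (ℤ.*-identityˡ (q^ 0 n))))

σ-q^-square : ∀ n → σ (q^ (n ℕ.* n)) ≈ˢ ε n ⊛ q^ (n ℕ.* n)
σ-q^-square n = ≈ˢ-trans (σ-q^ (n ℕ.* n)) (≈ˢ-trans (≈ˢ-intro λ i → cong (_* q^ (n ℕ.* n) i) (sgn-n² n)) (·ˢ-as-⊛ (sgn n) (q^ (n ℕ.* n))))

σ-𝒮 : ∀ n → σ (𝒮 n) ≈ˢ 𝒴 n
σ-𝒮 zero    = σ-constant (+ 1)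
σ-𝒮 (suc n) = ≈ˢ-trans (σ-+ (𝒮 n) (2ˢ ⊛ (e ⊛ z))) (Ser.+-cong (σ-𝒮 n) (beginˢ
  σ (2ˢ ⊛ (e ⊛ z))        ≈⟨ ≈ˢ-trans (σ-⊛ 2ˢ (e ⊛ z)) (⊛-congˡ (σ 2ˢ) (σ-⊛ e z)) ⟩
  σ 2ˢ ⊛ (σ e ⊛ σ z)      ≈⟨ ⊛-cong (σ-constant (+ 2)) (⊛-cong (σ-constant (sgn (suc n))) (σ-q^-square (suc n))) ⟩
  2ˢ ⊛ (e ⊛ (e ⊛ z))      ≈⟨ solveˢ 3 (λ t e z → t ⊠ (e ⊠ (e ⊠ z)) ≑ (e ⊠ e) ⊠ (t ⊠ z)) ≈ˢ-refl 2ˢ e z ⟩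
  (e ⊛ e) ⊛ (2ˢ ⊛ z)      ≈⟨ ⊛-congʳ (2ˢ ⊛ z) (ε-square (suc n)) ⟩
  1ˢ ⊛ (2ˢ ⊛ z)           ≈⟨ solveˢ 1 (λ a → conˢ (+ 1) ⊠ a ≑ a) ≈ˢ-refl (2ˢ ⊛ z) ⟩
  2ˢ ⊛ z                  ∎ˢ))
  where
  open Ser-Reasoning
  e = ε (suc n)
  z = q^ (suc n ℕ.* suc n)

σX : σ X ≈ˢ Y
σX = ≈ˢ-intro λ n → at (σ-𝒮 n) n

σY : σ Y ≈ˢ X
σY = ≈ˢ-trans (σ-cong (≈ˢ-sym σX)) (σ-σ X)

dbl-square : ∀ n → dbl (dbl (n ℕ.* n)) ≡ dbl n ℕ.* dbl n
dbl-square n = ℤ.+-injective (begin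
  + dbl (dbl (n ℕ.* n))            ≡⟨ trans (+dbl (dbl (n ℕ.* n))) (cong (+ 2 *_) (+dbl (n ℕ.* n))) ⟩
  + 2 * (+ 2 * + (n ℕ.* n))        ≡⟨ cong (λ z → + 2 * (+ 2 * z)) (ℤ.pos-* n n) ⟩
  + 2 * (+ 2 * (+ n * + n))        ≡⟨ solve 1 (λ n → con (+ 2) :* (con (+ 2) :* (n :* n)) := (con (+ 2) :* n) :* (con (+ 2) :* n)) refl (+ n) ⟩
  (+ 2 * + n) * (+ 2 * + n)        ≡⟨ cong₂ _*_ (+dbl n) (+dbl n) ⟨
  + dbl n * + dbl n                ≡⟨ ℤ.pos-* (dbl n) (dbl n) ⟨
  + (dbl n ℕ.* dbl n)              ∎)

-- The even part of Y comes from the squares of even numbers.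
𝒮+𝒴 : ∀ n → 𝒮 (dbl n) +ˢ 𝒴 (dbl n) ≈ˢ 2ˢ ⊛ double (double (𝒴 n))
𝒮+𝒴 zero    = ≈ˢ-trans (solveˢ 0 (conˢ (+ 1) ⊞ conˢ (+ 1) ≑ conˢ (+ 2) ⊠ conˢ (+ 1)) ≈ˢ-refl)
  (⊛-congˡ 2ˢ (≈ˢ-sym (≈ˢ-trans (double-cong double-1) double-1)))
𝒮+𝒴 (suc n) = beginˢ
  ((𝒮 m +ˢ 2ˢ ⊛ (ε (suc m) ⊛ u)) +ˢ 2ˢ ⊛ (ε (suc (suc m)) ⊛ v)) +ˢ ((𝒴 m +ˢ 2ˢ ⊛ u) +ˢ 2ˢ ⊛ v)
    ≈⟨ Ser.+-cong (Ser.+-cong (+ˢ-congˡ (𝒮 m) (⊛-congˡ 2ˢ (⊛-congʳ u ε-odd))) (⊛-congˡ 2ˢ (⊛-congʳ v ε-even))) ≈ˢ-refl ⟩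
  ((𝒮 m +ˢ 2ˢ ⊛ ((-ˢ 1ˢ) ⊛ u)) +ˢ 2ˢ ⊛ (1ˢ ⊛ v)) +ˢ ((𝒴 m +ˢ 2ˢ ⊛ u) +ˢ 2ˢ ⊛ v)
    ≈⟨ solveˢ 4 (λ s y u v → ((s ⊞ conˢ (+ 2) ⊠ ((⊟ conˢ (+ 1)) ⊠ u)) ⊞ conˢ (+ 2) ⊠ (conˢ (+ 1) ⊠ v)) ⊞ ((y ⊞ conˢ (+ 2) ⊠ u) ⊞ conˢ (+ 2) ⊠ v) ≑
         (s ⊞ y) ⊞ conˢ (+ 2) ⊠ (conˢ (+ 2) ⊠ v)) ≈ˢ-refl (𝒮 m) (𝒴 m) u v ⟩
  (𝒮 m +ˢ 𝒴 m) +ˢ 2ˢ ⊛ (2ˢ ⊛ v)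
    ≈⟨ Ser.+-cong (𝒮+𝒴 n) (⊛-congˡ 2ˢ (≈ˢ-sym increment)) ⟩
  2ˢ ⊛ double (double (𝒴 n)) +ˢ 2ˢ ⊛ double (double (2ˢ ⊛ z))
    ≈⟨ Ser.distribˡ 2ˢ (double (double (𝒴 n))) (double (double (2ˢ ⊛ z))) ⟨
  2ˢ ⊛ (double (double (𝒴 n)) +ˢ double (double (2ˢ ⊛ z)))
    ≈⟨ ⊛-congˡ 2ˢ (≈ˢ-trans (double-cong (double-+ (𝒴 n) (2ˢ ⊛ z))) (double-+ (double (𝒴 n)) (double (2ˢ ⊛ z)))) ⟨
  2ˢ ⊛ double (double (𝒴 (suc n))) ∎ˢ
  where
  open Ser-Reasoning
  m = dbl n
  u = q^ (suc m ℕ.* suc m)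
  v = q^ (suc (suc m) ℕ.* suc (suc m))
  z = q^ (suc n ℕ.* suc n)
  ε-even : ε (dbl (suc n)) ≈ˢ 1ˢ
  ε-even = ≈ˢ-intro λ i → cong (_* q^ 0 i) (sgn-dbl (suc n))
  ε-odd : ε (suc m) ≈ˢ -ˢ 1ˢ
  ε-odd = ≈ˢ-trans (ε-suc m) (-ˢ-cong (≈ˢ-intro λ i → cong (_* q^ 0 i) (sgn-dbl n)))
  increment : double (double (2ˢ ⊛ z)) ≈ˢ 2ˢ ⊛ v
  increment = ≈ˢ-trans (double-cong (≈ˢ-trans (double-⊛ 2ˢ z) (⊛-cong (double-constant (+ 2)) (double-q^ (suc n ℕ.* suc n)))))
    (≈ˢ-trans (double-⊛ 2ˢ (q^ (dbl (suc n ℕ.* suc n))))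
      (⊛-cong (double-constant (+ 2)) (≈ˢ-trans (double-q^ (dbl (suc n ℕ.* suc n))) (q^-≡ (dbl-square (suc n))))))

n≤dbl : ∀ n → n ℕ.≤ dbl n
n≤dbl n = subst (n ℕ.≤_) (sym (dbl-+ n)) (ℕ.m≤m+n n n)

X+Y : X +ˢ Y ≈ˢ 2ˢ ⊛ double (double Y)
X+Y = by-truncation λ N n n≤N → begin
  X n + Y n
    ≡⟨ cong₂ _+_ (lim-≈[] 𝒮-stable (dbl N) n (ℕ.≤-trans n≤N (n≤dbl N))) (lim-≈[] 𝒴-stable (dbl N) n (ℕ.≤-trans n≤N (n≤dbl N))) ⟩
  𝒮 (dbl N) n + 𝒴 (dbl N) n
    ≡⟨ at (𝒮+𝒴 N) n ⟩
  (2ˢ ⊛ double (double (𝒴 N))) n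
    ≡⟨ ≈[]-⊛ {a = 2ˢ} {2ˢ} {double (double (𝒴 N))} {double (double Y)} (λ _ _ → refl)
         (≈[]-double {a = double (𝒴 N)} {double Y} (≈[]-double {a = 𝒴 N} {Y} λ i i≤N → sym (lim-≈[] 𝒴-stable N i i≤N))) n n≤N ⟩
  (2ˢ ⊛ double (double Y)) n ∎

-- Sums of two squares

zsum : ℕ → (ℤ → ℤ) → ℤ
zsum zero    h = h (+ 0)
zsum (suc N) h = zsum N h + (h (+ suc N) + h -[1+ N ])

zsum-cong : ∀ N {h k} → (∀ z → ℤ.∣ z ∣ ℕ.≤ N → h z ≡ k z) → zsum N h ≡ zsum N k
zsum-cong zero    eq = eq (+ 0) z≤n
zsum-cong (suc N) eq = cong₂ _+_ (zsum-cong N λ z le → eq z (ℕ.m≤n⇒m≤1+n le)) (cong₂ _+_ (eq (+ suc N) ℕ.≤-refl) (eq -[1+ N ] ℕ.≤-refl))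

zsum-*ˡ : ∀ N c h → zsum N (λ z → c * h z) ≡ c * zsum N h
zsum-*ˡ zero    c h = refl
zsum-*ˡ (suc N) c h = trans (cong (_+ (c * h (+ suc N) + c * h -[1+ N ])) (zsum-*ˡ N c h))
  (solve 4 (λ c a b d → c :* a :+ (c :* b :+ c :* d) := c :* (a :+ (b :+ d))) refl c (zsum N h) (h (+ suc N)) (h -[1+ N ]))

zsum-+ : ∀ N h k → zsum N (λ z → h z + k z) ≡ zsum N h + zsum N k
zsum-+ zero    h k = refl
zsum-+ (suc N) h k = trans (cong (_+ ((h (+ suc N) + k (+ suc N)) + (h -[1+ N ] + k -[1+ N ]))) (zsum-+ N h k))
  (solve 6 (λ a b c d e f → (a :+ b) :+ ((c :+ d) :+ (e :+ f)) := (a :+ (c :+ e)) :+ (b :+ (d :+ f))) refl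
    (zsum N h) (zsum N k) (h (+ suc N)) (k (+ suc N)) (h -[1+ N ]) (k -[1+ N ]))

zsum-swap : ∀ M N (h : ℤ → ℤ → ℤ) → zsum M (λ a → zsum N (h a)) ≡ zsum N (λ b → zsum M λ a → h a b)
zsum-swap zero    N h = refl
zsum-swap (suc M) N h = begin
  zsum M (λ a → zsum N (h a)) + (zsum N (h (+ suc M)) + zsum N (h -[1+ M ]))
    ≡⟨ cong₂ _+_ (zsum-swap M N h) (sym (zsum-+ N (h (+ suc M)) (h -[1+ M ]))) ⟩
  zsum N (λ b → zsum M λ a → h a b) + zsum N (λ b → h (+ suc M) b + h -[1+ M ] b)
    ≡⟨ zsum-+ N _ _ ⟨
  zsum N (λ b → zsum M (λ a → h a b) + (h (+ suc M) b + h -[1+ M ] b)) ∎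

zsum-0 : ∀ N → zsum N (λ _ → + 0) ≡ + 0
zsum-0 zero    = refl
zsum-0 (suc N) = cong (_+ + 0) (zsum-0 N)

δᶻ : ℤ → ℤ → ℤ
δᶻ a b = if does (a ℤ.≟ b) then + 1 else + 0

δᶻ-on : ∀ a → δᶻ a a ≡ + 1
δᶻ-on a = cong (if_then + 1 else + 0) (dec-true (a ℤ.≟ a) refl)

δᶻ-off : ∀ a b → a ≢ b → δᶻ a b ≡ + 0
δᶻ-off a b a≢b = cong (if_then + 1 else + 0) (dec-false (a ℤ.≟ b) a≢b)

zsum-δ : ∀ N c (h : ℤ → ℤ) → ℤ.∣ c ∣ ℕ.≤ N → zsum N (λ z → δᶻ z c * h z) ≡ h c
zsum-δ zero    (+ zero)   h le = ℤ.*-identityˡ (h (+ 0))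
zsum-δ (suc N) c          h le with ℤ.∣ c ∣ ℕ.≤? N
... | yes le′ = begin
  zsum N (λ z → δᶻ z c * h z) + (δᶻ (+ suc N) c * h (+ suc N) + δᶻ -[1+ N ] c * h -[1+ N ])
    ≡⟨ cong₂ _+_ (zsum-δ N c h le′) (cong₂ (λ x y → x * h (+ suc N) + y * h -[1+ N ])
         (δᶻ-off (+ suc N) c λ { refl → ℕ.1+n≰n le′ }) (δᶻ-off -[1+ N ] c λ { refl → ℕ.1+n≰n le′ })) ⟩
  h c + (+ 0 * h (+ suc N) + + 0 * h -[1+ N ])
    ≡⟨ solve 3 (λ a b c → a :+ (con (+ 0) :* b :+ con (+ 0) :* c) := a) refl (h c) (h (+ suc N)) (h -[1+ N ]) ⟩
  h c ∎
... | no ¬le′ = trans (cong (_+ (δᶻ (+ suc N) c * h (+ suc N) + δᶻ -[1+ N ] c * h -[1+ N ])) zeros) (endpoint c refl)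
  where
  zeros : zsum N (λ z → δᶻ z c * h z) ≡ + 0
  zeros = trans (zsum-cong N λ z z≤N → trans (cong (_* h z) (δᶻ-off z c λ { refl → ¬le′ z≤N })) (ℤ.*-zeroˡ (h z))) (zsum-0 N)
  size : ℤ.∣ c ∣ ≡ suc N
  size = ℕ.≤-antisym le (ℕ.≰⇒> ¬le′)
  endpoint : ∀ d → d ≡ c → + 0 + (δᶻ (+ suc N) c * h (+ suc N) + δᶻ -[1+ N ] c * h -[1+ N ]) ≡ h c
  endpoint (+ n) refl with size
  ... | refl = trans (cong₂ (λ x y → + 0 + (x * h (+ suc N) + y * h -[1+ N ])) (δᶻ-on (+ suc N)) (δᶻ-off -[1+ N ] (+ suc N) λ ()))
    (solve 2 (λ a b → con (+ 0) :+ (con (+ 1) :* a :+ con (+ 0) :* b) := a) refl (h (+ suc N)) (h -[1+ N ]))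
  endpoint -[1+ n ] refl with size
  ... | refl = trans (cong₂ (λ x y → + 0 + (x * h (+ suc N) + y * h -[1+ N ])) (δᶻ-off (+ suc N) -[1+ N ] λ ()) (δᶻ-on -[1+ N ]))
    (solve 2 (λ a b → con (+ 0) :+ (con (+ 0) :* a :+ con (+ 1) :* b) := b) refl (h (+ suc N)) (h -[1+ N ]))

norm : ℤ → ℤ → ℕ
norm a b = ℤ.∣ a ∣ ℕ.* ℤ.∣ a ∣ ℕ.+ ℤ.∣ b ∣ ℕ.* ℤ.∣ b ∣

∣z∣² : ∀ z → + (ℤ.∣ z ∣ ℕ.* ℤ.∣ z ∣) ≡ z * z
∣z∣² (+ n)    = ℤ.pos-* n n
∣z∣² -[1+ n ] = refl

+norm : ∀ a b → + norm a b ≡ a * a + b * b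
+norm a b = cong₂ _+_ (∣z∣² a) (∣z∣² b)

norm-rotate : ∀ r s → norm (r + s) (r - s) ≡ dbl (norm r s)
norm-rotate r s = ℤ.+-injective (begin
  + norm (r + s) (r - s)                   ≡⟨ +norm (r + s) (r - s) ⟩
  (r + s) * (r + s) + (r - s) * (r - s)    ≡⟨ solve 2 (λ r s → (r :+ s) :* (r :+ s) :+ (r :- s) :* (r :- s) := con (+ 2) :* (r :* r :+ s :* s)) refl r s ⟩
  + 2 * (r * r + s * s)                    ≡⟨ cong (+ 2 *_) (+norm r s) ⟨
  + 2 * + norm r s                         ≡⟨ +dbl (norm r s) ⟨
  + dbl (norm r s)                         ∎)

parityᶻ : ∀ z → (∃[ k ] z ≡ + 2 * k) ⊎ (∃[ k ] z ≡ + 2 * k + + 1)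
parityᶻ (+ n) with parity n
... | inj₁ (m , refl) = inj₁ (+ m , +dbl m)
... | inj₂ (m , refl) = inj₂ (+ m , trans (cong (λ z → + 1 + z) (+dbl m)) (ℤ.+-comm (+ 1) (+ 2 * + m)))
parityᶻ -[1+ n ] with parity n
... | inj₁ (m , refl) = inj₂ (- + m - + 1 , trans (cong (λ z → - (+ 1 + z)) (+dbl m))
      (solve 1 (λ m → :- (con (+ 1) :+ con (+ 2) :* m) := con (+ 2) :* (:- m :- con (+ 1)) :+ con (+ 1)) refl (+ m)))
... | inj₂ (m , refl) = inj₁ (- + m - + 1 , trans (cong (λ z → - (+ 2 + z)) (+dbl m))
      (solve 1 (λ m → :- (con (+ 2) :+ con (+ 2) :* m) := con (+ 2) :* (:- m :- con (+ 1))) refl (+ m)))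

-- An even value of a² + b² forces a and b to have the same parity, so that (r , s) ↦ (r + s , r -
-- s) can be inverted over the integers.
rotation : ∀ a b {m} → norm a b ≡ dbl m → ∃[ r ] ∃[ s ] a ≡ r + s × b ≡ r - s
rotation a b {m} eq with parityᶻ a | parityᶻ b
... | inj₁ (k , refl) | inj₁ (l , refl) = k + l , k - l ,
  solve 2 (λ k l → con (+ 2) :* k := (k :+ l) :+ (k :- l)) refl k l , solve 2 (λ k l → con (+ 2) :* l := (k :+ l) :- (k :- l)) refl k l
... | inj₂ (k , refl) | inj₂ (l , refl) = k + l + + 1 , k - l ,
  solve 2 (λ k l → con (+ 2) :* k :+ con (+ 1) := (k :+ l :+ con (+ 1)) :+ (k :- l)) refl k l ,
  solve 2 (λ k l → con (+ 2) :* l :+ con (+ 1) := (k :+ l :+ con (+ 1)) :- (k :- l)) refl k l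
... | inj₁ (k , refl) | inj₂ (l , refl) = ⊥-elim (2∤1 (+ m - + 2 * (k * k + l * l + l)) (begin
  + 1
    ≡⟨ solve 2 (λ k l → con (+ 1) := (con (+ 2) :* k) :* (con (+ 2) :* k) :+ (con (+ 2) :* l :+ con (+ 1)) :* (con (+ 2) :* l :+ con (+ 1)) :- con (+ 4) :* (k :* k :+ l :* l :+ l)) refl k l ⟩
  a * a + b * b - + 4 * (k * k + l * l + l)
    ≡⟨ cong (_- + 4 * (k * k + l * l + l)) (trans (sym (+norm a b)) (trans (cong +_ eq) (+dbl m))) ⟩
  + 2 * + m - + 4 * (k * k + l * l + l)
    ≡⟨ solve 2 (λ m x → con (+ 2) :* m :- con (+ 4) :* x := con (+ 2) :* (m :- con (+ 2) :* x)) refl (+ m) (k * k + l * l + l) ⟩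
  + 2 * (+ m - + 2 * (k * k + l * l + l)) ∎))
... | inj₂ (k , refl) | inj₁ (l , refl) = ⊥-elim (2∤1 (+ m - + 2 * (k * k + l * l + k)) (begin
  + 1
    ≡⟨ solve 2 (λ k l → con (+ 1) := (con (+ 2) :* k :+ con (+ 1)) :* (con (+ 2) :* k :+ con (+ 1)) :+ (con (+ 2) :* l) :* (con (+ 2) :* l) :- con (+ 4) :* (k :* k :+ l :* l :+ k)) refl k l ⟩
  a * a + b * b - + 4 * (k * k + l * l + k)
    ≡⟨ cong (_- + 4 * (k * k + l * l + k)) (trans (sym (+norm a b)) (trans (cong +_ eq) (+dbl m))) ⟩
  + 2 * + m - + 4 * (k * k + l * l + k)
    ≡⟨ solve 2 (λ m x → con (+ 2) :* m :- con (+ 4) :* x := con (+ 2) :* (m :- con (+ 2) :* x)) refl (+ m) (k * k + l * l + k) ⟩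
  + 2 * (+ m - + 2 * (k * k + l * l + k)) ∎))

dbl-injective : ∀ {m n} → dbl m ≡ dbl n → m ≡ n
dbl-injective {zero}  {zero}  eq = refl
dbl-injective {suc m} {suc n} eq = cong suc (dbl-injective (ℕ.suc-injective (ℕ.suc-injective eq)))

q^-off : ∀ {k n} → n ≢ k → q^ k n ≡ + 0
q^-off {k} {n} n≢k = cong (if_then + 1 else + 0) (dec-false (n ℕ.≟ k) n≢k)

q^-dbl : ∀ k n → q^ (dbl k) (dbl n) ≡ q^ k n
q^-dbl zero    zero    = refl
q^-dbl zero    (suc n) = refl
q^-dbl (suc k) zero    = refl
q^-dbl (suc k) (suc n) = q^-dbl k n

n≤n² : ∀ n → n ℕ.≤ n ℕ.* n
n≤n² zero    = z≤n
n≤n² (suc n) = ℕ.m≤m+n (suc n) (n ℕ.* suc n)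

-- The number of representations of n as a² + b² with both a and b of absolute value at most N.
r₂ : ℕ → ℕ → ℤ
r₂ N n = zsum N λ a → zsum N λ b → q^ (norm a b) n

-- The map (r , s) ↦ (r + s , r - s) is a bijection from representations of m onto those of 2m. It
-- is applied by double counting with an indicator of its graph, and the box is doubled to contain
-- the images.
r₂-even : ∀ {m N} → m ℕ.≤ N → r₂ (dbl N) (dbl m) ≡ r₂ N m
r₂-even {m} {N} m≤N = begin
  zsum B (λ a → zsum B (χ a))
    ≡⟨ zsum-cong B (λ a _ → zsum-cong B λ b _ → sym (fibre a b)) ⟩
  zsum B (λ a → zsum B λ b → zsum N λ r → zsum N λ s → indicator a b r s * χ a b)
    ≡⟨ zsum-cong B (λ a _ → zsum-swap B N _) ⟩
  zsum B (λ a → zsum N λ r → zsum B λ b → zsum N λ s → indicator a b r s * χ a b)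
    ≡⟨ zsum-swap B N _ ⟩
  zsum N (λ r → zsum B λ a → zsum B λ b → zsum N λ s → indicator a b r s * χ a b)
    ≡⟨ zsum-cong N (λ r _ → zsum-cong B λ a _ → zsum-swap B N _) ⟩
  zsum N (λ r → zsum B λ a → zsum N λ s → zsum B λ b → indicator a b r s * χ a b)
    ≡⟨ zsum-cong N (λ r _ → zsum-swap B N _) ⟩
  zsum N (λ r → zsum N λ s → zsum B λ a → zsum B λ b → indicator a b r s * χ a b)
    ≡⟨ zsum-cong N (λ r r≤N → zsum-cong N λ s s≤N → evaluate r s (bound r s r≤N s≤N (ℤ.∣i+j∣≤∣i∣+∣j∣ r s))
         (bound r s r≤N s≤N (ℤ.∣i-j∣≤∣i∣+∣j∣ r s))) ⟩
  zsum N (λ r → zsum N λ s → q^ (norm r s) m) ∎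
  where
  B = dbl N
  χ : ℤ → ℤ → ℤ
  χ a b = q^ (norm a b) (dbl m)
  indicator : ℤ → ℤ → ℤ → ℤ → ℤ
  indicator a b r s = δᶻ a (r + s) * δᶻ b (r - s)
  bound : ∀ r s {k} → ℤ.∣ r ∣ ℕ.≤ N → ℤ.∣ s ∣ ℕ.≤ N → k ℕ.≤ ℤ.∣ r ∣ ℕ.+ ℤ.∣ s ∣ → k ℕ.≤ B
  bound r s r≤N s≤N le = ℕ.≤-trans le (subst (_ ℕ.≤_) (sym (dbl-+ N)) (ℕ.+-mono-≤ r≤N s≤N))
  evaluate : ∀ r s → ℤ.∣ r + s ∣ ℕ.≤ B → ℤ.∣ r - s ∣ ℕ.≤ B →
             zsum B (λ a → zsum B λ b → indicator a b r s * χ a b) ≡ q^ (norm r s) m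
  evaluate r s le le′ = begin
    zsum B (λ a → zsum B λ b → indicator a b r s * χ a b)
      ≡⟨ zsum-cong B (λ a _ → trans (zsum-cong B λ b _ → ℤ.*-assoc (δᶻ a (r + s)) (δᶻ b (r - s)) (χ a b))
           (trans (zsum-*ˡ B (δᶻ a (r + s)) λ b → δᶻ b (r - s) * χ a b) (cong (δᶻ a (r + s) *_) (zsum-δ B (r - s) (χ a) le′)))) ⟩
    zsum B (λ a → δᶻ a (r + s) * χ a (r - s))
      ≡⟨ zsum-δ B (r + s) (λ a → χ a (r - s)) le ⟩
    q^ (norm (r + s) (r - s)) (dbl m)
      ≡⟨ trans (cong (λ k → q^ k (dbl m)) (norm-rotate r s)) (q^-dbl (norm r s) m) ⟩
    q^ (norm r s) m ∎
  -- Each representation of 2m has exactly one preimage, which lies in the smaller box since r² + s²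
  -- = m ≤ N.
  fibre : ∀ a b → zsum N (λ r → zsum N λ s → indicator a b r s * χ a b) ≡ χ a b
  fibre a b with dbl m ℕ.≟ norm a b
  ... | no m≢ = trans (zsum-cong N λ r _ → trans (zsum-cong N λ s _ → trans (cong (indicator a b r s *_) (q^-off m≢)) (ℤ.*-zeroʳ (indicator a b r s))) (zsum-0 N))
      (trans (zsum-0 N) (sym (q^-off m≢)))
  ... | yes m≡ with rotation a b {m} (sym m≡)
  ...   | r , s , refl , refl = begin
    zsum N (λ r′ → zsum N λ s′ → indicator a b r′ s′ * χ a b)
      ≡⟨ zsum-cong N (λ r′ _ → zsum-cong N λ s′ _ → cong (_* χ a b) (separate r′ s′)) ⟩
    zsum N (λ r′ → zsum N λ s′ → δᶻ r′ r * δᶻ s′ s * χ a b)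
      ≡⟨ zsum-cong N (λ r′ _ → trans (zsum-cong N λ s′ _ → ℤ.*-assoc (δᶻ r′ r) (δᶻ s′ s) (χ a b))
           (trans (zsum-*ˡ N (δᶻ r′ r) λ s′ → δᶻ s′ s * χ a b) (cong (δᶻ r′ r *_) (zsum-δ N s (λ _ → χ a b) s≤N)))) ⟩
    zsum N (λ r′ → δᶻ r′ r * χ a b)
      ≡⟨ zsum-δ N r (λ _ → χ a b) r≤N ⟩
    χ a b ∎
    where
    m≡norm : m ≡ norm r s
    m≡norm = dbl-injective (trans m≡ (norm-rotate r s))
    r≤N : ℤ.∣ r ∣ ℕ.≤ N
    r≤N = ℕ.≤-trans (ℕ.≤-trans (n≤n² ℤ.∣ r ∣) (ℕ.≤-trans (ℕ.m≤m+n _ _) (ℕ.≤-reflexive (sym m≡norm)))) m≤N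
    s≤N : ℤ.∣ s ∣ ℕ.≤ N
    s≤N = ℕ.≤-trans (ℕ.≤-trans (n≤n² ℤ.∣ s ∣) (ℕ.≤-trans (ℕ.m≤n+m _ (ℤ.∣ r ∣ ℕ.* ℤ.∣ r ∣)) (ℕ.≤-reflexive (sym m≡norm)))) m≤N
    separate : ∀ r′ s′ → indicator (r + s) (r - s) r′ s′ ≡ δᶻ r′ r * δᶻ s′ s
    separate r′ s′ with r′ ℤ.≟ r | s′ ℤ.≟ s
    ... | yes refl | yes refl = cong₂ _*_ (δᶻ-on (r + s)) (δᶻ-on (r - s))
    ... | yes refl | no s′≢s  = trans (cong (_* δᶻ (r - s) (r - s′)) (δᶻ-off (r + s) (r + s′) λ eq → s′≢s (trans (solve 2 (λ r s → s := (r :+ s) :- r) refl r s′) (trans (cong (_- r) (sym eq)) (solve 2 (λ r s → (r :+ s) :- r := s) refl r s))))) (ℤ.*-zeroˡ (δᶻ (r - s) (r - s′)))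
    ... | no r′≢r  | _ with (r + s) ℤ.≟ (r′ + s′) | (r - s) ℤ.≟ (r′ - s′)
    ...   | no  _  | _      = refl
    ...   | yes _  | no _   = refl
    ...   | yes e₁ | yes e₂ = ⊥-elim (r′≢r (ℤ.*-cancelˡ-≡ (+ 2) r′ r (begin
      + 2 * r′                    ≡⟨ solve 2 (λ r s → con (+ 2) :* r := (r :+ s) :+ (r :- s)) refl r′ s′ ⟩
      (r′ + s′) + (r′ - s′)       ≡⟨ cong₂ _+_ e₁ e₂ ⟨
      (r + s) + (r - s)           ≡⟨ solve 2 (λ r s → (r :+ s) :+ (r :- s) := con (+ 2) :* r) refl r s ⟩
      + 2 * r                     ∎)))

constant-⊛ₙ : ∀ k a n → (constantˢ k ⊛ a) n ≡ k * a n
constant-⊛ₙ k a n = sym (at (·ˢ-as-⊛ k a) n)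

zsum-⊛ : ∀ N (h : ℤ → Series) c n → ((λ i → zsum N λ z → h z i) ⊛ c) n ≡ zsum N λ z → (h z ⊛ c) n
zsum-⊛ zero    h c n = refl
zsum-⊛ (suc N) h c n = trans (⊛-distribʳₙ n c (λ i → zsum N λ z → h z i) (h (+ suc N) +ˢ h -[1+ N ]))
  (cong₂ _+_ (zsum-⊛ N h c n) (⊛-distribʳₙ n c (h (+ suc N)) (h -[1+ N ])))

squares : ℤ → Series
squares z = q^ (ℤ.∣ z ∣ ℕ.* ℤ.∣ z ∣)

𝒴-zsum : ∀ N → 𝒴 N ≈ˢ λ n → zsum N λ z → squares z n
𝒴-zsum zero    = ≈ˢ-sym q⁰≈1
𝒴-zsum (suc N) = ≈ˢ-intro λ n → cong₂ _+_ (at (𝒴-zsum N) n)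
  (trans (constant-⊛ₙ (+ 2) (squares (+ suc N)) n) (solve 1 (λ a → con (+ 2) :* a := a :+ a) refl (squares (+ suc N) n)))

𝒴²-r₂ : ∀ N n → (𝒴 N ⊛ 𝒴 N) n ≡ r₂ N n
𝒴²-r₂ N n = begin
  (𝒴 N ⊛ 𝒴 N) n                                                ≡⟨ at (⊛-cong (𝒴-zsum N) (𝒴-zsum N)) n ⟩
  (Θ ⊛ Θ) n                                                    ≡⟨ zsum-⊛ N squares Θ n ⟩
  zsum N (λ a → (squares a ⊛ Θ) n)                             ≡⟨ zsum-cong N (λ a _ → trans (⊛-commₙ n (squares a) Θ) (zsum-⊛ N squares (squares a) n)) ⟩
  zsum N (λ a → zsum N λ b → (squares b ⊛ squares a) n)        ≡⟨ zsum-cong N (λ a _ → zsum-cong N λ b _ → trans (⊛-commₙ n (squares b) (squares a))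
                                                                    (sym (at (q^-+ (ℤ.∣ a ∣ ℕ.* ℤ.∣ a ∣) (ℤ.∣ b ∣ ℕ.* ℤ.∣ b ∣)) n))) ⟩
  r₂ N n                                                       ∎
  where
  Θ : Series
  Θ n = zsum N λ z → squares z n

Y²-r₂ : ∀ {n N} → n ℕ.≤ N → (Y ⊛ Y) n ≡ r₂ N n
Y²-r₂ {n} {N} n≤N = trans (≈[]-⊛ {a = Y} {𝒴 N} {Y} {𝒴 N} (lim-≈[] 𝒴-stable N) (lim-≈[] 𝒴-stable N) n n≤N) (𝒴²-r₂ N n)

Y²-even : ∀ m → (Y ⊛ Y) (dbl m) ≡ (Y ⊛ Y) m
Y²-even m = trans (Y²-r₂ {dbl m} {dbl m} ℕ.≤-refl) (trans (r₂-even {m} {m} ℕ.≤-refl) (sym (Y²-r₂ {m} {m} ℕ.≤-refl)))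

-- Relations among the values of theta series at q, q² and q⁴

X₂ Y₂ E₂ X₄ Y₄ E₄ E₈ : Series
X₂ = double X
Y₂ = double Y
E₂ = double E₁
X₄ = double X₂
Y₄ = double Y₂
E₄ = double E₂
E₈ = double E₄

-- X² is Y² with -q for q, so the sum is twice the even-degree terms of Y²; by `Y²-even` these are
-- the terms of Y² evaluated at q².
X²+Y² : X ⊛ X +ˢ Y ⊛ Y ≈ˢ 2ˢ ⊛ (Y₂ ⊛ Y₂)
X²+Y² = ≈ˢ-intro λ n → begin
  (X ⊛ X) n + (Y ⊛ Y) n                      ≡⟨ cong (_+ (Y ⊛ Y) n) (at (≈ˢ-trans (⊛-cong (≈ˢ-sym σY) (≈ˢ-sym σY)) (≈ˢ-sym (σ-⊛ Y Y))) n) ⟩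
  sgn n * (Y ⊛ Y) n + (Y ⊛ Y) n              ≡⟨ by-parity n (parity n) ⟩
  + 2 * double (Y ⊛ Y) n                     ≡⟨ constant-⊛ₙ (+ 2) (double (Y ⊛ Y)) n ⟨
  (2ˢ ⊛ double (Y ⊛ Y)) n                    ≡⟨ at (⊛-congˡ 2ˢ (double-⊛ Y Y)) n ⟩
  (2ˢ ⊛ (Y₂ ⊛ Y₂)) n                         ∎
  where
  by-parity : ∀ n → (∃[ m ] n ≡ dbl m) ⊎ (∃[ m ] n ≡ suc (dbl m)) → sgn n * (Y ⊛ Y) n + (Y ⊛ Y) n ≡ + 2 * double (Y ⊛ Y) n
  by-parity _ (inj₁ (m , refl)) = begin
    sgn (dbl m) * (Y ⊛ Y) (dbl m) + (Y ⊛ Y) (dbl m)  ≡⟨ cong (λ s → s * (Y ⊛ Y) (dbl m) + (Y ⊛ Y) (dbl m)) (sgn-dbl m) ⟩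
    + 1 * (Y ⊛ Y) (dbl m) + (Y ⊛ Y) (dbl m)          ≡⟨ solve 1 (λ a → con (+ 1) :* a :+ a := con (+ 2) :* a) refl ((Y ⊛ Y) (dbl m)) ⟩
    + 2 * (Y ⊛ Y) (dbl m)                            ≡⟨ cong (+ 2 *_) (trans (Y²-even m) (sym (double-dbl m (Y ⊛ Y)))) ⟩
    + 2 * double (Y ⊛ Y) (dbl m)                     ∎
  by-parity _ (inj₂ (m , refl)) = begin
    - sgn (dbl m) * (Y ⊛ Y) (suc (dbl m)) + (Y ⊛ Y) (suc (dbl m))  ≡⟨ cong (λ s → - s * (Y ⊛ Y) (suc (dbl m)) + (Y ⊛ Y) (suc (dbl m))) (sgn-dbl m) ⟩
    - + 1 * (Y ⊛ Y) (suc (dbl m)) + (Y ⊛ Y) (suc (dbl m))          ≡⟨ solve 1 (λ a → con (ℤ.- + 1) :* a :+ a := con (+ 2) :* con (+ 0)) refl ((Y ⊛ Y) (suc (dbl m))) ⟩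
    + 2 * + 0                                                      ≡⟨ cong (+ 2 *_) (double-odd m (Y ⊛ Y)) ⟨
    + 2 * double (Y ⊛ Y) (suc (dbl m))                             ∎

X₂²+Y₂² : X₂ ⊛ X₂ +ˢ Y₂ ⊛ Y₂ ≈ˢ 2ˢ ⊛ (Y₄ ⊛ Y₄)
X₂²+Y₂² = beginˢ
  X₂ ⊛ X₂ +ˢ Y₂ ⊛ Y₂                  ≈⟨ Ser.+-cong (double-⊛ X X) (double-⊛ Y Y) ⟨
  double (X ⊛ X) +ˢ double (Y ⊛ Y)    ≈⟨ double-+ (X ⊛ X) (Y ⊛ Y) ⟨
  double (X ⊛ X +ˢ Y ⊛ Y)             ≈⟨ double-cong X²+Y² ⟩
  double (2ˢ ⊛ (Y₂ ⊛ Y₂))             ≈⟨ double-⊛ 2ˢ (Y₂ ⊛ Y₂) ⟩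
  double 2ˢ ⊛ double (Y₂ ⊛ Y₂)        ≈⟨ ⊛-cong (double-constant (+ 2)) (double-⊛ Y₂ Y₂) ⟩
  2ˢ ⊛ (Y₄ ⊛ Y₄)                      ∎ˢ
  where open Ser-Reasoning

4ˢ : Series
4ˢ = constantˢ (+ 4)

-- Use 4xy = 2 (x + y)² - 2 (x² + y²), where both sums are known. The value at q⁴ that appears is
-- removed by the relation for x² + y² with q² in place of q.
XY : X ⊛ Y ≈ˢ X₂ ⊛ X₂
XY = cancel 4ˢ (λ ()) (beginˢ
  4ˢ ⊛ (X ⊛ Y)
    ≈⟨ solveˢ 2 (λ x y → conˢ (+ 4) ⊠ (x ⊠ y) ≑ conˢ (+ 2) ⊠ ((x ⊞ y) ⊠ (x ⊞ y)) ⊟ conˢ (+ 2) ⊠ (x ⊠ x ⊞ y ⊠ y)) ≈ˢ-refl X Y ⟩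
  2ˢ ⊛ ((X +ˢ Y) ⊛ (X +ˢ Y)) +ˢ (-ˢ (2ˢ ⊛ (X ⊛ X +ˢ Y ⊛ Y)))
    ≈⟨ Ser.+-cong (⊛-congˡ 2ˢ (⊛-cong X+Y X+Y)) (-ˢ-cong (⊛-congˡ 2ˢ X²+Y²)) ⟩
  2ˢ ⊛ ((2ˢ ⊛ Y₄) ⊛ (2ˢ ⊛ Y₄)) +ˢ (-ˢ (2ˢ ⊛ (2ˢ ⊛ (Y₂ ⊛ Y₂))))
    ≈⟨ solveˢ 2 (λ u v → conˢ (+ 2) ⊠ ((conˢ (+ 2) ⊠ u) ⊠ (conˢ (+ 2) ⊠ u)) ⊟ conˢ (+ 2) ⊠ (conˢ (+ 2) ⊠ (v ⊠ v)) ≑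
         conˢ (+ 4) ⊠ (conˢ (+ 2) ⊠ (u ⊠ u)) ⊟ conˢ (+ 4) ⊠ (v ⊠ v)) ≈ˢ-refl Y₄ Y₂ ⟩
  4ˢ ⊛ (2ˢ ⊛ (Y₄ ⊛ Y₄)) +ˢ (-ˢ (4ˢ ⊛ (Y₂ ⊛ Y₂)))
    ≈⟨ +ˢ-congʳ (-ˢ (4ˢ ⊛ (Y₂ ⊛ Y₂))) (⊛-congˡ 4ˢ X₂²+Y₂²) ⟨
  4ˢ ⊛ (X₂ ⊛ X₂ +ˢ Y₂ ⊛ Y₂) +ˢ (-ˢ (4ˢ ⊛ (Y₂ ⊛ Y₂)))
    ≈⟨ solveˢ 2 (λ u v → conˢ (+ 4) ⊠ (u ⊠ u ⊞ v ⊠ v) ⊟ conˢ (+ 4) ⊠ (v ⊠ v) ≑ conˢ (+ 4) ⊠ (u ⊠ u)) ≈ˢ-refl X₂ Y₂ ⟩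
  4ˢ ⊛ (X₂ ⊛ X₂) ∎ˢ)
  where open Ser-Reasoning

X₂Y₂ : X₂ ⊛ Y₂ ≈ˢ X₄ ⊛ X₄
X₂Y₂ = ≈ˢ-trans (≈ˢ-sym (double-⊛ X Y)) (≈ˢ-trans (double-cong XY) (double-⊛ X₂ X₂))

E₂² : E₂ ⊛ E₂ ≈ˢ X₂ ⊛ E₄
E₂² = ≈ˢ-trans (≈ˢ-sym (double-⊛ E₁ E₁)) (≈ˢ-trans (double-cong (≈ˢ-sym X⊛E₂)) (double-⊛ X E₂))

E₄² : E₄ ⊛ E₄ ≈ˢ X₄ ⊛ E₈
E₄² = ≈ˢ-trans (≈ˢ-sym (double-⊛ E₂ E₂)) (≈ˢ-trans (double-cong E₂²) (double-⊛ X₂ E₄))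

-- Uniqueness for the functional equation Z² = c Z(q²)

product-head : ∀ N a b → Vanishes N a → (a ⊛ b) N ≡ a N * b 0
product-head zero    a b p = ℤ.+-identityʳ (a 0 * b 0)
product-head (suc N) a b p = trans (⊛-sucʳ a b N) (trans
  (cong (_+ a (suc N) * b 0) (trans (⊛-commₙ N a (tail b)) (Vanishes-⊛ (tail b) {a} p N ℕ.≤-refl)))
  (ℤ.+-identityˡ (a (suc N) * b 0)))

-- Orders double under q ↦ q², so a positive order strictly grows; this gain drives the induction in
-- `functional-equation-unique`.
Vanishes-double : ∀ {N a} → Vanishes (suc N) a → Vanishes (suc (suc N)) (double a)
Vanishes-double {N} {a} p n n<2+N with parity n
... | inj₂ (m , refl)     = double-odd m a
... | inj₁ (zero , refl)  = p 0 (s≤s z≤n)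
... | inj₁ (suc m , refl) = trans (double-dbl (suc m) a) (p (suc m) (s≤s (ℕ.≤-trans (s≤s (n≤dbl m)) (ℕ.s≤s⁻¹ (ℕ.s≤s⁻¹ n<2+N)))))

shift-tail : ∀ a → a 0 ≡ + 0 → a ≈ˢ q^ 1 ⊛ tail a
shift-tail a a0 = ≈ˢ-intro λ where
  zero    → a0
  (suc n) → sym (trans (q^-suc 0 n (tail a)) (⊛-identityₙ n (tail a)))

cancel-q : ∀ {a b} → q^ 1 ⊛ a ≈ˢ q^ 1 ⊛ b → a ≈ˢ b
cancel-q {a} {b} eq = ≈ˢ-intro λ n → trans (sym (drop a n)) (trans (at eq (suc n)) (drop b n))
  where
  drop : ∀ a n → (q^ 1 ⊛ a) (suc n) ≡ a n
  drop a n = trans (q^-suc 0 n a) (⊛-identityₙ n a)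

-- A solution Z = z q + ⋯ with z ≠ 0 of Z² = c Z(q²) is determined by z: if two
-- solutions agree modulo qᴺ, then so do their values at q² modulo q²ᴺ.
functional-equation-unique : ∀ c P R → P ⊛ P ≈ˢ c ⊛ double P → R ⊛ R ≈ˢ c ⊛ double R →
  P 0 ≡ + 0 → R 0 ≡ + 0 → P 1 ≡ R 1 → P 1 + R 1 ≢ + 0 → P ≈ˢ R
functional-equation-unique c P R eqP eqR P0 R0 P1≡R1 nonzero = ≈ˢ-trans (shift-tail P P0)
  (≈ˢ-trans (⊛-congˡ (q^ 1) (≈ˢ-intro λ n → ℤ.i-j≡0⇒i≡j (tail P n) (tail R n) (vanishes (suc n) n ℕ.≤-refl))) (≈ˢ-sym (shift-tail R R0)))
  where
  reduced : ∀ Z → Z 0 ≡ + 0 → Z ⊛ Z ≈ˢ c ⊛ double Z → tail Z ⊛ tail Z ≈ˢ c ⊛ double (tail Z)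
  reduced Z Z0 eq = cancel-q (cancel-q (beginˢ
    q^ 1 ⊛ (q^ 1 ⊛ (tail Z ⊛ tail Z))    ≈⟨ solveˢ 2 (λ q z → q ⊠ (q ⊠ (z ⊠ z)) ≑ (q ⊠ z) ⊠ (q ⊠ z)) ≈ˢ-refl (q^ 1) (tail Z) ⟩
    (q^ 1 ⊛ tail Z) ⊛ (q^ 1 ⊛ tail Z)    ≈⟨ ⊛-cong (shift-tail Z Z0) (shift-tail Z Z0) ⟨
    Z ⊛ Z                                ≈⟨ eq ⟩
    c ⊛ double Z                         ≈⟨ ⊛-congˡ c (≈ˢ-trans (double-cong (shift-tail Z Z0)) (double-⊛ (q^ 1) (tail Z))) ⟩
    c ⊛ (double (q^ 1) ⊛ double (tail Z))  ≈⟨ ⊛-congˡ c (⊛-congʳ (double (tail Z)) (≈ˢ-trans (double-q^ 1) (q^-+ 1 1))) ⟩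
    c ⊛ ((q^ 1 ⊛ q^ 1) ⊛ double (tail Z))  ≈⟨ solveˢ 3 (λ c q z → c ⊠ ((q ⊠ q) ⊠ z) ≑ q ⊠ (q ⊠ (c ⊠ z))) ≈ˢ-refl c (q^ 1) (double (tail Z)) ⟩
    q^ 1 ⊛ (q^ 1 ⊛ (c ⊛ double (tail Z)))  ∎ˢ))
    where open Ser-Reasoning
  W V : Series
  W = tail P +ˢ (-ˢ tail R)
  V = tail P +ˢ tail R
  WV : W ⊛ V ≈ˢ c ⊛ double W
  WV = beginˢ
    W ⊛ V                                                  ≈⟨ solveˢ 2 (λ p r → (p ⊞ (⊟ r)) ⊠ (p ⊞ r) ≑ p ⊠ p ⊞ (⊟ (r ⊠ r))) ≈ˢ-refl (tail P) (tail R) ⟩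
    tail P ⊛ tail P +ˢ (-ˢ (tail R ⊛ tail R))              ≈⟨ Ser.+-cong (reduced P P0 eqP) (-ˢ-cong (reduced R R0 eqR)) ⟩
    c ⊛ double (tail P) +ˢ (-ˢ (c ⊛ double (tail R)))      ≈⟨ solveˢ 3 (λ c p r → c ⊠ p ⊞ (⊟ (c ⊠ r)) ≑ c ⊠ (p ⊞ (⊟ r))) ≈ˢ-refl c (double (tail P)) (double (tail R)) ⟩
    c ⊛ (double (tail P) +ˢ (-ˢ double (tail R)))          ≈⟨ ⊛-congˡ c (≈ˢ-trans (double-+ (tail P) (-ˢ tail R)) (+ˢ-congˡ (double (tail P)) (double-neg (tail R)))) ⟨
    c ⊛ double W                                           ∎ˢ
    where open Ser-Reasoning
  step : ∀ N → Vanishes (suc N) W → Vanishes (suc (suc N)) W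
  step N IH n n<2+N with ℕ.m≤n⇒m<n∨m≡n (ℕ.s≤s⁻¹ n<2+N)
  ... | inj₁ n<1+N = IH n n<1+N
  ... | inj₂ refl  = case ℤ.i*j≡0⇒i≡0∨j≡0 (W (suc N)) top of λ where
      (inj₁ eq) → eq
      (inj₂ eq) → ⊥-elim (nonzero eq)
    where
    top : W (suc N) * V 0 ≡ + 0
    top = trans (sym (product-head (suc N) W V IH)) (trans (at WV (suc N))
      (Vanishes-⊛ c (Vanishes-double {N} {W} IH) (suc N) ℕ.≤-refl))
  vanishes : ∀ N → Vanishes N W
  vanishes zero          n ()
  vanishes (suc zero)    zero _ = trans (cong (_- R 1) P1≡R1) (ℤ.+-inverseʳ (R 1))
  vanishes (suc zero)    (suc n) (s≤s ())
  vanishes (suc (suc N)) = step N (vanishes (suc N))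

-- Power series in a wrapper without η-equality, so that large products and
-- powers are compared as terms and never coefficient by coefficient.
record 𝕊 : Set where
  no-eta-equality
  field coef : Series

open 𝕊

infix 4 _≈_
infixl 6 _⊕_
infixl 7 _⊗_
infix 8 ⊖_

_⊕_ _⊗_ : 𝕊 → 𝕊 → 𝕊
(a ⊕ b) .coef = coef a +ˢ coef b
(a ⊗ b) .coef = coef a ⊛ coef b

⊖_ : 𝕊 → 𝕊
(⊖ a) .coef = -ˢ coef a

⟪_⟫ : Series → 𝕊
⟪ a ⟫ .coef = a

# : ℤ → 𝕊
# k .coef = constantˢ k

record _≈_ (a b : 𝕊) : Set where
  constructor lift
  field lower : coef a ≈ˢ coef b

open _≈_

𝕊-ring : CommutativeRing 0ℓ 0ℓ
𝕊-ring = record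
  { Carrier = 𝕊
  ; _≈_     = _≈_
  ; _+_     = _⊕_
  ; _*_     = _⊗_
  ; -_      = ⊖_
  ; 0#      = # (+ 0)
  ; 1#      = # (+ 1)
  ; isCommutativeRing = record
    { isRing = record
      { +-isAbelianGroup = record
        { isGroup = record
          { isMonoid = record
            { isSemigroup = record
              { isMagma = record
                { isEquivalence = record
                  { refl  = lift ≈ˢ-refl
                  ; sym   = λ p → lift (≈ˢ-sym (lower p))
                  ; trans = λ p q → lift (≈ˢ-trans (lower p) (lower q))
                  }
                ; ∙-cong = λ p q → lift (Ser.+-cong (lower p) (lower q))
                }
              ; assoc = λ a b c → lift (Ser.+-assoc (coef a) (coef b) (coef c))
              }
            ; identity = (λ a → lift (Ser.+-identityˡ (coef a))) , (λ a → lift (Ser.+-identityʳ (coef a)))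
            }
          ; inverse = (λ a → lift (Ser.-‿inverseˡ (coef a))) , (λ a → lift (Ser.-‿inverseʳ (coef a)))
          ; ⁻¹-cong = λ p → lift (-ˢ-cong (lower p))
          }
        ; comm = λ a b → lift (Ser.+-comm (coef a) (coef b))
        }
      ; *-cong = λ p q → lift (⊛-cong (lower p) (lower q))
      ; *-assoc = λ a b c → lift (Ser.*-assoc (coef a) (coef b) (coef c))
      ; *-identity = (λ a → lift (≈ˢ-trans (⊛-congʳ (coef a) (≈ˢ-sym q⁰≈1)) (Ser.*-identityˡ (coef a))))
                   , (λ a → lift (≈ˢ-trans (⊛-congˡ (coef a) (≈ˢ-sym q⁰≈1)) (Ser.*-identityʳ (coef a))))
      ; distrib = (λ a b c → lift (Ser.distribˡ (coef a) (coef b) (coef c)))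
                , (λ a b c → lift (Ser.distribʳ (coef a) (coef b) (coef c)))
      }
    ; *-comm = λ a b → lift (Ser.*-comm (coef a) (coef b))
    }
  }

module 𝕊-Ring = CommutativeRing 𝕊-ring
module 𝕊-Reasoning where
  open SetoidReasoning 𝕊-Ring.setoid public renaming (begin_ to begin𝕊_; _∎ to _∎𝕊)

open 𝕊-Ring using () renaming
  ( refl to ≈-refl; sym to ≈-sym; trans to ≈-trans; +-cong to ⊕-cong; +-congˡ to ⊕-congˡ
  ; *-cong to ⊗-cong; *-congˡ to ⊗-congˡ; *-congʳ to ⊗-congʳ; -‿cong to ⊖-cong )

𝕊-almostRing : ACR.AlmostCommutativeRing 0ℓ 0ℓ
𝕊-almostRing = ACR.fromCommutativeRing 𝕊-ring

module 𝕊-Exp = Exp (ACR.AlmostCommutativeRing.semiring 𝕊-almostRing)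
open 𝕊-Exp using (_^_; ^-congˡ)

#-+ : ∀ a b → # (a + b) ≈ # a ⊕ # b
#-+ a b = lift (≈ˢ-intro λ n → ℤ.*-distribʳ-+ (q^ 0 n) a b)

#-* : ∀ a b → # (a * b) ≈ # a ⊗ # b
#-* a b = lift (≈ˢ-intro λ n → trans (ℤ.*-assoc a b (q^ 0 n)) (at (·ˢ-as-⊛ a (constantˢ b)) n))

#-morphism : ℤ-rawRing ACR.-Raw-AlmostCommutative⟶ 𝕊-almostRing
#-morphism = record
  { ⟦_⟧    = #
  ; +-homo = #-+
  ; *-homo = #-*
  ; -‿homo = λ a → lift (≈ˢ-intro λ n → sym (ℤ.neg-distribˡ-* a (q^ 0 n)))
  ; 0-homo = lift ≈ˢ-refl
  ; 1-homo = lift ≈ˢ-refl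
  }

#-≟ : ∀ a b → Maybe (# a ≈ # b)
#-≟ a b with a ℤ.≟ b
... | yes refl = just ≈-refl
... | no _     = nothing

module 𝕊-Solver = RingSolver ℤ-rawRing 𝕊-almostRing #-morphism #-≟

open 𝕊-Solver using () renaming (solve to solve𝕊; _:=_ to _≗_; _:+_ to _∔_; _:*_ to _×ˢ_; :-_ to ∸_; _:^_ to _⇡_; con to ♯)

𝕊-cancel : ∀ u {a b} → coef u 0 ≢ + 0 → u ⊗ a ≈ u ⊗ b → a ≈ b
𝕊-cancel u {a} {b} u≢0 eq = lift (cancel (coef u) u≢0 (lower eq))

dbl𝕊 σ𝕊 : 𝕊 → 𝕊
dbl𝕊 a .coef = double (coef a)
σ𝕊 a .coef = σ (coef a)

coef-^ : ∀ n a → coef (a ^ n) ≈ˢ coef a ^ˢ n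
coef-^ zero    a = ≈ˢ-sym q⁰≈1
coef-^ (suc n) a = ⊛-congˡ (coef a) (coef-^ n a)

record IsEndomorphism (θ : 𝕊 → 𝕊) : Set where
  field
    θ-cong : ∀ {a b} → a ≈ b → θ a ≈ θ b
    θ-⊕    : ∀ a b → θ (a ⊕ b) ≈ θ a ⊕ θ b
    θ-⊗    : ∀ a b → θ (a ⊗ b) ≈ θ a ⊗ θ b
    θ-#    : ∀ k → θ (# k) ≈ # k

  θ-^ : ∀ n a → θ (a ^ n) ≈ θ a ^ n
  θ-^ zero    a = θ-# (+ 1)
  θ-^ (suc n) a = ≈-trans (θ-⊗ a (a ^ n)) (⊗-congˡ (θ-^ n a))

  θ-⊖ : ∀ a b → θ (a ⊕ ⊖ b) ≈ θ a ⊕ ⊖ θ b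
  θ-⊖ a b = begin𝕊
    θ (a ⊕ ⊖ b)                  ≈⟨ θ-cong (negation a b) ⟩
    θ (a ⊕ # (- + 1) ⊗ b)        ≈⟨ ≈-trans (θ-⊕ a (# (- + 1) ⊗ b)) (⊕-congˡ (≈-trans (θ-⊗ (# (- + 1)) b) (⊗-congʳ (θ-# (- + 1))))) ⟩
    θ a ⊕ # (- + 1) ⊗ θ b        ≈⟨ negation (θ a) (θ b) ⟨
    θ a ⊕ ⊖ θ b                  ∎𝕊
    where
    open 𝕊-Reasoning
    negation : ∀ a b → a ⊕ ⊖ b ≈ a ⊕ # (- + 1) ⊗ b
    negation = solve𝕊 2 (λ a b → a ∔ (∸ b) ≗ a ∔ ♯ (- + 1) ×ˢ b) ≈-refl

dbl𝕊-endomorphism : IsEndomorphism dbl𝕊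
dbl𝕊-endomorphism = record
  { θ-cong = λ p → lift (double-cong (lower p))
  ; θ-⊕    = λ a b → lift (double-+ (coef a) (coef b))
  ; θ-⊗    = λ a b → lift (double-⊛ (coef a) (coef b))
  ; θ-#    = λ k → lift (double-constant k)
  }

σ𝕊-endomorphism : IsEndomorphism σ𝕊
σ𝕊-endomorphism = record
  { θ-cong = λ p → lift (σ-cong (lower p))
  ; θ-⊕    = λ a b → lift (σ-+ (coef a) (coef b))
  ; θ-⊗    = λ a b → lift (σ-⊛ (coef a) (coef b))
  ; θ-#    = λ k → lift (σ-constant k)
  }

module dbl = IsEndomorphism dbl𝕊-endomorphism
module σσ = IsEndomorphism σ𝕊-endomorphism

-- Jacobi's identity

𝐪 𝐱 𝐲 𝐱₂ 𝐲₂ 𝐱₄ 𝐲₄ 𝐞₁ 𝐞₂ 𝐞₄ 𝐞₈ : 𝕊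
𝐪  = ⟪ q^ 1 ⟫
𝐱  = ⟪ X ⟫
𝐲  = ⟪ Y ⟫
𝐞₁ = ⟪ E₁ ⟫
𝐱₂ = dbl𝕊 𝐱
𝐲₂ = dbl𝕊 𝐲
𝐱₄ = dbl𝕊 𝐱₂
𝐲₄ = dbl𝕊 𝐲₂
𝐞₂ = dbl𝕊 𝐞₁
𝐞₄ = dbl𝕊 𝐞₂
𝐞₈ = dbl𝕊 𝐞₄

𝐱²+𝐲² : 𝐱 ⊗ 𝐱 ⊕ 𝐲 ⊗ 𝐲 ≈ # (+ 2) ⊗ (𝐲₂ ⊗ 𝐲₂)
𝐱²+𝐲² = lift X²+Y²

𝐱𝐲 : 𝐱 ⊗ 𝐲 ≈ 𝐱₂ ⊗ 𝐱₂
𝐱𝐲 = lift XY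

𝐱₂𝐲₂ : 𝐱₂ ⊗ 𝐲₂ ≈ 𝐱₄ ⊗ 𝐱₄
𝐱₂𝐲₂ = lift X₂Y₂

𝐞₁² : 𝐱 ⊗ 𝐞₂ ≈ 𝐞₁ ⊗ 𝐞₁
𝐞₁² = lift X⊛E₂

𝐞₂² : 𝐞₂ ⊗ 𝐞₂ ≈ 𝐱₂ ⊗ 𝐞₄
𝐞₂² = lift E₂²

𝐞₄² : 𝐞₄ ⊗ 𝐞₄ ≈ 𝐱₄ ⊗ 𝐞₈
𝐞₄² = lift E₄²

dbl-𝐪 : dbl𝕊 𝐪 ≈ 𝐪 ⊗ 𝐪
dbl-𝐪 = lift (≈ˢ-trans (double-q^ 1) (q^-+ 1 1))

-- θ₃⁴ - θ₄⁴, which `jacobi` identifies as θ₂⁴ = 16 q E₄⁸ / E₂⁴.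
𝐣 : 𝕊
𝐣 = 𝐲 ^ 4 ⊕ ⊖ 𝐱 ^ 4

private
  -- Multiplying by θ₄(q²)² = E₂⁴ / E₄² removes the denominator of θ₂⁴. It also makes the
  -- coefficient in the functional equation the same for both sides, namely 16 θ₄(q⁴)⁶.
  L R : 𝕊
  L = 𝐣 ⊗ 𝐱₂ ^ 2
  R = # (+ 16) ⊗ (𝐪 ⊗ 𝐞₄ ^ 6)

  cong³ : ∀ {a b c d} x → a ≈ b → c ≈ d → x ⊗ (a ⊗ c) ≈ x ⊗ (b ⊗ d)
  cong³ x p q = ⊗-congˡ (⊗-cong p q)

  -- The square of y⁴ - x⁴ = (y² + x²) (y² - x²) is a polynomial in x² + y² and xy, and both of
  -- these are known as expressions at q².
  𝐣² : 𝐣 ⊗ 𝐣 ≈ # (+ 16) ⊗ (𝐲₂ ^ 4 ⊗ (𝐲₂ ^ 4 ⊕ ⊖ 𝐱₂ ^ 4))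
  𝐣² = begin𝕊
    𝐣 ⊗ 𝐣
      ≈⟨ solve𝕊 2 (λ x y → (y ⇡ 4 ∔ (∸ x ⇡ 4)) ×ˢ (y ⇡ 4 ∔ (∸ x ⇡ 4)) ≗
           (x ×ˢ x ∔ y ×ˢ y) ⇡ 2 ×ˢ ((x ×ˢ x ∔ y ×ˢ y) ⇡ 2 ∔ (∸ (♯ (+ 4) ×ˢ (x ×ˢ y) ⇡ 2)))) ≈-refl 𝐱 𝐲 ⟩
    (𝐱 ⊗ 𝐱 ⊕ 𝐲 ⊗ 𝐲) ^ 2 ⊗ ((𝐱 ⊗ 𝐱 ⊕ 𝐲 ⊗ 𝐲) ^ 2 ⊕ ⊖ (# (+ 4) ⊗ (𝐱 ⊗ 𝐲) ^ 2))
      ≈⟨ ⊗-cong (^-congˡ 2 𝐱²+𝐲²) (⊕-cong (^-congˡ 2 𝐱²+𝐲²) (⊖-cong (⊗-congˡ (^-congˡ 2 𝐱𝐲)))) ⟩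
    (# (+ 2) ⊗ (𝐲₂ ⊗ 𝐲₂)) ^ 2 ⊗ ((# (+ 2) ⊗ (𝐲₂ ⊗ 𝐲₂)) ^ 2 ⊕ ⊖ (# (+ 4) ⊗ (𝐱₂ ⊗ 𝐱₂) ^ 2))
      ≈⟨ solve𝕊 2 (λ x y → (♯ (+ 2) ×ˢ (y ×ˢ y)) ⇡ 2 ×ˢ ((♯ (+ 2) ×ˢ (y ×ˢ y)) ⇡ 2 ∔ (∸ (♯ (+ 4) ×ˢ (x ×ˢ x) ⇡ 2))) ≗
           ♯ (+ 16) ×ˢ (y ⇡ 4 ×ˢ (y ⇡ 4 ∔ (∸ x ⇡ 4)))) ≈-refl 𝐱₂ 𝐲₂ ⟩
    # (+ 16) ⊗ (𝐲₂ ^ 4 ⊗ (𝐲₂ ^ 4 ⊕ ⊖ 𝐱₂ ^ 4)) ∎𝕊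
    where open 𝕊-Reasoning

  dbl-𝐣 : dbl𝕊 𝐣 ≈ 𝐲₂ ^ 4 ⊕ ⊖ 𝐱₂ ^ 4
  dbl-𝐣 = ≈-trans (dbl.θ-⊖ (𝐲 ^ 4) (𝐱 ^ 4)) (⊕-cong (dbl.θ-^ 4 𝐲) (⊖-cong (dbl.θ-^ 4 𝐱)))

  dbl-L : dbl𝕊 L ≈ (𝐲₂ ^ 4 ⊕ ⊖ 𝐱₂ ^ 4) ⊗ 𝐱₄ ^ 2
  dbl-L = ≈-trans (dbl.θ-⊗ 𝐣 (𝐱₂ ^ 2)) (⊗-cong dbl-𝐣 (dbl.θ-^ 2 𝐱₂))

  L² : L ⊗ L ≈ (# (+ 16) ⊗ 𝐱₄ ^ 6) ⊗ dbl𝕊 L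
  L² = begin𝕊
    L ⊗ L
      ≈⟨ solve𝕊 2 (λ j x → (j ×ˢ x ⇡ 2) ×ˢ (j ×ˢ x ⇡ 2) ≗ (j ×ˢ j) ×ˢ x ⇡ 4) ≈-refl 𝐣 𝐱₂ ⟩
    (𝐣 ⊗ 𝐣) ⊗ 𝐱₂ ^ 4
      ≈⟨ ⊗-congʳ 𝐣² ⟩
    (# (+ 16) ⊗ (𝐲₂ ^ 4 ⊗ d)) ⊗ 𝐱₂ ^ 4
      ≈⟨ solve𝕊 3 (λ x y d → (♯ (+ 16) ×ˢ (y ⇡ 4 ×ˢ d)) ×ˢ x ⇡ 4 ≗ ♯ (+ 16) ×ˢ ((x ×ˢ y) ⇡ 4 ×ˢ d)) ≈-refl 𝐱₂ 𝐲₂ d ⟩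
    # (+ 16) ⊗ ((𝐱₂ ⊗ 𝐲₂) ^ 4 ⊗ d)
      ≈⟨ cong³ (# (+ 16)) (^-congˡ 4 𝐱₂𝐲₂) ≈-refl ⟩
    # (+ 16) ⊗ ((𝐱₄ ⊗ 𝐱₄) ^ 4 ⊗ d)
      ≈⟨ solve𝕊 2 (λ x d → ♯ (+ 16) ×ˢ ((x ×ˢ x) ⇡ 4 ×ˢ d) ≗ (♯ (+ 16) ×ˢ x ⇡ 6) ×ˢ (d ×ˢ x ⇡ 2)) ≈-refl 𝐱₄ d ⟩
    (# (+ 16) ⊗ 𝐱₄ ^ 6) ⊗ (d ⊗ 𝐱₄ ^ 2)
      ≈⟨ ⊗-congˡ dbl-L ⟨
    (# (+ 16) ⊗ 𝐱₄ ^ 6) ⊗ dbl𝕊 L ∎𝕊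
    where
    open 𝕊-Reasoning
    d = 𝐲₂ ^ 4 ⊕ ⊖ 𝐱₂ ^ 4

  dbl-R : dbl𝕊 R ≈ # (+ 16) ⊗ ((𝐪 ⊗ 𝐪) ⊗ 𝐞₈ ^ 6)
  dbl-R = ≈-trans (dbl.θ-⊗ (# (+ 16)) (𝐪 ⊗ 𝐞₄ ^ 6)) (⊗-cong (dbl.θ-# (+ 16))
    (≈-trans (dbl.θ-⊗ 𝐪 (𝐞₄ ^ 6)) (⊗-cong dbl-𝐪 (dbl.θ-^ 6 𝐞₄))))

  R² : R ⊗ R ≈ (# (+ 16) ⊗ 𝐱₄ ^ 6) ⊗ dbl𝕊 R
  R² = begin𝕊
    R ⊗ R
      ≈⟨ solve𝕊 2 (λ q e → (♯ (+ 16) ×ˢ (q ×ˢ e ⇡ 6)) ×ˢ (♯ (+ 16) ×ˢ (q ×ˢ e ⇡ 6)) ≗ ♯ (+ 256) ×ˢ ((q ×ˢ q) ×ˢ (e ×ˢ e) ⇡ 6)) ≈-refl 𝐪 𝐞₄ ⟩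
    # (+ 256) ⊗ ((𝐪 ⊗ 𝐪) ⊗ (𝐞₄ ⊗ 𝐞₄) ^ 6)
      ≈⟨ cong³ (# (+ 256)) ≈-refl (^-congˡ 6 𝐞₄²) ⟩
    # (+ 256) ⊗ ((𝐪 ⊗ 𝐪) ⊗ (𝐱₄ ⊗ 𝐞₈) ^ 6)
      ≈⟨ solve𝕊 3 (λ q x e → ♯ (+ 256) ×ˢ (q ×ˢ (x ×ˢ e) ⇡ 6) ≗ (♯ (+ 16) ×ˢ x ⇡ 6) ×ˢ (♯ (+ 16) ×ˢ (q ×ˢ e ⇡ 6))) ≈-refl (𝐪 ⊗ 𝐪) 𝐱₄ 𝐞₈ ⟩
    (# (+ 16) ⊗ 𝐱₄ ^ 6) ⊗ (# (+ 16) ⊗ ((𝐪 ⊗ 𝐪) ⊗ 𝐞₈ ^ 6))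
      ≈⟨ ⊗-congˡ dbl-R ⟨
    (# (+ 16) ⊗ 𝐱₄ ^ 6) ⊗ dbl𝕊 R ∎𝕊
    where open 𝕊-Reasoning

-- Jacobi's aequatio identica satis abstrusa
jacobi : 𝐣 ⊗ 𝐱₂ ^ 2 ≈ # (+ 16) ⊗ (𝐪 ⊗ 𝐞₄ ^ 6)
jacobi = lift (functional-equation-unique (coef (# (+ 16) ⊗ 𝐱₄ ^ 6)) (coef L) (coef R) (lower L²) (lower R²) refl refl refl λ ())

-- The modular equation of level 2 and the matrix of U

1ˢ^ : ∀ n → 1ˢ ^ˢ n ≈ˢ 1ˢ
1ˢ^ zero    = q⁰≈1
1ˢ^ (suc n) = ≈ˢ-trans (⊛-congˡ 1ˢ (1ˢ^ n)) (solveˢ 0 (conˢ (+ 1) ⊠ conˢ (+ 1) ≑ conˢ (+ 1)) ≈ˢ-refl)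

-- Instantiated at m = 24 only; with m a variable the powers are not unfolded.
power-product : ∀ m (A : ℕ → Series) → A 0 ≈ˢ q^ 0 → (∀ n → A (suc n) ≈ˢ A n ⊛ (q^ 0 ⊖ˢ q^ (suc n)) ^ˢ m) →
                ∀ n → A n ≈ˢ 𝒩 n ^ˢ m
power-product m A A0 A-suc zero    = ≈ˢ-trans A0 (≈ˢ-trans q⁰≈1 (≈ˢ-sym (1ˢ^ m)))
power-product m A A0 A-suc (suc n) = ≈ˢ-trans (A-suc n) (≈ˢ-trans
  (⊛-cong (power-product m A A0 A-suc n) (^ˢ-cong m (+ˢ-congʳ (-ˢ q^ (suc n)) q⁰≈1)))
  (≈ˢ-sym (^ˢ-⊛ m (𝒩 n) (1ˢ +ˢ (-ˢ q^ (suc n))))))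

power-limit : ∀ m (A : ℕ → Series) → A 0 ≈ˢ q^ 0 → (∀ n → A (suc n) ≈ˢ A n ⊛ (q^ 0 ⊖ˢ q^ (suc n)) ^ˢ m) →
              ⟪ lim A ⟫ ≈ 𝐞₁ ^ m
power-limit m A A0 A-suc = lift (≈ˢ-trans
  (≈ˢ-intro λ n → trans (at (power-product m A A0 A-suc n) n)
    (sym (≈[]-^ {n} {E₁} {𝒩 n} m (lim-≈[] 𝒩-stable n) n ℕ.≤-refl)))
  (≈ˢ-sym (coef-^ m 𝐞₁)))

𝐟 𝐟₂ 𝚫 : 𝕊
𝐟  = ⟪ f ⟫
𝐟₂ = dbl𝕊 𝐟
𝚫  = ⟪ lim eulerProduct ⟫

𝚫≈𝐞₁ : 𝚫 ≈ 𝐞₁ ^ 24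
𝚫≈𝐞₁ = power-limit 24 eulerProduct ≈ˢ-refl (λ n → ≈ˢ-refl)

-- `tail Δ` and `lim eulerProduct` are the same function by definition, so the inverse that occurs
-- in `f` is the inverse of `𝚫`.
𝐟-𝚫 : 𝐟 ⊗ 𝚫 ≈ 𝐪 ⊗ dbl𝕊 𝚫
𝐟-𝚫 = begin𝕊
  𝐟 ⊗ 𝚫                ≈⟨ ⊗-congʳ {𝚫} {𝐟} {a ⊗ b} (lift ≈ˢ-refl) ⟩
  (a ⊗ b) ⊗ 𝚫          ≈⟨ solve𝕊 3 (λ a b c → (a ×ˢ b) ×ˢ c ≗ a ×ˢ (c ×ˢ b)) ≈-refl a b 𝚫 ⟩
  a ⊗ (𝚫 ⊗ b)          ≈⟨ ⊗-congˡ {a} (lift {𝚫 ⊗ b} {# (+ 1)} (≈ˢ-trans (Inverse.inverseʳ (tail Δ) refl) q⁰≈1)) ⟩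
  a ⊗ # (+ 1)          ≈⟨ 𝕊-Ring.*-identityʳ a ⟩
  a                    ≈⟨ lift (shift-tail (tail (double Δ)) refl) ⟩
  𝐪 ⊗ dbl𝕊 𝚫           ∎𝕊
  where
  open 𝕊-Reasoning
  a = ⟪ tail (double Δ) ⟫
  b = ⟪ inv (tail Δ) ⟫

HasUnitConstant : 𝕊 → Set
HasUnitConstant a = coef a 0 ≡ + 1

unit-⊗ : ∀ a b → HasUnitConstant a → HasUnitConstant b → HasUnitConstant (a ⊗ b)
unit-⊗ a b p q = trans (ℤ.+-identityʳ (coef a 0 * coef b 0)) (cong₂ _*_ p q)

unit-^ : ∀ n a → HasUnitConstant a → HasUnitConstant (a ^ n)
unit-^ zero    a p = refl
unit-^ (suc n) a p = unit-⊗ a (a ^ n) p (unit-^ n a p)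

-- Identities between quotients are proved after multiplication by a common denominator; this
-- removes such a denominator again, an integer times a series with constant term 1.
cancel-unit : ∀ k u {a b} → k ≢ + 0 → HasUnitConstant u → (# k ⊗ u) ⊗ a ≈ (# k ⊗ u) ⊗ b → a ≈ b
cancel-unit k u k≢0 p = 𝕊-cancel (# k ⊗ u) λ eq → k≢0 (trans
  (sym (trans (constant-⊛ₙ k (coef u) 0) (trans (cong (k *_) p) (ℤ.*-identityʳ k)))) eq)

cancel-power : ∀ n u {a b} → HasUnitConstant u → u ^ n ⊗ a ≈ u ^ n ⊗ b → a ≈ b
cancel-power n u p = 𝕊-cancel (u ^ n) λ eq → case trans (sym (unit-^ n u p)) eq of λ ()

-- Combine f = q (E₂ / E₁)²⁴ with Gauss's θ₄ = E₁² / E₂.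
𝐟-𝐱 : 𝐟 ⊗ 𝐱 ^ 12 ≈ 𝐪 ⊗ 𝐞₂ ^ 12
𝐟-𝐱 = cancel-power 12 𝐞₂ refl (begin𝕊
  𝐞₂ ^ 12 ⊗ (𝐟 ⊗ 𝐱 ^ 12)      ≈⟨ solve𝕊 3 (λ e f x → e ⇡ 12 ×ˢ (f ×ˢ x ⇡ 12) ≗ f ×ˢ (x ×ˢ e) ⇡ 12) ≈-refl 𝐞₂ 𝐟 𝐱 ⟩
  𝐟 ⊗ (𝐱 ⊗ 𝐞₂) ^ 12           ≈⟨ ⊗-congˡ (^-congˡ 12 𝐞₁²) ⟩
  𝐟 ⊗ (𝐞₁ ⊗ 𝐞₁) ^ 12          ≈⟨ solve𝕊 2 (λ f e → f ×ˢ (e ×ˢ e) ⇡ 12 ≗ f ×ˢ e ⇡ 24) ≈-refl 𝐟 𝐞₁ ⟩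
  𝐟 ⊗ 𝐞₁ ^ 24                 ≈⟨ ⊗-congˡ 𝚫≈𝐞₁ ⟨
  𝐟 ⊗ 𝚫                       ≈⟨ 𝐟-𝚫 ⟩
  𝐪 ⊗ dbl𝕊 𝚫                  ≈⟨ ⊗-congˡ (≈-trans (dbl.θ-cong 𝚫≈𝐞₁) (dbl.θ-^ 24 𝐞₁)) ⟩
  𝐪 ⊗ 𝐞₂ ^ 24                 ≈⟨ solve𝕊 2 (λ q e → q ×ˢ e ⇡ 24 ≗ e ⇡ 12 ×ˢ (q ×ˢ e ⇡ 12)) ≈-refl 𝐪 𝐞₂ ⟩
  𝐞₂ ^ 12 ⊗ (𝐪 ⊗ 𝐞₂ ^ 12)     ∎𝕊)
  where open 𝕊-Reasoning

𝐬 𝐭 : 𝕊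
𝐬 = 𝐱 ^ 4
𝐭 = 𝐲 ^ 4

unit-𝐬 : HasUnitConstant 𝐬
unit-𝐬 = unit-^ 4 𝐱 refl

unit-𝐭 : HasUnitConstant 𝐭
unit-𝐭 = unit-^ 4 𝐲 refl

𝐱₂⁸ : 𝐱₂ ^ 8 ≈ 𝐬 ⊗ 𝐭
𝐱₂⁸ = begin𝕊
  𝐱₂ ^ 8             ≈⟨ solve𝕊 1 (λ x → x ⇡ 8 ≗ (x ×ˢ x) ⇡ 4) ≈-refl 𝐱₂ ⟩
  (𝐱₂ ⊗ 𝐱₂) ^ 4      ≈⟨ ^-congˡ 4 𝐱𝐲 ⟨
  (𝐱 ⊗ 𝐲) ^ 4        ≈⟨ solve𝕊 2 (λ x y → (x ×ˢ y) ⇡ 4 ≗ x ⇡ 4 ×ˢ y ⇡ 4) ≈-refl 𝐱 𝐲 ⟩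
  𝐬 ⊗ 𝐭              ∎𝕊
  where open 𝕊-Reasoning

-- With u = 𝐭 / 𝐬 = (θ₃ / θ₄)⁴, the next three lemmas read f = u (u - 1) / 16,
-- f(q²) = (u - 1)² / 256 u and f(-q) = u⁻¹ (u⁻¹ - 1) / 16.

𝐟-uniformised : # (+ 16) ⊗ (𝐟 ⊗ (𝐬 ⊗ 𝐬)) ≈ 𝐭 ⊗ 𝐣
𝐟-uniformised = cancel-power 4 𝐱 refl (begin𝕊
  𝐬 ⊗ (# (+ 16) ⊗ (𝐟 ⊗ (𝐬 ⊗ 𝐬)))
    ≈⟨ solve𝕊 2 (λ f x → x ⇡ 4 ×ˢ (♯ (+ 16) ×ˢ (f ×ˢ (x ⇡ 4 ×ˢ x ⇡ 4))) ≗ ♯ (+ 16) ×ˢ (f ×ˢ x ⇡ 12)) ≈-refl 𝐟 𝐱 ⟩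
  # (+ 16) ⊗ (𝐟 ⊗ 𝐱 ^ 12)
    ≈⟨ ⊗-congˡ 𝐟-𝐱 ⟩
  # (+ 16) ⊗ (𝐪 ⊗ 𝐞₂ ^ 12)
    ≈⟨ solve𝕊 2 (λ q e → ♯ (+ 16) ×ˢ (q ×ˢ e ⇡ 12) ≗ ♯ (+ 16) ×ˢ (q ×ˢ (e ×ˢ e) ⇡ 6)) ≈-refl 𝐪 𝐞₂ ⟩
  # (+ 16) ⊗ (𝐪 ⊗ (𝐞₂ ⊗ 𝐞₂) ^ 6)
    ≈⟨ ⊗-congˡ (⊗-congˡ (^-congˡ 6 𝐞₂²)) ⟩
  # (+ 16) ⊗ (𝐪 ⊗ (𝐱₂ ⊗ 𝐞₄) ^ 6)
    ≈⟨ solve𝕊 3 (λ q x e → ♯ (+ 16) ×ˢ (q ×ˢ (x ×ˢ e) ⇡ 6) ≗ x ⇡ 6 ×ˢ (♯ (+ 16) ×ˢ (q ×ˢ e ⇡ 6))) ≈-refl 𝐪 𝐱₂ 𝐞₄ ⟩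
  𝐱₂ ^ 6 ⊗ (# (+ 16) ⊗ (𝐪 ⊗ 𝐞₄ ^ 6))
    ≈⟨ ⊗-congˡ jacobi ⟨
  𝐱₂ ^ 6 ⊗ (𝐣 ⊗ 𝐱₂ ^ 2)
    ≈⟨ solve𝕊 2 (λ j x → x ⇡ 6 ×ˢ (j ×ˢ x ⇡ 2) ≗ x ⇡ 8 ×ˢ j) ≈-refl 𝐣 𝐱₂ ⟩
  𝐱₂ ^ 8 ⊗ 𝐣
    ≈⟨ ⊗-congʳ 𝐱₂⁸ ⟩
  (𝐬 ⊗ 𝐭) ⊗ 𝐣
    ≈⟨ 𝕊-Ring.*-assoc 𝐬 𝐭 𝐣 ⟩
  𝐬 ⊗ (𝐭 ⊗ 𝐣) ∎𝕊)
  where open 𝕊-Reasoning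

𝐟₂-uniformised : # (+ 256) ⊗ (𝐟₂ ⊗ (𝐬 ⊗ 𝐭)) ≈ 𝐣 ⊗ 𝐣
𝐟₂-uniformised = cancel-power 4 𝐱₂ refl (begin𝕊
  𝐱₂ ^ 4 ⊗ (# (+ 256) ⊗ (𝐟₂ ⊗ (𝐬 ⊗ 𝐭)))
    ≈⟨ ⊗-congˡ (⊗-congˡ (⊗-congˡ 𝐱₂⁸)) ⟨
  𝐱₂ ^ 4 ⊗ (# (+ 256) ⊗ (𝐟₂ ⊗ 𝐱₂ ^ 8))
    ≈⟨ solve𝕊 2 (λ f x → x ⇡ 4 ×ˢ (♯ (+ 256) ×ˢ (f ×ˢ x ⇡ 8)) ≗ ♯ (+ 256) ×ˢ (f ×ˢ x ⇡ 12)) ≈-refl 𝐟₂ 𝐱₂ ⟩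
  # (+ 256) ⊗ (𝐟₂ ⊗ 𝐱₂ ^ 12)
    ≈⟨ ⊗-congˡ (≈-trans (⊗-congˡ (≈-sym (dbl.θ-^ 12 𝐱))) (≈-trans (≈-sym (dbl.θ-⊗ 𝐟 (𝐱 ^ 12)))
         (≈-trans (dbl.θ-cong 𝐟-𝐱) (≈-trans (dbl.θ-⊗ 𝐪 (𝐞₂ ^ 12)) (⊗-cong dbl-𝐪 (dbl.θ-^ 12 𝐞₂)))))) ⟩
  # (+ 256) ⊗ ((𝐪 ⊗ 𝐪) ⊗ 𝐞₄ ^ 12)
    ≈⟨ solve𝕊 2 (λ q e → ♯ (+ 256) ×ˢ ((q ×ˢ q) ×ˢ e ⇡ 12) ≗ (♯ (+ 16) ×ˢ (q ×ˢ e ⇡ 6)) ⇡ 2) ≈-refl 𝐪 𝐞₄ ⟩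
  (# (+ 16) ⊗ (𝐪 ⊗ 𝐞₄ ^ 6)) ^ 2
    ≈⟨ ^-congˡ 2 jacobi ⟨
  (𝐣 ⊗ 𝐱₂ ^ 2) ^ 2
    ≈⟨ solve𝕊 2 (λ j x → (j ×ˢ x ⇡ 2) ⇡ 2 ≗ x ⇡ 4 ×ˢ (j ×ˢ j)) ≈-refl 𝐣 𝐱₂ ⟩
  𝐱₂ ^ 4 ⊗ (𝐣 ⊗ 𝐣) ∎𝕊)
  where open 𝕊-Reasoning

σ𝐟-uniformised : # (+ 16) ⊗ (σ𝕊 𝐟 ⊗ (𝐭 ⊗ 𝐭)) ≈ 𝐬 ⊗ (𝐬 ⊕ ⊖ 𝐭)
σ𝐟-uniformised = begin𝕊
  # (+ 16) ⊗ (σ𝕊 𝐟 ⊗ (𝐭 ⊗ 𝐭))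
    ≈⟨ ⊗-cong (σσ.θ-# (+ 16)) (⊗-congˡ (⊗-cong σ𝐬 σ𝐬)) ⟨
  σ𝕊 (# (+ 16)) ⊗ (σ𝕊 𝐟 ⊗ (σ𝕊 𝐬 ⊗ σ𝕊 𝐬))
    ≈⟨ ≈-trans (σσ.θ-⊗ (# (+ 16)) (𝐟 ⊗ (𝐬 ⊗ 𝐬))) (⊗-congˡ (≈-trans (σσ.θ-⊗ 𝐟 (𝐬 ⊗ 𝐬)) (⊗-congˡ (σσ.θ-⊗ 𝐬 𝐬)))) ⟨
  σ𝕊 (# (+ 16) ⊗ (𝐟 ⊗ (𝐬 ⊗ 𝐬)))
    ≈⟨ σσ.θ-cong 𝐟-uniformised ⟩
  σ𝕊 (𝐭 ⊗ 𝐣)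
    ≈⟨ ≈-trans (σσ.θ-⊗ 𝐭 𝐣) (⊗-cong σ𝐭 (≈-trans (σσ.θ-⊖ 𝐭 𝐬) (⊕-cong σ𝐭 (⊖-cong σ𝐬)))) ⟩
  𝐬 ⊗ (𝐬 ⊕ ⊖ 𝐭) ∎𝕊
  where
  open 𝕊-Reasoning
  σ𝐱 : σ𝕊 𝐱 ≈ 𝐲
  σ𝐱 = lift σX
  σ𝐲 : σ𝕊 𝐲 ≈ 𝐱
  σ𝐲 = lift σY
  σ𝐬 : σ𝕊 𝐬 ≈ 𝐭
  σ𝐬 = ≈-trans (σσ.θ-^ 4 𝐱) (^-congˡ 4 σ𝐱)
  σ𝐭 : σ𝕊 𝐭 ≈ 𝐬
  σ𝐭 = ≈-trans (σσ.θ-^ 4 𝐲) (^-congˡ 4 σ𝐲)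

-- The series f(q) and f(-q) are conjugate over series in q²: they are the roots of
-- `modular-equation`, with this sum and with product -f(q²).
trace : 𝕊
trace = # (+ 48) ⊗ 𝐟₂ ⊕ # (+ 4096) ⊗ (𝐟₂ ⊗ 𝐟₂)

-- With f = t (t - s) / 16 s² and f(q²) = (t - s)² / 256 st, the term f(q²)² f has the largest
-- denominator, 2²⁰ s⁴ t². Multiplied by it, the equation is a polynomial identity in s and t.
modular-equation : 𝐟 ⊗ 𝐟 ≈ trace ⊗ 𝐟 ⊕ 𝐟₂
modular-equation = cancel-unit (+ 1048576) (𝐬 ^ 4 ⊗ 𝐭 ^ 2) (λ ()) (unit-⊗ (𝐬 ^ 4) (𝐭 ^ 2) (unit-^ 4 𝐬 unit-𝐬) (unit-^ 2 𝐭 unit-𝐭)) (begin𝕊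
  N ⊗ (𝐟 ⊗ 𝐟)
    ≈⟨ solve𝕊 3 (λ f s t → (♯ (+ 1048576) ×ˢ (s ⇡ 4 ×ˢ t ⇡ 2)) ×ˢ (f ×ˢ f) ≗
         (♯ (+ 4096) ×ˢ t ⇡ 2) ×ˢ (♯ (+ 16) ×ˢ (f ×ˢ (s ×ˢ s))) ⇡ 2) ≈-refl 𝐟 𝐬 𝐭 ⟩
  (# (+ 4096) ⊗ 𝐭 ^ 2) ⊗ (# (+ 16) ⊗ (𝐟 ⊗ (𝐬 ⊗ 𝐬))) ^ 2
    ≈⟨ ⊗-congˡ (^-congˡ 2 𝐟-uniformised) ⟩
  (# (+ 4096) ⊗ 𝐭 ^ 2) ⊗ (𝐭 ⊗ (𝐭 ⊕ ⊖ 𝐬)) ^ 2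
    ≈⟨ solve𝕊 2 (λ s t → let j = t ∔ (∸ s) in
         (♯ (+ 4096) ×ˢ t ⇡ 2) ×ˢ (t ×ˢ j) ⇡ 2 ≗
         (♯ (+ 12288) ×ˢ (s ×ˢ t)) ×ˢ ((j ×ˢ j) ×ˢ (t ×ˢ j)) ∔ ♯ (+ 4096) ×ˢ ((j ×ˢ j) ⇡ 2 ×ˢ (t ×ˢ j)) ∔ (♯ (+ 4096) ×ˢ (s ⇡ 3 ×ˢ t)) ×ˢ (j ×ˢ j))
         ≈-refl 𝐬 𝐭 ⟩
  (# (+ 12288) ⊗ (𝐬 ⊗ 𝐭)) ⊗ ((𝐣 ⊗ 𝐣) ⊗ (𝐭 ⊗ 𝐣)) ⊕ # (+ 4096) ⊗ ((𝐣 ⊗ 𝐣) ^ 2 ⊗ (𝐭 ⊗ 𝐣)) ⊕ (# (+ 4096) ⊗ (𝐬 ^ 3 ⊗ 𝐭)) ⊗ (𝐣 ⊗ 𝐣)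
    ≈⟨ ⊕-cong (⊕-cong (⊗-congˡ (⊗-cong 𝐟₂-uniformised 𝐟-uniformised))
         (⊗-congˡ (⊗-cong (^-congˡ 2 𝐟₂-uniformised) 𝐟-uniformised))) (⊗-congˡ 𝐟₂-uniformised) ⟨
  (# (+ 12288) ⊗ (𝐬 ⊗ 𝐭)) ⊗ (y′ ⊗ f′) ⊕ # (+ 4096) ⊗ (y′ ^ 2 ⊗ f′) ⊕ (# (+ 4096) ⊗ (𝐬 ^ 3 ⊗ 𝐭)) ⊗ y′
    ≈⟨ solve𝕊 4 (λ f y s t → let f′ = ♯ (+ 16) ×ˢ (f ×ˢ (s ×ˢ s)) ; y′ = ♯ (+ 256) ×ˢ (y ×ˢ (s ×ˢ t)) in
         (♯ (+ 12288) ×ˢ (s ×ˢ t)) ×ˢ (y′ ×ˢ f′) ∔ ♯ (+ 4096) ×ˢ (y′ ⇡ 2 ×ˢ f′) ∔ (♯ (+ 4096) ×ˢ (s ⇡ 3 ×ˢ t)) ×ˢ y′ ≗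
         (♯ (+ 1048576) ×ˢ (s ⇡ 4 ×ˢ t ⇡ 2)) ×ˢ ((♯ (+ 48) ×ˢ y ∔ ♯ (+ 4096) ×ˢ (y ×ˢ y)) ×ˢ f ∔ y)) ≈-refl 𝐟 𝐟₂ 𝐬 𝐭 ⟩
  N ⊗ (trace ⊗ 𝐟 ⊕ 𝐟₂) ∎𝕊)
  where
  open 𝕊-Reasoning
  N f′ y′ : 𝕊
  N = # (+ 1048576) ⊗ (𝐬 ^ 4 ⊗ 𝐭 ^ 2)
  f′ = # (+ 16) ⊗ (𝐟 ⊗ (𝐬 ⊗ 𝐬))
  y′ = # (+ 256) ⊗ (𝐟₂ ⊗ (𝐬 ⊗ 𝐭))

-- Here the common denominator is that of f(q²)², namely 2¹⁶ s² t²; f(-q) arises from f by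
-- exchanging s and t.
𝐟+σ𝐟 : 𝐟 ⊕ σ𝕊 𝐟 ≈ trace
𝐟+σ𝐟 = cancel-unit (+ 65536) ((𝐬 ⊗ 𝐭) ^ 2) (λ ()) (unit-^ 2 (𝐬 ⊗ 𝐭) (unit-⊗ 𝐬 𝐭 unit-𝐬 unit-𝐭)) (begin𝕊
  N ⊗ (𝐟 ⊕ σ𝕊 𝐟)
    ≈⟨ solve𝕊 4 (λ f f⁻ s t → (♯ (+ 65536) ×ˢ (s ×ˢ t) ⇡ 2) ×ˢ (f ∔ f⁻) ≗
         (♯ (+ 4096) ×ˢ t ⇡ 2) ×ˢ (♯ (+ 16) ×ˢ (f ×ˢ (s ×ˢ s))) ∔ (♯ (+ 4096) ×ˢ s ⇡ 2) ×ˢ (♯ (+ 16) ×ˢ (f⁻ ×ˢ (t ×ˢ t)))) ≈-refl 𝐟 (σ𝕊 𝐟) 𝐬 𝐭 ⟩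
  (# (+ 4096) ⊗ 𝐭 ^ 2) ⊗ (# (+ 16) ⊗ (𝐟 ⊗ (𝐬 ⊗ 𝐬))) ⊕ (# (+ 4096) ⊗ 𝐬 ^ 2) ⊗ (# (+ 16) ⊗ (σ𝕊 𝐟 ⊗ (𝐭 ⊗ 𝐭)))
    ≈⟨ ⊕-cong (⊗-congˡ 𝐟-uniformised) (⊗-congˡ σ𝐟-uniformised) ⟩
  (# (+ 4096) ⊗ 𝐭 ^ 2) ⊗ (𝐭 ⊗ 𝐣) ⊕ (# (+ 4096) ⊗ 𝐬 ^ 2) ⊗ (𝐬 ⊗ (𝐬 ⊕ ⊖ 𝐭))
    ≈⟨ solve𝕊 2 (λ s t → let j = t ∔ (∸ s) in
         (♯ (+ 4096) ×ˢ t ⇡ 2) ×ˢ (t ×ˢ j) ∔ (♯ (+ 4096) ×ˢ s ⇡ 2) ×ˢ (s ×ˢ (s ∔ (∸ t))) ≗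
         (♯ (+ 12288) ×ˢ (s ×ˢ t)) ×ˢ (j ×ˢ j) ∔ ♯ (+ 4096) ×ˢ (j ×ˢ j) ⇡ 2) ≈-refl 𝐬 𝐭 ⟩
  (# (+ 12288) ⊗ (𝐬 ⊗ 𝐭)) ⊗ (𝐣 ⊗ 𝐣) ⊕ # (+ 4096) ⊗ (𝐣 ⊗ 𝐣) ^ 2
    ≈⟨ ⊕-cong (⊗-congˡ 𝐟₂-uniformised) (⊗-congˡ (^-congˡ 2 𝐟₂-uniformised)) ⟨
  (# (+ 12288) ⊗ (𝐬 ⊗ 𝐭)) ⊗ y′ ⊕ # (+ 4096) ⊗ y′ ^ 2
    ≈⟨ solve𝕊 3 (λ y s t → let y′ = ♯ (+ 256) ×ˢ (y ×ˢ (s ×ˢ t)) in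
         (♯ (+ 12288) ×ˢ (s ×ˢ t)) ×ˢ y′ ∔ ♯ (+ 4096) ×ˢ y′ ⇡ 2 ≗
         (♯ (+ 65536) ×ˢ (s ×ˢ t) ⇡ 2) ×ˢ (♯ (+ 48) ×ˢ y ∔ ♯ (+ 4096) ×ˢ (y ×ˢ y))) ≈-refl 𝐟₂ 𝐬 𝐭 ⟩
  N ⊗ trace ∎𝕊)
  where
  open 𝕊-Reasoning
  N y′ : 𝕊
  N = # (+ 65536) ⊗ (𝐬 ⊗ 𝐭) ^ 2
  y′ = # (+ 256) ⊗ (𝐟₂ ⊗ (𝐬 ⊗ 𝐭))

-- U on the powers of g

ev : 𝕊 → 𝕊
ev a .coef = even-part (coef a)

ev-cong : ∀ {a b} → a ≈ b → ev a ≈ ev b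
ev-cong p = lift (≈ˢ-intro λ n → at (lower p) (dbl n))

ev-⊕ : ∀ a b → ev (a ⊕ b) ≈ ev a ⊕ ev b
ev-⊕ a b = lift ≈ˢ-refl

ev-dbl : ∀ a b → ev (dbl𝕊 b ⊗ a) ≈ b ⊗ ev a
ev-dbl a b = lift (≈ˢ-intro λ n → even-part-⊛ₙ n (coef a) (coef b))

ev-# : ∀ k a → ev (# k ⊗ a) ≈ # k ⊗ ev a
ev-# k a = ≈-trans (ev-cong (⊗-congʳ (≈-sym (dbl.θ-# k)))) (ev-dbl a (# k))

-- `𝐰` at q² is 64 times `trace`, that is g(q) + g(-q), written in terms of g(q²).
𝐠 𝐰 : 𝕊
𝐠 = ⟪ g ⟫
𝐰 = # (+ 48) ⊗ 𝐠 ⊕ # (+ 64) ⊗ (𝐠 ⊗ 𝐠)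

𝐠≈64𝐟 : 𝐠 ≈ # (+ 64) ⊗ 𝐟
𝐠≈64𝐟 = lift (·ˢ-as-⊛ (+ 64) f)

𝐠² : 𝐠 ⊗ 𝐠 ≈ dbl𝕊 𝐰 ⊗ 𝐠 ⊕ dbl𝕊 (# (+ 64) ⊗ 𝐠)
𝐠² = begin𝕊
  𝐠 ⊗ 𝐠
    ≈⟨ ⊗-cong 𝐠≈64𝐟 𝐠≈64𝐟 ⟩
  (# (+ 64) ⊗ 𝐟) ⊗ (# (+ 64) ⊗ 𝐟)
    ≈⟨ solve𝕊 1 (λ f → (♯ (+ 64) ×ˢ f) ×ˢ (♯ (+ 64) ×ˢ f) ≗ ♯ (+ 4096) ×ˢ (f ×ˢ f)) ≈-refl 𝐟 ⟩
  # (+ 4096) ⊗ (𝐟 ⊗ 𝐟)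
    ≈⟨ ⊗-congˡ modular-equation ⟩
  # (+ 4096) ⊗ (trace ⊗ 𝐟 ⊕ 𝐟₂)
    ≈⟨ solve𝕊 2 (λ f y → ♯ (+ 4096) ×ˢ ((♯ (+ 48) ×ˢ y ∔ ♯ (+ 4096) ×ˢ (y ×ˢ y)) ×ˢ f ∔ y) ≗
         (♯ (+ 48) ×ˢ (♯ (+ 64) ×ˢ y) ∔ ♯ (+ 64) ×ˢ ((♯ (+ 64) ×ˢ y) ×ˢ (♯ (+ 64) ×ˢ y))) ×ˢ (♯ (+ 64) ×ˢ f) ∔ ♯ (+ 64) ×ˢ (♯ (+ 64) ×ˢ y))
         ≈-refl 𝐟 𝐟₂ ⟩
  (# (+ 48) ⊗ (# (+ 64) ⊗ 𝐟₂) ⊕ # (+ 64) ⊗ ((# (+ 64) ⊗ 𝐟₂) ⊗ (# (+ 64) ⊗ 𝐟₂))) ⊗ (# (+ 64) ⊗ 𝐟) ⊕ # (+ 64) ⊗ (# (+ 64) ⊗ 𝐟₂)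
    ≈⟨ ⊕-cong (⊗-cong (⊕-cong (⊗-congˡ 𝐠₂) (⊗-congˡ (⊗-cong 𝐠₂ 𝐠₂))) 𝐠≈64𝐟) (⊗-congˡ 𝐠₂) ⟨
  (# (+ 48) ⊗ dbl𝕊 𝐠 ⊕ # (+ 64) ⊗ (dbl𝕊 𝐠 ⊗ dbl𝕊 𝐠)) ⊗ 𝐠 ⊕ # (+ 64) ⊗ dbl𝕊 𝐠
    ≈⟨ ⊕-cong (⊗-congʳ (≈-trans (dbl.θ-⊕ _ _) (⊕-cong (dbl-# (+ 48) 𝐠)
         (≈-trans (dbl-# (+ 64) (𝐠 ⊗ 𝐠)) (⊗-congˡ (dbl.θ-⊗ 𝐠 𝐠)))))) (dbl-# (+ 64) 𝐠) ⟨
  dbl𝕊 𝐰 ⊗ 𝐠 ⊕ dbl𝕊 (# (+ 64) ⊗ 𝐠) ∎𝕊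
  where
  open 𝕊-Reasoning
  dbl-# : ∀ k a → dbl𝕊 (# k ⊗ a) ≈ # k ⊗ dbl𝕊 a
  dbl-# k a = ≈-trans (dbl.θ-⊗ (# k) a) (⊗-congʳ (dbl.θ-# k))
  𝐠₂ : dbl𝕊 𝐠 ≈ # (+ 64) ⊗ 𝐟₂
  𝐠₂ = ≈-trans (dbl.θ-cong 𝐠≈64𝐟) (dbl-# (+ 64) 𝐟)

-- Multiply `𝐠²` by gʲ; its coefficients are series in q², which U lets pass. The result is the
-- three-term recurrence that defines `col`.
ev-power : ∀ j → ev (𝐠 ^ (2 ℕ.+ j)) ≈ 𝐰 ⊗ ev (𝐠 ^ (1 ℕ.+ j)) ⊕ (# (+ 64) ⊗ 𝐠) ⊗ ev (𝐠 ^ j)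
ev-power j = begin𝕊
  ev (𝐠 ⊗ (𝐠 ⊗ 𝐠 ^ j))
    ≈⟨ ev-cong (≈-trans (≈-sym (𝕊-Ring.*-assoc 𝐠 𝐠 (𝐠 ^ j))) (⊗-congʳ 𝐠²)) ⟩
  ev ((dbl𝕊 𝐰 ⊗ 𝐠 ⊕ dbl𝕊 (# (+ 64) ⊗ 𝐠)) ⊗ 𝐠 ^ j)
    ≈⟨ ev-cong (solve𝕊 4 (λ w g h p → (w ×ˢ g ∔ h) ×ˢ p ≗ w ×ˢ (g ×ˢ p) ∔ h ×ˢ p) ≈-refl (dbl𝕊 𝐰) 𝐠 (dbl𝕊 (# (+ 64) ⊗ 𝐠)) (𝐠 ^ j)) ⟩
  ev (dbl𝕊 𝐰 ⊗ (𝐠 ⊗ 𝐠 ^ j) ⊕ dbl𝕊 (# (+ 64) ⊗ 𝐠) ⊗ 𝐠 ^ j)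
    ≈⟨ ev-⊕ (dbl𝕊 𝐰 ⊗ (𝐠 ⊗ 𝐠 ^ j)) (dbl𝕊 (# (+ 64) ⊗ 𝐠) ⊗ 𝐠 ^ j) ⟩
  ev (dbl𝕊 𝐰 ⊗ (𝐠 ⊗ 𝐠 ^ j)) ⊕ ev (dbl𝕊 (# (+ 64) ⊗ 𝐠) ⊗ 𝐠 ^ j)
    ≈⟨ ⊕-cong (ev-dbl (𝐠 ⊗ 𝐠 ^ j) 𝐰) (ev-dbl (𝐠 ^ j) (# (+ 64) ⊗ 𝐠)) ⟩
  𝐰 ⊗ ev (𝐠 ⊗ 𝐠 ^ j) ⊕ (# (+ 64) ⊗ 𝐠) ⊗ ev (𝐠 ^ j) ∎𝕊
  where open 𝕊-Reasoning

ev-1 : ev (# (+ 1)) ≈ # (+ 1)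
ev-1 = ≈-trans (ev-cong (≈-sym (𝕊-Ring.*-identityʳ (# (+ 1)))))
  (≈-trans (ev-# (+ 1) (# (+ 1))) (≈-trans (𝕊-Ring.*-identityˡ (ev (# (+ 1)))) (lift (≈ˢ-intro λ n → cong (+ 1 *_) (q^0-dbl n)))))
  where
  q^0-dbl : ∀ n → q^ 0 (dbl n) ≡ q^ 0 n
  q^0-dbl = q^-dbl 0

-- U does not see the odd coefficients, so 2 U(f) = U(f(q) + f(-q)); the right side is U of a
-- polynomial in f(q²), and U undoes q ↦ q².
ev-𝐠 : ev 𝐠 ≈ # (+ 24) ⊗ 𝐠 ⊕ # (+ 32) ⊗ (𝐠 ⊗ 𝐠)
ev-𝐠 = 𝕊-cancel (# (+ 2)) (λ ()) (begin𝕊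
  # (+ 2) ⊗ ev 𝐠
    ≈⟨ ⊗-congˡ (≈-trans (ev-cong 𝐠≈64𝐟) (ev-# (+ 64) 𝐟)) ⟩
  # (+ 2) ⊗ (# (+ 64) ⊗ ev 𝐟)
    ≈⟨ solve𝕊 1 (λ e → ♯ (+ 2) ×ˢ (♯ (+ 64) ×ˢ e) ≗ ♯ (+ 64) ×ˢ (e ∔ e)) ≈-refl (ev 𝐟) ⟩
  # (+ 64) ⊗ (ev 𝐟 ⊕ ev 𝐟)
    ≈⟨ ⊗-congˡ (⊕-congˡ ev-σ) ⟨
  # (+ 64) ⊗ (ev 𝐟 ⊕ ev (σ𝕊 𝐟))
    ≈⟨ ⊗-congˡ (≈-trans (≈-sym (ev-⊕ 𝐟 (σ𝕊 𝐟))) (ev-cong 𝐟+σ𝐟)) ⟩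
  # (+ 64) ⊗ ev trace
    ≈⟨ ⊗-congˡ (≈-trans (ev-⊕ (# (+ 48) ⊗ 𝐟₂) (# (+ 4096) ⊗ (𝐟₂ ⊗ 𝐟₂)))
         (⊕-cong (≈-trans (ev-# (+ 48) 𝐟₂) (⊗-congˡ ev-𝐟₂))
           (≈-trans (ev-# (+ 4096) (𝐟₂ ⊗ 𝐟₂)) (⊗-congˡ (≈-trans (ev-dbl 𝐟₂ 𝐟) (⊗-congˡ ev-𝐟₂)))))) ⟩
  # (+ 64) ⊗ (# (+ 48) ⊗ 𝐟 ⊕ # (+ 4096) ⊗ (𝐟 ⊗ 𝐟))
    ≈⟨ solve𝕊 1 (λ f → ♯ (+ 64) ×ˢ (♯ (+ 48) ×ˢ f ∔ ♯ (+ 4096) ×ˢ (f ×ˢ f)) ≗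
         ♯ (+ 2) ×ˢ (♯ (+ 24) ×ˢ (♯ (+ 64) ×ˢ f) ∔ ♯ (+ 32) ×ˢ ((♯ (+ 64) ×ˢ f) ×ˢ (♯ (+ 64) ×ˢ f)))) ≈-refl 𝐟 ⟩
  # (+ 2) ⊗ (# (+ 24) ⊗ (# (+ 64) ⊗ 𝐟) ⊕ # (+ 32) ⊗ ((# (+ 64) ⊗ 𝐟) ⊗ (# (+ 64) ⊗ 𝐟)))
    ≈⟨ ⊗-congˡ (⊕-cong (⊗-congˡ 𝐠≈64𝐟) (⊗-congˡ (⊗-cong 𝐠≈64𝐟 𝐠≈64𝐟))) ⟨
  # (+ 2) ⊗ (# (+ 24) ⊗ 𝐠 ⊕ # (+ 32) ⊗ (𝐠 ⊗ 𝐠)) ∎𝕊)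
  where
  open 𝕊-Reasoning
  ev-σ : ev (σ𝕊 𝐟) ≈ ev 𝐟
  ev-σ = lift (≈ˢ-intro λ n → trans (cong (_* f (dbl n)) (sgn-dbl n)) (ℤ.*-identityˡ (f (dbl n))))
  ev-𝐟₂ : ev 𝐟₂ ≈ 𝐟
  ev-𝐟₂ = lift (≈ˢ-intro λ n → double-dbl n f)

-- Σ hᵢ gⁱ over i < m
evaluate : ℕ → (ℕ → ℤ) → 𝕊
evaluate zero    h = # (+ 0)
evaluate (suc m) h = # (h 0) ⊕ 𝐠 ⊗ evaluate m (h ∘ suc)

evaluate-cong : ∀ m {h k} → (∀ i → h i ≡ k i) → evaluate m h ≈ evaluate m k
evaluate-cong zero    eq = ≈-refl
evaluate-cong (suc m) eq = ⊕-cong (𝕊-Ring.reflexive (cong # (eq 0))) (⊗-congˡ (evaluate-cong m (eq ∘ suc)))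

evaluate-0 : ∀ m → evaluate m (λ _ → + 0) ≈ # (+ 0)
evaluate-0 zero    = ≈-refl
evaluate-0 (suc m) = ≈-trans (⊕-congˡ (≈-trans (⊗-congˡ (evaluate-0 m)) (𝕊-Ring.zeroʳ 𝐠))) (𝕊-Ring.+-identityˡ (# (+ 0)))

evaluate-+ : ∀ m h k → evaluate m (λ i → h i + k i) ≈ evaluate m h ⊕ evaluate m k
evaluate-+ zero    h k = ≈-sym (𝕊-Ring.+-identityˡ (# (+ 0)))
evaluate-+ (suc m) h k = ≈-trans (⊕-cong (#-+ (h 0) (k 0)) (⊗-congˡ (evaluate-+ m (h ∘ suc) (k ∘ suc))))
  (solve𝕊 5 (λ a b g x y → (a ∔ b) ∔ g ×ˢ (x ∔ y) ≗ (a ∔ g ×ˢ x) ∔ (b ∔ g ×ˢ y)) ≈-refl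
    (# (h 0)) (# (k 0)) 𝐠 (evaluate m (h ∘ suc)) (evaluate m (k ∘ suc)))

evaluate-* : ∀ m c h → evaluate m (λ i → c * h i) ≈ # c ⊗ evaluate m h
evaluate-* zero    c h = ≈-sym (𝕊-Ring.zeroʳ (# c))
evaluate-* (suc m) c h = ≈-trans (⊕-cong (#-* c (h 0)) (⊗-congˡ (evaluate-* m c (h ∘ suc))))
  (solve𝕊 4 (λ c a g x → c ×ˢ a ∔ g ×ˢ (c ×ˢ x) ≗ c ×ˢ (a ∔ g ×ˢ x)) ≈-refl (# c) (# (h 0)) 𝐠 (evaluate m (h ∘ suc)))

evaluate-shift : ∀ m h → evaluate (suc m) (shift h) ≈ 𝐠 ⊗ evaluate m h
evaluate-shift m h = 𝕊-Ring.+-identityˡ (𝐠 ⊗ evaluate m h)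

-- U(gʲ) is a polynomial of degree at most 2j in g. The padding `k` allows any larger length, so
-- that the terms of the recurrence, whose degrees differ, can be added at one length.
ev-col : ∀ j k → ev (𝐠 ^ j) ≈ evaluate (suc (dbl j ℕ.+ k)) (col j)
ev-col zero k = ≈-trans ev-1 (≈-sym (begin𝕊
  # (+ 1) ⊕ 𝐠 ⊗ evaluate k (λ _ → + 0)   ≈⟨ ⊕-congˡ (≈-trans (⊗-congˡ (evaluate-0 k)) (𝕊-Ring.zeroʳ 𝐠)) ⟩
  # (+ 1) ⊕ # (+ 0)                      ≈⟨ 𝕊-Ring.+-identityʳ (# (+ 1)) ⟩
  # (+ 1)                                ∎𝕊))
  where open 𝕊-Reasoning
ev-col (suc zero) k = begin𝕊
  ev (𝐠 ⊗ # (+ 1))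
    ≈⟨ ≈-trans (ev-cong (𝕊-Ring.*-identityʳ 𝐠)) ev-𝐠 ⟩
  # (+ 24) ⊗ 𝐠 ⊕ # (+ 32) ⊗ (𝐠 ⊗ 𝐠)
    ≈⟨ solve𝕊 1 (λ g → ♯ (+ 24) ×ˢ g ∔ ♯ (+ 32) ×ˢ (g ×ˢ g) ≗ ♯ (+ 0) ∔ g ×ˢ (♯ (+ 24) ∔ g ×ˢ (♯ (+ 32) ∔ g ×ˢ ♯ (+ 0)))) ≈-refl 𝐠 ⟩
  # (+ 0) ⊕ 𝐠 ⊗ (# (+ 24) ⊕ 𝐠 ⊗ (# (+ 32) ⊕ 𝐠 ⊗ # (+ 0)))
    ≈⟨ ⊕-congˡ (⊗-congˡ (⊕-congˡ (⊗-congˡ (⊕-congˡ (⊗-congˡ (evaluate-0 k)))))) ⟨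
  evaluate (3 ℕ.+ k) (col 1) ∎𝕊
  where open 𝕊-Reasoning
ev-col (suc (suc j)) k = begin𝕊
  ev (𝐠 ^ (2 ℕ.+ j))
    ≈⟨ ev-power j ⟩
  𝐰 ⊗ ev (𝐠 ^ (1 ℕ.+ j)) ⊕ (# (+ 64) ⊗ 𝐠) ⊗ ev (𝐠 ^ j)
    ≈⟨ solve𝕊 3 (λ g x y → (♯ (+ 48) ×ˢ g ∔ ♯ (+ 64) ×ˢ (g ×ˢ g)) ×ˢ x ∔ (♯ (+ 64) ×ˢ g) ×ˢ y ≗
         g ×ˢ (♯ (+ 48) ×ˢ x ∔ ♯ (+ 64) ×ˢ (g ×ˢ x ∔ y))) ≈-refl 𝐠 (ev (𝐠 ^ (1 ℕ.+ j))) (ev (𝐠 ^ j)) ⟩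
  𝐠 ⊗ (# (+ 48) ⊗ ev (𝐠 ^ (1 ℕ.+ j)) ⊕ # (+ 64) ⊗ (𝐠 ⊗ ev (𝐠 ^ (1 ℕ.+ j)) ⊕ ev (𝐠 ^ j)))
    ≈⟨ ⊗-congˡ (⊕-cong (⊗-congˡ (u₁ (ev-col (suc j) (suc k)))) (⊗-congˡ (⊕-cong
         (≈-trans (⊗-congˡ (ev-col (suc j) k)) (≈-sym (evaluate-shift m h₁))) (u₀ (ev-col j (3 ℕ.+ k)))))) ⟩
  𝐠 ⊗ (# (+ 48) ⊗ evaluate (suc m) h₁ ⊕ # (+ 64) ⊗ (evaluate (suc m) (shift h₁) ⊕ evaluate (suc m) h₀))
    ≈⟨ ⊗-congˡ (≈-trans (evaluate-+ (suc m) (λ i → + 48 * h₁ i) (λ i → + 64 * (shift h₁ i + h₀ i))) (⊕-cong (evaluate-* (suc m) (+ 48) h₁)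
         (≈-trans (evaluate-* (suc m) (+ 64) (λ i → shift h₁ i + h₀ i)) (⊗-congˡ (evaluate-+ (suc m) (shift h₁) h₀))))) ⟨
  𝐠 ⊗ evaluate (suc m) (λ i → + 48 * h₁ i + + 64 * (shift h₁ i + h₀ i))
    ≈⟨ evaluate-shift (suc m) (λ i → + 48 * h₁ i + + 64 * (shift h₁ i + h₀ i)) ⟨
  evaluate (suc (suc m)) (shift (λ i → + 48 * h₁ i + + 64 * (shift h₁ i + h₀ i)))
    ≈⟨ evaluate-cong (suc (suc m)) {shift (λ i → + 48 * h₁ i + + 64 * (shift h₁ i + h₀ i))} {col (suc (suc j))} (λ i → refl) ⟩
  evaluate (suc (suc m)) (col (suc (suc j))) ∎𝕊
  where
  open 𝕊-Reasoning
  m = suc (dbl (suc j) ℕ.+ k)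
  h₁ = col (suc j)
  h₀ = col j
  u₁ : ∀ {a} → a ≈ evaluate (suc (dbl (suc j) ℕ.+ suc k)) h₁ → a ≈ evaluate (suc m) h₁
  u₁ eq = ≈-trans eq (𝕊-Ring.reflexive (cong (λ n → evaluate (suc n) h₁) (ℕ.+-suc (dbl (suc j)) k)))
  u₀ : ∀ {a} → a ≈ evaluate (suc (dbl j ℕ.+ (3 ℕ.+ k))) h₀ → a ≈ evaluate (suc m) h₀
  u₀ eq = ≈-trans eq (𝕊-Ring.reflexive (cong (λ n → evaluate (suc n) h₀)
    (trans (ℕ.+-suc (dbl j) (2 ℕ.+ k)) (cong suc (trans (ℕ.+-suc (dbl j) (suc k)) (cong suc (ℕ.+-suc (dbl j) k)))))))

powers-Σ< : ∀ m h n → coef (evaluate m h) n ≡ Σ< m λ i → h i * (g ^ˢ i) n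
powers-Σ< zero    h n = refl
powers-Σ< (suc m) h n = begin
  h 0 * q^ 0 n + (g ⊛ coef (evaluate m (h ∘ suc))) n
    ≡⟨ cong (λ z → h 0 * q^ 0 n + z) (⊛-congₙ n {g} {g} {coef (evaluate m (h ∘ suc))} {λ i → Σ< m λ k → h (suc k) * (g ^ˢ k) i}
         (λ _ _ → refl) (λ i _ → powers-Σ< m (h ∘ suc) i)) ⟩
  h 0 * q^ 0 n + (g ⊛ (λ i → Σ< m λ k → h (suc k) * (g ^ˢ k) i)) n
    ≡⟨ cong (λ z → h 0 * q^ 0 n + z) (distribute m) ⟩
  h 0 * q^ 0 n + Σ< m (λ k → h (suc k) * (g ⊛ g ^ˢ k) n)
    ≡⟨ Σ<-first m (λ i → h i * (g ^ˢ i) n) ⟨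
  Σ< (suc m) (λ i → h i * (g ^ˢ i) n) ∎
  where
  distribute : ∀ m → (g ⊛ (λ i → Σ< m λ k → h (suc k) * (g ^ˢ k) i)) n ≡ Σ< m λ k → h (suc k) * (g ⊛ g ^ˢ k) n
  distribute zero    = trans (⊛-commₙ n g 0ˢ) (⊛-zeroₙ n g)
  distribute (suc m) = trans (at (Ser.distribˡ g (λ i → Σ< m λ k → h (suc k) * (g ^ˢ k) i) (h (suc m) ·ˢ (g ^ˢ m))) n)
    (cong₂ _+_ (distribute m) (trans (⊛-commₙ n g (h (suc m) ·ˢ (g ^ˢ m))) (trans (·ˢ-⊛ₙ n (h (suc m)) (g ^ˢ m) g)
      (cong (h (suc m) *_) (⊛-commₙ n (g ^ˢ m) g)))))

Σ<-extend : ∀ n k h → (∀ i → n ℕ.≤ i → h i ≡ + 0) → Σ< (k ℕ.+ n) h ≡ Σ< n h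
Σ<-extend n zero    h off = refl
Σ<-extend n (suc k) h off = trans (cong₂ _+_ (Σ<-extend n k h off) (off (k ℕ.+ n) (ℕ.m≤n+m n k))) (ℤ.+-identityʳ (Σ< n h))

g-vanishes : ∀ {i n} → n ℕ.< i → (g ^ˢ i) n ≡ + 0
g-vanishes {i} {n} = Vanishes-^ {g} refl i n

-- The sum from `ev-col` has a length depending on `b`; it is cut to the range i < n that
-- `qExpansion` uses.
U-power : ∀ b n → (g ^ˢ suc b) (2 ℕ.* n) ≡ Σ< n λ i → col (suc b) (suc i) * (g ^ˢ suc i) n
U-power b n = begin
  (g ^ˢ suc b) (2 ℕ.* n)
    ≡⟨ cong (g ^ˢ suc b) (ℤ.+-injective (trans (ℤ.pos-* 2 n) (sym (+dbl n)))) ⟩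
  (g ^ˢ suc b) (dbl n)
    ≡⟨ at (coef-^ (suc b) 𝐠) (dbl n) ⟨
  coef (ev (𝐠 ^ suc b)) n
    ≡⟨ at (lower (ev-col (suc b) n)) n ⟩
  coef (evaluate (suc (dbl (suc b) ℕ.+ n)) (col (suc b))) n
    ≡⟨ powers-Σ< (suc (dbl (suc b) ℕ.+ n)) (col (suc b)) n ⟩
  Σ< (suc (dbl (suc b) ℕ.+ n)) (λ i → col (suc b) i * (g ^ˢ i) n)
    ≡⟨ Σ<-first (dbl (suc b) ℕ.+ n) (λ i → col (suc b) i * (g ^ˢ i) n) ⟩
  col (suc b) 0 * q^ 0 n + Σ< (dbl (suc b) ℕ.+ n) term
    ≡⟨ cong₂ (λ x y → x * q^ 0 n + y) (constant-term b)
         -- The surplus terms vanish because gⁱ⁺¹ has order at least i + 1 > n, and the constant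
         -- term of U(gᵇ⁺¹) is 0.
         (Σ<-extend n (dbl (suc b)) term λ i n≤i → trans (cong (col (suc b) (suc i) *_) (g-vanishes (s≤s n≤i))) (ℤ.*-zeroʳ (col (suc b) (suc i)))) ⟩
  + 0 * q^ 0 n + Σ< n term
    ≡⟨ ℤ.+-identityˡ (Σ< n term) ⟩
  Σ< n term ∎
  where
  term : ℕ → ℤ
  term i = col (suc b) (suc i) * (g ^ˢ suc i) n
  constant-term : ∀ b → col (suc b) 0 ≡ + 0
  constant-term zero    = refl
  constant-term (suc b) = refl

-- Read off from `𝐟-𝚫` in degree 1, which avoids unfolding the inverse series.
f-leading : f 1 ≡ + 1
f-leading = begin
  f 1                                 ≡⟨ ℤ.*-identityʳ (f 1) ⟨
  f 1 * lim eulerProduct 0            ≡⟨ product-head 1 f (lim eulerProduct) (λ { zero _ → refl ; (suc _) (s≤s ()) }) ⟨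
  (f ⊛ lim eulerProduct) 1            ≡⟨ at (lower 𝐟-𝚫) 1 ⟩
  (q^ 1 ⊛ double (lim eulerProduct)) 1  ≡⟨ trans (q^-suc 0 0 (double (lim eulerProduct))) (⊛-identityₙ 0 (double (lim eulerProduct))) ⟩
  + 1                                 ∎

g-leading : ∀ k → (g ^ˢ k) k ≡ p2 (6 ℕ.* k)
g-leading zero    = refl
g-leading (suc k) = begin
  g 0 * (g ^ˢ k) (suc k) + (tail g ⊛ g ^ˢ k) k   ≡⟨ ℤ.+-identityˡ _ ⟩
  (tail g ⊛ g ^ˢ k) k                            ≡⟨ ⊛-commₙ k (tail g) (g ^ˢ k) ⟩
  (g ^ˢ k ⊛ tail g) k                            ≡⟨ product-head k (g ^ˢ k) (tail g) (λ n → g-vanishes) ⟩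
  (g ^ˢ k) k * (+ 64 * f 1)                      ≡⟨ cong₂ (λ x y → x * (+ 64 * y)) (g-leading k) f-leading ⟩
  p2 (6 ℕ.* k) * p2 6                            ≡⟨ ℤ.*-comm (p2 (6 ℕ.* k)) (p2 6) ⟩
  p2 6 * p2 (6 ℕ.* k)                            ≡⟨ p2-+ 6 (6 ℕ.* k) ⟨
  p2 (6 ℕ.+ 6 ℕ.* k)                             ≡⟨ cong p2 (ℕ.*-suc 6 k) ⟨
  p2 (6 ℕ.* suc k)                               ∎

-- From q-expansions to the matrix of U

Σ₂ : ℕ → (ℕ → ℚ₂) → ℚ₂
Σ₂ zero    t = 0₂
Σ₂ (suc n) t = Σ₂ n t +₂ t n

Σ₂-first : ∀ n t → Σ₂ (suc n) t ≈₂ t 0 +₂ Σ₂ n (t ∘ suc)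
Σ₂-first zero    t = ℚ₂-Ring.+-comm 0₂ (t 0)
Σ₂-first (suc n) t = ≈₂-trans (+₂-cong (Σ₂-first n t) (≈₂-refl {t (suc n)})) (ℚ₂-Ring.+-assoc (t 0) (Σ₂ n (t ∘ suc)) (t (suc n)))

sum-Σ₂ : ∀ n t → ℚ₂-Sum.sum (λ (i : Fin n) → t (toℕ i)) ≈₂ Σ₂ n t
sum-Σ₂ zero    t = ≈₂-refl
sum-Σ₂ (suc n) t = ≈₂-trans (+₂-cong (≈₂-refl {t 0}) (sum-Σ₂ n (t ∘ suc))) (≈₂-sym (Σ₂-first n t))

Σ₂-cong : ∀ n {t u} → (∀ i → i ℕ.< n → t i ≈₂ u i) → Σ₂ n t ≈₂ Σ₂ n u
Σ₂-cong zero    eq = ≈₂-refl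
Σ₂-cong (suc n) eq = +₂-cong (Σ₂-cong n λ i i<n → eq i (ℕ.m<n⇒m<1+n i<n)) (eq n ℕ.≤-refl)

K-Σ< : ∀ n z → K (Σ< n z) ≈₂ Σ₂ n (K ∘ z)
K-Σ< zero    z = pointwise λ _ → refl
K-Σ< (suc n) z = ≈₂-trans (pointwise λ _ → ι-+ (Σ< n z) (z n)) (+₂-cong (K-Σ< n z) (≈₂-refl {K (z n)}))

qExpansion-Σ₂ : ∀ a n → qExpansion a n ≈₂ Σ₂ n λ i → coeff a i *₂ K ((g ^ˢ suc i) n)
qExpansion-Σ₂ a n = sum-Σ₂ n λ i → coeff a i *₂ K ((g ^ˢ suc i) n)

-- If b lies beyond the range i < n of `qExpansion`, the sum is 0; this agrees with gᵇ⁺¹, which then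
-- has no term in degree n.
qExpansion-basis : ∀ b n → qExpansion (basis b) n ≈₂ K ((g ^ˢ suc b) n)
qExpansion-basis b n = ≈₂-trans (qExpansion-Σ₂ (basis b) n) (≈₂-trans
  (Σ₂-cong n λ i _ → ≈₂-trans (*₂-cong (basis-δ i) (≈₂-refl {K ((g ^ˢ suc i) n)})) (≈₂-sym (K-* (δ i b) ((g ^ˢ suc i) n))))
  (≈₂-trans (≈₂-sym (K-Σ< n λ i → δ i b * (g ^ˢ suc i) n)) (ℚ₂-Ring.reflexive (cong K evaluated))))
  where
  basis-δ : ∀ i → coeff (basis b) i ≈₂ K (δ i b)
  basis-δ i with does (i ℕ.≟ b)
  ... | true  = pointwise λ _ → refl
  ... | false = pointwise λ _ → refl
  off : ∀ i → i ≢ b → δ i b * (g ^ˢ suc i) n ≡ + 0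
  off i i≢b = cong (_* (g ^ˢ suc i) n) (δ-off i≢b)
  evaluated : Σ< n (λ i → δ i b * (g ^ˢ suc i) n) ≡ (g ^ˢ suc b) n
  evaluated = by-size (b ℕ.<? n)
    where
    by-size : Dec (b ℕ.< n) → Σ< n (λ i → δ i b * (g ^ˢ suc i) n) ≡ (g ^ˢ suc b) n
    by-size (yes b<n) = trans (Σ<-single (λ i → δ i b * (g ^ˢ suc i) n) b<n off)
      (trans (cong (_* (g ^ˢ suc b) n) (δ-on b)) (ℤ.*-identityˡ ((g ^ˢ suc b) n)))
    by-size (no b≮n)  = trans (Σ<-0 n (λ i → δ i b * (g ^ˢ suc i) n) λ i i<n → off i (ℕ.<⇒≢ (ℕ.<-≤-trans i<n (ℕ.≮⇒≥ b≮n))))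
      (sym (g-vanishes (s≤s (ℕ.≮⇒≥ b≮n))))

K-p2-cancel : ∀ k {x y} → x *₂ K (p2 k) ≈₂ y *₂ K (p2 k) → x ≈₂ y
K-p2-cancel k {x} {y} eq = ≈₂-trans (≈₂-sym (undo x)) (≈₂-trans (*₂-cong eq (≈₂-refl {const₂ (2^ (- + k))})) (undo y))
  where
  undo : ∀ x → (x *₂ K (p2 k)) *₂ const₂ (2^ (- + k)) ≈₂ x
  undo x = pointwise λ n → begin
    seq x n ℚ.* ι (p2 k) ℚ.* 2^ (- + k)      ≡⟨ ℚ.*-assoc (seq x n) (ι (p2 k)) (2^ (- + k)) ⟩
    seq x n ℚ.* (ι (p2 k) ℚ.* 2^ (- + k))    ≡⟨ cong (λ z → seq x n ℚ.* (z ℚ.* 2^ (- + k))) (2^-ι k) ⟨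
    seq x n ℚ.* (2^ (+ k) ℚ.* 2^ (- + k))    ≡⟨ cong (seq x n ℚ.*_) (trans (sym (2^-+ (+ k) (- + k))) (cong 2^ (ℤ.+-inverseʳ (+ k)))) ⟩
    seq x n ℚ.* 1ℚ                           ≡⟨ ℚ.*-identityʳ (seq x n) ⟩
    seq x n                                  ∎

+₂-cancelˡ : ∀ a a′ x y → a ≈₂ a′ → a +₂ x ≈₂ a′ +₂ y → x ≈₂ y
+₂-cancelˡ a a′ x y p q = ≈₂-trans (≈₂-sym (undo a x)) (≈₂-trans (+₂-cong (-₂-cong p) q) (undo a′ y))
  where
  undo : ∀ a x → (-₂ a) +₂ (a +₂ x) ≈₂ x
  undo a x = pointwise λ n → ℚS.solve 2 (λ a x → (ℚS.:- a) ℚS.:+ (a ℚS.:+ x) ℚS.:= x) refl (seq a n) (seq x n)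
    where module ℚS = ℚ-Solver.+-*-Solver

module _ (T : CompactOperator) (isU : IsU (CompactOperator.⟦_⟧ T)) where
  open CompactOperator T using (matrix)

  column-expansion : ∀ b n → Σ₂ n (λ i → matrix i b *₂ K ((g ^ˢ suc i) n)) ≈₂
                             Σ₂ n (λ i → K (col (suc b) (suc i)) *₂ K ((g ^ˢ suc i) n))
  column-expansion b n = ≈₂-trans (≈₂-sym (qExpansion-Σ₂ (CompactOperator.⟦_⟧ T (basis b)) n))
    (≈₂-trans (isU (basis b) n) (≈₂-trans (qExpansion-basis b (2 ℕ.* n)) (≈₂-trans (ℚ₂-Ring.reflexive (cong K (U-power b n)))
      (≈₂-trans (K-Σ< n λ i → col (suc b) (suc i) * (g ^ˢ suc i) n)
        (Σ₂-cong n λ i _ → K-* (col (suc b) (suc i)) ((g ^ˢ suc i) n))))))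

  -- gⁱ⁺¹ has leading coefficient 64ⁱ⁺¹, so the entries of a column are determined recursively.
  matrix-col : ∀ i b → matrix i b ≈₂ K (col (suc b) (suc i))
  matrix-col i b = below (suc i) i ℕ.≤-refl
    where
    below : ∀ m i → i ℕ.< m → matrix i b ≈₂ K (col (suc b) (suc i))
    below (suc m) i (s≤s i≤m) = K-p2-cancel (6 ℕ.* suc i) (subst
      (λ z → matrix i b *₂ K z ≈₂ K (col (suc b) (suc i)) *₂ K z) (g-leading (suc i))
      (+₂-cancelˡ _ _ (matrix i b *₂ K ((g ^ˢ suc i) (suc i))) (K (col (suc b) (suc i)) *₂ K ((g ^ˢ suc i) (suc i)))
        (Σ₂-cong i λ l l<i → *₂-cong (below m l (ℕ.<-≤-trans l<i i≤m)) (≈₂-refl {K ((g ^ˢ suc l) (suc i))}))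
        (column-expansion b (suc i))))

  U-link : ∀ m i j → i ℕ.< m → j ℕ.< m → matrix i j *₂ K (+ (w i ℕ.* w j)) ≈₂ K (Factorisation.entry U-factorisation m i j)
  U-link m i j i<m j<m = ≈₂-trans (*₂-cong (matrix-col i j) (≈₂-refl {K (+ (w i ℕ.* w j))}))
    (≈₂-trans (≈₂-sym (K-* (col (suc j) (suc i)) (+ (w i ℕ.* w j))))
      (ℚ₂-Ring.reflexive (cong K (trans (ℤ.*-comm (col (suc j) (suc i)) (+ (w i ℕ.* w j))) (U-entry m i j i<m j<m)))))

theorem2 : (U : CompactOperator) → IsU (CompactOperator.⟦_⟧ U) → NewtonPolygon (charSeries U) ≐ NewtonPolygon (charSeries D)
theorem2 U isU = NewtonPolygon-resp (+_ ∘ Exponents.E exponent exponent-mono)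
  (CharSeries.charSeries-valuation U U-factorisation w w-odd (U-link U isU))
  (CharSeries.charSeries-valuation D D-factorisation w w-odd D-link)
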